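{- Let $p\ge 5$ be a prime, $n,m\in \mathbb{Z}^{+}$, and $r,s,t\in \mathbb{N}$ with $r\ge 2$. Define \[ A_n^{(r,s,t)}=\sum_{k=0}^n{n\choose k}^r{n+k\choose k}^s{2k\choose n}^t . \] Then \[ A_{np^m}^{(r,s,t)}\equiv A_{np^{m-1}}^{(r,s,t)}+p^{3m}B_{p-3}\, \mathcal{A}^{(r,s,t)}_n\pmod{p^{3m+1}}, \] where the rational numbers $\mathcal{A}^{(r,s,t)}_n$ (independent of $m$ and $p$) are given by \begin{align*} \mathcal{A}^{(2,s,t)}_n &=-\frac{1}{3}\sum_{k=0}^{n} {n\choose k}^2 {n+k\choose k}^s {2k\choose n}^t nk(sn+sk+2n-2k+4tk-2tn)\\ &\quad+\frac{1}{6}\sum_{k=0}^{n-1} {n\choose k}^2{n+k\choose k}^s {2k\choose n}^t (n-k)^2\left(9nt-3ns+24k-18n+14\right)\\ &\quad+\frac{1}{6}\sum_{k=0}^{n-1}{n\choose k}^2 {n+k\choose k}^s {2k+1\choose n}^t (n-k)^2\left(9ns+15nt-24k+6n-10\right), \end{align*} \begin{align*} \mathcal{A}_{n}^{(3,s,t)} &=-\frac{1}{3}\sum_{k=0}^{n} {n\choose k}^3 {n+k\choose k}^s {2k\choose n}^t nk(sn+sk+3n-3k+4tk-2tn)\\ &\quad+\frac{1}{4}\sum_{k=0}^{n-1}(n-k)^3{n\choose k}^3 {n+k\choose k}^s\left({2k\choose n}^t+{2k+1\choose n}^t\right), \end{align*} and, for $r\ge 4$, \[ \mathcal{A}_{n}^{(r,s,t)}=-\frac{1}{3}\sum_{k=0}^{n}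 {n\choose k}^r {n+k\choose k}^s {2k\choose n}^t nk(sn+sk+rn-rk+4tk-2tn). \]
   Context: $\mathbb{N}$ denotes the non-negative integers and $\mathbb{Z}^+$ the positive integers. Binomial coefficients ${a\choose b}$ with $0\le a<b$ are $0$ (so ${2k\choose n}=0$ when $2k<n$). The Bernoulli numbers $B_n$ are defined by $\frac{z}{e^z-1}=\sum_{n\ge0}B_n\frac{z^n}{n!}$. For rationals $x,y$ and an integer $j$, $x\equiv y \pmod{p^j}$ means that $(x-y)/p^j$ is a rational number whose denominator is not divisible by $p$. -}

module Defs where

open import Data.Nat as ℕ using (ℕ; zero; suc; _^_; _∸_)
open import Data.Nat.Divisibility using (_∣_)
open import Data.Nat.Combinatorics using (_C_)
open import Data.Integer as ℤ using (ℤ; +_)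
open import Data.Rational as ℚ using (ℚ; _+_; _*_; _-_; -_; _/_; 0ℚ; 1ℚ)
open import Data.List using (List; []; _∷_; _++_; length; foldr; zipWith; upTo)
open import Relation.Nullary using (¬_)

q : ℕ → ℚ
q n = (+ n) / 1

sumTo : ℕ → (ℕ → ℚ) → ℚ
sumTo zero    f = f 0
sumTo (suc n) f = sumTo n f + f (suc n)

sumBelow : ℕ → (ℕ → ℚ) → ℚ
sumBelow zero    f = 0ℚ
sumBelow (suc n) f = sumTo n f

-- Bernoulli numbers: z/(e^z-1) = Σ B_n z^n/n!, i.e. B_0 = 1 and
-- Σ_{k=0}^{m-1} C(m,k) B_k = 0 for m ≥ 2, equivalently
-- B_m = -(1/(m+1)) Σ_{k=0}^{m-1} C(m+1,k) B_k.

nextBernoulli : ℕ → List ℚ → ℚ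
nextBernoulli m bs =
  - ((+ 1) / suc m) * foldr _+_ 0ℚ (zipWith (λ k b → q (suc m C k) * b) (upTo m) bs)

bernoulliList : ℕ → List ℚ
bernoulliList zero    = 1ℚ ∷ []
bernoulliList (suc n) = bernoulliList n ++ (nextBernoulli (suc n) (bernoulliList n) ∷ [])

B : ℕ → ℚ
B zero    = 1ℚ
B (suc n) = nextBernoulli (suc n) (bernoulliList n)

-- p-adic congruence of rationals: x ≡ y (mod p^j) iff the (reduced)
-- denominator of (x - y)/p^j is not divisible by p.

-- 1/d as a rational (d ≠ 0 in all uses; 0 ↦ 0 only as a dummy)
invℕ : ℕ → ℚ
invℕ zero    = 0ℚ
invℕ (suc d) = (+ 1) / suc d

_≡_[modℚ_^_] : ℚ → ℚ → ℕ → ℕ → Set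
x ≡ y [modℚ p ^ j ] = ¬ (p ∣ ℚ.denominatorℕ ((x - y) * invℕ (p ^ j)))

A : ℕ → ℕ → ℕ → ℕ → ℚ
A r s t n = sumTo n (λ k → q ((n C k) ^ r ℕ.* ((n ℕ.+ k) C k) ^ s ℕ.* ((2 ℕ.* k) C n) ^ t))

z : ℤ → ℚ
z a = a / 1

firstSum : ℕ → ℕ → ℕ → ℕ → ℚ
firstSum r s t n =
  - ((+ 1) / 3) *
  sumTo n (λ k → q ((n C k) ^ r ℕ.* ((n ℕ.+ k) C k) ^ s ℕ.* ((2 ℕ.* k) C n) ^ t)
                 * q (n ℕ.* k)
                 * z (+ (s ℕ.* n) ℤ.+ + (s ℕ.* k) ℤ.+ + (r ℕ.* n) ℤ.- + (r ℕ.* k)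
                      ℤ.+ + (4 ℕ.* t ℕ.* k) ℤ.- + (2 ℕ.* t ℕ.* n)))

calA2 : ℕ → ℕ → ℕ → ℚ
calA2 s t n =
  firstSum 2 s t n
  + ((+ 1) / 6) *
    sumBelow n (λ k → q ((n C k) ^ 2 ℕ.* ((n ℕ.+ k) C k) ^ s ℕ.* ((2 ℕ.* k) C n) ^ t)
                      * q ((n ∸ k) ^ 2)
                      * z (+ (9 ℕ.* n ℕ.* t) ℤ.- + (3 ℕ.* n ℕ.* s) ℤ.+ + (24 ℕ.* k)
                           ℤ.- + (18 ℕ.* n) ℤ.+ + 14))
  + ((+ 1) / 6) *
    sumBelow n (λ k → q ((n C k) ^ 2 ℕ.* ((n ℕ.+ k) C k) ^ s ℕ.* ((2 ℕ.* k ℕ.+ 1) C n) ^ t)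
                      * q ((n ∸ k) ^ 2)
                      * z (+ (9 ℕ.* n ℕ.* s) ℤ.+ + (15 ℕ.* n ℕ.* t) ℤ.- + (24 ℕ.* k)
                           ℤ.+ + (6 ℕ.* n) ℤ.- + 10))

calA3 : ℕ → ℕ → ℕ → ℚ
calA3 s t n =
  firstSum 3 s t n
  + ((+ 1) / 4) *
    sumBelow n (λ k → q ((n ∸ k) ^ 3 ℕ.* (n C k) ^ 3 ℕ.* ((n ℕ.+ k) C k) ^ s
                         ℕ.* (((2 ℕ.* k) C n) ^ t ℕ.+ ((2 ℕ.* k ℕ.+ 1) C n) ^ t)))

-- 𝒜_n^{(r,s,t)}; the cases r = 0,1 are never used (the theorem assumes r ≥ 2)
calA : ℕ → ℕ → ℕ → ℕ → ℚ
calA 2 s t n = calA2 s t n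
calA 3 s t n = calA3 s t n
calA r s t n = firstSum r s t n

{-# OPTIONS --safe #-}

-- Put N = n p^m.  With σ(k) = (−1)^k and ι(j) = 1/j for p ∤ j, ι(j) = 0 otherwise,
-- everything is expressed through θ = Σ_{j<p} σ(j) ι(j)³.  Reflecting j to p^i − j and
-- doubling indices give Σ ι² over a period p^i, half a period and the even indices
-- as multiples of p^i θ modulo p^(i+1); the sums Σ ι(k)² H_k follow in the same way
-- from Σ_{k<p} ι(k)² H_k ≡ −2θ, which is Σ_k (−1)^(k−1) C(n,k)/k² = Σ_k H_k/k at
-- n = p − 1.  On the other hand (−1)^i Σ_{k<p} k^i Σ_{j<k} 1/j obeys modulo p the
-- recurrence of the Bernoulli numbers, so with Fermat's theorem B_{p−3} ≡ −2θ.
--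
-- In the summands at k = pj, C(pa+pb, pb)/C(a+b, b) = ∏ (1 + pa/i) over i ≤ pb with p ∤ i;
-- squaring and pairing i with pb − i gives it to one digit beyond p³ ab(a+b), and the
-- powers of p dividing C(n p^(m−1), j)^r make up for those missing from j.
-- In the other summands C(N,k) = ± N/(N−k) ∏_{j≤k} (1 − N/j), which leaves only
-- r ≤ 3.  For r = 2 the remaining products are expanded one power of p at a time: the
-- level i ≥ 1 weights sum 1/k² over half periods of p^i, are multiples of p^i θ,
-- and so need the products to first order in N only.

module Submission where

open import Defs using (sumTo; sumBelow; invℕ; B; bernoulliList; firstSum; calA; calA2; calA3; _≡_[modℚ_^_])
  renaming (A to Apéry; q to ℕ→ℚ; z to ℤ→ℚ)
open import Algebra using (IsCommutativeRing)
open import Data.Empty using (⊥-elim)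
open import Data.Integer as ℤ using (ℤ; +_)
import Data.Integer.Properties as ℤP
open import Data.List using ([]; _∷_; _++_; foldr; zipWith; upTo; applyUpTo)
open import Data.List.Properties using (applyUpTo-∷ʳ)
open import Data.Maybe using (Maybe; just; nothing)
open import Data.Nat as ℕ using (ℕ; zero; suc; _≤_; _<_; _∸_; z≤n; s≤s)
open import Data.Nat.Combinatorics using (_C_; nCk+nC[k+1]≡[n+1]C[k+1]; nCn≡1; k>n⇒nCk≡0; nCk≡nC[n∸k])
open import Data.Nat.Coprimality using (1-coprimeTo; coprime-divisor) renaming
  (sym to coprime-sym; recompute to coprime-recompute)
open import Data.Nat.Divisibility hiding (quotient)
open import Data.Nat.DivMod using (m≡m%n+[m/n]*n; m%n<n)
open import Data.Nat.Induction using (<-rec)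
open import Data.Nat.Primality using (Prime; euclidsLemma; prime⇒irreducible)
import Data.Nat.Properties as ℕP
open import Data.Nat.Tactic.RingSolver using () renaming (solve-∀ to solveℕ-∀)
open import Data.Product using (_,_; _×_; ∃; ∃-syntax; proj₁; proj₂)
open import Data.Rational as ℚ using (ℚ; mkℚ; 0ℚ; 1ℚ; _/_)
import Data.Rational.Properties as ℚP
import Data.Rational.Unnormalised as ℚᵘ
import Data.Rational.Unnormalised.Properties as ℚᵘP
open import Data.Sum using (_⊎_; inj₁; inj₂; [_,_]′)
open import Function using (_∘_)
open import Level using (0ℓ)
open import Relation.Binary using (Setoid)
open import Relation.Binary.PropositionalEquality
import Relation.Binary.Reasoning.Setoid as SetoidReasoning
open import Relation.Nullary using (¬_; yes; no)
open import Tactic.RingSolver using (solve-∀)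
open import Tactic.RingSolver.Core.AlmostCommutativeRing using (AlmostCommutativeRing; fromCommutativeRing)

-- The statement compares two adjacent levels, but for r = 2 the summands prime to p have to be
-- pushed through all powers of p before they can be compared with a sum over k ≤ n. This is done in
-- the variable c = 2k. The quotients of 2k by powers of p take odd values too, and these odd values
-- are where the binomials C(2k+1, n) of 𝒜 come from.
--
-- The obstacle is that neither half has the stated form for r = 2. Both contain the unweighted sum
-- `U d`, d = m - 1, which vanishes modulo p for d > 0 but not in general for d = 0, so that each
-- half depends on m. The multiples of p contribute (U d - U 0) n³ (s - 2 + 4t)/3 through `W`, the
-- other summands contribute its negative, and only the total is independent of m. The agreement of
-- these coefficients rests on the block sums against harmonic numbers, where H always counts four
-- times as much as Ĥ apart from a sign term.
--
-- All constants are computed as multiples of θ. The Bernoulli number enters once, at the end, and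
-- B_{p-3} ≡ -2θ is the reason why the total is compared with -2 𝒜.

-- Rational arithmetic, finite sums and signs

module Field where
  open ≡-Reasoning

  -- A copy of ℚ whose operations are stuck on variables; those of ℚ itself
  -- unfold, by η, to quotients by greatest common divisors.
  data K : Set where
    κ : ℚ → K

  infixl 7 _*_
  infixl 6 _+_ _-_
  infix 8 -_
  infix 9 #_

  _+_ _*_ : K → K → K
  κ a + κ b = κ (a ℚ.+ b)
  κ a * κ b = κ (a ℚ.* b)

  -_ : K → K
  -_ (κ a) = κ (ℚ.- a)

  _-_ : K → K → K
  _-_ a b = a + - b

  0# 1# : K
  0# = κ 0ℚ
  1# = κ 1ℚ

  isCommutativeRing : IsCommutativeRing _≡_ _+_ _*_ -_ 0# 1#
  isCommutativeRing = record
    { isRing = record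
      { +-isAbelianGroup = record
        { isGroup = record
          { isMonoid = record
            { isSemigroup = record
              { isMagma = record { isEquivalence = isEquivalence ; ∙-cong = cong₂ _+_ }
              ; assoc = λ { (κ a) (κ b) (κ c) → cong κ (ℚP.+-assoc a b c) } }
            ; identity = (λ { (κ a) → cong κ (ℚP.+-identityˡ a) }) , λ { (κ a) → cong κ (ℚP.+-identityʳ a) } }
          ; inverse = (λ { (κ a) → cong κ (ℚP.+-inverseˡ a) }) , λ { (κ a) → cong κ (ℚP.+-inverseʳ a) }
          ; ⁻¹-cong = cong (λ a → - a) }
        ; comm = λ { (κ a) (κ b) → cong κ (ℚP.+-comm a b) } }
      ; *-cong = cong₂ _*_
      ; *-assoc = λ { (κ a) (κ b) (κ c) → cong κ (ℚP.*-assoc a b c) }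
      ; *-identity = (λ { (κ a) → cong κ (ℚP.*-identityˡ a) }) , λ { (κ a) → cong κ (ℚP.*-identityʳ a) }
      ; distrib = (λ { (κ a) (κ b) (κ c) → cong κ (ℚP.*-distribˡ-+ a b c) })
                , λ { (κ a) (κ b) (κ c) → cong κ (ℚP.*-distribʳ-+ a b c) } }
    ; *-comm = λ { (κ a) (κ b) → cong κ (ℚP.*-comm a b) } }

  ring : AlmostCommutativeRing 0ℓ 0ℓ
  ring = fromCommutativeRing (record { isCommutativeRing = isCommutativeRing }) 0≟
    where
    0≟ : ∀ x → Maybe (0# ≡ x)
    0≟ (κ x) with 0ℚ ℚP.≟ x
    ... | yes e = just (cong κ e)
    ... | no _  = nothing

  open IsCommutativeRing isCommutativeRing public
    using (+-identityˡ; +-identityʳ; *-identityˡ; +-comm; *-comm; +-assoc; *-assoc; distribˡ; zeroˡ; zeroʳ)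

  -- Recursive, so that `# suc n` unfolds to `1# + # n` by definition and closed numerals compute
  -- inside the ring identities.
  #_ : ℕ → K
  # zero  = 0#
  # suc n = 1# + # n

  ℕ→ℚ≡mkℚ : ∀ n → ℕ→ℚ n ≡ mkℚ (+ n) 0 (coprime-sym (1-coprimeTo n))
  ℕ→ℚ≡mkℚ n = ℚP.↥p/↧p≡p (mkℚ (+ n) 0 (coprime-sym (1-coprimeTo n)))

  κ-q : ∀ n → κ (ℕ→ℚ n) ≡ # n
  κ-q zero    = refl
  κ-q (suc n) = begin
    κ (ℕ→ℚ (suc n))         ≡⟨ cong κ (cong (λ a → (+ 1 ℤ.+ a) / 1) (sym (ℤP.*-identityʳ (+ n)))) ⟩
    κ (1ℚ ℚ.+ mkℚ (+ n) 0 (coprime-sym (1-coprimeTo n))) ≡⟨ cong (λ a → 1# + κ a) (ℕ→ℚ≡mkℚ n) ⟨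
    1# + κ (ℕ→ℚ n)          ≡⟨ cong (_+_ 1#) (κ-q n) ⟩
    1# + # n              ∎

  #-+ : ∀ m n → # (m ℕ.+ n) ≡ # m + # n
  #-+ zero    n = sym (+-identityˡ _)
  #-+ (suc m) n = trans (cong (_+_ 1#) (#-+ m n)) (sym (+-assoc _ _ _))

  #-* : ∀ m n → # (m ℕ.* n) ≡ # m * # n
  #-* zero    n = sym (zeroˡ _)
  #-* (suc m) n = begin
    # (n ℕ.+ m ℕ.* n)   ≡⟨ #-+ n (m ℕ.* n) ⟩
    # n + # (m ℕ.* n)   ≡⟨ cong (_+_ (# n)) (#-* m n) ⟩
    # n + # m * # n     ≡⟨ lem (# m) (# n) ⟩
    (1# + # m) * # n    ∎
    where
    lem : ∀ a b → b + a * b ≡ (1# + a) * b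
    lem = solve-∀ ring

  infixr 8 _^_
  _^_ : K → ℕ → K
  x ^ zero  = 1#
  x ^ suc n = x * x ^ n

  #-^ : ∀ m n → # (m ℕ.^ n) ≡ # m ^ n
  #-^ m zero    = refl
  #-^ m (suc n) = trans (#-* m (m ℕ.^ n)) (cong (_*_ (# m)) (#-^ m n))

  *-^ : ∀ x y n → (x * y) ^ n ≡ x ^ n * y ^ n
  *-^ x y zero    = refl
  *-^ x y (suc n) = trans (cong (_*_ (x * y)) (*-^ x y n)) (lem x y (x ^ n) (y ^ n))
    where
    lem : ∀ a b c d → a * b * (c * d) ≡ a * c * (b * d)
    lem = solve-∀ ring

  recip : ℕ → K
  recip n = κ (invℕ n)

  #*recip : ∀ n → # suc n * recip (suc n) ≡ 1#
  #*recip n = begin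
    # suc n * recip (suc n) ≡⟨ cong (_* recip (suc n)) (κ-q (suc n)) ⟨
    κ (ℕ→ℚ (suc n) ℚ.* ((+ 1) / suc n))
      ≡⟨ cong₂ (λ a b → κ (a ℚ.* b)) (ℕ→ℚ≡mkℚ (suc n)) (ℚP.↥p/↧p≡p (mkℚ (+ 1) n (1-coprimeTo (suc n)))) ⟩
    κ (mkℚ (+ suc n) 0 (coprime-sym (1-coprimeTo (suc n))) ℚ.* mkℚ (+ 1) n (1-coprimeTo (suc n)))
      ≡⟨ cong κ (ℚP.*-inverseʳ (mkℚ (+ suc n) 0 (coprime-sym (1-coprimeTo (suc n))))) ⟩
    1# ∎

  sum : ℕ → (ℕ → K) → K
  sum zero    f = 0#
  sum (suc n) f = sum n f + f n

  sum-cong : ∀ n {f g} → (∀ j → j < n → f j ≡ g j) → sum n f ≡ sum n g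
  sum-cong zero    eq = refl
  sum-cong (suc n) eq = cong₂ _+_ (sum-cong n (λ j j<n → eq j (ℕP.m<n⇒m<1+n j<n))) (eq n ℕP.≤-refl)

  sum-ext : ∀ n {f g} → (∀ j → f j ≡ g j) → sum n f ≡ sum n g
  sum-ext n eq = sum-cong n (λ j _ → eq j)

  sum-+ : ∀ n f g → sum n (λ j → f j + g j) ≡ sum n f + sum n g
  sum-+ zero    f g = refl
  sum-+ (suc n) f g = trans (cong (_+ (f n + g n)) (sum-+ n f g)) (lem (sum n f) (sum n g) (f n) (g n))
    where
    lem : ∀ a b c d → a + b + (c + d) ≡ a + c + (b + d)
    lem = solve-∀ ring

  sum-*ˡ : ∀ n c f → sum n (λ j → c * f j) ≡ c * sum n f
  sum-*ˡ zero    c f = sym (zeroʳ c)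
  sum-*ˡ (suc n) c f = trans (cong (_+ c * f n) (sum-*ˡ n c f)) (sym (distribˡ _ _ _))

  sum-*ʳ : ∀ n c f → sum n (λ j → f j * c) ≡ sum n f * c
  sum-*ʳ n c f = trans (sum-ext n (λ j → *-comm (f j) c)) (trans (sum-*ˡ n c f) (*-comm c _))

  sum-neg : ∀ n f → sum n (λ j → - f j) ≡ - sum n f
  sum-neg n f = trans (sum-ext n (λ j → lem (f j))) (trans (sum-*ˡ n (- 1#) f) (sym (lem (sum n f))))
    where
    lem : ∀ a → - a ≡ - 1# * a
    lem = solve-∀ ring

  sum-const : ∀ n c → sum n (λ _ → c) ≡ # n * c
  sum-const zero    c = sym (zeroˡ c)
  sum-const (suc n) c = trans (cong (_+ c) (sum-const n c)) (lem (# n) c)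
    where
    lem : ∀ a c → a * c + c ≡ (1# + a) * c
    lem = solve-∀ ring

  sum-++ : ∀ m n f → sum (m ℕ.+ n) f ≡ sum m f + sum n (λ j → f (m ℕ.+ j))
  sum-++ m zero    f = trans (cong (λ k → sum k f) (ℕP.+-identityʳ m)) (sym (+-identityʳ _))
  sum-++ m (suc n) f = begin
    sum (m ℕ.+ suc n) f                                           ≡⟨ cong (λ k → sum k f) (ℕP.+-suc m n) ⟩
    sum (m ℕ.+ n) f + f (m ℕ.+ n)                                 ≡⟨ cong (_+ f (m ℕ.+ n)) (sum-++ m n f) ⟩
    sum m f + sum n (λ j → f (m ℕ.+ j)) + f (m ℕ.+ n)             ≡⟨ +-assoc _ _ _ ⟩
    sum m f + sum (suc n) (λ j → f (m ℕ.+ j))                     ∎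

  sum-head : ∀ n f → sum (suc n) f ≡ f 0 + sum n (f ∘ suc)
  sum-head n f = trans (sum-++ 1 n f) (cong (_+ sum n (f ∘ suc)) (+-identityˡ (f 0)))

  sum-block : ∀ b a f → sum (b ℕ.* a) f ≡ sum a (λ u → sum b (λ w → f (b ℕ.* u ℕ.+ w)))
  sum-block b zero    f = cong (λ k → sum k f) (ℕP.*-zeroʳ b)
  sum-block b (suc a) f = begin
    sum (b ℕ.* suc a) f                                  
      ≡⟨ cong (λ k → sum k f) (trans (ℕP.*-suc b a) (ℕP.+-comm b _)) ⟩
    sum (b ℕ.* a ℕ.+ b) f                                 ≡⟨ sum-++ (b ℕ.* a) b f ⟩
    sum (b ℕ.* a) f + sum b (λ w → f (b ℕ.* a ℕ.+ w))    
      ≡⟨ cong (_+ sum b (λ w → f (b ℕ.* a ℕ.+ w))) (sum-block b a f) ⟩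
    sum (suc a) (λ u → sum b (λ w → f (b ℕ.* u ℕ.+ w)))   ∎

  sum-telescope : ∀ n (f : ℕ → K) → sum n (λ j → f (suc j) - f j) ≡ f n - f 0
  sum-telescope zero    f = lem (f 0)
    where
    lem : ∀ a → 0# ≡ a - a
    lem = solve-∀ ring
  sum-telescope (suc n) f = trans (cong (_+ (f (suc n) - f n)) (sum-telescope n f))
    (lem (f (suc n)) (f n) (f 0))
    where
    lem : ∀ a b c → b - c + (a - b) ≡ a - c
    lem = solve-∀ ring

  sum-reverse : ∀ n f → sum n f ≡ sum n (λ j → f (n ∸ suc j))
  sum-reverse zero    f = refl
  sum-reverse (suc n) f = begin
    sum n f + f n                             ≡⟨ +-comm _ _ ⟩
    f n + sum n f                             ≡⟨ cong (_+_ (f n)) (sum-reverse n f) ⟩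
    f n + sum n (λ j → f (n ∸ suc j))         ≡⟨ sum-head n (λ j → f (n ∸ j)) ⟨
    sum (suc n) (λ j → f (n ∸ j))             ∎

  σ : ℕ → K
  σ zero    = 1#
  σ (suc n) = - σ n

  σ-+ : ∀ m n → σ (m ℕ.+ n) ≡ σ m * σ n
  σ-+ zero    n = sym (*-identityˡ _)
  σ-+ (suc m) n = trans (cong (λ a → - a) (σ-+ m n)) (lem (σ m) (σ n))
    where
    lem : ∀ a b → - (a * b) ≡ - a * b
    lem = solve-∀ ring

  σ² : ∀ n → σ n * σ n ≡ 1#
  σ² zero    = refl
  σ² (suc n) = trans (lem (σ n)) (σ² n)
    where
    lem : ∀ a → - a * - a ≡ a * a
    lem = solve-∀ ring

  2*suc : ∀ n → 2 ℕ.* suc n ≡ suc (suc (2 ℕ.* n))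
  2*suc n = ℕP.*-suc 2 n

  σ-2* : ∀ n → σ (2 ℕ.* n) ≡ 1#
  σ-2* n = trans (cong σ (cong (n ℕ.+_) (ℕP.+-identityʳ n))) (trans (σ-+ n n) (σ² n))

  -- The weight 1 + σ c is 2 at even c and 0 at odd c. It turns a sum over k into an unrestricted
  -- sum over c = 2k, and such a range can be cut into blocks of length p.
  sum-even : ∀ n (f : ℕ → K) → sum (2 ℕ.* n) (λ c → (1# + σ c) * f c) ≡ # 2 * sum n (λ k → f (2 ℕ.* k))
  sum-even zero    f = refl
  sum-even (suc n) f = begin
    sum (2 ℕ.* suc n) g ≡⟨ cong (λ k → sum k g) (2*suc n) ⟩
    sum (2 ℕ.* n) g + g (2 ℕ.* n) + g (suc (2 ℕ.* n))
      ≡⟨ cong (λ s → sum (2 ℕ.* n) g + (1# + s) * f (2 ℕ.* n) + (1# + - s) * f (suc (2 ℕ.* n))) (σ-2* n) ⟩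
    sum (2 ℕ.* n) g + (1# + 1#) * f (2 ℕ.* n) + (1# + - 1#) * f (suc (2 ℕ.* n))
      ≡⟨ lem (sum (2 ℕ.* n) g) (f (2 ℕ.* n)) (f (suc (2 ℕ.* n))) ⟩
    sum (2 ℕ.* n) g + # 2 * f (2 ℕ.* n) ≡⟨ cong (_+ # 2 * f (2 ℕ.* n)) (sum-even n f) ⟩
    # 2 * sum n (λ k → f (2 ℕ.* k)) + # 2 * f (2 ℕ.* n)
      ≡⟨ distribˡ (# 2) (sum n (λ k → f (2 ℕ.* k))) (f (2 ℕ.* n)) ⟨
    # 2 * sum (suc n) (λ k → f (2 ℕ.* k)) ∎
    where
    g : ℕ → K
    g c = (1# + σ c) * f c
    lem : ∀ a b c → a + (1# + 1#) * b + (1# + - 1#) * c ≡ a + # 2 * b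
    lem = solve-∀ ring

-- The p-integral rationals and congruences modulo p^e

module Localisation (p : ℕ) (p-prime : Prime p) (5≤p : 5 ≤ p) where
  open Field

  infixl 6 _⊕_
  infixl 7 _⊗_
  -- The localisation of ℤ at p, generated from naturals and inverses of numbers prime to p. Being
  -- inductive, it lets a proof of integrality copy the syntax of the expression; denominators are
  -- extracted only in `Int⇒fraction`.
  data Int : K → Set where
    nat : ∀ n → Int (# n)
    _⊕_ : ∀ {x y} → Int x → Int y → Int (x + y)
    _⊗_ : ∀ {x y} → Int x → Int y → Int (x * y)
    ⊝_  : ∀ {x} → Int x → Int (- x)
    inv : ∀ {d} → ¬ p ∣ d → Int (recip d)

  Int-0 : Int 0#
  Int-0 = nat 0

  Int-1 : Int 1#
  Int-1 = nat 1

  Int-^ : ∀ {x} → Int x → ∀ n → Int (x ^ n)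
  Int-^ ix zero    = Int-1
  Int-^ ix (suc n) = ix ⊗ Int-^ ix n

  Int-sum : ∀ n {f} → (∀ j → j < n → Int (f j)) → Int (sum n f)
  Int-sum zero    i = Int-0
  Int-sum (suc n) i = Int-sum n (λ j j<n → i j (ℕP.m<n⇒m<1+n j<n)) ⊕ i n ℕP.≤-refl

  Int-σ : ∀ n → Int (σ n)
  Int-σ zero    = Int-1
  Int-σ (suc n) = ⊝ Int-σ n

  infix 4 _≈[_]_
  -- Only the quotient of the difference is required to be integral, not x and y themselves.
  record _≈[_]_ (x : K) (e : ℕ) (y : K) : Set where
    constructor quotient
    field
      {quot}   : K
      integral : Int quot
      equality : x - y ≡ # (p ℕ.^ e) * quot

  P : ℕ → K
  P e = # (p ℕ.^ e)

  P-+ : ∀ e f → P (e ℕ.+ f) ≡ P e * P f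
  P-+ e f = trans (cong #_ (ℕP.^-distribˡ-+-* p e f)) (#-* (p ℕ.^ e) (p ℕ.^ f))

  private variable
    x y x′ y′ u v w : K
    e f : ℕ

  ≈-refl : x ≈[ e ] x
  ≈-refl {x} {e} = quotient Int-0 (lem x (P e))
    where
    lem : ∀ a b → a - a ≡ b * # 0
    lem = solve-∀ ring

  ≡⇒≈ : x ≡ y → x ≈[ e ] y
  ≡⇒≈ refl = ≈-refl

  -- Reduces a linear deduction to one ring identity: the wanted difference is an integral multiple
  -- of a known one. `≈-by₂` does the same with two known congruences.
  ≈-by₁ : ∀ c → Int c → u ≈[ e ] v → x - y ≡ c * (u - v) → x ≈[ e ] y
  ≈-by₁ {e = e} c ic (quotient {q} i eq) id = quotient (ic ⊗ i)
    (trans id (trans (cong (_*_ c) eq) (lem c (P e) q)))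
    where
    lem : ∀ a b c → a * (b * c) ≡ b * (a * c)
    lem = solve-∀ ring

  ≈-by₂ : ∀ c d {u′ v′} → Int c → Int d → u ≈[ e ] v → u′ ≈[ e ] v′ →
          x - y ≡ c * (u - v) + d * (u′ - v′) → x ≈[ e ] y
  ≈-by₂ {e = e} c d ic id (quotient {q} i eq) (quotient {q′} i′ eq′) identity =
    quotient (ic ⊗ i ⊕ id ⊗ i′)
      (trans identity (trans (cong₂ (λ a b → c * a + d * b) eq eq′) (lem c d (P e) q q′)))
    where
    lem : ∀ c d a q q′ → c * (a * q) + d * (a * q′) ≡ a * (c * q + d * q′)
    lem = solve-∀ ring

  ≈-sym : x ≈[ e ] y → y ≈[ e ] x
  ≈-sym {x} {e} {y} xy = ≈-by₁ (- # 1) (⊝ nat 1) xy (lem x y)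
    where
    lem : ∀ a b → b - a ≡ - # 1 * (a - b)
    lem = solve-∀ ring

  ≈-trans : ∀ {z} → x ≈[ e ] y → y ≈[ e ] z → x ≈[ e ] z
  ≈-trans {x} {e} {y} {z} xy yz = ≈-by₂ (# 1) (# 1) (nat 1) (nat 1) xy yz (lem x y z)
    where
    lem : ∀ a b c → a - c ≡ # 1 * (a - b) + # 1 * (b - c)
    lem = solve-∀ ring

  ≈-setoid : ℕ → Setoid 0ℓ 0ℓ
  ≈-setoid e = record
    { Carrier = K
    ; _≈_ = λ x y → x ≈[ e ] y
    ; isEquivalence = record { refl = ≈-refl ; sym = ≈-sym ; trans = ≈-trans }
    }

  module ≈-Reasoning (e : ℕ) = SetoidReasoning (≈-setoid e)

  +-≈ : x ≈[ e ] y → x′ ≈[ e ] y′ → x + x′ ≈[ e ] y + y′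
  +-≈ {x} {e} {y} {x′} {y′} xy xy′ = ≈-by₂ (# 1) (# 1) (nat 1) (nat 1) xy xy′ (lem x y x′ y′)
    where
    lem : ∀ a b c d → a + c - (b + d) ≡ # 1 * (a - b) + # 1 * (c - d)
    lem = solve-∀ ring

  *-≈ : Int x′ → Int y → x ≈[ e ] y → x′ ≈[ e ] y′ → x * x′ ≈[ e ] y * y′
  *-≈ {x′} {y} {x} {e} {y′} ix′ iy xy xy′ = ≈-by₂ x′ y ix′ iy xy xy′ (lem x y x′ y′)
    where
    lem : ∀ a b c d → a * c - b * d ≡ c * (a - b) + b * (c - d)
    lem = solve-∀ ring

  *ˡ-≈ : Int u → x ≈[ e ] y → u * x ≈[ e ] u * y
  *ˡ-≈ {u} {x} {e} {y} iu xy = ≈-by₁ u iu xy (lem u x y)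
    where
    lem : ∀ c a b → c * a - c * b ≡ c * (a - b)
    lem = solve-∀ ring

  *ʳ-≈ : Int u → x ≈[ e ] y → x * u ≈[ e ] y * u
  *ʳ-≈ {u} {x} {e} {y} iu xy = ≈-by₁ u iu xy (lem u x y)
    where
    lem : ∀ c a b → a * c - b * c ≡ c * (a - b)
    lem = solve-∀ ring

  -- The way in which congruences modulo a low power of p are lifted: a factor divisible by p^f
  -- gains f digits.
  scale : u ≈[ f ] 0# → x ≈[ e ] y → u * x ≈[ f ℕ.+ e ] u * y
  scale {u} {f} {x} {e} {y} (quotient {q} i eq) (quotient {q′} i′ eq′) = quotient (i ⊗ i′) (begin
    u * x - u * y                ≡⟨ lem u x y ⟩
    (u - 0#) * (x - y)           ≡⟨ cong₂ _*_ eq eq′ ⟩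
    P f * q * (P e * q′)         ≡⟨ lem′ (P f) q (P e) q′ ⟩
    P f * P e * (q * q′)         ≡⟨ cong (_* (q * q′)) (P-+ f e) ⟨
    P (f ℕ.+ e) * (q * q′)       ∎)
    where
    open ≡-Reasoning
    lem : ∀ u a b → u * a - u * b ≡ (u - 0#) * (a - b)
    lem = solve-∀ ring
    lem′ : ∀ a b c d → a * b * (c * d) ≡ a * c * (b * d)
    lem′ = solve-∀ ring

  *-≈0 : u ≈[ f ] 0# → x ≈[ e ] 0# → u * x ≈[ f ℕ.+ e ] 0#
  *-≈0 {u} pu px = ≈-trans (scale pu px) (≡⇒≈ (zeroʳ u))

  *ˡ-≈0 : Int u → x ≈[ e ] 0# → u * x ≈[ e ] 0#
  *ˡ-≈0 {u} iu px = ≈-trans (*ˡ-≈ iu px) (≡⇒≈ (zeroʳ u))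

  *ʳ-≈0 : Int u → x ≈[ e ] 0# → x * u ≈[ e ] 0#
  *ʳ-≈0 {u} iu px = ≈-trans (*ʳ-≈ iu px) (≡⇒≈ (zeroˡ u))

  ≈-weaken : e ≤ f → x ≈[ f ] y → x ≈[ e ] y
  ≈-weaken {e} {f} {x} {y} e≤f (quotient {q} i eq) = quotient (nat (p ℕ.^ (f ∸ e)) ⊗ i) (begin
    x - y                       ≡⟨ eq ⟩
    P f * q                     ≡⟨ cong (λ k → P k * q) (ℕP.m+[n∸m]≡n e≤f) ⟨
    P (e ℕ.+ (f ∸ e)) * q       ≡⟨ cong (_* q) (P-+ e (f ∸ e)) ⟩
    P e * P (f ∸ e) * q         ≡⟨ *-assoc _ _ _ ⟩
    P e * (P (f ∸ e) * q)       ∎)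
    where open ≡-Reasoning

  Int-≈ : Int y → x ≈[ e ] y → Int x
  Int-≈ {y} {x} {e} iy (quotient {q} i eq) = subst Int (trans (cong (_+_ y) (sym eq)) (lem y x))
    (iy ⊕ nat (p ℕ.^ e) ⊗ i)
    where
    lem : ∀ a b → a + (b - a) ≡ b
    lem = solve-∀ ring

  sum-≈ : ∀ n {f g} → (∀ j → j < n → f j ≈[ e ] g j) → sum n f ≈[ e ] sum n g
  sum-≈ zero    eq = ≈-refl
  sum-≈ (suc n) eq = +-≈ (sum-≈ n (λ j j<n → eq j (ℕP.m<n⇒m<1+n j<n))) (eq n ℕP.≤-refl)

  ^-≈ : Int x → Int y → x ≈[ e ] y → ∀ n → x ^ n ≈[ e ] y ^ n
  ^-≈ ix iy xy zero    = ≈-refl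
  ^-≈ ix iy xy (suc n) = *-≈ (Int-^ ix n) iy xy (^-≈ ix iy xy n)

  ≈0-0 : Int x → x ≈[ 0 ] 0#
  ≈0-0 {x} ix = quotient ix (lem x)
    where
    lem : ∀ a → a - 0# ≡ # 1 * a
    lem = solve-∀ ring

  ≈0-P : ∀ e → P e ≈[ e ] 0#
  ≈0-P e = quotient Int-1 (lem (P e))
    where
    lem : ∀ a → a - 0# ≡ a * 1#
    lem = solve-∀ ring

  ≈0-P* : ∀ e {x} → Int x → P e * x ≈[ e ] 0#
  ≈0-P* e ix = *ʳ-≈0 ix (≈0-P e)

  ∣⇒≈0 : ∀ {n} → p ℕ.^ e ∣ n → # n ≈[ e ] 0#
  ∣⇒≈0 {e} (divides k refl) = quotient (nat k) (trans (cong (_- 0#) (#-* k (p ℕ.^ e))) (lem (# k) (P e)))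
    where
    lem : ∀ a b → a * b - 0# ≡ b * a
    lem = solve-∀ ring

  p∤ : ∀ {d} .{{_ : ℕ.NonZero d}} → d < 5 → ¬ p ∣ d
  p∤ d<5 = >⇒∤ (ℕP.<-≤-trans d<5 5≤p)

  p∤2 : ¬ p ∣ 2
  p∤2 = p∤ (s≤s (s≤s (s≤s z≤n)))
  p∤3 : ¬ p ∣ 3
  p∤3 = p∤ (s≤s (s≤s (s≤s (s≤s z≤n))))
  p∤4 : ¬ p ∣ 4
  p∤4 = p∤ (s≤s (s≤s (s≤s (s≤s (s≤s z≤n)))))

  #*recip′ : ∀ {d} → ¬ p ∣ d → # d * recip d ≡ 1#
  #*recip′ {zero}  p∤0 = ⊥-elim (p∤0 (p ∣0))
  #*recip′ {suc d} _   = #*recip d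

  cancel : ∀ {d} → ¬ p ∣ d → # d * x ≈[ e ] # d * y → x ≈[ e ] y
  cancel {x} {e} {y} {d} p∤d dx = ≈-by₁ (recip d) (inv p∤d) dx
    (trans (lem x y) (trans (cong (_* (x - y)) (sym (#*recip′ p∤d))) (lem′ (# d) (recip d) x y)))
    where
    lem : ∀ a b → a - b ≡ 1# * (a - b)
    lem = solve-∀ ring
    lem′ : ∀ d r a b → d * r * (a - b) ≡ r * (d * a - d * b)
    lem′ = solve-∀ ring

  ½ ⅓ ¼ : K
  ½ = recip 2
  ⅓ = recip 3
  ¼ = recip 4

  Int-½ : Int ½
  Int-½ = inv p∤2
  Int-⅓ : Int ⅓
  Int-⅓ = inv p∤3
  Int-¼ : Int ¼
  Int-¼ = inv p∤4

  -- The inverse truncated at multiples of p, and the oddness of p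

  ι : ℕ → K
  ι j with p ∣? j
  ... | yes _ = 0#
  ... | no _  = recip j

  ι-∣ : ∀ {j} → p ∣ j → ι j ≡ 0#
  ι-∣ {j} p∣j with p ∣? j
  ... | yes _  = refl
  ... | no p∤j = ⊥-elim (p∤j p∣j)

  ι-∤ : ∀ {j} → ¬ p ∣ j → # j * ι j ≡ 1#
  ι-∤ {j} p∤j with p ∣? j
  ... | yes p∣j = ⊥-elim (p∤j p∣j)
  ... | no p∤j′ = #*recip′ p∤j′

  ι-0 : ι 0 ≡ 0#
  ι-0 = ι-∣ (p ∣0)

  Int-ι : ∀ j → Int (ι j)
  Int-ι j with p ∣? j
  ... | yes _  = Int-0
  ... | no p∤j = inv p∤j

  -- Both differences below vanish when p divides j, and are b(a′a) − a(b′b)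
  -- with a′a = b′b = 1 otherwise.
  ι-shift : ∀ {m} → p ∣ m → ∀ j → ι j - ι (m ℕ.+ j) ≡ # m * ι j * ι (m ℕ.+ j)
  ι-shift {m} p∣m j with p ∣? j
  ... | yes p∣j rewrite ι-∣ (∣m∣n⇒∣m+n p∣m p∣j) = lem (# m)
    where
    lem : ∀ a → 0# - 0# ≡ a * 0# * 0#
    lem = solve-∀ ring
  ... | no p∤j = begin
    recip j - ι (m ℕ.+ j)  ≡⟨ lem (recip j) (ι (m ℕ.+ j)) ⟩
    recip j * 1# - ι (m ℕ.+ j) * 1#
      ≡⟨ cong₂ (λ a b → recip j * a - ι (m ℕ.+ j) * b)
        (trans (cong (_* ι (m ℕ.+ j)) (sym (#-+ m j))) (ι-∤ (λ p∣m+j → p∤j (∣m+n∣m⇒∣n p∣m+j p∣m))))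
        (#*recip′ p∤j) ⟨
    recip j * ((# m + # j) * ι (m ℕ.+ j)) - ι (m ℕ.+ j) * (# j * recip j)
      ≡⟨ lem′ (recip j) (ι (m ℕ.+ j)) (# m) (# j) ⟩
    # m * recip j * ι (m ℕ.+ j) ∎
    where
    open ≡-Reasoning
    lem : ∀ a b → a - b ≡ a * 1# - b * 1#
    lem = solve-∀ ring
    lem′ : ∀ a b m j → a * ((m + j) * b) - b * (j * a) ≡ m * a * b
    lem′ = solve-∀ ring

  ι-reflect : ∀ {m} → p ∣ m → ∀ j k → j ℕ.+ k ≡ m → ι j + ι k ≡ # m * ι j * ι k
  ι-reflect p∣m j k refl with p ∣? j
  ... | yes p∣j rewrite ι-∣ (∣m+n∣m⇒∣n p∣m p∣j) = lem (# (j ℕ.+ k))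
    where
    lem : ∀ a → 0# + 0# ≡ a * 0# * 0#
    lem = solve-∀ ring
  ... | no p∤j = begin
    recip j + ι k ≡⟨ lem (recip j) (ι k) ⟩
    recip j * 1# + ι k * 1#
      ≡⟨ cong₂ (λ a b → recip j * a + ι k * b)
        (ι-∤ (λ p∣k → p∤j (∣m+n∣m⇒∣n (subst (p ∣_) (ℕP.+-comm j k) p∣m) p∣k))) (#*recip′ p∤j) ⟨
    recip j * (# k * ι k) + ι k * (# j * recip j) ≡⟨ lem′ (recip j) (ι k) (# j) (# k) ⟩
    (# j + # k) * recip j * ι k ≡⟨ cong (λ a → a * recip j * ι k) (#-+ j k) ⟨
    # (j ℕ.+ k) * recip j * ι k ∎
    where
    open ≡-Reasoning
    lem : ∀ a b → a + b ≡ a * 1# + b * 1#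
    lem = solve-∀ ring
    lem′ : ∀ a b j k → a * (k * b) + b * (j * a) ≡ (j + k) * a * b
    lem′ = solve-∀ ring

  M : ℕ
  M = p ℕ./ 2

  p-odd : p ≡ suc (2 ℕ.* M)
  p-odd with p ℕ.% 2 in eq | m≡m%n+[m/n]*n p 2 | m%n<n p 2
  ... | 0 | h | _ = ⊥-elim (2≢p (subst (2 ∣_) (sym h) (n∣m*n M)))
    where
    open import Data.Nat.Primality using (prime⇒irreducible)
    2≢p : ¬ 2 ∣ p
    2≢p 2∣p with prime⇒irreducible p-prime 2∣p
    ... | inj₂ 2≡p = ℕP.<⇒≢ (ℕP.<-≤-trans (s≤s (s≤s (s≤s z≤n))) 5≤p) 2≡p
  ... | 1 | h | _ = trans h (cong suc (ℕP.*-comm M 2))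
  ... | suc (suc _) | _ | s≤s (s≤s ())

  σ-p : σ p ≡ - 1#
  σ-p = trans (cong σ p-odd) (cong (λ a → - a) (σ-2* M))

  σ-p* : ∀ c → σ (p ℕ.* c) ≡ σ c
  σ-p* zero    = cong σ (ℕP.*-zeroʳ p)
  σ-p* (suc c) = begin
    σ (p ℕ.* suc c)       ≡⟨ cong σ (ℕP.*-suc p c) ⟩
    σ (p ℕ.+ p ℕ.* c)     ≡⟨ σ-+ p (p ℕ.* c) ⟩
    σ p * σ (p ℕ.* c)     ≡⟨ cong₂ _*_ σ-p (σ-p* c) ⟩
    - 1# * σ c            ≡⟨ lem (σ c) ⟩
    - σ c                 ∎
    where
    open ≡-Reasoning
    lem : ∀ a → - 1# * a ≡ - a
    lem = solve-∀ ring

  σ-p^* : ∀ i c → σ (p ℕ.^ i ℕ.* c) ≡ σ c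
  σ-p^* zero    c = cong σ (ℕP.*-identityˡ c)
  σ-p^* (suc i) c = trans (cong σ (ℕP.*-assoc p (p ℕ.^ i) c)) (trans (σ-p* (p ℕ.^ i ℕ.* c)) (σ-p^* i c))

  σ-p^ : ∀ i → σ (p ℕ.^ i) ≡ - 1#
  σ-p^ i = trans (cong σ (sym (ℕP.*-identityʳ (p ℕ.^ i)))) (σ-p^* i 1)

module Supercongruence (p : ℕ) (p-prime : Prime p) (5≤p : 5 ≤ p) where
  open Field
  open Localisation p p-prime 5≤p

  private variable
    e : ℕ

  -- Sums of powers of ι over a period

  ι² ι³ : ℕ → K
  ι² j = ι j * ι j
  ι³ j = ι j * ι j * ι j

  Int-ι² : ∀ j → Int (ι² j)
  Int-ι² j = Int-ι j ⊗ Int-ι j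

  Int-ι³ : ∀ j → Int (ι³ j)
  Int-ι³ j = Int-ι² j ⊗ Int-ι j

  p∣p^ : ∀ {i m} → p ℕ.^ suc i ∣ m → p ∣ m
  p∣p^ {i} h = ∣-trans (m∣m*n (p ℕ.^ i)) h

  -- Lets a ring identity use one relation u = v: the two sides may differ by any multiple c of u -
  -- v.
  ≡-by : ∀ {x y u v : K} → u ≡ v → ∀ c → x ≡ y + (u - v) * c → x ≡ y
  ≡-by {y = y} {u} refl c eq = trans eq (lem y u c)
    where
    lem : ∀ y u c → y + (u - u) * c ≡ y
    lem = solve-∀ ring

  ≈-square : ∀ {m x y u} → p ℕ.^ e ∣ m → Int u → x - y ≡ # m * # m * u → x ≈[ e ℕ.+ e ] y
  ≈-square {e} {m} {x} {y} {u} d iu eq =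
    ≈-by₁ u iu (*-≈0 (∣⇒≈0 {e} d) (∣⇒≈0 {e} d)) (trans eq (lem (# m) u))
    where
    lem : ∀ m u → m * m * u ≡ u * (m * m - 0#)
    lem = solve-∀ ring

  ι-shift≈ : ∀ {i m} → p ℕ.^ suc i ∣ m → ∀ j → ι (m ℕ.+ j) ≈[ suc i ] ι j
  ι-shift≈ {i} {m} d j = ≈-sym (≈-by₁ (ι j * ι (m ℕ.+ j)) (Int-ι j ⊗ Int-ι _) (∣⇒≈0 {suc i} d)
    (trans (ι-shift (p∣p^ {i} d) j) (lem (# m) (ι j) (ι (m ℕ.+ j)))))
    where
    lem : ∀ m a b → m * a * b ≡ a * b * (m - 0#)
    lem = solve-∀ ring

  -- First-order Taylor expansion of 1/(m + j)² in m. The cofactor in the proof is what remains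
  -- after eliminating ι (m + j) with `ι-shift`.
  ι²-shift : ∀ {i m} → p ℕ.^ suc i ∣ m → ∀ j → ι² (m ℕ.+ j) ≈[ suc i ℕ.+ suc i ] ι² j - # 2 * # m * ι³ j
  ι²-shift {i} {m} d j = ≈-square d (Int-ι (m ℕ.+ j) ⊗ Int-ι² j ⊗ (nat 2 ⊗ Int-ι j ⊕ Int-ι (m ℕ.+ j)))
    (≡-by (ι-shift (p∣p^ {i} d) j) (# m * b * (# 2 * b + a) - (a + b)) (lem (# m) a b))
    where
    a = ι (m ℕ.+ j)
    b = ι j
    lem : ∀ m a b → a * a - (b * b - # 2 * m * (b * b * b)) ≡
          m * m * (a * (b * b) * (# 2 * b + a)) + (b - a - m * b * a) * (m * b * (# 2 * b + a) - (a + b))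
    lem = solve-∀ ring

  ι-mirror : ∀ {i m} → p ℕ.^ suc i ∣ m → ∀ j k → j ℕ.+ k ≡ m → ι k ≈[ suc i ] - ι j
  ι-mirror {i} {m} d j k eq = ≈-by₁ (ι j * ι k) (Int-ι j ⊗ Int-ι k) (∣⇒≈0 {suc i} d)
    (trans (lem′ (ι k) (ι j)) (trans (ι-reflect (p∣p^ {i} d) j k eq) (lem (# m) (ι j) (ι k))))
    where
    lem : ∀ m a b → m * a * b ≡ a * b * (m - 0#)
    lem = solve-∀ ring
    lem′ : ∀ a b → a - - b ≡ b + a
    lem′ = solve-∀ ring

  ι²-mirror : ∀ {i m} → p ℕ.^ suc i ∣ m → ∀ j k → j ℕ.+ k ≡ m → ι² k ≈[ suc i ℕ.+ suc i ] ι² j + # 2 * # m * ι³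
    j
  ι²-mirror {i} {m} d j k eq = ≈-square d (Int-ι k ⊗ Int-ι² j ⊗ (Int-ι k ⊕ ⊝ (nat 2 ⊗ Int-ι j)))
    (≡-by (ι-reflect (p∣p^ {i} d) j k eq) (a - b + # m * b * (a - # 2 * b)) (lem (# m) a b))
    where
    a = ι k
    b = ι j
    lem : ∀ m a b → a * a - (b * b + # 2 * m * (b * b * b)) ≡
          m * m * (a * (b * b) * (a - # 2 * b)) + (b + a - m * b * a) * (a - b + m * b * (a - # 2 * b))
    lem = solve-∀ ring

  p^1∣ : ∀ {m} → p ∣ m → p ℕ.^ 1 ∣ m
  p^1∣ {m} = subst (_∣ m) (sym (ℕP.^-identityʳ p))

  ι³-cong : ∀ {a b} → ι a ≈[ e ] ι b → ι³ a ≈[ e ] ι³ b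
  ι³-cong {a = a} {b} h = *-≈ (Int-ι a) (Int-ι² b) (*-≈ (Int-ι a) (Int-ι b) h h) h

  ι³-mirror : ∀ {m} → p ∣ m → ∀ j k → j ℕ.+ k ≡ m → ι³ k ≈[ 1 ] - ι³ j
  ι³-mirror d j k eq = ≈-trans (*-≈ (Int-ι k) (⊝ Int-ι j ⊗ ⊝ Int-ι j) (*-≈ (Int-ι k) (⊝ Int-ι j) h h) h)
    (≡⇒≈ (lem (ι j)))
    where
    h = ι-mirror {0} (p^1∣ d) j k eq
    lem : ∀ a → - a * - a * - a ≡ - (a * a * a)
    lem = solve-∀ ring

  σ-mirror : ∀ {m} → σ m ≡ - 1# → ∀ j k → j ℕ.+ k ≡ m → σ k ≡ - σ j
  σ-mirror σm j k refl = begin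
    σ k                     ≡⟨ *-identityˡ (σ k) ⟨
    1# * σ k                ≡⟨ cong (_* σ k) (σ² j) ⟨
    σ j * σ j * σ k         ≡⟨ *-assoc _ _ _ ⟩
    σ j * (σ j * σ k)       ≡⟨ cong (_*_ (σ j)) (trans (sym (σ-+ j k)) σm) ⟩
    σ j * - 1#              ≡⟨ lem (σ j) ⟩
    - σ j                   ∎
    where
    open ≡-Reasoning
    lem : ∀ a → a * - 1# ≡ - a
    lem = solve-∀ ring

  -- Reflection pairs 0 < j < n among themselves; index 0 would go to n, outside the range, hence
  -- the two vanishing conditions.
  sum-mirror : ∀ n {f g : ℕ → K} → f 0 ≡ 0# → g 0 ≡ 0# →
               (∀ j k → suc j ℕ.+ suc k ≡ n → f (suc k) ≈[ e ] g (suc j)) → sum n f ≈[ e ] sum n g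
  sum-mirror {e} zero    f0 g0 eq = ≈-refl
  sum-mirror {e} (suc n) {f} {g} f0 g0 eq = begin
    sum (suc n) f                     ≡⟨ trans (sum-head n f) (cong (_+ sum n (f ∘ suc)) f0) ⟩
    0# + sum n (f ∘ suc)              ≡⟨ cong (_+_ 0#) (sum-reverse n (f ∘ suc)) ⟩
    0# + sum n (λ j → f (suc (n ∸ suc j)))
      ≈⟨ +-≈ ≈-refl (sum-≈ n (λ j j<n → eq j (n ∸ suc j) (cong suc (trans (ℕP.+-suc j _) (ℕP.m+[n∸m]≡n j<n)))))
        ⟩
    0# + sum n (g ∘ suc)              ≡⟨ trans (sum-head n g) (cong (_+ sum n (g ∘ suc)) g0) ⟨
    sum (suc n) g                     ∎
    where open ≈-Reasoning e

  sum-odd : ∀ n {f : ℕ → K} → f 0 ≡ 0# →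
            (∀ j k → suc j ℕ.+ suc k ≡ n → f (suc k) ≈[ e ] - f (suc j)) → sum n f ≈[ e ] 0#
  sum-odd {e} n {f} f0 eq = cancel p∤2 (≈-by₁ 1# Int-1
    (≈-trans (sum-mirror n {f} {λ j → - f j} f0 (cong (λ a → - a) f0) eq) (≡⇒≈ (sum-neg n f))) (lem (sum n f)))
    where
    lem : ∀ a → # 2 * a - # 2 * 0# ≡ 1# * (a - - a)
    lem = solve-∀ ring

  ι*0 : ∀ {x} → x * ι 0 ≡ 0#
  ι*0 {x} = trans (cong (_*_ x) ι-0) (zeroʳ x)

  sum-ι : ∀ {m} → p ∣ m → sum m ι ≈[ 1 ] 0#
  sum-ι {m} d = sum-odd m ι-0 (λ j k eq → ι-mirror {0} (p^1∣ d) (suc j) (suc k) eq)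

  sum-ι³ : ∀ {m} → p ∣ m → sum m ι³ ≈[ 1 ] 0#
  sum-ι³ {m} d = sum-odd m (ι*0 {ι 0 * ι 0}) (λ j k eq → ι³-mirror d (suc j) (suc k) eq)

  σι³ σι² : ℕ → K
  σι³ j = σ j * ι³ j
  σι² j = σ j * ι² j

  θ : K
  θ = sum p σι³

  Int-θ : Int θ
  Int-θ = Int-sum p (λ j _ → Int-σ j ⊗ Int-ι³ j)

  sum-σ : ∀ n → # 2 * sum n σ ≡ 1# - σ n
  sum-σ zero    = refl
  sum-σ (suc n) = trans (distribˡ (# 2) _ _) (trans (cong (_+ # 2 * σ n) (sum-σ n)) (lem (σ n)))
    where
    lem : ∀ a → 1# - a + # 2 * a ≡ 1# - - a
    lem = solve-∀ ring

  sum-σ-odd : ∀ n → σ n ≡ - 1# → sum n σ ≡ 1#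
  sum-σ-odd n σn = trans (lem (sum n σ)) (trans (cong (_*_ ½) (trans (sum-σ n) (cong (_-_ 1#) σn))) refl)
    where
    lem : ∀ a → a ≡ ½ * (# 2 * a)
    lem = solve-∀ ring

  σ-block : ∀ u w → σ (p ℕ.* u ℕ.+ w) ≡ σ u * σ w
  σ-block u w = trans (σ-+ (p ℕ.* u) w) (cong (_* σ w) (σ-p* u))

  p^1∣p* : ∀ u → p ℕ.^ 1 ∣ p ℕ.* u
  p^1∣p* u = p^1∣ (m∣m*n u)

  -- As p is odd, the block u contributes σ u θ, and the signs over a range of odd length n add up
  -- to 1.
  sum-σι³ : ∀ n → σ n ≡ - 1# → sum (p ℕ.* n) σι³ ≈[ 1 ] θ
  sum-σι³ n σn = begin
    sum (p ℕ.* n) σι³ ≡⟨ sum-block p n σι³ ⟩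
    sum n (λ u → sum p (λ w → σι³ (p ℕ.* u ℕ.+ w)))
      ≈⟨ sum-≈ n (λ u _ → sum-≈ p (λ w _ → *-≈ (Int-ι³ _) (Int-σ u ⊗ Int-σ w) (≡⇒≈ (σ-block u w))
        (ι³-cong (ι-shift≈ {0} (p^1∣p* u) w)))) ⟩
    sum n (λ u → sum p (λ w → σ u * σ w * ι³ w))
      ≡⟨ sum-ext n (λ u → trans (sum-ext p (λ w → *-assoc (σ u) (σ w) (ι³ w))) (sum-*ˡ p (σ u) σι³)) ⟩
    sum n (λ u → σ u * θ) ≡⟨ sum-*ʳ n θ σ ⟩
    sum n σ * θ ≡⟨ trans (cong (_* θ) (sum-σ-odd n σn)) (*-identityˡ θ) ⟩
    θ ∎
    where open ≈-Reasoning 1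

  p^-odd : ∀ i → ∃ λ n → p ℕ.^ i ≡ suc (2 ℕ.* n)
  p^-odd zero = 0 , refl
  p^-odd (suc i) with p^-odd i
  ... | n , eq = M ℕ.+ n ℕ.+ 2 ℕ.* M ℕ.* n , trans (cong₂ ℕ._*_ p-odd eq) (lem M n)
    where
    lem : ∀ a b → suc (2 ℕ.* a) ℕ.* suc (2 ℕ.* b) ≡ suc (2 ℕ.* (a ℕ.+ b ℕ.+ 2 ℕ.* a ℕ.* b))
    lem = solveℕ-∀

  ι-2* : ∀ k → # 2 * ι (2 ℕ.* k) ≡ ι k
  ι-2* k with p ∣? k
  ... | yes p∣k = trans (cong (_*_ (# 2)) (ι-∣ (∣n⇒∣m*n 2 p∣k))) (zeroʳ (# 2))
  ... | no p∤k = begin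
    # 2 * ι (2 ℕ.* k) ≡⟨ lem (ι (2 ℕ.* k)) ⟩
    1# * (# 2 * ι (2 ℕ.* k)) ≡⟨ cong (_* (# 2 * ι (2 ℕ.* k))) (#*recip′ p∤k) ⟨
    # k * recip k * (# 2 * ι (2 ℕ.* k)) ≡⟨ lem′ (# k) (recip k) (ι (2 ℕ.* k)) ⟩
    recip k * (# 2 * # k * ι (2 ℕ.* k)) ≡⟨ cong (λ a → recip k * (a * ι (2 ℕ.* k))) (#-* 2 k) ⟨
    recip k * (# (2 ℕ.* k) * ι (2 ℕ.* k))
      ≡⟨ cong (_*_ (recip k)) (ι-∤ (λ p∣2k → [ p∤2 , p∤k ]′ (euclidsLemma 2 k p-prime p∣2k))) ⟩
    recip k * 1# ≡⟨ lem″ (recip k) ⟩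
    recip k ∎
    where
    open ≡-Reasoning
    lem : ∀ a → # 2 * a ≡ 1# * (# 2 * a)
    lem = solve-∀ ring
    lem′ : ∀ k r a → k * r * (# 2 * a) ≡ r * (# 2 * k * a)
    lem′ = solve-∀ ring
    lem″ : ∀ a → a * 1# ≡ a
    lem″ = solve-∀ ring

  -- The range ends at the even index 2n; appending 2n + 1, which has weight 0, reduces to
  -- `sum-even`.
  sum-even-odd : ∀ n (f : ℕ → K) → sum (suc (2 ℕ.* n)) (λ c → (1# + σ c) * f c) ≡ # 2 * sum (suc n)
    (λ k → f (2 ℕ.* k))
  sum-even-odd n f = begin
    sum (suc (2 ℕ.* n)) g ≡⟨ lem (sum (suc (2 ℕ.* n)) g) (f (suc (2 ℕ.* n))) ⟩
    sum (suc (2 ℕ.* n)) g + (1# + - 1#) * f (suc (2 ℕ.* n))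
      ≡⟨ cong (λ s → sum (suc (2 ℕ.* n)) g + (1# + - s) * f (suc (2 ℕ.* n))) (σ-2* n) ⟨
    sum (suc (suc (2 ℕ.* n))) g ≡⟨ cong (λ k → sum k g) (2*suc n) ⟨
    sum (2 ℕ.* suc n) g ≡⟨ sum-even (suc n) f ⟩
    # 2 * sum (suc n) (λ k → f (2 ℕ.* k)) ∎
    where
    open ≡-Reasoning
    g : ℕ → K
    g c = (1# + σ c) * f c
    lem : ∀ a b → a ≡ a + (1# + - 1#) * b
    lem = solve-∀ ring

  ρ̂ : ℕ → K
  ρ̂ c = 1# + σ c

  sum-half : ∀ n → (sum (suc (2 ℕ.* n)) (λ c → ρ̂ c * ι² c) ≡ ½ * sum (suc n) ι²)
  sum-half n = trans (sum-even-odd n ι²)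
    (trans (cong (_*_ (# 2)) (trans (sum-ext (suc n)
    (λ k → trans (lem (ι (2 ℕ.* k))) (cong (λ a → ¼ * (a * a)) (ι-2* k)))) (sum-*ˡ (suc n) ¼ ι²)))
    (lem′ (sum (suc n) ι²)))
    where
    lem : ∀ a → a * a ≡ ¼ * (# 2 * a * (# 2 * a))
    lem = solve-∀ ring
    lem′ : ∀ a → # 2 * (¼ * a) ≡ ½ * a
    lem′ = solve-∀ ring

  sum-half³ : ∀ n → (sum (suc (2 ℕ.* n)) (λ c → ρ̂ c * ι³ c) ≡ ¼ * sum (suc n) ι³)
  sum-half³ n = trans (sum-even-odd n ι³)
    (trans (cong (_*_ (# 2)) (trans (sum-ext (suc n)
    (λ k → trans (lem (ι (2 ℕ.* k))) (cong (λ a → ½ * ¼ * (a * a * a)) (ι-2* k)))) (sum-*ˡ (suc n) (½ * ¼) ι³)))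
    (lem′ (sum (suc n) ι³)))
    where
    lem : ∀ a → a * a * a ≡ ½ * ¼ * (# 2 * a * (# 2 * a) * (# 2 * a))
    lem = solve-∀ ring
    lem′ : ∀ a → # 2 * (½ * ¼ * a) ≡ ¼ * a
    lem′ = solve-∀ ring

  sum-ρ̂ : ∀ n (f : ℕ → K) → sum n (λ c → ρ̂ c * f c) ≡ sum n f + sum n (λ c → σ c * f c)
  sum-ρ̂ n f = trans (sum-ext n (λ c → lem (σ c) (f c))) (sum-+ n f (λ c → σ c * f c))
    where
    lem : ∀ s a → (1# + s) * a ≡ a + s * a
    lem = solve-∀ ring

  Int-sumAll : ∀ n {f : ℕ → K} → (∀ j → Int (f j)) → Int (sum n f)
  Int-sumAll n i = Int-sum n (λ j _ → i j)

  -- Reflection in p^(i+1) reverses σ but preserves ι² up to the linear term 2 p^(i+1) ι³, so twice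
  -- the sum equals that term.
  sum-σι² : ∀ i → sum (p ℕ.^ suc i) σι² ≈[ suc i ℕ.+ suc i ] - (P (suc i) * sum (p ℕ.^ suc i) σι³)
  sum-σι² i = cancel p∤2 (≈-by₁ 1# Int-1 (≈-trans mirrored (≡⇒≈ expand)) (lem′ a b c))
    where
    n = p ℕ.^ suc i
    a = sum n σι²
    b = P (suc i)
    c = sum n σι³
    g : ℕ → K
    g j = - 1# * σι² j + - (# 2 * b) * σι³ j
    lem : ∀ s a b → - s * (a * a + # 2 * b * (a * a * a)) ≡ - 1# * (s * (a * a)) + - (# 2 * b)
      * (s * (a * a * a))
    lem = solve-∀ ring
    lem₀ : ∀ s a b → - 1# * (s * (a * a)) + - (# 2 * b) * (s * (a * a * a)) ≡ a
      * (- 1# * (s * a) + - (# 2 * b) * (s * (a * a)))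
    lem₀ = solve-∀ ring
    step : ∀ j k → suc j ℕ.+ suc k ≡ n → σι² (suc k) ≈[ suc i ℕ.+ suc i ] g (suc j)
    step j k eq = ≈-trans (*-≈ (Int-ι² (suc k)) (⊝ Int-σ (suc j))
      (≡⇒≈ (σ-mirror (σ-p^ (suc i)) (suc j) (suc k) eq)) (ι²-mirror {i} ∣-refl (suc j) (suc k) eq))
                    (≡⇒≈ (lem (σ (suc j)) (ι (suc j)) b))
    mirrored : sum n σι² ≈[ suc i ℕ.+ suc i ] sum n g
    mirrored = sum-mirror n (trans (*-identityˡ _) (ι*0 {ι 0}))
      (trans (lem₀ (σ 0) (ι 0) b) (trans (cong (_* (- 1# * (σ 0 * ι 0) + - (# 2 * b) * (σ 0 * (ι 0 * ι 0))))
      ι-0) (zeroˡ _))) step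
    expand : sum n g ≡ - 1# * a + - (# 2 * b) * c
    expand = trans (sum-+ n (λ j → - 1# * σι² j) (λ j → - (# 2 * b) * σι³ j))
      (cong₂ _+_ (sum-*ˡ n (- 1#) σι²) (sum-*ˡ n (- (# 2 * b)) σι³))
    lem′ : ∀ a b c → # 2 * a - # 2 * - (b * c) ≡ 1# * (a - (- 1# * a + - (# 2 * b) * c))
    lem′ = solve-∀ ring

  -- Folding the range [0, p^(i+1)) at its midpoint expresses Σ ι² through the
  -- lower half, which by doubling is also the sum over the even indices.
  sum-ι²-double : ∀ i → let n = p ℕ.^ suc i in
    sum n ι² ≈[ suc i ℕ.+ suc i ]
      # 4 * (sum n ι² + sum n σι²) + # 8 * P (suc i) * (sum n ι³ + sum n σι³)
  sum-ι²-double i with p^-odd (suc i)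
  ... | h , n≡ = begin
    sum n ι²                                              ≡⟨ cong (λ k → sum k ι²) n≡ ⟩
    sum (suc (2 ℕ.* h)) ι²                                ≡⟨ cong (λ k → sum k ι²) (lem h) ⟩
    sum (suc h ℕ.+ h) ι²                                  ≡⟨ sum-++ (suc h) h ι² ⟩
    Z₂ + sum h (λ j → ι² (suc h ℕ.+ j))                  
      ≡⟨ cong (_+_ Z₂) (sum-reverse h (λ j → ι² (suc h ℕ.+ j))) ⟩
    Z₂ + sum h (λ j → ι² (suc h ℕ.+ (h ∸ suc j)))        
      ≈⟨ +-≈ ≈-refl (sum-≈ h (λ j j<h → ι²-mirror {i} ∣-refl (suc j) (suc h ℕ.+ (h ∸ suc j)) (eq j j<h))) ⟩
    Z₂ + sum h (λ j → ι² (suc j) + # 2 * P (suc i) * ι³ (suc j)) ≡⟨ cong (_+_ Z₂) (head) ⟩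
    Z₂ + (Z₂ + # 2 * P (suc i) * Z₃)                      ≡⟨ lem′ Z₂ (P (suc i)) Z₃ ⟩
    # 4 * (½ * Z₂) + # 8 * P (suc i) * (¼ * Z₃)          
      ≡⟨ cong₂ (λ a b → # 4 * a + # 8 * P (suc i) * b) (sum-half h) (sum-half³ h) ⟨
    # 4 * sum (suc (2 ℕ.* h)) (λ c → ρ̂ c * ι² c) + # 8 * P (suc i) * sum (suc (2 ℕ.* h)) (λ c → ρ̂ c * ι³ c)
      ≡⟨ cong (λ k → # 4 * sum k (λ c → ρ̂ c * ι² c) + # 8 * P (suc i) * sum k (λ c → ρ̂ c * ι³ c)) n≡ ⟨
    # 4 * sum n (λ c → ρ̂ c * ι² c) + # 8 * P (suc i) * sum n (λ c → ρ̂ c * ι³ c)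
      ≡⟨ cong₂ (λ a b → # 4 * a + # 8 * P (suc i) * b) (sum-ρ̂ n ι²) (sum-ρ̂ n ι³) ⟩
    # 4 * (sum n ι² + sum n σι²) + # 8 * P (suc i) * (sum n ι³ + sum n σι³) ∎
    where
    open ≈-Reasoning (suc i ℕ.+ suc i)
    n = p ℕ.^ suc i
    Z₂ = sum (suc h) ι²
    Z₃ = sum (suc h) ι³
    lem : ∀ h → suc (2 ℕ.* h) ≡ suc h ℕ.+ h
    lem = solveℕ-∀
    lem″ : ∀ h j k → suc j ℕ.+ (suc h ℕ.+ k) ≡ suc (h ℕ.+ (suc j ℕ.+ k))
    lem″ = solveℕ-∀
    lem‴ : ∀ h → suc (h ℕ.+ h) ≡ suc (2 ℕ.* h)
    lem‴ = solveℕ-∀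
    eq : ∀ j → j < h → suc j ℕ.+ (suc h ℕ.+ (h ∸ suc j)) ≡ n
    eq j j<h = trans (lem″ h j (h ∸ suc j))
      (trans (cong (λ k → suc (h ℕ.+ k)) (ℕP.m+[n∸m]≡n j<h)) (trans (lem‴ h) (sym n≡)))
    g : ℕ → K
    g j = ι² j + # 2 * P (suc i) * ι³ j
    lem₀ : ∀ a b → a * a + # 2 * b * (a * a * a) ≡ a * (a + # 2 * b * (a * a))
    lem₀ = solve-∀ ring
    g0 : g 0 ≡ 0#
    g0 = trans (lem₀ (ι 0) (P (suc i))) (trans (cong (_* (ι 0 + # 2 * P (suc i) * (ι 0 * ι 0))) ι-0) (zeroˡ _))
    head : sum h (g ∘ suc) ≡ Z₂ + # 2 * P (suc i) * Z₃
    head = ≡-Reasoning.begin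
      sum h (g ∘ suc)        ≡-Reasoning.≡⟨ +-identityˡ _ ⟨
      0# + sum h (g ∘ suc)   ≡-Reasoning.≡⟨ cong (_+ sum h (g ∘ suc)) g0 ⟨
      g 0 + sum h (g ∘ suc)  ≡-Reasoning.≡⟨ sum-head h g ⟨
      sum (suc h) g          ≡-Reasoning.≡⟨ trans (sum-+ (suc h) ι² (λ j → # 2 * P (suc i) * ι³ j))
        (cong (_+_ Z₂) (sum-*ˡ (suc h) (# 2 * P (suc i)) ι³)) ⟩
      Z₂ + # 2 * P (suc i) * Z₃ ≡-Reasoning.∎
    lem′ : ∀ a b c → a + (a + # 2 * b * c) ≡ # 4 * (½ * a) + # 8 * b * (¼ * c)
    lem′ = solve-∀ ring

  -- The working precision for a modulus p^(i+1) is one digit more, p^(i+2); the errors of the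
  -- first-order expansions are of order p^(2i+2) and therefore negligible.
  suc≤ : ∀ i → suc (suc i) ≤ suc i ℕ.+ suc i
  suc≤ i = s≤s (subst (suc i ≤_) (sym (ℕP.+-suc i i)) (s≤s (ℕP.m≤m+n i i)))

  P*≈ : ∀ i {x y} → x ≈[ 1 ] y → P (suc i) * x ≈[ suc (suc i) ] P (suc i) * y
  P*≈ i {x} {y} h = subst (λ e → P (suc i) * x ≈[ e ] P (suc i) * y) (ℕP.+-comm (suc i) 1)
    (scale (≈0-P (suc i)) h)

  sum-σι²-p^ : ∀ i → sum (p ℕ.^ suc i) σι² ≈[ suc (suc i) ] - (P (suc i) * θ)
  sum-σι²-p^ i = ≈-trans (≈-weaken (suc≤ i) (sum-σι² i))
    (≈-by₁ (- 1#) (⊝ Int-1) (P*≈ i (sum-σι³ (p ℕ.^ i) (σ-p^ i)))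
      (lem (P (suc i) * sum (p ℕ.^ suc i) σι³) (P (suc i) * θ)))
    where
    lem : ∀ a b → - a - - b ≡ - 1# * (a - b)
    lem = solve-∀ ring

  -- With Σ σι² ≡ -p^(i+1) θ, Σ ι³ ≡ 0 and Σ σι³ ≡ θ, the relation `sum-ι²-double` becomes -3 Σ ι² ≡
  -- (-4 + 8) p^(i+1) θ. This is the origin of 4/3.
  sum-ι²-p^ : ∀ i → sum (p ℕ.^ suc i) ι² ≈[ suc (suc i) ] - (# 4 * ⅓ * (P (suc i) * θ))
  sum-ι²-p^ i = cancel p∤3 (≈-trans
    (≈-by₂ (# 2) 1# (nat 2) Int-1 tail double (lem a b (P (suc i)) c d θ))
    ≈-refl)
    where
    n = p ℕ.^ suc i
    a = sum n ι²
    b = sum n σι²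
    c = sum n ι³
    d = sum n σι³
    pd = P*≈ i (sum-σι³ (p ℕ.^ i) (σ-p^ i))
    pc = P*≈ i (sum-ι³ {n} (m∣m*n (p ℕ.^ i)))
    rest : # 4 * (b + P (suc i) * θ) + # 8 * (P (suc i) * c) + # 8 * (P (suc i) * d) ≈[ suc (suc i) ]
           # 4 * (- (P (suc i) * θ) + P (suc i) * θ) + # 8 * (P (suc i) * 0#) + # 8 * (P (suc i) * θ)
    rest = +-≈ (+-≈ (*ˡ-≈ (nat 4) (+-≈ (sum-σι²-p^ i) ≈-refl)) (*ˡ-≈ (nat 8) pc)) (*ˡ-≈ (nat 8) pd)
    tail : - (½ * (# 4 * (b + P (suc i) * θ) + # 8 * (P (suc i) * c) + # 8 * (P (suc i) * d))) ≈[ suc (suc i) ]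
           - (½ * (# 4 * (- (P (suc i) * θ) + P (suc i) * θ) + # 8 * (P (suc i) * 0#) + # 8 * (P (suc i) * θ)))
    tail = ≈-by₁ (- ½) (⊝ Int-½) rest (neg½ _ _)
      where
      neg½ : ∀ x y → - (½ * x) - - (½ * y) ≡ - ½ * (x - y)
      neg½ = solve-∀ ring
    double : - a ≈[ suc (suc i) ] - (# 4 * (a + b) + # 8 * P (suc i) * (c + d))
    double = ≈-by₁ (- 1#) (⊝ Int-1) (≈-weaken (suc≤ i) (sum-ι²-double i)) (neg _ _)
      where
      neg : ∀ x y → - x - - y ≡ - 1# * (x - y)
      neg = solve-∀ ring
    lem : ∀ a b p c d t → # 3 * a - # 3 * - (# 4 * ⅓ * (p * t)) ≡
      # 2 * (- (½ * (# 4 * (b + p * t) + # 8 * (p * c) + # 8 * (p * d)))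
        - - (½ * (# 4 * (- (p * t) + p * t) + # 8 * (p * 0#) + # 8 * (p * t))))
      + 1# * (- a - - (# 4 * (a + b) + # 8 * p * (c + d)))
    lem = solve-∀ ring

  -- All blocks of length p^(i+1) give the same value, because the linear term of a shift is
  -- multiplied by Σ ι³ ≡ 0.
  sum-ι²-≈ : ∀ i {m} → p ℕ.^ suc i ∣ m → sum m ι² ≈[ suc (suc i) ] - (# 4 * ⅓ * (# m * θ))
  sum-ι²-≈ i (divides k refl) = begin
    sum (k ℕ.* n) ι²        ≡⟨ trans (cong (λ l → sum l ι²) (ℕP.*-comm k n)) (sum-block n k ι²) ⟩
    sum k (λ u → sum n (λ j → ι² (n ℕ.* u ℕ.+ j)))  ≈⟨ sum-≈ k (λ u _ → inner u) ⟩
    sum k (λ u → - (# 4 * ⅓ * (P (suc i) * θ)))     ≡⟨ sum-const k _ ⟩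
    # k * - (# 4 * ⅓ * (P (suc i) * θ))             ≡⟨ lem (# k) (P (suc i)) θ ⟩
    - (# 4 * ⅓ * (# k * P (suc i) * θ))             ≡⟨ cong (λ a → - (# 4 * ⅓ * (a * θ))) (#-* k n) ⟨
    - (# 4 * ⅓ * (# (k ℕ.* n) * θ))                 ∎
    where
    open ≈-Reasoning (suc (suc i))
    n = p ℕ.^ suc i
    lem : ∀ k p t → k * - (# 4 * ⅓ * (p * t)) ≡ - (# 4 * ⅓ * (k * p * t))
    lem = solve-∀ ring
    lem′ : ∀ a n u b → a - # 2 * (n * u) * b ≡ a + - (# 2) * u * (n * b)
    lem′ = solve-∀ ring
    lem″ : ∀ a b c → a + b * (c * 0#) ≡ a
    lem″ = solve-∀ ring
    inner : ∀ u → sum n (λ j → ι² (n ℕ.* u ℕ.+ j)) ≈[ suc (suc i) ] - (# 4 * ⅓ * (P (suc i) * θ))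
    inner u = begin
      sum n (λ j → ι² (n ℕ.* u ℕ.+ j)) ≈⟨ sum-≈ n (λ j _ → ≈-weaken (suc≤ i) (ι²-shift {i} (m∣m*n u) j)) ⟩
      sum n (λ j → ι² j - # 2 * # (n ℕ.* u) * ι³ j)
        ≡⟨ sum-ext n (λ j → trans (cong (λ a → ι² j - # 2 * a * ι³ j) (#-* n u))
          (trans (lem′ (ι² j) (P (suc i)) (# u) (ι³ j))
          (cong (_+_ (ι² j)) (sym (*-assoc (- # 2 * # u) (P (suc i)) (ι³ j)))))) ⟩
      sum n (λ j → ι² j + - # 2 * # u * P (suc i) * ι³ j)
        ≡⟨ trans (sum-+ n ι² (λ j → - # 2 * # u * P (suc i) * ι³ j))
          (cong (_+_ (sum n ι²)) (trans (sum-*ˡ n (- # 2 * # u * P (suc i)) ι³)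
          (*-assoc (- # 2 * # u) (P (suc i)) (sum n ι³)))) ⟩
      sum n ι² + - # 2 * # u * (P (suc i) * sum n ι³)
        ≈⟨ +-≈ (sum-ι²-p^ i) (*ˡ-≈ (⊝ nat 2 ⊗ nat u) (P*≈ i (sum-ι³ {n} (m∣m*n (p ℕ.^ i))))) ⟩
      - (# 4 * ⅓ * (P (suc i) * θ)) + - # 2 * # u * (P (suc i) * 0#)
        ≡⟨ lem″ (- (# 4 * ⅓ * (P (suc i) * θ))) (- # 2 * # u) (P (suc i)) ⟩
      - (# 4 * ⅓ * (P (suc i) * θ)) ∎

  -- The summation index k is replaced by c = 2k, and at level i by c = ⌊2k/p^i⌋:
  -- then ⌊k/p^i⌋ = ⌊c/2⌋, and the levels are linked by c ↦ ⌊c/p⌋ alone.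
  -- The weight h₀ is 1/k² at c = 2k and 0 at odd c.
  h₀ : ℕ → K
  h₀ c = # 2 * (ρ̂ c * ι² c)

  level : ℕ → ℕ → K
  level i c = sum (p ℕ.^ i) (λ j → h₀ (p ℕ.^ i ℕ.* c ℕ.+ j))

  -- `level i c` for i ≥ 1, divided by -2 p^i θ: the term 4/3 comes from Σ ι², σ c from Σ σι², and 2
  -- c σ c from the shift of the block by p^i c.
  ℓ : ℕ → K
  ℓ c = # 4 * ⅓ + σ c * (1# + # 2 * # c)

  level-≈ : ∀ i c → level (suc i) c ≈[ suc (suc i) ] P (suc i) * (- # 2 * θ * ℓ c)
  level-≈ i c = begin
    level (suc i) c ≈⟨ sum-≈ n (λ j _ → term j) ⟩
    sum n (λ j → # 2 * ι² j + # 2 * s * σι² j + (- # 4 * c′ * P₁ * ι³ j + - # 4 * s * c′ * P₁ * σι³ j))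
      ≡⟨ expand ⟩
    # 2 * sum n ι² + # 2 * s * sum n σι² + (- # 4 * c′ * P₁ * sum n ι³ + - # 4 * s * c′ * P₁ * sum n σι³)
      ≡⟨ lem′ s c′ P₁ (sum n ι²) (sum n σι²) (sum n ι³) (sum n σι³) ⟩
    # 2 * sum n ι² + # 2 * s * sum n σι² + (- # 4 * c′ * (P₁ * sum n ι³) + - # 4 * s * c′ * (P₁ * sum n σι³))
      ≈⟨ +-≈ (+-≈ (*ˡ-≈ (nat 2) (sum-ι²-p^ i)) (*ˡ-≈ (nat 2 ⊗ Int-σ c) (sum-σι²-p^ i)))
        (+-≈ (*ˡ-≈ (⊝ nat 4 ⊗ nat c) (P*≈ i (sum-ι³ {n} (m∣m*n (p ℕ.^ i)))))
        (*ˡ-≈ (⊝ nat 4 ⊗ Int-σ c ⊗ nat c) (P*≈ i (sum-σι³ (p ℕ.^ i) (σ-p^ i))))) ⟩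
    # 2 * - (# 4 * ⅓ * (P₁ * θ)) + # 2 * s * - (P₁ * θ) + (- # 4 * c′ * (P₁ * 0#) + - # 4 * s * c′ * (P₁ * θ))
      ≡⟨ lem″ s c′ P₁ θ ⟩
    P₁ * (- # 2 * θ * ℓ c) ∎
    where
    open ≈-Reasoning (suc (suc i))
    n = p ℕ.^ suc i
    s = σ c
    c′ = # c
    P₁ = P (suc i)
    lem : ∀ s t c′ P b → # 2 * ((1# + s * t) * (b * b - # 2 * (P * c′) * (b * b * b))) ≡
          # 2 * (b * b) + # 2 * s * (t * (b * b))
            + (- # 4 * c′ * P * (b * b * b) + - # 4 * s * c′ * P * (t * (b * b * b)))
    lem = solve-∀ ring
    lem′ : ∀ s c′ P a b c d → # 2 * a + # 2 * s * b + (- # 4 * c′ * P * c + - # 4 * s * c′ * P * d)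
         ≡ # 2 * a + # 2 * s * b + (- # 4 * c′ * (P * c) + - # 4 * s * c′ * (P * d))
    lem′ = solve-∀ ring
    lem″ : ∀ s c′ P t → # 2 * - (# 4 * ⅓ * (P * t)) + # 2 * s * - (P * t)
      + (- # 4 * c′ * (P * 0#) + - # 4 * s * c′ * (P * t)) ≡ P * (- # 2 * t * (# 4 * ⅓ + s * (1# + # 2 * c′)))
    lem″ = solve-∀ ring
    term : ∀ j → h₀ (n ℕ.* c ℕ.+ j) ≈[ suc (suc i) ] # 2 * ι² j + # 2 * s * σι² j
      + (- # 4 * c′ * P₁ * ι³ j + - # 4 * s * c′ * P₁ * σι³ j)
    term j = begin
      # 2 * ((1# + σ (n ℕ.* c ℕ.+ j)) * ι² (n ℕ.* c ℕ.+ j))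
        ≈⟨ *ˡ-≈ (nat 2) (*-≈ (Int-ι² (n ℕ.* c ℕ.+ j)) (Int-1 ⊕ Int-σ c ⊗ Int-σ j)
          (≡⇒≈ (cong (_+_ 1#) (trans (σ-+ (n ℕ.* c) j) (cong (_* σ j) (σ-p^* (suc i) c)))))
          (≈-weaken (suc≤ i) (ι²-shift {i} (m∣m*n c) j))) ⟩
      # 2 * ((1# + s * σ j) * (ι² j - # 2 * # (n ℕ.* c) * ι³ j))
        ≡⟨ cong (λ a → # 2 * ((1# + s * σ j) * (ι² j - # 2 * a * ι³ j))) (#-* n c) ⟩
      # 2 * ((1# + s * σ j) * (ι² j - # 2 * (P₁ * c′) * ι³ j)) ≡⟨ lem s (σ j) c′ P₁ (ι j) ⟩
      # 2 * ι² j + # 2 * s * σι² j + (- # 4 * c′ * P₁ * ι³ j + - # 4 * s * c′ * P₁ * σι³ j) ∎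
    expand : sum n (λ j → # 2 * ι² j + # 2 * s * σι² j + (- # 4 * c′ * P₁ * ι³ j + - # 4 * s * c′ * P₁ * σι³ j))
           ≡ # 2 * sum n ι² + # 2 * s * sum n σι²
             + (- # 4 * c′ * P₁ * sum n ι³ + - # 4 * s * c′ * P₁ * sum n σι³)
    expand = trans (sum-+ n (λ j → # 2 * ι² j + # 2 * s * σι² j)
      (λ j → - # 4 * c′ * P₁ * ι³ j + - # 4 * s * c′ * P₁ * σι³ j))
      (cong₂ _+_ (trans (sum-+ n (λ j → # 2 * ι² j) (λ j → # 2 * s * σι² j))
        (cong₂ _+_ (sum-*ˡ n (# 2) ι²) (sum-*ˡ n (# 2 * s) σι²)))
                 (trans (sum-+ n (λ j → - # 4 * c′ * P₁ * ι³ j) (λ j → - # 4 * s * c′ * P₁ * σι³ j))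
                   (cong₂ _+_ (sum-*ˡ n (- # 4 * c′ * P₁) ι³) (sum-*ˡ n (- # 4 * s * c′ * P₁) σι³))))

  -- Harmonic double sums

  one : ℕ → K
  one _ = 1#

  harm : (ℕ → K) → ℕ → K
  harm ρ k = sum (suc k) (λ j → ρ j * ι j)

  Int-ρ̂ : ∀ c → Int (ρ̂ c)
  Int-ρ̂ c = Int-1 ⊕ Int-σ c

  Int-harm : ∀ {ρ} → (∀ j → Int (ρ j)) → ∀ k → Int (harm ρ k)
  Int-harm iρ k = Int-sumAll (suc k) (λ j → iρ j ⊗ Int-ι j)

  -- Harmonic numbers without the multiples of p: the ordinary one, the alternating one, and Ĥ,
  -- which is H at half the index (`Ĥ-2*`).
  H H′ Ĥ : ℕ → K
  H  = harm one
  H′ = harm σ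
  Ĥ  = harm ρ̂

  Int-one : ∀ j → Int (one j)
  Int-one _ = Int-1

  Int-H : ∀ k → Int (H k)
  Int-H = Int-harm Int-one

  Int-H′ : ∀ k → Int (H′ k)
  Int-H′ = Int-harm Int-σ

  Int-Ĥ : ∀ k → Int (Ĥ k)
  Int-Ĥ = Int-harm Int-ρ̂

  ι-period : ∀ u w → ι (p ℕ.* u ℕ.+ w) ≈[ 1 ] ι w
  ι-period u w = ι-shift≈ {0} (p^1∣p* u) w

  ι²-period : ∀ u w → ι² (p ℕ.* u ℕ.+ w) ≈[ 1 ] ι² w
  ι²-period u w = *-≈ (Int-ι _) (Int-ι w) (ι-period u w) (ι-period u w)

  sum-one-ι : ∀ m → sum m (λ j → 1# * ι j) ≡ sum m ι
  sum-one-ι m = sum-ext m (λ j → *-identityˡ (ι j))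

  H-period : ∀ u w → H (p ℕ.* u ℕ.+ w) ≈[ 1 ] H w
  H-period u w = begin
    sum (suc (p ℕ.* u ℕ.+ w)) f
      ≡⟨ trans (cong (λ k → sum k f) (sym (ℕP.+-suc (p ℕ.* u) w))) (sum-++ (p ℕ.* u) (suc w) f) ⟩
    sum (p ℕ.* u) f + sum (suc w) (λ j → f (p ℕ.* u ℕ.+ j))
      ≈⟨ +-≈ (≈-trans (≡⇒≈ (sum-one-ι (p ℕ.* u))) (sum-ι (m∣m*n {p} u)))
        (sum-≈ (suc w) (λ j _ → *ˡ-≈ Int-1 (ι-period u j))) ⟩
    0# + H w ≡⟨ +-identityˡ _ ⟩
    H w ∎
    where
    open ≈-Reasoning 1
    f : ℕ → K
    f j = 1# * ι j

  -- The contribution of the complete periods. Unlike for H it need not vanish modulo p; in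
  -- `block-Ĥ` it is multiplied by Σ ι² or Σ σι² and disappears there.
  Ĥ₀ : ℕ → K
  Ĥ₀ u = sum (p ℕ.* u) (λ j → ρ̂ j * ι j)

  Int-Ĥ₀ : ∀ u → Int (Ĥ₀ u)
  Int-Ĥ₀ u = Int-sumAll (p ℕ.* u) (λ j → Int-ρ̂ j ⊗ Int-ι j)

  Ĥ-period : ∀ u w → Ĥ (p ℕ.* u ℕ.+ w) ≈[ 1 ] Ĥ₀ u + (H w + σ u * H′ w)
  Ĥ-period u w = begin
    sum (suc (p ℕ.* u ℕ.+ w)) f
      ≡⟨ trans (cong (λ k → sum k f) (sym (ℕP.+-suc (p ℕ.* u) w))) (sum-++ (p ℕ.* u) (suc w) f) ⟩
    Ĥ₀ u + sum (suc w) (λ j → f (p ℕ.* u ℕ.+ j))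
      ≈⟨ +-≈ ≈-refl (sum-≈ (suc w) (λ j _ → *-≈ (Int-ι (p ℕ.* u ℕ.+ j)) (Int-1 ⊕ Int-σ u ⊗ Int-σ j)
        (≡⇒≈ (cong (_+_ 1#) (σ-block u j))) (ι-period u j))) ⟩
    Ĥ₀ u + sum (suc w) (λ j → (1# + σ u * σ j) * ι j)
      ≡⟨ cong (_+_ (Ĥ₀ u)) (sum-ext (suc w) (λ j → lem (σ u) (σ j) (ι j))) ⟩
    Ĥ₀ u + sum (suc w) (λ j → 1# * ι j + σ u * (σ j * ι j))
      ≡⟨ cong (_+_ (Ĥ₀ u)) (trans (sum-+ (suc w) (λ j → 1# * ι j) (λ j → σ u * (σ j * ι j)))
        (cong (_+_ (H w)) (sum-*ˡ (suc w) (σ u) (λ j → σ j * ι j)))) ⟩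
    Ĥ₀ u + (H w + σ u * H′ w) ∎
    where
    open ≈-Reasoning 1
    f : ℕ → K
    f j = ρ̂ j * ι j
    lem : ∀ s t a → (1# + s * t) * a ≡ 1# * a + s * (t * a)
    lem = solve-∀ ring

  -- The indices from k + 1 up to n - 1 are the reflections of 1, ..., j. For f = g this relates a
  -- partial sum to the one of the complementary length.
  sum-split-mirror : ∀ {n j k} {f g : ℕ → K} → g 0 ≡ 0# → suc j ℕ.+ k ≡ n →
    (∀ i l → suc i ℕ.+ suc l ≡ n → f (suc l) ≈[ e ] g (suc i)) → sum n f ≈[ e ] sum (suc k) f + sum (suc j) g
  sum-split-mirror {e} {n} {j} {k} {f} {g} g0 eq h = begin
    sum n f ≡⟨ cong (λ l → sum l f) (trans (sym eq) (trans (ℕP.+-comm (suc j) k) (ℕP.+-suc k j))) ⟩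
    sum (suc k ℕ.+ j) f
      ≡⟨ trans (sum-++ (suc k) j f) (cong (_+_ (sum (suc k) f)) (sum-reverse j (λ i → f (suc k ℕ.+ i)))) ⟩
    sum (suc k) f + sum j (λ i → f (suc k ℕ.+ (j ∸ suc i)))
      ≈⟨ +-≈ ≈-refl (sum-≈ j (λ i i<j → h i (k ℕ.+ (j ∸ suc i))
        (trans (lem i k (j ∸ suc i)) (trans (cong (λ l → suc k ℕ.+ l) (ℕP.m+[n∸m]≡n i<j))
        (trans (cong suc (ℕP.+-comm k j)) eq))))) ⟩
    sum (suc k) f + sum j (g ∘ suc)
      ≡⟨ cong (_+_ (sum (suc k) f)) (trans (sum-head j g)
        (trans (cong (_+ sum j (g ∘ suc)) g0) (+-identityˡ _))) ⟨
    sum (suc k) f + sum (suc j) g ∎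
    where
    open ≈-Reasoning e
    lem : ∀ i k l → suc i ℕ.+ suc (k ℕ.+ l) ≡ suc k ℕ.+ (suc i ℕ.+ l)
    lem = solveℕ-∀

  p∣p : p ∣ p
  p∣p = ∣-refl

  -- The classical H_{p-1-j} ≡ H_j: the right side is H (suc j) without its last term.
  H-mirror : ∀ j k → suc j ℕ.+ suc k ≡ p → H (suc k) ≈[ 1 ] H (suc j) - ι (suc j)
  H-mirror j k eq = ≈-by₂ (- 1#) 1# (⊝ Int-1) Int-1
    (sum-split-mirror {j = j} {k = suc k} {f = f} {g = g} g0 eq mirror)
      (≈-trans (≡⇒≈ (sum-one-ι p)) (sum-ι p∣p))
      (trans (lem (H (suc k)) (sum (suc j) f) (ι (suc j)) (sum p f))
        (cong (λ a → - 1# * (sum p f - (H (suc k) + a)) + 1# * (sum p f - 0#)) (sym neg)))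
    where
    f g : ℕ → K
    f i = 1# * ι i
    g i = - 1# * (1# * ι i)
    g0 : g 0 ≡ 0#
    g0 = trans (cong (_*_ (- 1#)) (ι*0 {1#})) (zeroʳ (- 1#))
    lem₁ : ∀ a → 1# * - a ≡ - 1# * (1# * a)
    lem₁ = solve-∀ ring
    mirror : ∀ i l → suc i ℕ.+ suc l ≡ p → f (suc l) ≈[ 1 ] g (suc i)
    mirror i l eq = ≈-trans (*ˡ-≈ Int-1 (ι-mirror {0} (p^1∣ p∣p) (suc i) (suc l) eq)) (≡⇒≈ (lem₁ (ι (suc i))))
    neg : sum (suc j) g ≡ - 1# * sum (suc j) f
    neg = sum-*ˡ (suc j) (- 1#) f
    lem : ∀ a b c s → a - (b + 1# * c - c) ≡ - 1# * (s - (a + - 1# * b)) + 1# * (s - 0#)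
    lem = solve-∀ ring

  -- Up to sign twice a Fermat quotient modulo p; it cancels in `D₂≈`, where it is multiplied by Σ
  -- ι² ≡ 0.
  η : K
  η = sum p (λ j → σ j * ι j)

  Int-η : Int η
  Int-η = Int-sumAll p (λ j → Int-σ j ⊗ Int-ι j)

  σι-mirror : ∀ i l → suc i ℕ.+ suc l ≡ p → σ (suc l) * ι (suc l) ≈[ 1 ] σ (suc i) * ι (suc i)
  σι-mirror i l eq = ≈-trans (*-≈ (Int-ι (suc l)) (⊝ Int-σ (suc i)) (≡⇒≈ (σ-mirror σ-p (suc i) (suc l) eq))
    (ι-mirror {0} (p^1∣ p∣p) (suc i) (suc l) eq)) (≡⇒≈ (lem (σ (suc i)) (ι (suc i))))
    where
    lem : ∀ a b → - a * - b ≡ a * b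
    lem = solve-∀ ring

  H′-mirror : ∀ j k → suc j ℕ.+ suc k ≡ p → H′ (suc k) ≈[ 1 ] η - H′ (suc j) + σ (suc j) * ι (suc j)
  H′-mirror j k eq = ≈-by₁ (- 1#) (⊝ Int-1)
    (sum-split-mirror {j = j} {k = suc k} {f = f} {g = f} (ι*0 {1#}) eq σι-mirror)
    (lem (H′ (suc k)) (sum (suc j) f) (σ (suc j) * ι (suc j)) η)
    where
    f : ℕ → K
    f i = σ i * ι i
    lem : ∀ a b c s → a - (s - (b + c) + c) ≡ - 1# * (s - (a + b))
    lem = solve-∀ ring

  -- The four sums into which ι² times (1 + σ)(H ± H′) expands over one period. D₁ and D₂ follow by
  -- reflection, D₃ from D by doubling indices, and D itself from a binomial identity.
  D D₁ D₂ D₃ : K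
  D  = sum p (λ w → ι² w * H w)
  D₁ = sum p (λ w → σι² w * H w)
  D₂ = sum p (λ w → ι² w * H′ w)
  D₃ = sum p (λ w → σι² w * H′ w)

  Int-σι² : ∀ w → Int (σι² w)
  Int-σι² w = Int-σ w ⊗ Int-ι² w

  ι²-mirror₁ : ∀ i l → suc i ℕ.+ suc l ≡ p → ι² (suc l) ≈[ 1 ] ι² (suc i)
  ι²-mirror₁ i l eq = ≈-trans (*-≈ (Int-ι (suc l)) (⊝ Int-ι (suc i)) h h) (≡⇒≈ (lem (ι (suc i))))
    where
    h = ι-mirror {0} (p^1∣ p∣p) (suc i) (suc l) eq
    lem : ∀ a → - a * - a ≡ a * a
    lem = solve-∀ ring

  σι²-mirror₁ : ∀ i l → suc i ℕ.+ suc l ≡ p → σι² (suc l) ≈[ 1 ] - σι² (suc i)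
  σι²-mirror₁ i l eq = ≈-trans (*-≈ (Int-ι² (suc l)) (⊝ Int-σ (suc i)) (≡⇒≈ (σ-mirror σ-p (suc i) (suc l) eq))
    (ι²-mirror₁ i l eq)) (≡⇒≈ (lem (σ (suc i)) (ι² (suc i))))
    where
    lem : ∀ a b → - a * b ≡ - (a * b)
    lem = solve-∀ ring

  ι²0* : ∀ x → ι² 0 * x ≡ 0#
  ι²0* x = trans (cong (_* x) (ι*0 {ι 0})) (zeroˡ x)

  σι²0* : ∀ x → σι² 0 * x ≡ 0#
  σι²0* x = trans (cong (λ a → 1# * a * x) (ι*0 {ι 0})) (trans (cong (_* x) (zeroʳ 1#)) (zeroˡ x))

  sum-ι²-p : sum p ι² ≈[ 1 ] 0#
  sum-ι²-p = ≈-trans (≈-weaken (s≤s z≤n) (sum-ι²-≈ 0 (p^1∣ p∣p)))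
    (≈-by₁ (- (# 4 * ⅓ * θ)) (⊝ (nat 4 ⊗ Int-⅓ ⊗ Int-θ)) (∣⇒≈0 {1} (p^1∣ p∣p)) (lem (# p) θ))
    where
    lem : ∀ p t → - (# 4 * ⅓ * (p * t)) - 0# ≡ - (# 4 * ⅓ * t) * (p - 0#)
    lem = solve-∀ ring

  sum-σι²-p : sum p σι² ≈[ 1 ] 0#
  sum-σι²-p = sum-odd p {σι²} (trans (*-identityˡ _) (ι*0 {ι 0})) σι²-mirror₁

  -- Under reflection σι² changes sign and H loses its last term, so D₁ ≡ -D₁ + θ.
  D₁≈ : D₁ ≈[ 1 ] ½ * θ
  D₁≈ = cancel p∤2 (≈-by₁ 1# Int-1 step (lem D₁ θ))
    where
    lem : ∀ a t → # 2 * a - # 2 * (½ * t) ≡ 1# * (a - (- 1# * a + t))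
    lem = solve-∀ ring
    lem′ : ∀ s b h → - (s * (b * b)) * (h - b) ≡ - 1# * (s * (b * b) * h) + s * (b * b * b)
    lem′ = solve-∀ ring
    lem₀ : ∀ s b h → - 1# * (s * (b * b) * h) + s * (b * b * b) ≡ b * (- 1# * (s * b * h) + s * (b * b))
    lem₀ = solve-∀ ring
    g : ℕ → K
    g j = - 1# * (σι² j * H j) + σι³ j
    step : D₁ ≈[ 1 ] - 1# * D₁ + θ
    step = ≈-trans (sum-mirror p {λ w → σι² w * H w} {g} (σι²0* (H 0))
        (trans (lem₀ (σ 0) (ι 0) (H 0)) (trans (cong (_* (- 1# * (σ 0 * ι 0 * H 0) + σ 0 * (ι 0 * ι 0))) ι-0)
          (zeroˡ _)))
        (λ j k eq → ≈-trans (*-≈ (Int-H (suc k)) (⊝ Int-σι² (suc j)) (σι²-mirror₁ j k eq) (H-mirror j k eq))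
          (≡⇒≈ (lem′ (σ (suc j)) (ι (suc j)) (H (suc j))))))
      (≡⇒≈ (trans (sum-+ p (λ j → - 1# * (σι² j * H j)) σι³)
        (cong (_+ θ) (sum-*ˡ p (- 1#) (λ j → σι² j * H j)))))

  -- Under reflection H′ becomes η - H′ plus its last term. The part with η vanishes, which leaves
  -- D₂ ≡ -D₂ + θ.
  D₂≈ : D₂ ≈[ 1 ] ½ * θ
  D₂≈ = cancel p∤2 (≈-by₂ 1# η Int-1 Int-η step sum-ι²-p (lem D₂ θ η (sum p ι²)))
    where
    lem : ∀ a t e s → # 2 * a - # 2 * (½ * t) ≡ 1# * (a - (e * s + (- 1# * a + t))) + e * (s - 0#)
    lem = solve-∀ ring
    lem′ : ∀ s b h e → b * b * (e - h + s * b) ≡ e * (b * b) + (- 1# * (b * b * h) + s * (b * b * b))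
    lem′ = solve-∀ ring
    lem₀ : ∀ s b h e → e * (b * b) + (- 1# * (b * b * h) + s * (b * b * b)) ≡ b
      * (e * b + (- 1# * (b * h) + s * (b * b)))
    lem₀ = solve-∀ ring
    g : ℕ → K
    g j = η * ι² j + (- 1# * (ι² j * H′ j) + σι³ j)
    step : D₂ ≈[ 1 ] η * sum p ι² + (- 1# * D₂ + θ)
    step = ≈-trans (sum-mirror p {λ w → ι² w * H′ w} {g} (ι²0* (H′ 0))
        (trans (lem₀ (σ 0) (ι 0) (H′ 0) η) (trans
          (cong (_* (η * ι 0 + (- 1# * (ι 0 * H′ 0) + σ 0 * (ι 0 * ι 0)))) ι-0) (zeroˡ _)))
        (λ j k eq → ≈-trans (*-≈ (Int-H′ (suc k)) (Int-ι² (suc j)) (ι²-mirror₁ j k eq) (H′-mirror j k eq))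
          (≡⇒≈ (lem′ (σ (suc j)) (ι (suc j)) (H′ (suc j)) η))))
      (≡⇒≈ (trans (sum-+ p (λ j → η * ι² j) (λ j → - 1# * (ι² j * H′ j) + σι³ j)) (cong₂ _+_ (sum-*ˡ p η ι²)
        (trans (sum-+ p (λ j → - 1# * (ι² j * H′ j)) σι³)
          (cong (_+ θ) (sum-*ˡ p (- 1#) (λ j → ι² j * H′ j)))))))

  block-Ĥ : ∀ c → sum p (λ w → ρ̂ (p ℕ.* c ℕ.+ w) * (ι² (p ℕ.* c ℕ.+ w) * Ĥ (p ℕ.* c ℕ.+ w))) ≈[ 1 ] D + D₃ + σ
    c * (D₁ + D₂)
  block-Ĥ c = begin
    sum p (λ w → ρ̂ (p ℕ.* c ℕ.+ w) * (ι² (p ℕ.* c ℕ.+ w) * Ĥ (p ℕ.* c ℕ.+ w)))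
      ≈⟨ sum-≈ p (λ w _ → *-≈ (Int-ι² _ ⊗ Int-Ĥ _) (Int-1 ⊕ Int-σ c ⊗ Int-σ w)
        (≡⇒≈ (cong (_+_ 1#) (σ-block c w))) (*-≈ (Int-Ĥ _) (Int-ι² w) (ι²-period c w) (Ĥ-period c w))) ⟩
    sum p (λ w → (1# + s * σ w) * (ι² w * (E + (H w + s * H′ w))))
      ≡⟨ sum-ext p (λ w → trans (lem s (σ w) (ι² w) E (H w) (H′ w))
        (cong (λ a → E * ι² w + (E * s * (σ w * ι² w)
        + (ι² w * H w + (a * (σ w * ι² w * H′ w) + (s * (σ w * ι² w * H w) + s * (ι² w * H′ w)))))) (σ² c))) ⟩
    sum p (λ w → E * ι² w + (E * s * σι² w
      + (ι² w * H w + (1# * (σι² w * H′ w) + (s * (σι² w * H w) + s * (ι² w * H′ w))))))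
      ≡⟨ expand ⟩
    E * sum p ι² + (E * s * sum p σι² + (D + (1# * D₃ + (s * D₁ + s * D₂))))
      ≈⟨ +-≈ (*ˡ-≈ (Int-Ĥ₀ c) sum-ι²-p) (+-≈ (*ˡ-≈ (Int-Ĥ₀ c ⊗ Int-σ c) sum-σι²-p) ≈-refl) ⟩
    E * 0# + (E * s * 0# + (D + (1# * D₃ + (s * D₁ + s * D₂))))
      ≡⟨ lem′ E s D D₁ D₂ D₃ ⟩
    D + D₃ + s * (D₁ + D₂) ∎
    where
    open ≈-Reasoning 1
    s = σ c
    E = Ĥ₀ c
    lem : ∀ s t b E h h′ → (1# + s * t) * (b * (E + (h + s * h′))) ≡ E * b
      + (E * s * (t * b) + (b * h + (s * s * (t * b * h′) + (s * (t * b * h) + s * (b * h′)))))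
    lem = solve-∀ ring
    lem′ : ∀ E s a b c d → E * 0# + (E * s * 0# + (a + (1# * d + (s * b + s * c)))) ≡ a + d + s * (b + c)
    lem′ = solve-∀ ring
    expand : sum p (λ w → E * ι² w + (E * s * σι² w
      + (ι² w * H w + (1# * (σι² w * H′ w) + (s * (σι² w * H w) + s * (ι² w * H′ w))))))
           ≡ E * sum p ι² + (E * s * sum p σι² + (D + (1# * D₃ + (s * D₁ + s * D₂))))
    expand = trans (sum-+ p _ _) (cong₂ _+_ (sum-*ˡ p E ι²)
            (trans (sum-+ p _ _) (cong₂ _+_ (sum-*ˡ p (E * s) σι²)
            (trans (sum-+ p _ _) (cong₂ _+_ refl
            (trans (sum-+ p _ _) (cong₂ _+_ (sum-*ˡ p 1# (λ w → σι² w * H′ w))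
            (trans (sum-+ p _ _) (cong₂ _+_ (sum-*ˡ p s (λ w → σι² w * H w))
              (sum-*ˡ p s (λ w → ι² w * H′ w)))))))))))

  Ĥ-2* : ∀ k → Ĥ (2 ℕ.* k) ≡ H k
  Ĥ-2* k = trans (sum-even-odd k ι) (trans (sym (sum-*ˡ (suc k) (# 2) (λ i → ι (2 ℕ.* i))))
    (sum-ext (suc k) (λ i → trans (ι-2* i) (sym (*-identityˡ (ι i))))))

  -- Summing ι² Ĥ over the even indices below 2p recovers ¼ D.
  D₃≈ : D + D₃ ≈[ 1 ] ¼ * D
  D₃≈ = cancel p∤2 (≈-trans (≈-sym blocks) (≡⇒≈ doubled))
    where
    F : ℕ → K
    F c = ρ̂ c * (ι² c * Ĥ c)
    lem : ∀ a b → 0# + (a + 1# * b) + (a + - 1# * b) ≡ # 2 * a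
    lem = solve-∀ ring
    blocks : sum (p ℕ.* 2) F ≈[ 1 ] # 2 * (D + D₃)
    blocks = ≈-trans (≡⇒≈ (sum-block p 2 F))
      (≈-trans (+-≈ (+-≈ ≈-refl (block-Ĥ 0)) (block-Ĥ 1)) (≡⇒≈ (lem (D + D₃) (D₁ + D₂))))
    lem′ : ∀ a h → a * a * h ≡ ¼ * (# 2 * a * (# 2 * a) * h)
    lem′ = solve-∀ ring
    doubled : sum (p ℕ.* 2) F ≡ # 2 * (¼ * D)
    doubled = trans (cong (λ k → sum k F) (ℕP.*-comm p 2))
      (trans (sum-even p (λ c → ι² c * Ĥ c)) (cong (_*_ (# 2))
      (trans (sum-ext p (λ k → trans (lem′ (ι (2 ℕ.* k)) (Ĥ (2 ℕ.* k)))
        (cong₂ (λ a h → ¼ * (a * a * h)) (ι-2* k) (Ĥ-2* k)))) (sum-*ˡ p ¼ (λ k → ι² k * H k)))))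

  -- Alternating binomial sums and the value of `D`

  nC0 : ∀ n → n C 0 ≡ 1
  nC0 zero    = refl
  nC0 (suc n) = refl

  -- Stated in the ring, where n − k may be negative.
  absorb : ∀ n k → # suc k * # (n C suc k) ≡ (# n - # k) * # (n C k)
  absorb zero zero    = refl
  absorb zero (suc k) = trans (zeroʳ (# suc (suc k))) (sym (zeroʳ (0# - # suc k)))
  absorb (suc n) zero = begin
    # 1 * # (suc n C 1)               ≡⟨ cong (λ a → # 1 * # a) (nCk+nC[k+1]≡[n+1]C[k+1] n 0) ⟨
    # 1 * # (n C 0 ℕ.+ n C 1)         ≡⟨ cong (_*_ (# 1)) (#-+ (n C 0) (n C 1)) ⟩
    # 1 * (# (n C 0) + # (n C 1))     ≡⟨ lem (# (n C 0)) (# (n C 1)) ⟩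
    # (n C 0) + # 1 * # (n C 1)       ≡⟨ cong (_+_ (# (n C 0))) (absorb n 0) ⟩
    # (n C 0) + (# n - 0#) * # (n C 0) ≡⟨ lem′ (# (n C 0)) (# n) ⟩
    (# suc n - 0#) * # (n C 0)        ≡⟨ cong (λ a → (# suc n - 0#) * # a) (trans (nC0 n) (sym (nC0 (suc n)))) ⟩
    (# suc n - # 0) * # (suc n C 0)   ∎
    where
    open ≡-Reasoning
    lem : ∀ a b → # 1 * (a + b) ≡ a + # 1 * b
    lem = solve-∀ ring
    lem′ : ∀ a n → a + (n - 0#) * a ≡ (1# + n - 0#) * a
    lem′ = solve-∀ ring
  absorb (suc n) (suc k) = begin
    # suc (suc k) * # (suc n C suc (suc k)) 
      ≡⟨ cong (λ a → # suc (suc k) * # a) (nCk+nC[k+1]≡[n+1]C[k+1] n (suc k)) ⟨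
    # suc (suc k) * # (n C suc k ℕ.+ n C suc (suc k)) ≡⟨ cong (_*_ (# suc (suc k))) (#-+ (n C suc k) _) ⟩
    # suc (suc k) * (# (n C suc k) + # (n C suc (suc k))) ≡⟨ lem (# k) (# (n C suc k)) (# (n C suc (suc k))) ⟩
    # (n C suc k) + # suc k * # (n C suc k) + # suc (suc k) * # (n C suc (suc k))
      ≡⟨ cong₂ (λ a b → # (n C suc k) + a + b) (absorb n k) (absorb n (suc k)) ⟩
    # (n C suc k) + (# n - # k) * # (n C k) + (# n - # suc k) * # (n C suc k)
      ≡⟨ lem′ (# n) (# k) (# (n C k)) (# (n C suc k)) ⟩
    (# suc n - # suc k) * (# (n C k) + # (n C suc k))
      ≡⟨ cong (_*_ (# suc n - # suc k)) (trans (sym (#-+ (n C k) (n C suc k)))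
        (cong #_ (nCk+nC[k+1]≡[n+1]C[k+1] n k))) ⟩
    (# suc n - # suc k) * # (suc n C suc k) ∎
    where
    open ≡-Reasoning
    lem : ∀ k a b → (1# + (1# + k)) * (a + b) ≡ a + (1# + k) * a + (1# + (1# + k)) * b
    lem = solve-∀ ring
    lem′ : ∀ n k a b → b + (n - k) * a + (n - (1# + k)) * b ≡ (1# + n - (1# + k)) * (a + b)
    lem′ = solve-∀ ring

  absorb′ : ∀ n k → # suc n * # (n C k) ≡ # suc k * # (suc n C suc k)
  absorb′ n k = begin
    # suc n * # (n C k) ≡⟨ lem (# n) (# k) (# (n C k)) ⟩
    # suc k * # (n C k) + (# n - # k) * # (n C k) ≡⟨ cong (_+_ (# suc k * # (n C k))) (absorb n k) ⟨
    # suc k * # (n C k) + # suc k * # (n C suc k) ≡⟨ distribˡ (# suc k) (# (n C k)) (# (n C suc k)) ⟨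
    # suc k * (# (n C k) + # (n C suc k))
      ≡⟨ cong (_*_ (# suc k)) (trans (sym (#-+ (n C k) (n C suc k))) (cong #_ (nCk+nC[k+1]≡[n+1]C[k+1] n k))) ⟩
    # suc k * # (suc n C suc k) ∎
    where
    open ≡-Reasoning
    lem : ∀ n k a → (1# + n) * a ≡ (1# + k) * a + (n - k) * a
    lem = solve-∀ ring

  recip⁺ : ℕ → K
  recip⁺ k = recip (suc k)

  -- Σ (-1)^(k-1) C(n,k)/k^j over 1 ≤ k ≤ n, with k shifted by one. For j = 1 and 2 these are H_n
  -- and Σ H_k/k.
  altSum : ℕ → ℕ → K
  altSum j n = sum n (λ k → σ k * # (n C suc k) * recip⁺ k ^ j)

  altSum-0 : ∀ n → altSum 0 (suc n) ≡ 1#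
  altSum-0 n = begin
    sum (suc n) (λ k → σ k * # (suc n C suc k) * 1#)
      ≡⟨ sum-ext (suc n) (λ k → trans (cong (λ a → σ k * a * 1#)
        (trans (cong #_ (sym (nCk+nC[k+1]≡[n+1]C[k+1] n k))) (#-+ (n C k) (n C suc k))))
        (lem (σ k) (# (n C k)) (# (n C suc k)))) ⟩
    sum (suc n) (λ k → F (suc k) - F k) ≡⟨ sum-telescope (suc n) F ⟩
    F (suc n) - F 0
      ≡⟨ cong₂ (λ a b → - (σ (suc n) * # a) - - (1# * # b)) (k>n⇒nCk≡0 {n} {suc n} ℕP.≤-refl) (nC0 n) ⟩
    - (σ (suc n) * 0#) - - (1# * # 1) ≡⟨ lem′ (σ (suc n)) ⟩
    1# ∎
    where
    open ≡-Reasoning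
    F : ℕ → K
    F k = - (σ k * # (n C k))
    lem : ∀ s a b → s * (a + b) * 1# ≡ - (- s * b) - - (s * a)
    lem = solve-∀ ring
    lem′ : ∀ s → - (s * 0#) - - (1# * # 1) ≡ 1#
    lem′ = solve-∀ ring

  -- Pascal's rule splits C(n+1, k+1), and the new part has C(n,k)/(k+1) = C(n+1, k+1)/(n+1), so
  -- that one factor of the denominator leaves the sum.
  altSum-step : ∀ j n → altSum (suc j) (suc n) ≡ altSum (suc j) n + recip⁺ n * altSum j (suc n)
  altSum-step j n = begin
    sum (suc n) (λ k → σ k * # (suc n C suc k) * recip⁺ k ^ suc j) ≡⟨ sum-ext (suc n) split ⟩
    sum (suc n) (λ k → F k + recip⁺ n * G k)
      ≡⟨ trans (sum-+ (suc n) F (λ k → recip⁺ n * G k))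
        (cong (_+_ (sum (suc n) F)) (sum-*ˡ (suc n) (recip⁺ n) G)) ⟩
    sum n F + F n + recip⁺ n * sum (suc n) G
      ≡⟨ cong (λ a → sum n F + σ n * # a * recip⁺ n ^ suc j + recip⁺ n * sum (suc n) G)
        (k>n⇒nCk≡0 {n} {suc n} ℕP.≤-refl) ⟩
    sum n F + σ n * 0# * recip⁺ n ^ suc j + recip⁺ n * sum (suc n) G
      ≡⟨ lem (sum n F) (σ n) (recip⁺ n ^ suc j) (recip⁺ n * sum (suc n) G) ⟩
    sum n F + recip⁺ n * sum (suc n) G ∎
    where
    open ≡-Reasoning
    F G : ℕ → K
    F k = σ k * # (n C suc k) * recip⁺ k ^ suc j
    G k = σ k * # (suc n C suc k) * recip⁺ k ^ j
    lem : ∀ a s b c → a + s * 0# * b + c ≡ a + c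
    lem = solve-∀ ring
    lem₁ : ∀ s a b r q → s * (a + b) * (r * q) ≡ s * b * (r * q) + s * (1# * a * r) * q
    lem₁ = solve-∀ ring
    lem₂ : ∀ N R a r → N * R * a * r ≡ R * (N * a) * r
    lem₂ = solve-∀ ring
    lem₃ : ∀ R k c r → R * (k * c) * r ≡ k * r * (R * c)
    lem₃ = solve-∀ ring
    lem₄ : ∀ s R c q → s * (1# * (R * c)) * q ≡ R * (s * c * q)
    lem₄ = solve-∀ ring
    swap : ∀ k → 1# * # (n C k) * recip⁺ k ≡ 1# * (recip⁺ n * # (suc n C suc k))
    swap k = trans (cong (λ a → a * # (n C k) * recip⁺ k) (sym (#*recip n)))
      (trans (lem₂ (# suc n) (recip⁺ n) (# (n C k)) (recip⁺ k))
      (trans (cong (λ a → recip⁺ n * a * recip⁺ k) (absorb′ n k))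
        (trans (lem₃ (recip⁺ n) (# suc k) (# (suc n C suc k)) (recip⁺ k))
        (cong (_* (recip⁺ n * # (suc n C suc k))) (#*recip k)))))
    split : ∀ k → σ k * # (suc n C suc k) * recip⁺ k ^ suc j ≡ F k + recip⁺ n * G k
    split k = trans (cong (λ a → σ k * a * recip⁺ k ^ suc j)
      (trans (cong #_ (sym (nCk+nC[k+1]≡[n+1]C[k+1] n k))) (#-+ (n C k) (n C suc k))))
      (trans (lem₁ (σ k) (# (n C k)) (# (n C suc k)) (recip⁺ k) (recip⁺ k ^ j))
      (cong (_+_ (F k)) (trans (cong (λ a → σ k * a * recip⁺ k ^ j) (swap k))
        (lem₄ (σ k) (recip⁺ n) (# (suc n C suc k)) (recip⁺ k ^ j)))))

  altSum-1 : ∀ n → altSum 1 n ≡ sum n recip⁺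
  altSum-1 zero    = refl
  altSum-1 (suc n) = trans (altSum-step 0 n)
    (cong₂ _+_ (altSum-1 n) (trans (cong (_*_ (recip⁺ n)) (altSum-0 n)) (lem (recip⁺ n))))
    where
    lem : ∀ a → a * 1# ≡ a
    lem = solve-∀ ring

  -- The symmetric form of Σ H_k/k. At n = p - 1 the square of the harmonic sum vanishes modulo p²,
  -- and only Σ 1/k² remains.
  altSum-2 : ∀ n → # 2 * altSum 2 n ≡ sum n recip⁺ * sum n recip⁺ + sum n (λ k → recip⁺ k * recip⁺ k)
  altSum-2 zero    = refl
  altSum-2 (suc n) = begin
    # 2 * altSum 2 (suc n)
      ≡⟨ cong (_*_ (# 2)) (trans (altSum-step 1 n) (cong (λ a → altSum 2 n + recip⁺ n * a) (altSum-1 (suc n))))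
        ⟩
    # 2 * (altSum 2 n + recip⁺ n * (sum n recip⁺ + recip⁺ n)) ≡⟨ lem (altSum 2 n) (recip⁺ n) (sum n recip⁺) ⟩
    # 2 * altSum 2 n + # 2 * (recip⁺ n * (sum n recip⁺ + recip⁺ n))
      ≡⟨ cong (_+ # 2 * (recip⁺ n * (sum n recip⁺ + recip⁺ n))) (altSum-2 n) ⟩
    sum n recip⁺ * sum n recip⁺ + sum n (λ k → recip⁺ k * recip⁺ k) + # 2
      * (recip⁺ n * (sum n recip⁺ + recip⁺ n))
      ≡⟨ lem′ (sum n recip⁺) (sum n (λ k → recip⁺ k * recip⁺ k)) (recip⁺ n) ⟩
    (sum n recip⁺ + recip⁺ n) * (sum n recip⁺ + recip⁺ n)
      + (sum n (λ k → recip⁺ k * recip⁺ k) + recip⁺ n * recip⁺ n) ∎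
    where
    open ≡-Reasoning
    lem : ∀ a b c → # 2 * (a + b * (c + b)) ≡ # 2 * a + # 2 * (b * (c + b))
    lem = solve-∀ ring
    lem′ : ∀ a b c → a * a + b + # 2 * (c * (a + c)) ≡ (a + c) * (a + c) + (b + c * c)
    lem′ = solve-∀ ring

  p₁ : ℕ
  p₁ = 2 ℕ.* M

  #p≡ : # p ≡ # suc p₁
  #p≡ = cong #_ p-odd

  k<p⇒p∤ : ∀ {k} → suc k < p → ¬ p ∣ suc k
  k<p⇒p∤ k<p = >⇒∤ k<p

  ι≡recip⁺ : ∀ {k} → suc k < p → ι (suc k) ≡ recip⁺ k
  ι≡recip⁺ {k} k<p with p ∣? suc k
  ... | yes p∣k = ⊥-elim (k<p⇒p∤ k<p p∣k)
  ... | no _    = refl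

  -- C(p−1,k) = (−1)^k ∏_{j≤k} (1 − p/j).
  binom-p₁ : ∀ k → k < p → σ k * # (p₁ C k) ≈[ 2 ] 1# - # p * H k
  binom-p₁ zero _ = ≡⇒≈ (trans (cong (λ a → 1# * # a) (nC0 p₁))
    (trans (lem (# p)) (cong (λ a → 1# - # p * (0# + 1# * a)) (sym ι-0))))
    where
    lem : ∀ p → 1# * # 1 ≡ 1# - p * (0# + 1# * 0#)
    lem = solve-∀ ring
  binom-p₁ (suc k) k<p = begin
    - σ k * # (p₁ C suc k) ≡⟨ lem (σ k) (# (p₁ C suc k)) ⟩
    1# * (- σ k * # (p₁ C suc k)) ≡⟨ cong (_* (- σ k * # (p₁ C suc k))) unit ⟨
    # suc k * a * (- σ k * # (p₁ C suc k)) ≡⟨ lem′ (# suc k) a (σ k) (# (p₁ C suc k)) ⟩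
    - a * σ k * (# suc k * # (p₁ C suc k)) ≡⟨ cong (_*_ (- a * σ k)) (absorb p₁ k) ⟩
    - a * σ k * ((# p₁ - # k) * # (p₁ C k)) ≡⟨ lem″ a (σ k) (# p₁) (# k) (# (p₁ C k)) ⟩
    (# suc k * a - # suc p₁ * a) * (σ k * # (p₁ C k))
      ≡⟨ cong₂ (λ x y → (x - y * a) * (σ k * # (p₁ C k))) unit (sym #p≡) ⟩
    (1# - # p * a) * (σ k * # (p₁ C k))
      ≈⟨ *ˡ-≈ (Int-1 ⊕ ⊝ (nat p ⊗ Int-ι (suc k))) (binom-p₁ k (ℕP.<-trans (ℕP.n<1+n k) k<p)) ⟩
    (1# - # p * a) * (1# - # p * H k)
      ≈⟨ ≈-square {e = 1} (p^1∣ {p} p∣p) (Int-ι (suc k) ⊗ Int-H k) (lem‴ (# p) a (H k)) ⟩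
    1# - # p * (H k + 1# * a) ∎
    where
    open ≈-Reasoning 2
    a = ι (suc k)
    unit : # suc k * a ≡ 1#
    unit = ι-∤ (k<p⇒p∤ k<p)
    lem : ∀ a b → - a * b ≡ 1# * (- a * b)
    lem = solve-∀ ring
    lem′ : ∀ x a s b → x * a * (- s * b) ≡ - a * s * (x * b)
    lem′ = solve-∀ ring
    lem″ : ∀ a s n k c → - a * s * ((n - k) * c) ≡ ((1# + k) * a - (1# + n) * a) * (s * c)
    lem″ = solve-∀ ring
    lem‴ : ∀ p a h → (1# - p * a) * (1# - p * h) - (1# - p * (h + 1# * a)) ≡ p * p * (a * h)
    lem‴ = solve-∀ ring

  sum-p : ∀ f → f 0 ≡ 0# → sum p f ≡ sum p₁ (f ∘ suc)
  sum-p f f0 = trans (cong (λ k → sum k f) p-odd)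
    (trans (sum-head p₁ f) (trans (cong (_+ sum p₁ (f ∘ suc)) f0) (+-identityˡ _)))

  suc<p : ∀ {k} → k < p₁ → suc k < p
  suc<p k<p₁ = subst (_ <_) (sym p-odd) (s≤s k<p₁)

  P-inverse : ∀ f → P f * recip (p ℕ.^ f) ≡ 1#
  P-inverse f with p ℕ.^ f in h
  ... | zero  = ⊥-elim (ℕP.<⇒≢ (ℕP.m^n>0 p {{ℕ.>-nonZero (ℕP.<-≤-trans (s≤s z≤n) 5≤p)}} f) (sym h))
  ... | suc k = #*recip k

  P-cancel : ∀ f {x y} → P f * x ≈[ f ℕ.+ e ] P f * y → x ≈[ e ] y
  P-cancel {e} f {x} {y} (quotient {z} i eq) = quotient i (begin
    x - y                         ≡⟨ lem x y ⟩
    1# * (x - y)                  ≡⟨ cong (_* (x - y)) (P-inverse f) ⟨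
    P f * R * (x - y)             ≡⟨ lem′ (P f) R x y ⟩
    R * (P f * x - P f * y)       ≡⟨ cong (_*_ R) (trans eq (cong (_* z) (P-+ f e))) ⟩
    R * (P f * P e * z)           ≡⟨ lem″ R (P f) (P e) z ⟩
    P f * R * (P e * z)           ≡⟨ trans (cong (_* (P e * z)) (P-inverse f)) (*-identityˡ _) ⟩
    P e * z                       ∎)
    where
    open ≡-Reasoning
    R = recip (p ℕ.^ f)
    lem : ∀ a b → a - b ≡ 1# * (a - b)
    lem = solve-∀ ring
    lem′ : ∀ q r a b → q * r * (a - b) ≡ r * (q * a - q * b)
    lem′ = solve-∀ ring
    lem″ : ∀ r f e z → r * (f * e * z) ≡ f * r * (e * z)
    lem″ = solve-∀ ring

  -- Both sides evaluate Σ_{0<k<p} (−1)^(k−1) C(p−1,k)/k² modulo p².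
  D≈ : D ≈[ 1 ] - # 2 * θ
  D≈ = P-cancel 1 (subst (λ a → a * D ≈[ 2 ] a * (- # 2 * θ)) (cong #_ (sym (ℕP.^-identityʳ p)))
    (≈-by₂ 1# (# 3 * ½) Int-1 (nat 3 ⊗ Int-½) key (sum-ι²-≈ 0 (p^1∣ p∣p)) (lem (# p) D a₂ θ)))
    where
    a₂ = sum p ι²
    lem : ∀ p d a t → p * d - p * (- # 2 * t) ≡ 1# * (p * d - # 3 * ½ * a) + # 3 * ½
      * (a - - (# 4 * ⅓ * (p * t)))
    lem = solve-∀ ring
    F : ℕ → K
    F k = σ k * # (p₁ C k) * ι² k
    approx : sum p F ≈[ 2 ] a₂ - # p * D
    approx = begin
      sum p F                                ≈⟨ sum-≈ p (λ k k<p → *ʳ-≈ (Int-ι² k) (binom-p₁ k k<p)) ⟩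
      sum p (λ k → (1# - # p * H k) * ι² k)  ≡⟨ sum-ext p (λ k → l (# p) (H k) (ι² k)) ⟩
      sum p (λ k → ι² k + - # p * (ι² k * H k))
        ≡⟨ trans (sum-+ p ι² (λ k → - # p * (ι² k * H k))) (cong (_+_ a₂) (sum-*ˡ p (- # p) (λ k → ι² k * H k)))
          ⟩
      a₂ + - # p * D                         ≡⟨ l′ a₂ (# p) D ⟩
      a₂ - # p * D                           ∎
      where
      open ≈-Reasoning 2
      l : ∀ p h b → (1# - p * h) * b ≡ b + - p * (b * h)
      l = solve-∀ ring
      l′ : ∀ a p d → a + - p * d ≡ a - p * d
      l′ = solve-∀ ring
    exact : sum p F ≡ - altSum 2 p₁
    exact = trans (sum-p F (trans (cong (_*_ (σ 0 * # (p₁ C 0))) (ι*0 {ι 0})) (zeroʳ (σ 0 * # (p₁ C 0)))))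
      (trans (sum-cong p₁ (λ k k<p₁ → trans
        (cong (λ a → - σ k * # (p₁ C suc k) * (a * a)) (ι≡recip⁺ (suc<p k<p₁)))
        (l (σ k) (# (p₁ C suc k)) (recip⁺ k)))) (sum-neg p₁ (λ k → σ k * # (p₁ C suc k) * recip⁺ k ^ 2)))
      where
      l : ∀ s c a → - s * c * (a * a) ≡ - (s * c * (a * (a * 1#)))
      l = solve-∀ ring
    r≡ : sum p₁ recip⁺ ≡ sum p ι
    r≡ = sym (trans (sum-p ι ι-0) (sum-cong p₁ (λ k k<p₁ → ι≡recip⁺ (suc<p k<p₁))))
    r²≡ : sum p₁ (λ k → recip⁺ k * recip⁺ k) ≡ a₂
    r²≡ = sym (trans (sum-p ι² (ι*0 {ι 0}))
      (sum-cong p₁ (λ k k<p₁ → cong (λ a → a * a) (ι≡recip⁺ (suc<p k<p₁)))))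
    halved : # 2 * altSum 2 p₁ ≈[ 2 ] a₂
    halved = ≈-trans (≡⇒≈ (trans (altSum-2 p₁) (cong₂ (λ a b → a * a + b) r≡ r²≡)))
      (≈-trans (+-≈ (*-≈0 {f = 1} {e = 1} (sum-ι p∣p) (sum-ι p∣p)) ≈-refl) (≡⇒≈ (+-identityˡ a₂)))
    -- Σ ι² - p D ≡ -(1/2) Σ ι². Together with Σ ι² ≡ -(4/3) p θ this yields the constant -2 of the
    -- statement as -(3/2)(4/3).
    key : # p * D ≈[ 2 ] # 3 * ½ * a₂
    key = ≈-by₂ 1# ½ Int-1 Int-½ (≈-trans (≡⇒≈ (sym exact)) approx) halved (l (# p * D) a₂ (altSum 2 p₁))
      where
      l : ∀ d a s → d - # 3 * ½ * a ≡ 1# * (- s - (a - d)) + ½ * (# 2 * s - a)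
      l = solve-∀ ring

  -- Sums of `h₀` and `ℓ` against harmonic numbers over one block

  -- Since complete periods add nothing to H modulo p, the block reduces to 2D + 2 σ c D₁, with D ≡
  -- -2θ and D₁ ≡ θ/2.
  block-h₀H : ∀ c → sum p (λ w → h₀ (p ℕ.* c ℕ.+ w) * H (p ℕ.* c ℕ.+ w)) ≈[ 1 ] (- # 4 + σ c) * θ
  block-h₀H c = begin
    sum p (λ w → h₀ (p ℕ.* c ℕ.+ w) * H (p ℕ.* c ℕ.+ w))
      ≈⟨ sum-≈ p (λ w _ → *-≈ (Int-H _) (nat 2 ⊗ ((Int-1 ⊕ Int-σ c ⊗ Int-σ w) ⊗ Int-ι² w))
        (*ˡ-≈ (nat 2) (*-≈ (Int-ι² _) (Int-1 ⊕ Int-σ c ⊗ Int-σ w) (≡⇒≈ (cong (_+_ 1#) (σ-block c w)))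
        (ι²-period c w))) (H-period c w)) ⟩
    sum p (λ w → # 2 * ((1# + σ c * σ w) * ι² w) * H w) ≡⟨ sum-ext p (λ w → lem (σ c) (σ w) (ι² w) (H w)) ⟩
    sum p (λ w → # 2 * (ι² w * H w) + # 2 * σ c * (σι² w * H w))
      ≡⟨ trans (sum-+ p (λ w → # 2 * (ι² w * H w)) (λ w → # 2 * σ c * (σι² w * H w)))
        (cong₂ _+_ (sum-*ˡ p (# 2) (λ w → ι² w * H w)) (sum-*ˡ p (# 2 * σ c) (λ w → σι² w * H w))) ⟩
    # 2 * D + # 2 * σ c * D₁ ≈⟨ +-≈ (*ˡ-≈ (nat 2) D≈) (*ˡ-≈ (nat 2 ⊗ Int-σ c) D₁≈) ⟩
    # 2 * (- # 2 * θ) + # 2 * σ c * (½ * θ) ≡⟨ lem′ (σ c) θ ⟩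
    (- # 4 + σ c) * θ ∎
    where
    open ≈-Reasoning 1
    lem : ∀ s t b h → # 2 * ((1# + s * t) * b) * h ≡ # 2 * (b * h) + # 2 * s * (t * b * h)
    lem = solve-∀ ring
    lem′ : ∀ s t → # 2 * (- # 2 * t) + # 2 * s * (½ * t) ≡ (- # 4 + s) * t
    lem′ = solve-∀ ring

  block-h₀Ĥ : ∀ c → sum p (λ w → h₀ (p ℕ.* c ℕ.+ w) * Ĥ (p ℕ.* c ℕ.+ w)) ≈[ 1 ] (- 1# + # 2 * σ c) * θ
  block-h₀Ĥ c = begin
    sum p (λ w → h₀ (p ℕ.* c ℕ.+ w) * Ĥ (p ℕ.* c ℕ.+ w))
      ≡⟨ trans (sum-ext p (λ w → lem (ρ̂ (p ℕ.* c ℕ.+ w)) (ι² (p ℕ.* c ℕ.+ w)) (Ĥ (p ℕ.* c ℕ.+ w))))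
        (sum-*ˡ p (# 2) F) ⟩
    # 2 * sum p F ≈⟨ *ˡ-≈ (nat 2) (block-Ĥ c) ⟩
    # 2 * (D + D₃ + σ c * (D₁ + D₂))
      ≈⟨ *ˡ-≈ (nat 2) (+-≈ (≈-trans D₃≈ (*ˡ-≈ Int-¼ D≈)) (*ˡ-≈ (Int-σ c) (+-≈ D₁≈ D₂≈))) ⟩
    # 2 * (¼ * (- # 2 * θ) + σ c * (½ * θ + ½ * θ)) ≡⟨ lem′ (σ c) θ ⟩
    (- 1# + # 2 * σ c) * θ ∎
    where
    open ≈-Reasoning 1
    F : ℕ → K
    F w = ρ̂ (p ℕ.* c ℕ.+ w) * (ι² (p ℕ.* c ℕ.+ w) * Ĥ (p ℕ.* c ℕ.+ w))
    lem : ∀ r b h → # 2 * (r * b) * h ≡ # 2 * (r * (b * h))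
    lem = solve-∀ ring
    lem′ : ∀ s t → # 2 * (¼ * (- # 2 * t) + s * (½ * t + ½ * t)) ≡ (- 1# + # 2 * s) * t
    lem′ = solve-∀ ring

  block-ι³ : ∀ c → sum p (λ w → # 8 * (ρ̂ (p ℕ.* c ℕ.+ w) * ι³ (p ℕ.* c ℕ.+ w))) ≈[ 1 ] # 8 * (σ c * θ)
  block-ι³ c = begin
    sum p (λ w → # 8 * (ρ̂ (p ℕ.* c ℕ.+ w) * ι³ (p ℕ.* c ℕ.+ w)))
      ≈⟨ sum-≈ p (λ w _ → *ˡ-≈ (nat 8) (*-≈ (Int-ι³ _) (Int-1 ⊕ Int-σ c ⊗ Int-σ w)
        (≡⇒≈ (cong (_+_ 1#) (σ-block c w))) (ι³-cong (ι-period c w)))) ⟩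
    sum p (λ w → # 8 * ((1# + σ c * σ w) * ι³ w))
      ≡⟨ trans (sum-ext p (λ w → lem (σ c) (σ w) (ι³ w)))
        (trans (sum-+ p (λ w → # 8 * ι³ w) (λ w → # 8 * σ c * σι³ w))
        (cong₂ _+_ (sum-*ˡ p (# 8) ι³) (sum-*ˡ p (# 8 * σ c) σι³))) ⟩
    # 8 * sum p ι³ + # 8 * σ c * θ ≈⟨ +-≈ (*ˡ-≈ (nat 8) (sum-ι³ p∣p)) ≈-refl ⟩
    # 8 * 0# + # 8 * σ c * θ ≡⟨ lem′ (σ c) θ ⟩
    # 8 * (σ c * θ) ∎
    where
    open ≈-Reasoning 1
    lem : ∀ s t a → # 8 * ((1# + s * t) * a) ≡ # 8 * a + # 8 * s * (t * a)
    lem = solve-∀ ring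
    lem′ : ∀ s t → # 8 * 0# + # 8 * s * t ≡ # 8 * (s * t)
    lem′ = solve-∀ ring

  -- The indicator function of p ∤ j, in the form in which its factor j can be absorbed by a
  -- binomial coefficient.
  χ : ℕ → K
  χ j = # j * ι j

  χ-∣ : ∀ {j} → p ∣ j → χ j ≡ 0#
  χ-∣ {j} d = trans (cong (_*_ (# j)) (ι-∣ d)) (zeroʳ (# j))

  χ-period : ∀ u w → χ (p ℕ.* u ℕ.+ w) ≡ χ w
  χ-period u w with p ∣? w
  ... | yes d = trans (χ-∣ (∣m∣n⇒∣m+n (m∣m*n u) d)) (sym (zeroʳ (# w)))
  ... | no ¬d = trans (ι-∤ (λ d → ¬d (∣m+n∣m⇒∣n d (m∣m*n u)))) (sym (#*recip′ ¬d))

  sum-χ : ∀ f → sum p (λ w → f w * χ w) ≡ sum p f - f 0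
  sum-χ f = begin
    sum p (λ w → f w * χ w)     ≡⟨ sum-p (λ w → f w * χ w) (trans (cong (_*_ (f 0)) (ι*0 {0#})) (zeroʳ (f 0))) ⟩
    sum p₁ (λ w → f (suc w) * χ (suc w))
      ≡⟨ sum-cong p₁ (λ w w<p₁ → trans (cong (_*_ (f (suc w))) (ι-∤ (k<p⇒p∤ (suc<p w<p₁)))) (lem (f (suc w)))) ⟩
    sum p₁ (f ∘ suc)            ≡⟨ lem′ (f 0) (sum p₁ (f ∘ suc)) ⟩
    f 0 + sum p₁ (f ∘ suc) - f 0 ≡⟨ cong (_- f 0) (sum-head p₁ f) ⟨
    sum (suc p₁) f - f 0        ≡⟨ cong (λ k → sum k f - f 0) p-odd ⟨
    sum p f - f 0               ∎
    where
    open ≡-Reasoning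
    lem : ∀ a → a * 1# ≡ a
    lem = solve-∀ ring
    lem′ : ∀ a b → b ≡ a + b - a
    lem′ = solve-∀ ring

  -- The antidifference of ℓ normalised to be a multiple of c, so that it vanishes modulo p at both
  -- ends of every block.
  L : ℕ → K
  L c = # 4 * ⅓ * # c - σ c * # c

  L-step : ∀ c → L (suc c) - L c ≡ ℓ c
  L-step c = lem (# c) (σ c)
    where
    lem : ∀ c s → # 4 * ⅓ * (1# + c) - - s * (1# + c) - (# 4 * ⅓ * c - s * c) ≡ # 4 * ⅓ + s * (1# + # 2 * c)
    lem = solve-∀ ring

  L-∣ : ∀ {c} → p ∣ c → L c ≈[ 1 ] 0#
  L-∣ {c} d = ≈-by₁ (# 4 * ⅓ - σ c) (nat 4 ⊗ Int-⅓ ⊕ ⊝ Int-σ c) (∣⇒≈0 {1} (p^1∣ d)) (lem (# c) (σ c))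
    where
    lem : ∀ c s → # 4 * ⅓ * c - s * c - 0# ≡ (# 4 * ⅓ - s) * (c - 0#)
    lem = solve-∀ ring

  -- Summation by parts, with ℓ = ΔL and L vanishing modulo p at both ends.
  block-ℓ : ∀ {ρ} → (∀ j → Int (ρ j)) → ∀ c →
    sum p (λ w → ℓ (p ℕ.* c ℕ.+ w) * harm ρ (p ℕ.* c ℕ.+ w)) ≈[ 1 ]
    - sum p (λ w → (# 4 * ⅓ - σ (p ℕ.* c ℕ.+ w)) * ρ (p ℕ.* c ℕ.+ w) * χ (p ℕ.* c ℕ.+ w))
  block-ℓ {ρ} iρ c = begin
    sum p (λ w → ℓ (a ℕ.+ w) * harm ρ (a ℕ.+ w)) ≡⟨ sum-ext p parts ⟩
    sum p (λ w → (T (suc w) - T w) + - 1# * X (suc w))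
      ≡⟨ trans (sum-+ p (λ w → T (suc w) - T w) (λ w → - 1# * X (suc w)))
        (cong₂ _+_ (sum-telescope p T) (sum-*ˡ p (- 1#) (X ∘ suc))) ⟩
    T p - T 0 + - 1# * sum p (X ∘ suc) ≈⟨ +-≈ (+-≈ Tp (neg T0)) (≡⇒≈ (cong (_*_ (- 1#)) shifted)) ⟩
    0# + - 0# + - 1# * sum p X ≡⟨ lem₀ (sum p X) ⟩
    - sum p X ∎
    where
    open ≈-Reasoning 1
    a = p ℕ.* c
    T X : ℕ → K
    T w = L (a ℕ.+ w) * harm ρ (a ℕ.+ w)
    X w = (# 4 * ⅓ - σ (a ℕ.+ w)) * ρ (a ℕ.+ w) * χ (a ℕ.+ w)
    lem₀ : ∀ x → 0# + - 0# + - 1# * x ≡ - x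
    lem₀ = solve-∀ ring
    neg : ∀ {x y} → x ≈[ 1 ] y → - x ≈[ 1 ] - y
    neg {x} {y} h = ≈-by₁ (- 1#) (⊝ Int-1) h (l x y)
      where
      l : ∀ x y → - x - - y ≡ - 1# * (x - y)
      l = solve-∀ ring
    Tp : T p ≈[ 1 ] 0#
    Tp = *ʳ-≈0 (Int-harm iρ _) (L-∣ (∣m∣n⇒∣m+n (m∣m*n c) p∣p))
    T0 : T 0 ≈[ 1 ] 0#
    T0 = *ʳ-≈0 (Int-harm iρ _) (L-∣ (∣m∣n⇒∣m+n (m∣m*n c) (p ∣0)))
    X0 : ∀ {w} → p ∣ w → X w ≡ 0#
    X0 {w} d = trans (cong (_*_ ((# 4 * ⅓ - σ (a ℕ.+ w)) * ρ (a ℕ.+ w))) (χ-∣ (∣m∣n⇒∣m+n (m∣m*n c) d)))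
      (zeroʳ ((# 4 * ⅓ - σ (a ℕ.+ w)) * ρ (a ℕ.+ w)))
    shifted : sum p (X ∘ suc) ≡ sum p X
    shifted = ≡-Reasoning.begin
      sum p (X ∘ suc)           ≡-Reasoning.≡⟨ +-identityˡ _ ⟨
      0# + sum p (X ∘ suc)      ≡-Reasoning.≡⟨ cong (_+ sum p (X ∘ suc)) (X0 (p ∣0)) ⟨
      X 0 + sum p (X ∘ suc)     ≡-Reasoning.≡⟨ sum-head p X ⟨
      sum p X + X p             ≡-Reasoning.≡⟨ trans (cong (_+_ (sum p X)) (X0 p∣p)) (+-identityʳ _) ⟩
      sum p X                   ≡-Reasoning.∎
    parts : ∀ w → ℓ (a ℕ.+ w) * harm ρ (a ℕ.+ w) ≡ T (suc w) - T w + - 1# * X (suc w)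
    parts w = ≡-Reasoning.begin
      ℓ x * harm ρ x ≡-Reasoning.≡⟨ cong (_* harm ρ x) (L-step x) ⟨
      (L (suc x) - L x) * harm ρ x ≡-Reasoning.≡⟨ lem (# suc x) (σ (suc x)) (L x) (harm ρ x) (ρ (suc x))
        (ι (suc x)) ⟩
      L (suc x) * harm ρ (suc x) - L x * harm ρ x + - 1# * ((# 4 * ⅓ - σ (suc x)) * ρ (suc x) * χ (suc x))
        ≡-Reasoning.≡⟨ cong (λ y → L y * harm ρ y - T w + - 1# * ((# 4 * ⅓ - σ y) * ρ y * χ y)) (ℕP.+-suc a w) ⟨
      T (suc w) - T w + - 1# * X (suc w) ≡-Reasoning.∎
      where
      x = a ℕ.+ w
      lem : ∀ n s l h r i → (# 4 * ⅓ * n - s * n - l) * h ≡ (# 4 * ⅓ * n - s * n) * (h + r * i) - l * h + - 1#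
        * ((# 4 * ⅓ - s) * r * (n * i))
      lem = solve-∀ ring

  sum-σ-p : sum p σ ≡ 1#
  sum-σ-p = sum-σ-odd p σ-p

  -- The full sum of 4/3 - σ over the block is ≡ -σ c; χ removes the term w = 0, which is 4/3 - σ c,
  -- and -4/3 is left before the change of sign.
  block-ℓH : ∀ c → sum p (λ w → ℓ (p ℕ.* c ℕ.+ w) * H (p ℕ.* c ℕ.+ w)) ≈[ 1 ] # 4 * ⅓
  block-ℓH c = ≈-trans (block-ℓ Int-one c)
    (≈-trans (≡⇒≈ (cong (λ a → - a) (trans
    (sum-ext p (λ w → cong₂ (λ s x → (# 4 * ⅓ - s) * 1# * x) (σ-block c w) (χ-period c w)))
    (trans (sum-χ f) (cong (_- f 0) expand)))))
    (≈-by₁ (- (# 4 * ⅓)) (⊝ (nat 4 ⊗ Int-⅓)) (∣⇒≈0 {1} (p^1∣ p∣p)) (lem′ (# p) (σ c))))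
    where
    f : ℕ → K
    f w = (# 4 * ⅓ - σ c * σ w) * 1#
    lem : ∀ s t → (# 4 * ⅓ - s * t) * 1# ≡ # 4 * ⅓ + - s * t
    lem = solve-∀ ring
    lem′ : ∀ p s → - (p * (# 4 * ⅓) + - s * 1# - (# 4 * ⅓ - s * 1#) * 1#) - # 4 * ⅓ ≡ - (# 4 * ⅓) * (p - 0#)
    lem′ = solve-∀ ring
    expand : sum p f ≡ # p * (# 4 * ⅓) + - σ c * 1#
    expand = trans (sum-ext p (λ w → lem (σ c) (σ w)))
      (trans (sum-+ p (λ _ → # 4 * ⅓) (λ w → - σ c * σ w))
      (cong₂ _+_ (sum-const p (# 4 * ⅓)) (trans (sum-*ˡ p (- σ c) σ) (cong (_*_ (- σ c)) sum-σ-p))))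

  -- By σ² = 1 the weight (4/3 - σ)(1 + σ) is (1 + σ)/3. The block sum is ≡ σ c/3, from which χ
  -- removes (1 + σ c)/3.
  block-ℓĤ : ∀ c → sum p (λ w → ℓ (p ℕ.* c ℕ.+ w) * Ĥ (p ℕ.* c ℕ.+ w)) ≈[ 1 ] ⅓
  block-ℓĤ c = ≈-trans (block-ℓ Int-ρ̂ c)
    (≈-trans (≡⇒≈ (cong (λ a → - a) (trans (sum-ext p term) (trans (sum-χ f) (cong (_- f 0) expand)))))
    (≈-by₁ (- ⅓) (⊝ Int-⅓) (∣⇒≈0 {1} (p^1∣ p∣p)) (lem′ (# p) (σ c))))
    where
    f : ℕ → K
    f w = ⅓ + ⅓ * σ c * σ w
    lem : ∀ s → (# 4 * ⅓ - s) * (1# + s) ≡ # 4 * ⅓ + ⅓ * s - s * s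
    lem = solve-∀ ring
    lem₁ : ∀ s t → # 4 * ⅓ + ⅓ * (s * t) - 1# ≡ ⅓ + ⅓ * s * t
    lem₁ = solve-∀ ring
    lem′ : ∀ p s → - (p * ⅓ + ⅓ * s * 1# - (⅓ + ⅓ * s * 1#)) - ⅓ ≡ - ⅓ * (p - 0#)
    lem′ = solve-∀ ring
    term : ∀ w → (# 4 * ⅓ - σ (p ℕ.* c ℕ.+ w)) * ρ̂ (p ℕ.* c ℕ.+ w) * χ (p ℕ.* c ℕ.+ w) ≡ f w * χ w
    term w = cong₂ _*_ (trans (lem (σ x))
      (trans (cong₂ (λ s t → # 4 * ⅓ + ⅓ * s - t) (σ-block c w) (σ² x)) (lem₁ (σ c) (σ w)))) (χ-period c w)
      where x = p ℕ.* c ℕ.+ w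
    expand : sum p f ≡ # p * ⅓ + ⅓ * σ c * 1#
    expand = trans (sum-+ p (λ _ → ⅓) (λ w → ⅓ * σ c * σ w))
      (cong₂ _+_ (sum-const p ⅓) (trans (sum-*ˡ p (⅓ * σ c) σ) (cong (_*_ (⅓ * σ c)) sum-σ-p)))

  -- Bernoulli numbers

  bernoulliList≡ : ∀ n → bernoulliList n ≡ applyUpTo B (suc n)
  bernoulliList≡ zero    = refl
  bernoulliList≡ (suc n) = trans (cong (λ bs → bs ++ B (suc n) ∷ []) (bernoulliList≡ n))
    (applyUpTo-∷ʳ B (suc n))

  zipWith-applyUpTo : ∀ {A B C : Set} (g : A → B → C) f h n →
    zipWith g (applyUpTo f n) (applyUpTo h n) ≡ applyUpTo (λ i → g (f i) (h i)) n
  zipWith-applyUpTo g f h zero    = refl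
  zipWith-applyUpTo g f h (suc n) = cong (g (f 0) (h 0) ∷_) (zipWith-applyUpTo g (f ∘ suc) (h ∘ suc) n)

  foldr-applyUpTo : ∀ f n → κ (foldr ℚ._+_ 0ℚ (applyUpTo f n)) ≡ sum n (κ ∘ f)
  foldr-applyUpTo f zero    = refl
  foldr-applyUpTo f (suc n) = trans (cong (_+_ (κ (f 0))) (foldr-applyUpTo (f ∘ suc) n))
    (sym (sum-head n (κ ∘ f)))

  𝔹 : ℕ → K
  𝔹 n = κ (B n)

  𝔹-rec : ∀ m → # suc (suc m) * 𝔹 (suc m) ≡ - sum (suc m) (λ k → # (suc (suc m) C k) * 𝔹 k)
  𝔹-rec m = trans (cong (_*_ (# suc (suc m))) unfold)
    (trans (lem (# suc (suc m)) (recip⁺ (suc m)) S)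
    (trans (cong (λ a → - (a * S)) (#*recip (suc m))) (cong (λ a → - a) (*-identityˡ S))))
    where
    S = sum (suc m) (λ k → # (suc (suc m) C k) * 𝔹 k)
    lem : ∀ n r s → n * (- r * s) ≡ - (n * r * s)
    lem = solve-∀ ring
    unfold : 𝔹 (suc m) ≡ - recip⁺ (suc m) * S
    unfold = cong (_*_ (- recip⁺ (suc m))) (begin
      κ (foldr ℚ._+_ 0ℚ (zipWith g (upTo (suc m)) (bernoulliList m))) 
        ≡⟨ cong (λ bs → κ (foldr ℚ._+_ 0ℚ (zipWith g (upTo (suc m)) bs))) (bernoulliList≡ m) ⟩
      κ (foldr ℚ._+_ 0ℚ (zipWith g (upTo (suc m)) (applyUpTo B (suc m))))
        ≡⟨ cong (λ bs → κ (foldr ℚ._+_ 0ℚ bs)) (zipWith-applyUpTo g (λ i → i) B (suc m)) ⟩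
      κ (foldr ℚ._+_ 0ℚ (applyUpTo (λ i → g i (B i)) (suc m))) ≡⟨ foldr-applyUpTo (λ i → g i (B i)) (suc m) ⟩
      sum (suc m) (λ i → κ (ℕ→ℚ (suc (suc m) C i)) * 𝔹 i)
        ≡⟨ sum-ext (suc m) (λ i → cong (_* 𝔹 i) (κ-q (suc (suc m) C i))) ⟩
      S ∎)
      where
      open ≡-Reasoning
      g = λ k b → ℕ→ℚ (suc (suc m) C k) ℚ.* b

  binomial : ∀ x n → (x + 1#) ^ n ≡ sum (suc n) (λ i → # (n C i) * x ^ i)
  binomial x zero    = refl
  binomial x (suc n) = begin
    (x + 1#) * (x + 1#) ^ n                 ≡⟨ cong (_*_ (x + 1#)) (binomial x n) ⟩
    (x + 1#) * sum (suc n) F                ≡⟨ lem x (sum (suc n) F) ⟩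
    sum (suc n) F + x * sum (suc n) F      
      ≡⟨ cong₂ _+_ (trans (sum-head n F) (cong (λ a → # a * 1# + sum n (F ∘ suc))
        (trans (nC0 n) (sym (nC0 (suc n)))))) (sym (sum-*ˡ (suc n) x F)) ⟩
    # (suc n C 0) * 1# + sum n (F ∘ suc) + sum (suc n) (λ i → x * F i)
      ≡⟨ cong (λ a → # (suc n C 0) * 1# + a + sum (suc n) (λ i → x * F i)) extend ⟩
    # (suc n C 0) * 1# + sum (suc n) (F ∘ suc) + sum (suc n) (λ i → x * F i) ≡⟨ +-assoc _ _ _ ⟩
    # (suc n C 0) * 1# + (sum (suc n) (F ∘ suc) + sum (suc n) (λ i → x * F i))
      ≡⟨ cong (_+_ (# (suc n C 0) * 1#)) (sum-+ (suc n) (F ∘ suc) (λ i → x * F i)) ⟨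
    # (suc n C 0) * 1# + sum (suc n) (λ i → F (suc i) + x * F i)
      ≡⟨ cong (_+_ (# (suc n C 0) * 1#)) (sum-ext (suc n) pascal) ⟩
    # (suc n C 0) * 1# + sum (suc n) (G ∘ suc) ≡⟨ sum-head (suc n) G ⟨
    sum (suc (suc n)) G ∎
    where
    open ≡-Reasoning
    F G : ℕ → K
    F i = # (n C i) * x ^ i
    G i = # (suc n C i) * x ^ i
    lem : ∀ x s → (x + 1#) * s ≡ s + x * s
    lem = solve-∀ ring
    lem′ : ∀ a b x y → b * (x * y) + x * (a * y) ≡ (a + b) * (x * y)
    lem′ = solve-∀ ring
    extend : sum n (F ∘ suc) ≡ sum (suc n) (F ∘ suc)
    extend = sym (trans (cong (λ a → sum n (F ∘ suc) + # a * x ^ suc n) (k>n⇒nCk≡0 {n} {suc n} ℕP.≤-refl))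
      (trans (cong (_+_ (sum n (F ∘ suc))) (zeroˡ (x ^ suc n))) (+-identityʳ _)))
    pascal : ∀ i → F (suc i) + x * F i ≡ G (suc i)
    pascal i = trans (lem′ (# (n C i)) (# (n C suc i)) x (x ^ i))
      (cong (_* x ^ suc i) (trans (sym (#-+ (n C i) (n C suc i))) (cong #_ (nCk+nC[k+1]≡[n+1]C[k+1] n i))))

  binomial-difference : ∀ x n → sum n (λ i → # (n C i) * x ^ i) ≡ (x + 1#) ^ n - x ^ n
  binomial-difference x n = trans (lem (sum n F) (x ^ n))
    (cong (_- x ^ n) (sym (trans (binomial x n) (cong (λ a → sum n F + # a * x ^ n) (nCn≡1 n)))))
    where
    F : ℕ → K
    F i = # (n C i) * x ^ i
    lem : ∀ a b → a ≡ a + # 1 * b - b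
    lem = solve-∀ ring

  ^-neg : ∀ x n → (- x) ^ n ≡ σ n * x ^ n
  ^-neg x zero    = refl
  ^-neg x (suc n) = trans (cong (_*_ (- x)) (^-neg x n)) (lem x (σ n) (x ^ n))
    where
    lem : ∀ x s y → - x * (s * y) ≡ - s * (x * y)
    lem = solve-∀ ring

  sum-swap : ∀ m n (f : ℕ → ℕ → K) → sum m (λ i → sum n (f i)) ≡ sum n (λ j → sum m (λ i → f i j))
  sum-swap zero    n f = sym (trans (sum-const n 0#) (zeroʳ (# n)))
  sum-swap (suc m) n f = trans (cong (_+ sum n (f m)) (sum-swap m n f))
    (sym (sum-+ n (λ j → sum m (λ i → f i j)) (f m)))

  powerSum : ℕ → K
  powerSum m = sum p (λ k → # k ^ m)

  powerSum-rec : ∀ m → sum (suc m) (λ i → # (suc m C i) * powerSum i) ≈[ 1 ] 0#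
  powerSum-rec m = begin
    sum (suc m) (λ i → # (suc m C i) * powerSum i)
      ≡⟨ sum-ext (suc m) (λ i → sym (sum-*ˡ p (# (suc m C i)) (λ k → # k ^ i))) ⟩
    sum (suc m) (λ i → sum p (λ k → # (suc m C i) * # k ^ i))
      ≡⟨ sum-swap (suc m) p (λ i k → # (suc m C i) * # k ^ i) ⟩
    sum p (λ k → sum (suc m) (λ i → # (suc m C i) * # k ^ i))
      ≡⟨ sum-ext p (λ k → trans (binomial-difference (# k) (suc m))
        (cong (λ a → a ^ suc m - # k ^ suc m) (+-comm (# k) 1#))) ⟩
    sum p (λ k → # suc k ^ suc m - # k ^ suc m) ≡⟨ sum-telescope p (λ k → # k ^ suc m) ⟩
    # p * # p ^ m - 0# * 0# ^ m
      ≈⟨ ≈-by₁ (# p ^ m) (Int-^ (nat p) m) (∣⇒≈0 {1} (p^1∣ p∣p)) (lem (# p) (# p ^ m) (0# ^ m)) ⟩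
    0# ∎
    where
    open ≈-Reasoning 1
    lem : ∀ p a b → p * a - 0# * b - 0# ≡ a * (p - 0#)
    lem = solve-∀ ring

  [1+n]Cn : ∀ n → suc n C n ≡ suc n
  [1+n]Cn zero    = refl
  [1+n]Cn (suc n) = trans (sym (nCk+nC[k+1]≡[n+1]C[k+1] (suc n) n))
    (trans (cong₂ ℕ._+_ ([1+n]Cn n) (nCn≡1 (suc n))) (ℕP.+-comm (suc n) 1))

  sum-0 : ∀ n {f} → (∀ j → j < n → f j ≈[ 1 ] 0#) → sum n f ≈[ 1 ] 0#
  sum-0 n h = ≈-trans (sum-≈ n h) (≡⇒≈ (trans (sum-const n 0#) (zeroʳ (# n))))

  -- In `powerSum-rec` the leading coefficient is m + 1, a unit because m + 1 < p; all earlier power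
  -- sums vanish by induction.
  powerSum≈0 : ∀ m → suc m < p → powerSum m ≈[ 1 ] 0#
  powerSum≈0 = <-rec _ step
    where
    lem : ∀ a n x → n * x - n * 0# ≡ 1# * (a + n * x - 0#) + - 1# * (a - 0#)
    lem = solve-∀ ring
    step : ∀ m → (∀ {i} → i < m → suc i < p → powerSum i ≈[ 1 ] 0#) → suc m < p → powerSum m ≈[ 1 ] 0#
    step m rec m<p = cancel (k<p⇒p∤ m<p) (≈-by₂ 1# (- 1#) Int-1 (⊝ Int-1)
      (subst (λ a → sum m (λ i → # (suc m C i) * powerSum i) + # a * powerSum m ≈[ 1 ] 0#) ([1+n]Cn m)
        (powerSum-rec m))
      (sum-0 m (λ i i<m → *ˡ-≈0 (nat (suc m C i)) (rec i<m (ℕP.<-trans (s≤s i<m) m<p))))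
      (lem (sum m (λ i → # (suc m C i) * powerSum i)) (# suc m) (powerSum m)))

  -- Modulo p these satisfy the recurrence of the Bernoulli numbers, by summation by parts.
  β : ℕ → K
  β i = sum p (λ k → (- # k) ^ i * sum k ι)

  -- The binomial theorem at -k collapses the sum over i to a difference of the powers k^(m+1) up to
  -- sign. Summation by parts against Σ_{j<k} ι j leaves Σ k^m, and the boundary term vanishes by Σ
  -- ι ≡ 0.
  β-rec : ∀ m → sum (suc m) (λ i → # (suc m C i) * β i) ≈[ 1 ] σ (suc m) * sum p₁ (λ k → # suc k ^ m)
  β-rec m = begin
    sum (suc m) (λ i → # (suc m C i) * β i)
      ≡⟨ sum-ext (suc m) (λ i → sym (sum-*ˡ p (# (suc m C i)) (λ k → (- # k) ^ i * sum k ι))) ⟩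
    sum (suc m) (λ i → sum p (λ k → # (suc m C i) * ((- # k) ^ i * sum k ι)))
      ≡⟨ sum-swap (suc m) p (λ i k → # (suc m C i) * ((- # k) ^ i * sum k ι)) ⟩
    sum p (λ k → sum (suc m) (λ i → # (suc m C i) * ((- # k) ^ i * sum k ι)))
      ≡⟨ sum-ext p (λ k → trans (sum-ext (suc m) (λ i → sym (*-assoc (# (suc m C i)) ((- # k) ^ i) (sum k ι))))
        (sum-*ʳ (suc m) (sum k ι) (λ i → # (suc m C i) * (- # k) ^ i))) ⟩
    sum p (λ k → sum (suc m) (λ i → # (suc m C i) * (- # k) ^ i) * sum k ι)
      ≡⟨ sum-p (λ k → sum (suc m) (λ i → # (suc m C i) * (- # k) ^ i) * sum k ι)
        (zeroʳ (sum (suc m) (λ i → # (suc m C i) * (- 0#) ^ i))) ⟩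
    sum p₁ (λ k → sum (suc m) (λ i → # (suc m C i) * (- # suc k) ^ i) * sum (suc k) ι) ≡⟨ sum-ext p₁ parts ⟩
    sum p₁ (λ k → σ (suc m) * (T (suc k) * ι (suc k)) + - σ (suc m) * (G (suc k) - G k))
      ≡⟨ trans (sum-+ p₁ (λ k → σ (suc m) * (T (suc k) * ι (suc k))) (λ k → - σ (suc m) * (G (suc k) - G k)))
        (cong₂ _+_ (sum-*ˡ p₁ (σ (suc m)) (λ k → T (suc k) * ι (suc k)))
        (trans (sum-*ˡ p₁ (- σ (suc m)) (λ k → G (suc k) - G k))
        (cong (_*_ (- σ (suc m))) (sum-telescope p₁ G)))) ⟩
    σ (suc m) * sum p₁ (λ k → T (suc k) * ι (suc k)) + - σ (suc m) * (G p₁ - G 0)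
      ≈⟨ +-≈ (≡⇒≈ (cong (_*_ (σ (suc m))) (sum-cong p₁ unit)))
        (*ˡ-≈ (⊝ Int-σ (suc m)) (≈-by₁ 1# Int-1 G≈ (lem₀ (G p₁) (0# ^ m) (ι 0)))) ⟩
    σ (suc m) * sum p₁ (λ k → # suc k ^ m) + - σ (suc m) * 0# ≡⟨ lem₁ (σ (suc m)) (sum p₁ (λ k → # suc k ^ m)) ⟩
    σ (suc m) * sum p₁ (λ k → # suc k ^ m) ∎
    where
    open ≈-Reasoning 1
    T G : ℕ → K
    T k = # k ^ suc m
    G k = T k * sum (suc k) ι
    lem₀ : ∀ g a b → g - 0# * a * (0# + b) - 0# ≡ 1# * (g - 0#)
    lem₀ = solve-∀ ring
    lem₁ : ∀ s a → s * a + - s * 0# ≡ s * a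
    lem₁ = solve-∀ ring
    G≈ : G p₁ ≈[ 1 ] 0#
    G≈ = *ˡ-≈0 (Int-^ (nat p₁) (suc m)) (subst (λ k → sum k ι ≈[ 1 ] 0#) p-odd (sum-ι p∣p))
    lem₂ : ∀ k m i → k * m * i ≡ m * (k * i)
    lem₂ = solve-∀ ring
    unit : ∀ k → k < p₁ → T (suc k) * ι (suc k) ≡ # suc k ^ m
    unit k k<p₁ = trans (lem₂ (# suc k) (# suc k ^ m) (ι (suc k)))
      (trans (cong (_*_ (# suc k ^ m)) (ι-∤ (k<p⇒p∤ (suc<p k<p₁))))
      (trans (*-comm (# suc k ^ m) 1#) (*-identityˡ (# suc k ^ m))))
    lem₃ : ∀ k → - (1# + k) + 1# ≡ - k
    lem₃ = solve-∀ ring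
    lem₄ : ∀ s a b h i → (s * a - s * b) * h ≡ s * (b * i) + - s * (b * (h + i) - a * h)
    lem₄ = solve-∀ ring
    parts : ∀ k → sum (suc m) (λ i → # (suc m C i) * (- # suc k) ^ i) * sum (suc k) ι ≡ σ (suc m)
      * (T (suc k) * ι (suc k)) + - σ (suc m) * (G (suc k) - G k)
    parts k = trans (cong (_* sum (suc k) ι)
      (trans (binomial-difference (- # suc k) (suc m))
      (cong₂ _-_ (trans (cong (_^ suc m) (lem₃ (# k))) (^-neg (# k) (suc m))) (^-neg (# suc k) (suc m)))))
      (lem₄ (σ (suc m)) (T k) (T (suc k)) (sum (suc k) ι) (ι (suc k)))

  -- For positive index the right side of `β-rec` is a power sum, hence ≡ 0 as in the recurrence of
  -- the Bernoulli numbers. At index 0 it is -(p - 1) ≡ 1 = B_0. The bound m + 1 < p makes the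
  -- leading coefficients units.
  𝔹≈β : ∀ m → suc m < p → 𝔹 m ≈[ 1 ] β m
  𝔹≈β = <-rec _ step
    where
    base : 1# ≈[ 1 ] β 0
    base = ≈-by₂ (- 1#) 1# (⊝ Int-1) Int-1 (β-rec 0) (∣⇒≈0 {1} (p^1∣ p∣p))
      (trans (lem (# p₁) (β 0)) (cong₂ (λ x y → - 1# * (0# + # 1 * β 0 - - 1# * x) + 1# * (y - 0#))
        (sym (trans (sum-const p₁ 1#) (l (# p₁)))) (sym #p≡)))
      where
      l : ∀ a → a * 1# ≡ a
      l = solve-∀ ring
      lem : ∀ a b → 1# - b ≡ - 1# * (0# + # 1 * b - - 1# * a) + 1# * (1# + a - 0#)
      lem = solve-∀ ring
    lem : ∀ n x y a c → n * x - n * y ≡ 1# * (n * x - - a) + - 1# * (n * y - - c) + - 1# * (a - c)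
    lem = solve-∀ ring
    step : ∀ m → (∀ {i} → i < m → suc i < p → 𝔹 i ≈[ 1 ] β i) → suc m < p → 𝔹 m ≈[ 1 ] β m
    step zero    rec m<p = base
    step (suc m) rec m<p = cancel (k<p⇒p∤ m<p) (≈-by₂ (- 1#) (- 1#) (⊝ Int-1) (⊝ Int-1) lower whole
      (trans (cong (_- # suc (suc m) * β (suc m)) (𝔹-rec m)) (lem′ _ _ _)))
      where
      S₁ = sum (suc m) (λ k → # (suc (suc m) C k) * 𝔹 k)
      S₂ = sum (suc m) (λ k → # (suc (suc m) C k) * β k)
      lem′ : ∀ s t x → - s - x ≡ - 1# * (s - t) + - 1# * (t + x - 0#)
      lem′ = solve-∀ ring
      lower : S₁ ≈[ 1 ] S₂
      lower = sum-≈ (suc m) (λ i i<m → *ˡ-≈ (nat (suc (suc m) C i)) (rec i<m (ℕP.<-trans (s≤s i<m) m<p)))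
      pw : sum p₁ (λ k → # suc k ^ suc m) ≈[ 1 ] 0#
      pw = ≈-trans (≡⇒≈ (sym (sum-p (λ k → # k ^ suc m) (zeroˡ (0# ^ m))))) (powerSum≈0 (suc m) m<p)
      whole : S₂ + # suc (suc m) * β (suc m) ≈[ 1 ] 0#
      whole = subst (λ a → S₂ + # a * β (suc m) ≈[ 1 ] 0#) ([1+n]Cn (suc m))
        (≈-trans (β-rec (suc m)) (*ˡ-≈0 (Int-σ (suc (suc m))) pw))

  fermat : ∀ k → # k ^ p ≈[ 1 ] # k
  fermat zero = ≡⇒≈ (trans (cong (0# ^_) p-odd) (zeroˡ (0# ^ p₁)))
  fermat (suc k) = begin
    # suc k ^ p ≡⟨ cong (_^ p) (+-comm 1# (# k)) ⟩
    (# k + 1#) ^ p ≡⟨ lem ((# k + 1#) ^ p) (# k ^ p) ⟩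
    (# k + 1#) ^ p - # k ^ p + # k ^ p ≡⟨ cong (_+ # k ^ p) (binomial-difference (# k) p) ⟨
    sum p F + # k ^ p ≡⟨ cong (λ n → sum n F + # k ^ p) p-odd ⟩
    sum (suc p₁) F + # k ^ p
      ≡⟨ cong (_+ # k ^ p) (trans (sum-head p₁ F) (cong (λ a → # a * 1# + sum p₁ (F ∘ suc)) (nC0 p))) ⟩
    # 1 * 1# + sum p₁ (F ∘ suc) + # k ^ p ≈⟨ +-≈ (+-≈ ≈-refl (sum-0 p₁ vanish)) (fermat k) ⟩
    # 1 * 1# + 0# + # k ≡⟨ lem′ (# k) ⟩
    1# + # k ∎
    where
    open ≈-Reasoning 1
    F : ℕ → K
    F i = # (p C i) * # k ^ i
    lem : ∀ a b → a ≡ a - b + b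
    lem = solve-∀ ring
    lem′ : ∀ k → # 1 * 1# + 0# + k ≡ 1# + k
    lem′ = solve-∀ ring
    vanish : ∀ i → i < p₁ → F (suc i) ≈[ 1 ] 0#
    vanish i i<p₁ = *ʳ-≈0 (Int-^ (nat k) (suc i)) (cancel (k<p⇒p∤ (suc<p i<p₁))
      (≈-by₁ (# (p₁ C i)) (nat (p₁ C i)) (∣⇒≈0 {1} (p^1∣ p∣p))
        (trans (cong (λ a → # suc i * # (a C suc i) - # suc i * 0#) p-odd)
          (trans (cong (_- # suc i * 0#) (sym (absorb′ p₁ i)))
          (trans (l (# suc p₁) (# (p₁ C i)) (# suc i)) (cong (λ a → # (p₁ C i) * (a - 0#)) (sym #p≡)))))))
      where
      l : ∀ p c i → p * c - i * 0# ≡ c * (p - 0#)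
      l = solve-∀ ring

  p∸3 : p ≡ suc (suc (suc (p ∸ 3)))
  p∸3 = sym (ℕP.m+[n∸m]≡n (ℕP.≤-trans (s≤s (s≤s (s≤s z≤n))) 5≤p))

  -- By Fermat k^(p-3) ≡ 1/k², and p - 3 is even. The sum over j < k in β and the sum over j ≤ k in
  -- D differ by Σ ι³ ≡ 0.
  𝔹≈D : 𝔹 (p ∸ 3) ≈[ 1 ] D
  𝔹≈D = begin
    𝔹 (p ∸ 3) ≈⟨ 𝔹≈β (p ∸ 3) (subst (suc (suc (p ∸ 3)) ≤_) (sym p∸3) (ℕP.n≤1+n _)) ⟩
    sum p (λ k → (- # k) ^ (p ∸ 3) * sum k ι) ≈⟨ sum-≈ p term ⟩
    sum p (λ k → ι² k * sum k ι) ≡⟨ lem₀ (sum p (λ k → ι² k * sum k ι)) ⟩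
    sum p (λ k → ι² k * sum k ι) + 0# ≈⟨ +-≈ ≈-refl (≈-sym (sum-ι³ p∣p)) ⟩
    sum p (λ k → ι² k * sum k ι) + sum p ι³ ≡⟨ sum-+ p (λ k → ι² k * sum k ι) ι³ ⟨
    sum p (λ k → ι² k * sum k ι + ι³ k)
      ≡⟨ sum-ext p (λ k → trans (lem₁ (ι k) (sum k ι)) (cong (_*_ (ι² k)) (sym (sum-one-ι (suc k))))) ⟩
    D ∎
    where
    open ≈-Reasoning 1
    lem₀ : ∀ a → a ≡ a + 0#
    lem₀ = solve-∀ ring
    lem₁ : ∀ a h → a * a * h + a * a * a ≡ a * a * (h + a)
    lem₁ = solve-∀ ring
    m : ℕ
    m = p ∸ 3
    σ-m : σ m ≡ 1#
    σ-m = trans (l (σ m)) (cong (λ x → - x) (trans (sym (cong σ p∸3)) σ-p))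
      where
      l : ∀ s → s ≡ - - - - s
      l = solve-∀ ring
    lem₂ : ∀ k i x → k * (k * (k * x)) * (i * i * i) ≡ x * (k * i * (k * i) * (k * i))
    lem₂ = solve-∀ ring
    lem₃ : ∀ x → x ≡ x * (1# * 1# * 1#)
    lem₃ = solve-∀ ring
    lem₄ : ∀ k i → k * (i * i * i) ≡ (k * i) * (i * i)
    lem₄ = solve-∀ ring
    power : ∀ k → suc k < p → # suc k ^ m ≈[ 1 ] ι² (suc k)
    power k k<p = begin
      # suc k ^ m ≡⟨ lem₃ (# suc k ^ m) ⟩
      # suc k ^ m * (1# * 1# * 1#) ≡⟨ cong (λ a → # suc k ^ m * (a * a * a)) (ι-∤ (k<p⇒p∤ k<p)) ⟨
      # suc k ^ m * (# suc k * ι (suc k) * (# suc k * ι (suc k)) * (# suc k * ι (suc k)))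
        ≡⟨ lem₂ (# suc k) (ι (suc k)) (# suc k ^ m) ⟨
      # suc k ^ (suc (suc (suc m))) * ι³ (suc k) ≡⟨ cong (λ a → # suc k ^ a * ι³ (suc k)) p∸3 ⟨
      # suc k ^ p * ι³ (suc k) ≈⟨ *ʳ-≈ (Int-ι³ (suc k)) (fermat (suc k)) ⟩
      # suc k * ι³ (suc k)
        ≡⟨ trans (lem₄ (# suc k) (ι (suc k)))
          (trans (cong (_* ι² (suc k)) (ι-∤ (k<p⇒p∤ k<p))) (*-identityˡ (ι² (suc k)))) ⟩
      ι² (suc k) ∎
    term : ∀ k → k < p → (- # k) ^ m * sum k ι ≈[ 1 ] ι² k * sum k ι
    term zero    _   = ≡⇒≈ (trans (zeroʳ ((- 0#) ^ m)) (sym (zeroʳ (ι² 0))))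
    term (suc k) k<p = *ʳ-≈ (Int-sumAll (suc k) Int-ι)
      (≈-trans (≡⇒≈ (trans (^-neg (# suc k) m) (trans (cong (_* # suc k ^ m) σ-m) (*-identityˡ (# suc k ^ m)))))
      (power k k<p))

  𝔹≈θ : 𝔹 (p ∸ 3) ≈[ 1 ] - # 2 * θ
  𝔹≈θ = ≈-trans 𝔹≈D D≈

  -- Binomial coefficients as products

  prod : ℕ → (ℕ → K) → K
  prod zero    f = 1#
  prod (suc n) f = prod n f * f n

  prod-ext : ∀ n {f g} → (∀ j → j < n → f j ≡ g j) → prod n f ≡ prod n g
  prod-ext zero    eq = refl
  prod-ext (suc n) eq = cong₂ _*_ (prod-ext n (λ j j<n → eq j (ℕP.m<n⇒m<1+n j<n))) (eq n ℕP.≤-refl)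

  prod-* : ∀ n f g → prod n (λ j → f j * g j) ≡ prod n f * prod n g
  prod-* zero    f g = refl
  prod-* (suc n) f g = trans (cong (_* (f n * g n)) (prod-* n f g)) (lem (prod n f) (prod n g) (f n) (g n))
    where
    lem : ∀ a b c d → a * b * (c * d) ≡ a * c * (b * d)
    lem = solve-∀ ring

  prod-head : ∀ n f → prod (suc n) f ≡ f 0 * prod n (f ∘ suc)
  prod-head zero    f = *-comm 1# (f 0)
  prod-head (suc n) f = trans (cong (_* f (suc n)) (prod-head n f)) (*-assoc (f 0) _ _)

  prod-reverse : ∀ n f → prod n f ≡ prod n (λ j → f (n ∸ suc j))
  prod-reverse zero    f = refl
  prod-reverse (suc n) f = trans (*-comm (prod n f) (f n))
    (trans (cong (_*_ (f n)) (prod-reverse n f)) (sym (prod-head n (λ j → f (n ∸ j)))))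

  prod-mirror : ∀ n {f g : ℕ → K} → f 0 ≡ g 0 → (∀ j k → suc j ℕ.+ suc k ≡ n → f (suc k) ≡ g (suc j)) → prod n f
    ≡ prod n g
  prod-mirror zero    f0 eq = refl
  prod-mirror (suc n) {f} {g} f0 eq = begin
    prod (suc n) f                 ≡⟨ prod-head n f ⟩
    f 0 * prod n (f ∘ suc)        
      ≡⟨ cong₂ _*_ f0 (trans (prod-reverse n (f ∘ suc))
        (prod-ext n (λ j j<n → eq j (n ∸ suc j) (cong suc (trans (ℕP.+-suc j _) (ℕP.m+[n∸m]≡n j<n)))))) ⟩
    g 0 * prod n (g ∘ suc)         ≡⟨ prod-head n g ⟨
    prod (suc n) g                 ∎
    where open ≡-Reasoning

  prod-≈ : ∀ {y g} → y ≈[ e ] 0# → (∀ j → Int (g j)) → ∀ n → prod n (λ j → 1# + y * g j) ≈[ e ℕ.+ e ] 1# + y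
    * sum n g
  prod-≈ {y = y} {g} y≈0 ig zero = ≡⇒≈ (lem y)
    where
    lem : ∀ y → 1# ≡ 1# + y * 0#
    lem = solve-∀ ring
  prod-≈ {e} {y} {g} y≈0 ig (suc n) = begin
    prod n (λ j → 1# + y * g j) * (1# + y * g n) ≈⟨ *ʳ-≈ (Int-1 ⊕ Int-≈ Int-0 y≈0 ⊗ ig n) (prod-≈ y≈0 ig n) ⟩
    (1# + y * sum n g) * (1# + y * g n)
      ≈⟨ ≈-by₁ (sum n g * g n) (Int-sumAll n ig ⊗ ig n) (*-≈0 y≈0 y≈0) (lem y (sum n g) (g n)) ⟩
    1# + y * (sum n g + g n) ∎
    where
    open ≈-Reasoning (e ℕ.+ e)
    lem : ∀ y a b → (1# + y * a) * (1# + y * b) - (1# + y * (a + b)) ≡ a * b * (y * y - 0#)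
    lem = solve-∀ ring

  -- The factor at j = 0 is 1, since recip 0 = ι 0 = 0.  The weight ρ̂ = 1 + σ keeps
  -- the even j only, so that Π ρ̂ x c = ∏_{1≤k≤⌊c/2⌋} (1 + x/k).
  Π Φ : (ℕ → K) → K → ℕ → K
  Π ρ x c = prod (suc c) (λ j → 1# + x * (ρ j * recip j))
  Φ ρ x c = prod (suc c) (λ j → 1# + x * (ρ j * ι j))

  Φ≈ : ∀ {ρ x} → (∀ j → Int (ρ j)) → x ≈[ e ] 0# → ∀ c → Φ ρ x c ≈[ e ℕ.+ e ] 1# + x * harm ρ c
  Φ≈ iρ x≈0 c = prod-≈ x≈0 (λ j → iρ j ⊗ Int-ι j) (suc c)

  factor-0 : ∀ x a → 1# + x * (a * 0#) ≡ 1#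
  factor-0 = solve-∀ ring

  Π-0 : ∀ ρ x → Π ρ x 0 ≡ 1#
  Π-0 ρ x = trans (*-identityˡ _) (factor-0 x (ρ 0))

  Φ-0 : ∀ ρ x → Φ ρ x 0 ≡ 1#
  Φ-0 ρ x = trans (*-identityˡ _) (trans (cong (λ a → 1# + x * (ρ 0 * a)) ι-0) (factor-0 x (ρ 0)))

  recip-p* : ∀ c → # p * recip (p ℕ.* suc c) ≡ recip (suc c)
  recip-p* c = begin
    # p * recip (p ℕ.* suc c) ≡⟨ lem (# p) (recip (p ℕ.* suc c)) ⟩
    # p * recip (p ℕ.* suc c) * 1# ≡⟨ cong (_*_ (# p * recip (p ℕ.* suc c))) (#*recip c) ⟨
    # p * recip (p ℕ.* suc c) * (# suc c * recip (suc c))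
      ≡⟨ lem′ (# p) (recip (p ℕ.* suc c)) (# suc c) (recip (suc c)) ⟩
    # p * # suc c * recip (p ℕ.* suc c) * recip (suc c)
      ≡⟨ cong (λ a → a * recip (p ℕ.* suc c) * recip (suc c)) (#-* p (suc c)) ⟨
    # (p ℕ.* suc c) * recip (p ℕ.* suc c) * recip (suc c)
      ≡⟨ cong (λ n → # n * recip n * recip (suc c)) (cong (ℕ._* suc c) p-odd) ⟩
    # (suc p₁ ℕ.* suc c) * recip (suc p₁ ℕ.* suc c) * recip (suc c)
      ≡⟨ cong (_* recip (suc c)) (#*recip (c ℕ.+ p₁ ℕ.* suc c)) ⟩
    1# * recip (suc c) ≡⟨ *-identityˡ _ ⟩
    recip (suc c) ∎
    where
    open ≡-Reasoning
    lem : ∀ a b → a * b ≡ a * b * 1#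
    lem = solve-∀ ring
    lem′ : ∀ a b c d → a * b * (c * d) ≡ a * c * b * d
    lem′ = solve-∀ ring

  ι≡recip : ∀ {j} → ¬ p ∣ j → ι j ≡ recip j
  ι≡recip {j} p∤j with p ∣? j
  ... | yes p∣j = ⊥-elim (p∤j p∣j)
  ... | no _    = refl

  -- The factors at multiples pu are 1 + x ρ(u)/u and rebuild Π ρ x c; the others form Φ. The
  -- factors are added one at a time, along the pairs (c, w).
  Π-block : ∀ {ρ} → (∀ c → ρ (p ℕ.* c) ≡ ρ c) → ∀ x c w → w < p →
    Π ρ (# p * x) (p ℕ.* c ℕ.+ w) ≡ Π ρ x c * Φ ρ (# p * x) (p ℕ.* c ℕ.+ w)
  Π-block {ρ} ρp x zero zero _ = subst (λ k → Π ρ (# p * x) k ≡ Π ρ x 0 * Φ ρ (# p * x) k)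
    (sym (trans (ℕP.+-identityʳ _) (ℕP.*-zeroʳ p)))
    (trans (Π-0 ρ (# p * x)) (sym (cong₂ _*_ (Π-0 ρ x) (Φ-0 ρ (# p * x)))))
  -- The index p(c+1) is the successor of the last one in block c, so the induction continues from w
  -- = p - 1. Its factor goes to Π, while Φ receives a trivial one.
  Π-block {ρ} ρp x (suc c) zero _ = subst (λ k → Π ρ y k ≡ Π ρ x (suc c) * Φ ρ y k) (sym index) (begin
    Π ρ y (a ℕ.+ p₁) * (1# + y * (ρ k * recip k))
      ≡⟨ cong (_* (1# + y * (ρ k * recip k))) (Π-block ρp x c p₁ (subst (p₁ <_) (sym p-odd) ℕP.≤-refl)) ⟩
    Π ρ x c * Φ ρ y (a ℕ.+ p₁) * (1# + y * (ρ k * recip k))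
      ≡⟨ cong (λ n → Π ρ x c * Φ ρ y (a ℕ.+ p₁) * (1# + y * (ρ n * recip n))) index′ ⟨
    Π ρ x c * Φ ρ y (a ℕ.+ p₁) * (1# + y * (ρ (p ℕ.* suc c) * recip (p ℕ.* suc c)))
      ≡⟨ lem (Π ρ x c) (Φ ρ y (a ℕ.+ p₁)) (# p) x (ρ (p ℕ.* suc c)) (recip (p ℕ.* suc c)) (ρ k) ⟩
    Π ρ x c * (1# + x * (ρ (p ℕ.* suc c) * (# p * recip (p ℕ.* suc c))))
      * (Φ ρ y (a ℕ.+ p₁) * (1# + y * (ρ k * 0#)))
      ≡⟨ cong₂ (λ u v → Π ρ x c * (1# + x * (u * v)) * (Φ ρ y (a ℕ.+ p₁) * (1# + y * (ρ k * 0#)))) (ρp (suc c))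
        (recip-p* c) ⟩
    Π ρ x (suc c) * (Φ ρ y (a ℕ.+ p₁) * (1# + y * (ρ k * 0#)))
      ≡⟨ cong (λ i → Π ρ x (suc c) * (Φ ρ y (a ℕ.+ p₁) * (1# + y * (ρ k * i))))
        (ι-∣ (subst (p ∣_) index′ (m∣m*n (suc c)))) ⟨
    Π ρ x (suc c) * Φ ρ y k ∎)
    where
    open ≡-Reasoning
    y = # p * x
    a = p ℕ.* c
    k = suc (a ℕ.+ p₁)
    index′ : p ℕ.* suc c ≡ k
    index′ = trans (ℕP.*-suc p c) (trans (ℕP.+-comm p a) (trans (cong (a ℕ.+_) p-odd) (ℕP.+-suc a p₁)))
    index : p ℕ.* suc c ℕ.+ 0 ≡ k
    index = trans (ℕP.+-identityʳ _) index′
    lem : ∀ a b p x s q s′ → a * b * (1# + p * x * (s * q)) ≡ a * (1# + x * (s * (p * q)))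
      * (b * (1# + p * x * (s′ * 0#)))
    lem = solve-∀ ring
  Π-block {ρ} ρp x c (suc w) w<p = subst (λ k → Π ρ y k ≡ Π ρ x c * Φ ρ y k) (sym (ℕP.+-suc a w))
    (trans (cong₂ (λ u v → u * (1# + y * (ρ k * v))) (Π-block ρp x c w (ℕP.<-trans (ℕP.n<1+n w) w<p))
      (sym (ι≡recip p∤k)))
      (*-assoc (Π ρ x c) (Φ ρ y (a ℕ.+ w)) (1# + y * (ρ k * ι k))))
    where
    y = # p * x
    a = p ℕ.* c
    k = suc (a ℕ.+ w)
    p∤k : ¬ p ∣ k
    p∤k d = k<p⇒p∤ w<p (∣m+n∣m⇒∣n (subst (p ∣_) (sym (ℕP.+-suc a w)) d) (m∣m*n c))

  Π-binomial : ∀ a b → Π one (# a) b ≡ # ((a ℕ.+ b) C b)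
  Π-binomial a zero = trans (Π-0 one (# a)) (cong #_ (sym (nC0 (a ℕ.+ 0))))
  Π-binomial a (suc b) = begin
    Π one (# a) b * (1# + # a * (1# * recip⁺ b)) ≡⟨ cong (_* (1# + # a * (1# * recip⁺ b))) (Π-binomial a b) ⟩
    C₁ * (1# + # a * (1# * recip⁺ b)) ≡⟨ cong (λ u → C₁ * (u + # a * (1# * recip⁺ b))) (#*recip b) ⟨
    C₁ * (# suc b * recip⁺ b + # a * (1# * recip⁺ b)) ≡⟨ lem C₁ (# a) (# b) (recip⁺ b) ⟩
    (1# + (# a + # b)) * C₁ * recip⁺ b ≡⟨ cong (λ u → (1# + u) * C₁ * recip⁺ b) (#-+ a b) ⟨
    # suc (a ℕ.+ b) * C₁ * recip⁺ b ≡⟨ cong (_* recip⁺ b) (absorb′ (a ℕ.+ b) b) ⟩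
    # suc b * # (suc (a ℕ.+ b) C suc b) * recip⁺ b ≡⟨ lem′ (# suc b) (# (suc (a ℕ.+ b) C suc b)) (recip⁺ b) ⟩
    # suc b * recip⁺ b * # (suc (a ℕ.+ b) C suc b)
      ≡⟨ trans (cong (_* # (suc (a ℕ.+ b) C suc b)) (#*recip b)) (*-identityˡ _) ⟩
    # (suc (a ℕ.+ b) C suc b) ≡⟨ cong (λ k → # (k C suc b)) (ℕP.+-suc a b) ⟨
    # ((a ℕ.+ suc b) C suc b) ∎
    where
    open ≡-Reasoning
    C₁ = # ((a ℕ.+ b) C b)
    lem : ∀ c a b r → c * ((1# + b) * r + a * (1# * r)) ≡ (1# + (a + b)) * c * r
    lem = solve-∀ ring
    lem′ : ∀ a b c → a * b * c ≡ a * c * b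
    lem′ = solve-∀ ring

  Π-binomial′ : ∀ a b → Π one (# a) b ≡ # ((a ℕ.+ b) C a)
  Π-binomial′ a b = trans (Π-binomial a b)
    (cong #_ (sym (trans (nCk≡nC[n∸k] {a} {a ℕ.+ b} (ℕP.m≤m+n a b)) (cong ((a ℕ.+ b) C_) (ℕP.m+n∸m≡n a b)))))

  Π-negative : ∀ n k → Π one (- # suc n) k ≡ σ k * # (n C k)
  Π-negative n zero = trans (Π-0 one (- # suc n)) (sym (trans (*-identityˡ _) (cong #_ (nC0 n))))
  Π-negative n (suc k) = begin
    Π one (- # suc n) k * (1# + - # suc n * (1# * recip⁺ k))
      ≡⟨ cong (_* (1# + - # suc n * (1# * recip⁺ k))) (Π-negative n k) ⟩
    σ k * # (n C k) * (1# + - # suc n * (1# * recip⁺ k))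
      ≡⟨ cong (λ u → σ k * # (n C k) * (u + - # suc n * (1# * recip⁺ k))) (#*recip k) ⟨
    σ k * # (n C k) * (# suc k * recip⁺ k + - # suc n * (1# * recip⁺ k))
      ≡⟨ lem (σ k) (# (n C k)) (# n) (# k) (recip⁺ k) ⟩
    - σ k * ((# n - # k) * # (n C k)) * recip⁺ k ≡⟨ cong (λ u → - σ k * u * recip⁺ k) (absorb n k) ⟨
    - σ k * (# suc k * # (n C suc k)) * recip⁺ k ≡⟨ lem′ (- σ k) (# suc k) (# (n C suc k)) (recip⁺ k) ⟩
    - σ k * # (n C suc k) * (# suc k * recip⁺ k)
      ≡⟨ trans (cong (_*_ (- σ k * # (n C suc k))) (#*recip k)) (lem″ (- σ k * # (n C suc k))) ⟩
    σ (suc k) * # (n C suc k) ∎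
    where
    open ≡-Reasoning
    lem : ∀ s c n k r → s * c * ((1# + k) * r + - (1# + n) * (1# * r)) ≡ - s * ((n - k) * c) * r
    lem = solve-∀ ring
    lem′ : ∀ s k c r → s * (k * c) * r ≡ s * c * (k * r)
    lem′ = solve-∀ ring
    lem″ : ∀ a → a * 1# ≡ a
    lem″ = solve-∀ ring

  C-complement : ∀ N .{{_ : ℕ.NonZero N}} k → # (N C k) * (# N - # k) ≡ # N * (σ k * Π one (- # N) k)
  C-complement (suc n) k = begin
    # (suc n C k) * (# suc n - # k) ≡⟨ *-comm _ _ ⟩
    (# suc n - # k) * # (suc n C k) ≡⟨ absorb (suc n) k ⟨
    # suc k * # (suc n C suc k) ≡⟨ absorb′ n k ⟨
    # suc n * # (n C k) ≡⟨ cong (_*_ (# suc n)) (*-identityˡ (# (n C k))) ⟨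
    # suc n * (1# * # (n C k)) ≡⟨ cong (λ u → # suc n * (u * # (n C k))) (σ² k) ⟨
    # suc n * (σ k * σ k * # (n C k))
      ≡⟨ cong (_*_ (# suc n)) (trans (*-assoc (σ k) (σ k) (# (n C k)))
        (cong (_*_ (σ k)) (sym (Π-negative n k)))) ⟩
    # suc n * (σ k * Π one (- # suc n) k) ∎
    where open ≡-Reasoning

  recip-2* : ∀ k → # 2 * recip (2 ℕ.* suc k) ≡ recip (suc k)
  recip-2* k = begin
    # 2 * R ≡⟨ lem R ⟩
    # 2 * R * 1# ≡⟨ cong (_*_ (# 2 * R)) (#*recip k) ⟨
    # 2 * R * (# suc k * recip (suc k)) ≡⟨ lem′ R (# suc k) (recip (suc k)) ⟩
    # 2 * # suc k * R * recip (suc k) ≡⟨ cong (λ a → a * R * recip (suc k)) (#-* 2 (suc k)) ⟨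
    # (2 ℕ.* suc k) * R * recip (suc k) ≡⟨ cong (_* recip (suc k)) (#*recip (k ℕ.+ 1 ℕ.* suc k)) ⟩
    1# * recip (suc k) ≡⟨ *-identityˡ _ ⟩
    recip (suc k) ∎
    where
    open ≡-Reasoning
    R = recip (2 ℕ.* suc k)
    lem : ∀ b → # 2 * b ≡ # 2 * b * 1#
    lem = solve-∀ ring
    lem′ : ∀ b c d → # 2 * b * (c * d) ≡ # 2 * c * b * d
    lem′ = solve-∀ ring

  Π-odd : ∀ x k → Π ρ̂ x (suc (2 ℕ.* k)) ≡ Π ρ̂ x (2 ℕ.* k)
  Π-odd x k = trans (cong (λ s → Π ρ̂ x (2 ℕ.* k) * (1# + x * ((1# + - s) * recip (suc (2 ℕ.* k))))) (σ-2* k))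
    (lem (Π ρ̂ x (2 ℕ.* k)) x (recip (suc (2 ℕ.* k))))
    where
    lem : ∀ a x r → a * (1# + x * ((1# + - 1#) * r)) ≡ a
    lem = solve-∀ ring

  Π-even : ∀ x k → Π ρ̂ x (2 ℕ.* k) ≡ Π one x k
  Π-even x zero    = trans (Π-0 ρ̂ x) (sym (Π-0 one x))
  Π-even x (suc k) = begin
    Π ρ̂ x (2 ℕ.* suc k) ≡⟨ cong (Π ρ̂ x) (2*suc k) ⟩
    Π ρ̂ x (suc (2 ℕ.* k)) * factor (suc (suc (2 ℕ.* k)))
      ≡⟨ cong (λ n → Π ρ̂ x (suc (2 ℕ.* k)) * factor n) (2*suc k) ⟨
    Π ρ̂ x (suc (2 ℕ.* k)) * factor (2 ℕ.* suc k)
      ≡⟨ cong₂ (λ u s → u * (1# + x * ((1# + s) * recip (2 ℕ.* suc k)))) (trans (Π-odd x k) (Π-even x k))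
        (σ-2* (suc k)) ⟩
    Π one x k * (1# + x * ((1# + 1#) * recip (2 ℕ.* suc k))) ≡⟨ lem (Π one x k) x (recip (2 ℕ.* suc k)) ⟩
    Π one x k * (1# + x * (1# * (# 2 * recip (2 ℕ.* suc k))))
      ≡⟨ cong (λ u → Π one x k * (1# + x * (1# * u))) (recip-2* k) ⟩
    Π one x (suc k) ∎
    where
    open ≡-Reasoning
    factor : ℕ → K
    factor j = 1# + x * (ρ̂ j * recip j)
    lem : ∀ a x r → a * (1# + x * ((1# + 1#) * r)) ≡ a * (1# + x * (1# * (# 2 * r)))
    lem = solve-∀ ring

  parity : ∀ c → ∃ λ k → c ≡ 2 ℕ.* k ⊎ c ≡ suc (2 ℕ.* k)
  parity zero = 0 , inj₁ refl
  parity (suc c) with parity c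
  ... | k , inj₁ eq = k , inj₂ (cong suc eq)
  ... | k , inj₂ eq = suc k , inj₁ (trans (cong suc eq) (sym (2*suc k)))

  -- The single factors 1 + x/j need not be integral; integrality comes from the identification of
  -- the products with binomial coefficients.
  Int-Π̂ : ∀ {x} → (∀ k → Int (Π one x k)) → ∀ c → Int (Π ρ̂ x c)
  Int-Π̂ {x} i c with parity c
  ... | k , inj₁ refl = subst Int (sym (Π-even x k)) (i k)
  ... | k , inj₂ refl = subst Int (sym (trans (Π-odd x k) (Π-even x k))) (i k)

  Int-Π⁺ : ∀ N k → Int (Π one (# N) k)
  Int-Π⁺ N k = subst Int (sym (Π-binomial N k)) (nat ((N ℕ.+ k) C k))

  Int-Π⁻ : ∀ N .{{_ : ℕ.NonZero N}} k → Int (Π one (- # N) k)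
  Int-Π⁻ (suc n) k = subst Int (sym (Π-negative n k)) (Int-σ k ⊗ nat (n C k))

  ^-1+ : ∀ {k x δ} → Int x → δ ≈[ e ] 0# → k ≤ e ℕ.+ e → x ≈[ k ] 1# + δ → ∀ n → x ^ n ≈[ k ] 1# + # n * δ
  ^-1+ {δ = δ} ix δ≈0 k≤ h zero = ≡⇒≈ (lem δ)
    where
    lem : ∀ d → 1# ≡ 1# + # 0 * d
    lem = solve-∀ ring
  ^-1+ {e} {k} {x} {δ} ix δ≈0 k≤ h (suc n) = begin
    x * x ^ n ≈⟨ *-≈ (Int-^ ix n) (Int-1 ⊕ Int-≈ Int-0 δ≈0) h (^-1+ ix δ≈0 k≤ h n) ⟩
    (1# + δ) * (1# + # n * δ) ≈⟨ ≈-weaken k≤ (≈-by₁ (# n) (nat n) (*-≈0 δ≈0 δ≈0) (lem δ (# n))) ⟩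
    1# + # suc n * δ ∎
    where
    open ≈-Reasoning k
    lem : ∀ d n → (1# + d) * (1# + n * d) - (1# + (1# + n) * d) ≡ n * (d * d - 0#)
    lem = solve-∀ ring

  *-1+ : ∀ {k x y δ ε} → Int y → δ ≈[ e ] 0# → ε ≈[ e ] 0# → k ≤ e ℕ.+ e →
         x ≈[ k ] 1# + δ → y ≈[ k ] 1# + ε → x * y ≈[ k ] 1# + (δ + ε)
  *-1+ {e} {k} {x} {y} {δ} {ε} iy δ≈0 ε≈0 k≤ hx hy = ≈-trans (*-≈ iy (Int-1 ⊕ Int-≈ Int-0 δ≈0) hx hy)
    (≈-weaken k≤ (≈-by₁ 1# Int-1 (*-≈0 δ≈0 ε≈0) (lem δ ε)))
    where
    lem : ∀ d e → (1# + d) * (1# + e) - (1# + (d + e)) ≡ 1# * (d * e - 0#)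
    lem = solve-∀ ring

  +-≈0 : ∀ {x y} → x ≈[ e ] 0# → y ≈[ e ] 0# → x + y ≈[ e ] 0#
  +-≈0 hx hy = ≈-trans (+-≈ hx hy) (≡⇒≈ (+-identityˡ 0#))

  ^-1+³ : ∀ {k x y z δ ε ζ} r s t → Int x → Int y → Int z → δ ≈[ e ] 0# → ε ≈[ e ] 0# → ζ ≈[ e ] 0# → k ≤ e
    ℕ.+ e →
    x ≈[ k ] 1# + δ → y ≈[ k ] 1# + ε → z ≈[ k ] 1# + ζ →
    x ^ r * y ^ s * z ^ t ≈[ k ] 1# + (# r * δ + # s * ε + # t * ζ)
  ^-1+³ {e} {k} {x} {y} {z} {δ} {ε} {ζ} r s t ix iy iz δ≈0 ε≈0 ζ≈0 k≤ hx hy hz =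
    *-1+ {e} (Int-^ iz t) (+-≈0 rδ sε) tζ k≤
      (*-1+ {e} (Int-^ iy s) rδ sε k≤ (^-1+ ix δ≈0 k≤ hx r) (^-1+ iy ε≈0 k≤ hy s)) (^-1+ iz ζ≈0 k≤ hz t)
    where
    rδ = *ˡ-≈0 (nat r) δ≈0
    sε = *ˡ-≈0 (nat s) ε≈0
    tζ = *ˡ-≈0 (nat t) ζ≈0

  -- A refinement of Lucas' theorem. Shifting by p N′ converts the coefficient into a product ending
  -- at p(c - N′) + w, whose H agrees modulo p with the H at pc + w.
  C-block : ∀ {i N′} → p ℕ.^ suc i ∣ p ℕ.* N′ → ∀ c w → w < p → ∃ λ z → Int z ×
    # ((p ℕ.* c ℕ.+ w) C (p ℕ.* N′)) ≡ # (c C N′) * z × z ≈[ suc (suc i) ] 1# + # (p ℕ.* N′) * H (p ℕ.* c ℕ.+ w)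
  C-block {i} {N′} d c w w<p with N′ ℕ.≤? c
  -- Both coefficients are zero here and any z satisfies the equation, so the approximation itself
  -- is taken.
  ... | no N′≰c = 1# + # (p ℕ.* N′) * H (p ℕ.* c ℕ.+ w) , Int-1 ⊕ nat (p ℕ.* N′) ⊗ Int-H (p ℕ.* c ℕ.+ w) ,
        trans (cong #_ (k>n⇒nCk≡0 c<N)) (sym
          (trans (cong (λ a → # a * (1# + # (p ℕ.* N′) * H (p ℕ.* c ℕ.+ w))) (k>n⇒nCk≡0 (ℕP.≰⇒> N′≰c)))
          (zeroˡ _))) , ≈-refl
    where
    c<N : p ℕ.* c ℕ.+ w < p ℕ.* N′
    c<N = ℕP.<-≤-trans (ℕP.+-monoʳ-< (p ℕ.* c) w<p)
      (subst (_≤ p ℕ.* N′) (trans (ℕP.*-suc p c) (ℕP.+-comm p (p ℕ.* c))) (ℕP.*-monoʳ-≤ p (ℕP.≰⇒> N′≰c)))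
  ... | yes N′≤c = z , Int-≈ (Int-1 ⊕ nat (p ℕ.* N′) ⊗ Int-H (p ℕ.* c ℕ.+ w)) z≈ , exact , z≈
    where
    g = c ∸ N′
    N = p ℕ.* N′
    z = Φ one (# p * # N′) (p ℕ.* g ℕ.+ w)
    y≡ : # p * # N′ ≡ # N
    y≡ = sym (#-* p N′)
    index : p ℕ.* c ℕ.+ w ≡ N ℕ.+ (p ℕ.* g ℕ.+ w)
    index = trans (cong (λ k → p ℕ.* k ℕ.+ w) (sym (ℕP.m+[n∸m]≡n N′≤c)))
      (trans (cong (ℕ._+ w) (ℕP.*-distribˡ-+ p N′ g)) (ℕP.+-assoc N (p ℕ.* g) w))
    exact : # ((p ℕ.* c ℕ.+ w) C N) ≡ # (c C N′) * z
    exact = begin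
      # ((p ℕ.* c ℕ.+ w) C N) ≡⟨ cong (λ k → # (k C N)) index ⟩
      # ((N ℕ.+ (p ℕ.* g ℕ.+ w)) C N) ≡⟨ Π-binomial′ N (p ℕ.* g ℕ.+ w) ⟨
      Π one (# N) (p ℕ.* g ℕ.+ w) ≡⟨ cong (λ y → Π one y (p ℕ.* g ℕ.+ w)) y≡ ⟨
      Π one (# p * # N′) (p ℕ.* g ℕ.+ w) ≡⟨ Π-block {one} (λ _ → refl) (# N′) g w w<p ⟩
      Π one (# N′) g * z
        ≡⟨ cong (_* z) (trans (Π-binomial′ N′ g) (cong (λ k → # (k C N′)) (ℕP.m+[n∸m]≡n N′≤c))) ⟩
      # (c C N′) * z ∎
      where open ≡-Reasoning
    z≈ : z ≈[ suc (suc i) ] 1# + # N * H (p ℕ.* c ℕ.+ w)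
    z≈ = begin
      Φ one (# p * # N′) (p ℕ.* g ℕ.+ w) ≡⟨ cong (λ y → Φ one y (p ℕ.* g ℕ.+ w)) y≡ ⟩
      Φ one (# N) (p ℕ.* g ℕ.+ w) ≈⟨ ≈-weaken (suc≤ i) (Φ≈ Int-one (∣⇒≈0 {suc i} d) (p ℕ.* g ℕ.+ w)) ⟩
      1# + # N * H (p ℕ.* g ℕ.+ w)
        ≈⟨ +-≈ ≈-refl (subst (λ k → # N * H (p ℕ.* g ℕ.+ w) ≈[ k ] # N * H (p ℕ.* c ℕ.+ w))
          (ℕP.+-comm (suc i) 1) (scale (∣⇒≈0 {suc i} d) (≈-trans (H-period g w) (≈-sym (H-period c w))))) ⟩
      1# + # N * H (p ℕ.* c ℕ.+ w) ∎
      where open ≈-Reasoning (suc (suc i))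

  -- The function `G` on all indices c and its expansion over a block

  module _ (r s t : ℕ) where

    -- At c = 2k this is the summand of index k with C(N,k) replaced by (-1)^k C(N-1,k). At c = 2k +
    -- 1 only the last coefficient changes, to C(2k+1, N).
    G : ℕ → ℕ → K
    G N c = Π ρ̂ (- # N) c ^ r * Π ρ̂ (# N) c ^ s * # (c C N) ^ t

    Int-G : ∀ N .{{_ : ℕ.NonZero N}} c → Int (G N c)
    Int-G N c = Int-^ (Int-Π̂ (Int-Π⁻ N) c) r ⊗ Int-^ (Int-Π̂ (Int-Π⁺ N) c) s ⊗ Int-^ (nat (c C N)) t

    -- The linear coefficient in N of the new factors in a block: -r Ĥ and s Ĥ from the two
    -- products, t H from C(c, N).
    Θ : ℕ → K
    Θ c = (# s - # r) * Ĥ c + # t * H c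

    Int-Θ : ∀ c → Int (Θ c)
    Int-Θ c = (nat s ⊕ ⊝ nat r) ⊗ Int-Ĥ c ⊕ nat t ⊗ Int-H c

    G-block : ∀ {i N′} .{{_ : ℕ.NonZero N′}} → p ℕ.^ suc i ∣ p ℕ.* N′ → ∀ c w → w < p →
      G (p ℕ.* N′) (p ℕ.* c ℕ.+ w) ≈[ suc (suc i) ] G N′ c * (1# + # (p ℕ.* N′) * Θ (p ℕ.* c ℕ.+ w))
    G-block {i} {N′} d c w w<p with C-block {i} {N′} d c w w<p
    ... | z , iz , z≡ , z≈ = begin
      G N x ≡⟨ cong₂ _*_ (cong₂ (λ a b → a ^ r * b ^ s) minus plus) (cong (_^ t) z≡) ⟩
      (Π ρ̂ (- # N′) c * Φ₋) ^ r * (Π ρ̂ (# N′) c * Φ₊) ^ s * (# (c C N′) * z) ^ t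
        ≡⟨ trans (cong₂ _*_ (cong₂ _*_ (*-^ _ Φ₋ r) (*-^ _ Φ₊ s)) (*-^ _ z t))
          (lem₀ (Π ρ̂ (- # N′) c ^ r) (Φ₋ ^ r) (Π ρ̂ (# N′) c ^ s) (Φ₊ ^ s) (# (c C N′) ^ t) (z ^ t)) ⟩
      G N′ c * (Φ₋ ^ r * Φ₊ ^ s * z ^ t)
        ≈⟨ *ˡ-≈ (Int-G N′ c) (^-1+³ {e = suc i} r s t (Int-≈ (Int-1 ⊕ ⊝ nat N ⊗ Int-Ĥ x) h₋)
          (Int-≈ (Int-1 ⊕ nat N ⊗ Int-Ĥ x) h₊) iz
             (*ʳ-≈0 (Int-Ĥ x) N₋≈0) (*ʳ-≈0 (Int-Ĥ x) N≈0) (*ʳ-≈0 (Int-H x) N≈0) (suc≤ i) h₋ h₊ z≈) ⟩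
      G N′ c * (1# + (# r * (- # N * Ĥ x) + # s * (# N * Ĥ x) + # t * (# N * H x)))
        ≡⟨ cong (_*_ (G N′ c)) (lem (# r) (# s) (# t) (# N) (Ĥ x) (H x)) ⟩
      G N′ c * (1# + # N * Θ x) ∎
      where
      open ≈-Reasoning (suc (suc i))
      N = p ℕ.* N′
      x = p ℕ.* c ℕ.+ w
      Φ₋ = Φ ρ̂ (- # N) x
      Φ₊ = Φ ρ̂ (# N) x
      ρ̂-p* : ∀ c → ρ̂ (p ℕ.* c) ≡ ρ̂ c
      ρ̂-p* c = cong (_+_ 1#) (σ-p* c)
      neg* : ∀ a b → a * - b ≡ - (a * b)
      neg* = solve-∀ ring
      y₋ : # p * - # N′ ≡ - # N
      y₋ = trans (neg* (# p) (# N′)) (cong (λ a → - a) (sym (#-* p N′)))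
      y₊ : # p * # N′ ≡ # N
      y₊ = sym (#-* p N′)
      minus : Π ρ̂ (- # N) x ≡ Π ρ̂ (- # N′) c * Φ₋
      minus = subst (λ y → Π ρ̂ y x ≡ Π ρ̂ (- # N′) c * Φ ρ̂ y x) y₋ (Π-block ρ̂-p* (- # N′) c w w<p)
      plus : Π ρ̂ (# N) x ≡ Π ρ̂ (# N′) c * Φ₊
      plus = subst (λ y → Π ρ̂ y x ≡ Π ρ̂ (# N′) c * Φ ρ̂ y x) y₊ (Π-block ρ̂-p* (# N′) c w w<p)
      N≈0 : # N ≈[ suc i ] 0#
      N≈0 = ∣⇒≈0 {suc i} d
      N₋≈0 : - # N ≈[ suc i ] 0#
      N₋≈0 = ≈-by₁ (- 1#) (⊝ Int-1) N≈0 (l (# N))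
        where
        l : ∀ a → - a - 0# ≡ - 1# * (a - 0#)
        l = solve-∀ ring
      h₋ : Φ₋ ≈[ suc (suc i) ] 1# + - # N * Ĥ x
      h₋ = ≈-weaken (suc≤ i) (Φ≈ Int-ρ̂ N₋≈0 x)
      h₊ : Φ₊ ≈[ suc (suc i) ] 1# + # N * Ĥ x
      h₊ = ≈-weaken (suc≤ i) (Φ≈ Int-ρ̂ N≈0 x)
      lem₀ : ∀ a a′ b b′ c c′ → a * a′ * (b * b′) * (c * c′) ≡ a * b * c * (a′ * b′ * c′)
      lem₀ = solve-∀ ring
      lem : ∀ r s t n h h′ → 1# + (r * (- n * h) + s * (n * h) + t * (n * h′)) ≡ 1# + n * ((s - r) * h + t * h′)
      lem = solve-∀ ring

    G-block₁ : ∀ {N′} .{{_ : ℕ.NonZero N′}} c w → w < p → G (p ℕ.* N′) (p ℕ.* c ℕ.+ w) ≈[ 1 ] G N′ c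
    G-block₁ {N′} c w w<p = ≈-trans (≈-weaken (s≤s z≤n) (G-block {0} (p^1∣p* N′) c w w<p))
      (≈-by₁ (G N′ c * Θ x) (Int-G N′ c ⊗ Int-Θ x) (∣⇒≈0 {1} (p^1∣p* N′)) (lem (G N′ c) (# (p ℕ.* N′)) (Θ x)))
      where
      x = p ℕ.* c ℕ.+ w
      lem : ∀ g n h → g * (1# + n * h) - g ≡ g * h * (n - 0#)
      lem = solve-∀ ring

  -- The summands at the multiples of p

  neg-≈ : ∀ {x y} → x ≈[ e ] y → - x ≈[ e ] - y
  neg-≈ {x = x} {y} h = ≈-by₁ (- 1#) (⊝ Int-1) h (lem x y)
    where
    lem : ∀ a b → - a - - b ≡ - 1# * (a - b)
    lem = solve-∀ ring

  -- Newton iteration: each pass through x − 1 = (x² − 1 − (x − 1)²)/2 gains a digit.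
  square-root : ∀ {k x δ} → x ≈[ 1 ] 1# → δ ≈[ suc k ] 0# → x * x ≈[ suc (suc k) ] 1# + # 2 * δ → x ≈[ suc
    (suc k) ] 1# + δ
  square-root {k} {x} {δ} x≈1 δ≈0 h = cancel p∤2 (≈-by₂ 1# (- 1#) Int-1 (⊝ Int-1) h z²≈0 (lem x δ))
    where
    lem : ∀ x d → # 2 * x - # 2 * (1# + d) ≡ 1# * (x * x - (1# + # 2 * d)) + - 1# * ((x - 1#) * (x - 1#) - 0#)
    lem = solve-∀ ring
    z≈0 : ∀ j → j ≤ k → x - 1# ≈[ suc j ] 0#
    z≈0 zero    _   = ≈-by₁ 1# Int-1 x≈1 (l x)
      where
      l : ∀ x → x - 1# - 0# ≡ 1# * (x - 1#)
      l = solve-∀ ring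
    z≈0 (suc j) j<k = cancel p∤2 (≈-by₂ 1# (- 1#) Int-1 (⊝ Int-1) square (≈-weaken (suc≤ j) (*-≈0 z z)) (l x))
      where
      z = z≈0 j (ℕP.≤-trans (ℕP.n≤1+n j) j<k)
      square : x * x - 1# ≈[ suc (suc j) ] 0#
      square = ≈-weaken (s≤s j<k) (≈-by₂ 1# (# 2) Int-1 (nat 2) (≈-weaken (ℕP.n≤1+n (suc k)) h) δ≈0 (l′ x δ))
        where
        l′ : ∀ x d → x * x - 1# - 0# ≡ 1# * (x * x - (1# + # 2 * d)) + # 2 * (d - 0#)
        l′ = solve-∀ ring
      l : ∀ x → # 2 * (x - 1#) - # 2 * 0# ≡ 1# * (x * x - 1# - 0#) + - 1# * ((x - 1#) * (x - 1#) - 0#)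
      l = solve-∀ ring
    z²≈0 : (x - 1#) * (x - 1#) ≈[ suc (suc k) ] 0#
    z²≈0 = ≈-weaken (suc≤ k) (*-≈0 (z≈0 k ℕP.≤-refl) (z≈0 k ℕP.≤-refl))

  -- ι (m - j) is -ι j to leading order with linear correction -m ι² j, so the sum is -Σ ι² - m Σ ι³
  -- with Σ ι³ ≡ 0.
  sum-ι*ι : ∀ i {m} → p ℕ.^ suc i ∣ m → sum m (λ j → ι j * ι (m ∸ j)) ≈[ suc (suc i) ] # 4 * ⅓ * (# m * θ)
  sum-ι*ι i {m} d = begin
    sum m (λ j → ι j * ι (m ∸ j)) ≈⟨ sum-≈ m (λ j j<m → term j (ℕP.<⇒≤ j<m)) ⟩
    sum m (λ j → - 1# * ι² j + - # m * ι³ j)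
      ≡⟨ trans (sum-+ m (λ j → - 1# * ι² j) (λ j → - # m * ι³ j))
        (cong₂ _+_ (sum-*ˡ m (- 1#) ι²) (sum-*ˡ m (- # m) ι³)) ⟩
    - 1# * sum m ι² + - # m * sum m ι³
      ≈⟨ +-≈ (*ˡ-≈ (⊝ Int-1) (sum-ι²-≈ i d)) (m* (neg-≈ (∣⇒≈0 {suc i} d)) (sum-ι³ (p∣p^ {i} d))) ⟩
    - 1# * - (# 4 * ⅓ * (# m * θ)) + - # m * 0# ≡⟨ lem (# m) θ ⟩
    # 4 * ⅓ * (# m * θ) ∎
    where
    open ≈-Reasoning (suc (suc i))
    m* : ∀ {u x y} → u ≈[ suc i ] - 0# → x ≈[ 1 ] y → u * x ≈[ suc (suc i) ] u * y
    m* {u} {x} {y} hu h = subst (λ e → u * x ≈[ e ] u * y) (ℕP.+-comm (suc i) 1) (scale hu h)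
    lem : ∀ m t → - 1# * - (# 4 * ⅓ * (m * t)) + - m * 0# ≡ # 4 * ⅓ * (m * t)
    lem = solve-∀ ring
    lem₁ : ∀ a b m → a * b ≡ a * (a + b) + - 1# * (a * a)
    lem₁ = solve-∀ ring
    lem₂ : ∀ a b m → a * (m * a * b) + - 1# * (a * a) ≡ - m * (- (a * a) * b) + - 1# * (a * a)
    lem₂ = solve-∀ ring
    lem₃ : ∀ a m → - m * (- (a * a) * - a) + - 1# * (a * a) ≡ - 1# * (a * a) + - m * (a * a * a)
    lem₃ = solve-∀ ring
    term : ∀ j → j ≤ m → ι j * ι (m ∸ j) ≈[ suc (suc i) ] - 1# * ι² j + - # m * ι³ j
    term j j≤m = begin
      ι j * ι k ≡⟨ lem₁ (ι j) (ι k) (# m) ⟩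
      ι j * (ι j + ι k) + - 1# * ι² j ≡⟨ cong (λ a → ι j * a + - 1# * ι² j) (ι-reflect (p∣p^ {i} d) j k eq) ⟩
      ι j * (# m * ι j * ι k) + - 1# * ι² j ≡⟨ lem₂ (ι j) (ι k) (# m) ⟩
      - # m * (- ι² j * ι k) + - 1# * ι² j
        ≈⟨ +-≈ (m* (neg-≈ (∣⇒≈0 {suc i} d)) (*ˡ-≈ (⊝ Int-ι² j) (ι-mirror {0} (p^1∣ (p∣p^ {i} d)) j k eq)))
          ≈-refl ⟩
      - # m * (- ι² j * - ι j) + - 1# * ι² j ≡⟨ lem₃ (ι j) (# m) ⟩
      - 1# * ι² j + - # m * ι³ j ∎
      where
      k = m ∸ j
      eq : j ℕ.+ k ≡ m
      eq = ℕP.m+[n∸m]≡n j≤m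

  -- In a pair the linear term X (ι j + ι (m - j)) equals X m ι j ι (m - j); added to the quadratic
  -- term it gives the coefficient X (X + m).
  Φ-square : ∀ X {m} → p ∣ m → Φ one (# X) m * Φ one (# X) m ≡ prod m
    (λ j → 1# + # X * (# X + # m) * (ι j * ι (m ∸ j)))
  Φ-square X {m} d = begin
    Φ one (# X) m * Φ one (# X) m ≡⟨ cong (λ a → a * a) top ⟩
    prod m f * prod m f ≡⟨ cong (_*_ (prod m f)) mirror ⟩
    prod m f * prod m g ≡⟨ prod-* m f g ⟨
    prod m (λ j → f j * g j)
      ≡⟨ prod-ext m (λ j j<m → trans (lem (# X) (ι j) (ι (m ∸ j)))
        (trans (cong (λ a → 1# + # X * a + # X * # X * (ι j * ι (m ∸ j)))
        (ι-reflect d j (m ∸ j) (ℕP.m+[n∸m]≡n (ℕP.<⇒≤ j<m)))) (lem′ (# X) (# m) (ι j) (ι (m ∸ j))))) ⟩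
    prod m (λ j → 1# + # X * (# X + # m) * (ι j * ι (m ∸ j))) ∎
    where
    open ≡-Reasoning
    f g : ℕ → K
    f j = 1# + # X * (1# * ι j)
    g j = 1# + # X * (1# * ι (m ∸ j))
    lem : ∀ x a b → (1# + x * (1# * a)) * (1# + x * (1# * b)) ≡ 1# + x * (a + b) + x * x * (a * b)
    lem = solve-∀ ring
    lem′ : ∀ x m a b → 1# + x * (m * a * b) + x * x * (a * b) ≡ 1# + x * (x + m) * (a * b)
    lem′ = solve-∀ ring
    top : Φ one (# X) m ≡ prod m f
    top = trans (cong (λ a → prod m f * (1# + # X * (1# * a))) (ι-∣ d))
      (trans (cong (_*_ (prod m f)) (factor-0 (# X) 1#)) (trans (*-comm (prod m f) 1#) (*-identityˡ _)))
    mirror : prod m f ≡ prod m g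
    mirror = prod-mirror m {f} {g} (cong (λ a → 1# + # X * (1# * a)) (trans ι-0 (sym (ι-∣ d))))
      (λ j k eq → cong (λ a → 1# + # X * (1# * ι a))
        (sym (trans (cong (_∸ suc j) (sym eq)) (ℕP.m+n∸m≡n (suc j) (suc k)))))

  -- The square of Φ has linear term 4/3, and the square root halves it to 2/3. The condition i + 2
  -- ≤ a makes the terms of second order in X (X + m) negligible.
  Φ-cubic : ∀ {i a X m} → p ∣ X → p ℕ.^ suc i ∣ m → p ℕ.^ a ∣ X ℕ.* (X ℕ.+ m) → suc (suc i) ≤ a →
    Φ one (# X) m ≈[ a ℕ.+ suc (suc i) ] 1# + # 2 * ⅓ * θ * (# X * (# X + # m) * # m)
  Φ-cubic {i} {a} {X} {m} dX dm dy i≤a = subst (λ e → Φ one (# X) m ≈[ e ] 1# + δ) (sym E≡)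
    (square-root Φ≈1 δ≈0 (subst (λ e → Φ one (# X) m * Φ one (# X) m ≈[ e ] 1# + # 2 * δ) E≡ square))
    where
    y = # X * (# X + # m)
    δ = # 2 * ⅓ * θ * (y * # m)
    E≡ : a ℕ.+ suc (suc i) ≡ suc (suc (a ℕ.+ i))
    E≡ = trans (ℕP.+-suc a (suc i)) (cong suc (ℕP.+-suc a i))
    y≈0 : y ≈[ a ] 0#
    y≈0 = subst (_≈[ a ] 0#) (trans (#-* X (X ℕ.+ m)) (cong (_*_ (# X)) (#-+ X m))) (∣⇒≈0 {a} dy)
    δ≈0 : δ ≈[ suc (a ℕ.+ i) ] 0#
    δ≈0 = *ˡ-≈0 (nat 2 ⊗ Int-⅓ ⊗ Int-θ) (subst (λ e → y * # m ≈[ e ] 0#) (ℕP.+-suc a i)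
      (*-≈0 y≈0 (∣⇒≈0 {suc i} dm)))
    Φ≈1 : Φ one (# X) m ≈[ 1 ] 1#
    Φ≈1 = ≈-trans (≈-weaken (s≤s z≤n) (Φ≈ Int-one X≈0 m)) (≈-by₁ (H m) (Int-H m) X≈0 (lem (# X) (H m)))
      where
      X≈0 : # X ≈[ 1 ] 0#
      X≈0 = ∣⇒≈0 {1} (p^1∣ dX)
      lem : ∀ x h → 1# + x * h - 1# ≡ h * (x - 0#)
      lem = solve-∀ ring
    lem : ∀ y m t → 1# + y * (# 4 * ⅓ * (m * t)) ≡ 1# + # 2 * (# 2 * ⅓ * t * (y * m))
    lem = solve-∀ ring
    square : Φ one (# X) m * Φ one (# X) m ≈[ a ℕ.+ suc (suc i) ] 1# + # 2 * δ
    square = begin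
      Φ one (# X) m * Φ one (# X) m ≡⟨ Φ-square X (p∣p^ {i} dm) ⟩
      prod m (λ j → 1# + y * (ι j * ι (m ∸ j)))
        ≈⟨ ≈-weaken (ℕP.+-monoʳ-≤ a i≤a) (prod-≈ y≈0 (λ j → Int-ι j ⊗ Int-ι (m ∸ j)) m) ⟩
      1# + y * sum m (λ j → ι j * ι (m ∸ j)) ≈⟨ +-≈ ≈-refl (scale y≈0 (sum-ι*ι i dm)) ⟩
      1# + y * (# 4 * ⅓ * (# m * θ)) ≡⟨ lem y (# m) θ ⟩
      1# + # 2 * δ ∎
      where open ≈-Reasoning (a ℕ.+ suc (suc i))

  p³ : K
  p³ = # p * # p * # p

  -- In terms of B_{p-3} ≡ -2θ this is -B_{p-3} p³ a b (a + b)/3, the correction term in the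
  -- Jacobsthal-Kazandzidis congruence.
  cubic : K → K → K
  cubic a b = # 2 * ⅓ * θ * (p³ * (a * (a + b) * b))

  -- The exponent of the ratio lemmas: p³ a (a+b) b is divisible by p^(precision − 1).
  precision : ℕ → ℕ → ℕ
  precision d i = suc (suc (d ℕ.+ i)) ℕ.+ suc (suc i)

  p*p^ : ∀ {a x y} → p ℕ.^ a ∣ x ℕ.* y → p ℕ.^ suc (suc a) ∣ p ℕ.* x ℕ.* (p ℕ.* y)
  p*p^ {a} {x} {y} (divides k eq) = divides k
    (trans (lem p x y) (trans (cong (λ z → p ℕ.* p ℕ.* z) eq) (lem′ p k (p ℕ.^ a))))
    where
    lem : ∀ p x y → p ℕ.* x ℕ.* (p ℕ.* y) ≡ p ℕ.* p ℕ.* (x ℕ.* y)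
    lem = solveℕ-∀
    lem′ : ∀ p k q → p ℕ.* p ℕ.* (k ℕ.* q) ≡ k ℕ.* (p ℕ.* (p ℕ.* q))
    lem′ = solveℕ-∀

  -- In all three uses one of a and a + b is N, divisible by p^d, and the other (N - j, N + j or 2j)
  -- is divisible by p^i.
  Π-ratio : ∀ {d i} a b → p ℕ.^ i ∣ b → p ℕ.^ (d ℕ.+ i) ∣ a ℕ.* (a ℕ.+ b) →
    ∃ λ φ → Π one (# (p ℕ.* a)) (p ℕ.* b) ≡ Π one (# a) b * φ × φ ≈[ precision d i ] 1# + cubic (# a) (# b)
  Π-ratio {d} {i} a b db dab = φ ,
    subst₂ (λ y k → Π one y k ≡ Π one (# a) b * Φ one y k) (sym (#-* p a)) (ℕP.+-identityʳ (p ℕ.* b))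
      (Π-block {one} (λ _ → refl) (# a) b 0 (ℕP.<-≤-trans (s≤s z≤n) 5≤p)) ,
    ≈-trans (Φ-cubic {i} {suc (suc (d ℕ.+ i))} (m∣m*n a) (*-monoʳ-∣ p db)
      (subst (λ y → p ℕ.^ suc (suc (d ℕ.+ i)) ∣ p ℕ.* a ℕ.* y) (ℕP.*-distribˡ-+ p a b)
      (p*p^ {d ℕ.+ i} {a} {a ℕ.+ b} dab)) (s≤s (s≤s (ℕP.m≤n+m i d))))
      (≡⇒≈ (trans (cong₂ (λ x y → 1# + # 2 * ⅓ * θ * (x * (x + y) * y)) (#-* p a) (#-* p b))
        (lem (# p) (# a) (# b) θ)))
    where
    φ = Φ one (# (p ℕ.* a)) (p ℕ.* b)
    lem : ∀ p a b t → 1# + # 2 * ⅓ * t * (p * a * (p * a + p * b) * (p * b)) ≡ 1# + # 2 * ⅓ * t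
      * (p * p * p * (a * (a + b) * b))
    lem = solve-∀ ring

  p∣ : ∀ {i a b} → p ℕ.^ i ∣ a → p ℕ.^ i ∣ a ℕ.+ b → p ℕ.^ i ∣ b
  p∣ da dab = ∣m+n∣m⇒∣n dab da

  p^-*-∣ : ∀ {d i x y} → p ℕ.^ d ∣ x → p ℕ.^ i ∣ y → p ℕ.^ (d ℕ.+ i) ∣ x ℕ.* y
  p^-*-∣ {d} {i} dx dy = subst (_∣ _) (sym (ℕP.^-distribˡ-+-* p d i)) (*-pres-∣ dx dy)

  p^-mono : ∀ {i d x} → i ≤ d → p ℕ.^ d ∣ x → p ℕ.^ i ∣ x
  p^-mono {i} {d} i≤d = ∣-trans (subst (p ℕ.^ i ∣_)
    (trans (sym (ℕP.^-distribˡ-+-* p i (d ∸ i))) (cong (p ℕ.^_) (ℕP.m+[n∸m]≡n i≤d))) (m∣m*n (p ℕ.^ (d ∸ i))))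

  cubic≈0 : ∀ {d i a b} → # a * (# a + b) ≈[ d ℕ.+ i ] 0# → b ≈[ i ] 0# → cubic (# a) b ≈[ suc (suc (d ℕ.+ i))
    ℕ.+ suc i ] 0#
  cubic≈0 {d} {i} {a} {b} h hb = *ˡ-≈0 (nat 2 ⊗ Int-⅓ ⊗ Int-θ)
    (subst (λ e → p³ * (# a * (# a + b) * b) ≈[ e ] 0#) (lem (d ℕ.+ i) i)
    (*-≈0 (*-≈0 (*-≈0 p≈ p≈) p≈) (*-≈0 h hb)))
    where
    p≈ : # p ≈[ 1 ] 0#
    p≈ = ∣⇒≈0 {1} (p^1∣ p∣p)
    lem : ∀ x i → 3 ℕ.+ (x ℕ.+ i) ≡ suc (suc x) ℕ.+ suc i
    lem = solveℕ-∀

  P-cancel-≡ : ∀ f {x y} → P f * x ≡ P f * y → x ≡ y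
  P-cancel-≡ f {x} {y} eq = trans (sym (lem x)) (trans (cong (_*_ (recip (p ℕ.^ f))) eq) (lem y))
    where
    lem : ∀ x → recip (p ℕ.^ f) * (P f * x) ≡ x
    lem x = trans (l (recip (p ℕ.^ f)) (P f) x) (trans (cong (_* x) (P-inverse f)) (*-identityˡ x))
      where
      l : ∀ a b c → a * (b * c) ≡ b * a * c
      l = solve-∀ ring

  -- The valuation of j capped at d, which also gives j = 0 a place.
  valuation : ∀ d j → p ℕ.^ d ∣ j ⊎ (∃[ i ] ∃[ j′ ] i < d × j ≡ p ℕ.^ i ℕ.* j′ × ¬ p ∣ j′)
  valuation zero    j = inj₁ (1∣ j)
  valuation (suc d) j with valuation d j
  ... | inj₂ (i , j′ , i<d , eq , h) = inj₂ (i , j′ , ℕP.m<n⇒m<1+n i<d , eq , h)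
  ... | inj₁ (divides k eq) with p ∣? k
  ...   | yes (divides l eq′) = inj₁ (divides l
    (trans eq (trans (cong (ℕ._* p ℕ.^ d) eq′) (ℕP.*-assoc l p (p ℕ.^ d)))))
  ...   | no ¬d = inj₂ (d , k , ℕP.≤-refl , trans eq (ℕP.*-comm k (p ℕ.^ d)) , ¬d)

  sum-multiples : ∀ {e} q .{{_ : ℕ.NonZero q}} n f → (∀ j → j < q ℕ.* n → ¬ q ∣ j → f j ≈[ e ] 0#) →
    sum (q ℕ.* n) f ≈[ e ] sum n (λ u → f (q ℕ.* u))
  sum-multiples {e} q@(suc q₁) n f h = ≈-trans (≡⇒≈ (sum-block q n f)) (sum-≈ n (λ u u<n → begin
    sum q (λ w → f (q ℕ.* u ℕ.+ w)) ≡⟨ sum-head q₁ (λ w → f (q ℕ.* u ℕ.+ w)) ⟩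
    f (q ℕ.* u ℕ.+ 0) + sum q₁ (λ w → f (q ℕ.* u ℕ.+ suc w))
      ≈⟨ +-≈ (≡⇒≈ (cong f (ℕP.+-identityʳ (q ℕ.* u))))
        (sum-≈ q₁ (λ w w<q₁ → h (q ℕ.* u ℕ.+ suc w) (bound u w u<n w<q₁) (indivisible u w w<q₁))) ⟩
    f (q ℕ.* u) + sum q₁ (λ _ → 0#)
      ≡⟨ trans (cong (_+_ (f (q ℕ.* u))) (trans (sum-const q₁ 0#) (zeroʳ (# q₁)))) (+-identityʳ _) ⟩
    f (q ℕ.* u) ∎))
    where
    open ≈-Reasoning e
    indivisible : ∀ u w → w < q₁ → ¬ q ∣ q ℕ.* u ℕ.+ suc w
    indivisible u w w<q₁ d = >⇒∤ (s≤s w<q₁) (∣m+n∣m⇒∣n d (m∣m*n u))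
    bound : ∀ u w → u < n → w < q₁ → q ℕ.* u ℕ.+ suc w < q ℕ.* n
    bound u w u<n w<q₁ = ℕP.<-≤-trans (ℕP.+-monoʳ-< (q ℕ.* u) (s≤s w<q₁))
      (subst (_≤ q ℕ.* n) (trans (ℕP.*-suc q u) (ℕP.+-comm q (q ℕ.* u))) (ℕP.*-monoʳ-≤ q u<n))

  #-∸ : ∀ {m n} → n ≤ m → # (m ∸ n) ≡ # m - # n
  #-∸ {m} {n} n≤m = trans (lem (# (m ∸ n)) (# n))
    (cong (_- # n) (trans (sym (#-+ n (m ∸ n))) (cong #_ (ℕP.m+[n∸m]≡n n≤m))))
    where
    lem : ∀ a b → a ≡ b + a - b
    lem = solve-∀ ring

  C-ratio : ∀ {d i N j} → i ≤ d → p ℕ.^ d ∣ N → p ℕ.^ i ∣ j → ∃ λ z →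
    # ((2 ℕ.* (p ℕ.* j)) C (p ℕ.* N)) ≡ # ((2 ℕ.* j) C N) * z × z ≈[ precision d i ] 1# + cubic (# N)
      (# (2 ℕ.* j) - # N)
  C-ratio {d} {i} {N} {j} i≤d dN dj with N ℕ.≤? 2 ℕ.* j
  -- Both coefficients vanish; z is chosen to satisfy the congruence trivially.
  ... | no ≰ = 1# + cubic (# N) (# (2 ℕ.* j) - # N) ,
      trans (cong #_ (k>n⇒nCk≡0 lt)) (sym (trans
        (cong (λ a → # a * (1# + cubic (# N) (# (2 ℕ.* j) - # N))) (k>n⇒nCk≡0 (ℕP.≰⇒> ≰))) (zeroˡ _))) , ≈-refl
    where
    lem : ∀ p j → p ℕ.* (2 ℕ.* j) ≡ 2 ℕ.* (p ℕ.* j)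
    lem = solveℕ-∀
    lt : 2 ℕ.* (p ℕ.* j) < p ℕ.* N
    lt = subst (_< p ℕ.* N) (lem p j) (ℕP.*-monoʳ-< p {{ℕ.>-nonZero (ℕP.<-≤-trans (s≤s z≤n) 5≤p)}} (ℕP.≰⇒> ≰))
  ... | yes N≤2j = z , exact , subst (λ a → z ≈[ precision d i ] 1# + cubic (# N) a) (#-∸ N≤2j)
    (proj₂ (proj₂ R))
    where
    g = 2 ℕ.* j ∸ N
    R = Π-ratio {d} {i} N (2 ℕ.* j ∸ N) (p∣ {i} {N} (p^-mono i≤d dN)
      (subst (p ℕ.^ i ∣_) (sym (ℕP.m+[n∸m]≡n N≤2j)) (∣n⇒∣m*n 2 dj)))
                        (p^-*-∣ {d} {i} dN (subst (p ℕ.^ i ∣_) (sym (ℕP.m+[n∸m]≡n N≤2j)) (∣n⇒∣m*n 2 dj)))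
    z = proj₁ R
    eq = proj₁ (proj₂ R)
    lem : ∀ p j → p ℕ.* (2 ℕ.* j) ≡ 2 ℕ.* (p ℕ.* j)
    lem = solveℕ-∀
    index : p ℕ.* N ℕ.+ p ℕ.* g ≡ 2 ℕ.* (p ℕ.* j)
    index = trans (sym (ℕP.*-distribˡ-+ p N g)) (trans (cong (p ℕ.*_) (ℕP.m+[n∸m]≡n N≤2j)) (lem p j))
    exact : # ((2 ℕ.* (p ℕ.* j)) C (p ℕ.* N)) ≡ # ((2 ℕ.* j) C N) * z
    exact = trans (cong (λ k → # (k C (p ℕ.* N))) (sym index))
      (trans (sym (Π-binomial′ (p ℕ.* N) (p ℕ.* g))) (trans eq
      (cong (_* z) (trans (Π-binomial′ N g) (cong (λ k → # (k C N)) (ℕP.m+[n∸m]≡n N≤2j))))))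

  instance
    p-nonZero : ℕ.NonZero p
    p-nonZero = ℕ.>-nonZero (ℕP.<-≤-trans (s≤s z≤n) 5≤p)

  N-nonZero : ∀ d n .{{_ : ℕ.NonZero n}} → ℕ.NonZero (p ℕ.^ d ℕ.* n)
  N-nonZero d n = ℕP.m*n≢0 (p ℕ.^ d) n {{ℕP.m^n≢0 p d}}

  -- N − j = p^i k with p ∤ k, whence the power of p in C(N, j) = N C(N−1, j)/(N−j).
  C-valuation : ∀ d n .{{_ : ℕ.NonZero n}} i j′ → i < d → ¬ p ∣ j′ → p ℕ.^ i ℕ.* j′ ≤ p ℕ.^ d ℕ.* n →
    let N = p ℕ.^ d ℕ.* n ; j = p ℕ.^ i ℕ.* j′ in
    ∃[ k ] # k ≡ P (d ∸ i) * # n - # j′ × ¬ p ∣ k ×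
           # (N C j) ≡ P (d ∸ i) * (# n * (σ j * Π one (- # N) j) * ι k)
  C-valuation d n i j′ i<d p∤j′ j≤N = k , #k , p∤k , (begin
    # (N C j) ≡⟨ lem (# (N C j)) ⟩
    # (N C j) * 1# ≡⟨ cong (_*_ (# (N C j))) (ι-∤ p∤k) ⟨
    # (N C j) * (# k * ι k) ≡⟨ *-assoc _ _ _ ⟨
    # (N C j) * # k * ι k ≡⟨ cong (_* ι k) scaled ⟩
    P (d ∸ i) * (# n * S) * ι k ≡⟨ *-assoc _ _ _ ⟩
    P (d ∸ i) * (# n * S * ι k) ∎)
    where
    open ≡-Reasoning
    N = p ℕ.^ d ℕ.* n
    j = p ℕ.^ i ℕ.* j′
    N≡ : N ≡ p ℕ.^ i ℕ.* (p ℕ.^ (d ∸ i) ℕ.* n)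
    N≡ = trans (cong (λ k → p ℕ.^ k ℕ.* n) (sym (ℕP.m+[n∸m]≡n (ℕP.<⇒≤ i<d))))
      (trans (cong (ℕ._* n) (ℕP.^-distribˡ-+-* p i (d ∸ i))) (ℕP.*-assoc (p ℕ.^ i) (p ℕ.^ (d ∸ i)) n))
    j′≤ : j′ ≤ p ℕ.^ (d ∸ i) ℕ.* n
    j′≤ = ℕP.*-cancelˡ-≤ (p ℕ.^ i) {{ℕP.m^n≢0 p i}} (subst (j ≤_) N≡ j≤N)
    k = p ℕ.^ (d ∸ i) ℕ.* n ∸ j′
    #k : # k ≡ P (d ∸ i) * # n - # j′
    #k = trans (#-∸ j′≤) (cong (_- # j′) (#-* (p ℕ.^ (d ∸ i)) n))
    p∣top : p ∣ j′ ℕ.+ k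
    p∣top = subst (p ∣_) (sym (ℕP.m+[n∸m]≡n j′≤))
      (∣m⇒∣m*n n (subst (λ f → p ∣ p ℕ.^ f) (ℕP.m+[n∸m]≡n {1} {d ∸ i} (ℕP.m<n⇒0<n∸m i<d))
      (m∣m*n (p ℕ.^ (d ∸ i ∸ 1)))))
    p∤k : ¬ p ∣ k
    p∤k p∣k = p∤j′ (∣m+n∣m⇒∣n (subst (p ∣_) (ℕP.+-comm j′ k) p∣top) p∣k)
    S = σ j * Π one (- # N) j
    lem : ∀ a → a ≡ a * 1#
    lem = solve-∀ ring
    #N : # N ≡ P i * (P (d ∸ i) * # n)
    #N = trans (cong #_ N≡) (trans (#-* (p ℕ.^ i) (p ℕ.^ (d ∸ i) ℕ.* n))
      (cong (_*_ (P i)) (#-* (p ℕ.^ (d ∸ i)) n)))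
    #N-j : # N - # j ≡ P i * # k
    #N-j = trans (cong₂ _-_ #N (#-* (p ℕ.^ i) j′))
      (trans (l (P i) (P (d ∸ i) * # n) (# j′)) (cong (_*_ (P i)) (sym #k)))
      where
      l : ∀ a b c → a * b - a * c ≡ a * (b - c)
      l = solve-∀ ring
    scaled : # (N C j) * # k ≡ P (d ∸ i) * (# n * S)
    scaled = P-cancel-≡ i (begin
      P i * (# (N C j) * # k) ≡⟨ l (P i) (# (N C j)) (# k) ⟩
      # (N C j) * (P i * # k) ≡⟨ cong (_*_ (# (N C j))) #N-j ⟨
      # (N C j) * (# N - # j) ≡⟨ C-complement N {{N-nonZero d n}} j ⟩
      # N * S ≡⟨ cong (_* S) #N ⟩
      P i * (P (d ∸ i) * # n) * S ≡⟨ l′ (P i) (P (d ∸ i)) (# n) S ⟩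
      P i * (P (d ∸ i) * (# n * S)) ∎)
      where
      l : ∀ a b c → a * (b * c) ≡ b * (a * c)
      l = solve-∀ ring
      l′ : ∀ a b c d → a * (b * c) * d ≡ a * (b * (c * d))
      l′ = solve-∀ ring

  C≈0 : ∀ d n .{{_ : ℕ.NonZero n}} i j′ → i < d → ¬ p ∣ j′ → p ℕ.^ i ℕ.* j′ ≤ p ℕ.^ d ℕ.* n →
    # ((p ℕ.^ d ℕ.* n) C (p ℕ.^ i ℕ.* j′)) ≈[ d ∸ i ] 0#
  C≈0 d n i j′ i<d p∤j′ j≤N = ≈-trans (≡⇒≈ (proj₂ (proj₂ (proj₂ R))))
    (≈0-P* (d ∸ i) (nat n ⊗ (Int-σ j ⊗ Int-Π⁻ N {{N-nonZero d n}} j) ⊗ Int-ι (proj₁ R)))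
    where
    N = p ℕ.^ d ℕ.* n
    j = p ℕ.^ i ℕ.* j′
    R = C-valuation d n i j′ i<d p∤j′ j≤N

  module _ (r s t : ℕ) where

    F : ℕ → ℕ → K
    F N k = # (N C k) ^ r * # ((N ℕ.+ k) C k) ^ s * # ((2 ℕ.* k) C N) ^ t

    Int-F : ∀ N k → Int (F N k)
    Int-F N k = Int-^ (nat (N C k)) r ⊗ Int-^ (nat ((N ℕ.+ k) C k)) s ⊗ Int-^ (nat ((2 ℕ.* k) C N)) t

    -- The last factor in the summands of 𝒜, grouped by origin. The cubic corrections of the three
    -- coefficients are (N - j) N j, N (N + j) j and N · 2j · (2j - N); after the common factor N j
    -- is taken out, the last one keeps a factor 2.
    Λ : K → K → K
    Λ N j = # r * (N - j) + # s * (N + j) + # 2 * # t * (# 2 * j - N)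

    Int-Λ : ∀ {x y} → Int x → Int y → Int (Λ x y)
    Int-Λ ix iy = nat r ⊗ (ix ⊕ ⊝ iy) ⊕ nat s ⊗ (ix ⊕ iy) ⊕ nat 2 ⊗ nat t ⊗ (nat 2 ⊗ iy ⊕ ⊝ ix)

    correction : ℕ → ℕ → K
    correction N j = # 2 * ⅓ * θ * (p³ * (# N * (# j * Λ (# N) (# j))))

    F-ratio : ∀ {d i N j} → i ≤ d → p ℕ.^ d ∣ N → p ℕ.^ i ∣ j → j ≤ N →
      ∃ λ ψ → F (p ℕ.* N) (p ℕ.* j) ≡ F N j * ψ × ψ ≈[ precision d i ] 1# + correction N j
    F-ratio {d} {i} {N} {j} i≤d dN dj j≤N =
        x ^ r * y ^ s * z ^ t , exact , ψ≈
      where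
      R₁ = Π-ratio {d} {i} (N ∸ j) j dj (subst₂ (λ a b → p ℕ.^ a ∣ (N ∸ j) ℕ.* b) (ℕP.+-comm i d)
        (sym (ℕP.m∸n+n≡m j≤N)) (p^-*-∣ {i} {d}
        (p∣ {i} {j} dj (subst (p ℕ.^ i ∣_) (sym (ℕP.m+[n∸m]≡n j≤N)) (p^-mono i≤d dN))) dN))
      R₂ = Π-ratio {d} {i} N j dj (p^-*-∣ {d} {i} dN (∣m∣n⇒∣m+n (p^-mono i≤d dN) dj))
      R₃ = C-ratio {d} {i} {N} {j} i≤d dN dj
      x = proj₁ R₁
      x≡ = proj₁ (proj₂ R₁)
      x≈ = proj₂ (proj₂ R₁)
      y = proj₁ R₂
      y≡ = proj₁ (proj₂ R₂)
      y≈ = proj₂ (proj₂ R₂)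
      z = proj₁ R₃
      z≡ = proj₁ (proj₂ R₃)
      z≈ = proj₂ (proj₂ R₃)
      exact : F (p ℕ.* N) (p ℕ.* j) ≡ F N j * (x ^ r * y ^ s * z ^ t)
      exact = begin
        F (p ℕ.* N) (p ℕ.* j) ≡⟨ cong₂ _*_ (cong₂ (λ a b → a ^ r * b ^ s) first second) (cong (_^ t) z≡) ⟩
        (# (N C j) * x) ^ r * (# ((N ℕ.+ j) C j) * y) ^ s * (# ((2 ℕ.* j) C N) * z) ^ t
          ≡⟨ cong₂ _*_ (cong₂ _*_ (*-^ (# (N C j)) x r) (*-^ (# ((N ℕ.+ j) C j)) y s))
            (*-^ (# ((2 ℕ.* j) C N)) z t) ⟩
        # (N C j) ^ r * x ^ r * (# ((N ℕ.+ j) C j) ^ s * y ^ s) * (# ((2 ℕ.* j) C N) ^ t * z ^ t)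
          ≡⟨ lem (# (N C j) ^ r) (x ^ r) (# ((N ℕ.+ j) C j) ^ s) (y ^ s) (# ((2 ℕ.* j) C N) ^ t) (z ^ t) ⟩
        F N j * (x ^ r * y ^ s * z ^ t) ∎
        where
        open ≡-Reasoning
        lem : ∀ a a′ b b′ c c′ → a * a′ * (b * b′) * (c * c′) ≡ a * b * c * (a′ * b′ * c′)
        lem = solve-∀ ring
        first : # ((p ℕ.* N) C (p ℕ.* j)) ≡ # (N C j) * x
        first = trans (cong (λ k → # (k C (p ℕ.* j)))
          (trans (cong (p ℕ.*_) (sym (ℕP.m∸n+n≡m j≤N))) (ℕP.*-distribˡ-+ p (N ∸ j) j)))
          (trans (sym (Π-binomial (p ℕ.* (N ∸ j)) (p ℕ.* j)))
            (trans x≡ (cong (_* x) (trans (Π-binomial (N ∸ j) j) (cong (λ k → # (k C j)) (ℕP.m∸n+n≡m j≤N))))))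
        second : # ((p ℕ.* N ℕ.+ p ℕ.* j) C (p ℕ.* j)) ≡ # ((N ℕ.+ j) C j) * y
        second = trans (sym (Π-binomial (p ℕ.* N) (p ℕ.* j))) (trans y≡ (cong (_* y) (Π-binomial N j)))
      -- One less than the precision: each of the three corrections is divisible by p^E′, so their
      -- products drop out.
      E′ = suc (suc (d ℕ.+ i)) ℕ.+ suc i
      E≤ : precision d i ≤ E′ ℕ.+ E′
      E≤ = subst (_≤ E′ ℕ.+ E′) (sym (ℕP.+-suc (suc (suc (d ℕ.+ i))) (suc i))) (suc≤ (suc (d ℕ.+ i) ℕ.+ suc i))
      i≈ : ∀ {n} → p ℕ.^ d ∣ n → # n ≈[ i ] 0#
      i≈ h = ∣⇒≈0 {i} (p^-mono i≤d h)
      N≈0 : # N ≈[ d ] 0#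
      N≈0 = ∣⇒≈0 {d} dN
      j≈0 : # j ≈[ i ] 0#
      j≈0 = ∣⇒≈0 {i} dj
      sub≈0 : ∀ {x y} → x ≈[ i ] 0# → y ≈[ i ] 0# → x - y ≈[ i ] 0#
      sub≈0 hx hy = ≈-trans (+-≈ hx (neg-≈ hy)) (≡⇒≈ refl)
      2j≈0 : # (2 ℕ.* j) ≈[ i ] 0#
      2j≈0 = ∣⇒≈0 {i} (∣n⇒∣m*n 2 dj)
      δ≈0 : cubic (# (N ∸ j)) (# j) ≈[ E′ ] 0#
      δ≈0 = cubic≈0 {d} {i} {N ∸ j} (subst₂ (λ f a → # (N ∸ j) * a ≈[ f ] 0#) (ℕP.+-comm i d)
        (trans (cong #_ (sym (ℕP.m∸n+n≡m j≤N))) (#-+ (N ∸ j) j))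
        (*-≈0 (subst (_≈[ i ] 0#) (sym (#-∸ j≤N)) (sub≈0 (i≈ dN) j≈0)) N≈0)) j≈0
      ε≈0 : cubic (# N) (# j) ≈[ E′ ] 0#
      ε≈0 = cubic≈0 {d} {i} {N} (*-≈0 N≈0 (+-≈0 (i≈ dN) j≈0)) j≈0
      ζ≈0 : cubic (# N) (# (2 ℕ.* j) - # N) ≈[ E′ ] 0#
      ζ≈0 = cubic≈0 {d} {i} {N} (*-≈0 N≈0 (+-≈0 (i≈ dN) (sub≈0 2j≈0 (i≈ dN)))) (sub≈0 2j≈0 (i≈ dN))
      unit : ∀ {x δ} → δ ≈[ E′ ] 0# → x ≈[ precision d i ] 1# + δ → Int x
      unit hδ h = Int-≈ (Int-1 ⊕ Int-≈ Int-0 hδ) h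
      W = # 2 * ⅓ * θ * p³ * (# N * # j)
      cubic₁ : ∀ T q N j → # 2 * ⅓ * T * (q * ((N - j) * (N - j + j) * j)) ≡ # 2 * ⅓ * T * q * (N * j) * (N - j)
      cubic₁ = solve-∀ ring
      cubic₂ : ∀ T q N j → # 2 * ⅓ * T * (q * (N * (N + j) * j)) ≡ # 2 * ⅓ * T * q * (N * j) * (N + j)
      cubic₂ = solve-∀ ring
      cubic₃ : ∀ T q N j → # 2 * ⅓ * T * (q * (N * (N + (# 2 * j - N)) * (# 2 * j - N))) ≡ # 2 * ⅓ * T * q
        * (N * j) * (# 2 * (# 2 * j - N))
      cubic₃ = solve-∀ ring
      collect : ∀ r s t W a b c → 1# + (r * (W * a) + s * (W * b) + t * (W * (# 2 * c))) ≡ 1# + W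
        * (r * a + s * b + # 2 * t * c)
      collect = solve-∀ ring
      regroup : ∀ T q N j Λ → # 2 * ⅓ * T * q * (N * j) * Λ ≡ # 2 * ⅓ * T * (q * (N * (j * Λ)))
      regroup = solve-∀ ring
      total : 1# + (# r * cubic (# N - # j) (# j) + # s * cubic (# N) (# j) + # t * cubic (# N)
        (# 2 * # j - # N)) ≡ 1# + correction N j
      total = trans (cong (_+_ 1#) (cong₂ _+_
        (cong₂ (λ a b → # r * a + # s * b) (cubic₁ θ p³ (# N) (# j)) (cubic₂ θ p³ (# N) (# j)))
        (cong (_*_ (# t)) (cubic₃ θ p³ (# N) (# j)))))
        (trans (collect (# r) (# s) (# t) W (# N - # j) (# N + # j) (# 2 * # j - # N))
          (cong (_+_ 1#) (regroup θ p³ (# N) (# j) (Λ (# N) (# j)))))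
      ψ≈ : x ^ r * y ^ s * z ^ t ≈[ precision d i ] 1# + correction N j
      ψ≈ = ≈-trans (^-1+³ {e = E′} r s t (unit δ≈0 x≈) (unit ε≈0 y≈) (unit ζ≈0 z≈) δ≈0 ε≈0 ζ≈0 E≤ x≈ y≈ z≈)
        (≡⇒≈ (trans (cong₂ (λ a b → 1# + (# r * cubic a (# j) + # s * cubic (# N) (# j) + # t * cubic (# N)
          (b - # N))) (#-∸ j≤N) (#-* 2 j)) total))

  -- The balance of the powers of p: C(N,j) is divisible by p^(d-i), and two factors of it,
  -- available as r ≥ 2, supply exactly what the ratio lacks when p^i is the power dividing j.
  precision-total : ∀ {d i} → i ≤ d → (d ∸ i) ℕ.+ (d ∸ i) ℕ.+ precision d i ≡ 3 ℕ.* suc d ℕ.+ 1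
  precision-total {d} {i} i≤d = subst (λ d′ → (d ∸ i) ℕ.+ (d ∸ i) ℕ.+ precision d′ i ≡ 3 ℕ.* suc d′ ℕ.+ 1)
    (ℕP.m+[n∸m]≡n i≤d) (lem i (d ∸ i))
    where
    lem : ∀ i k → k ℕ.+ k ℕ.+ (suc (suc (i ℕ.+ k ℕ.+ i)) ℕ.+ suc (suc i)) ≡ 3 ℕ.* suc (i ℕ.+ k) ℕ.+ 1
    lem = solveℕ-∀

  P-3* : ∀ d → P (3 ℕ.* d) ≡ P d * P d * P d
  P-3* d = trans (P-+ d (d ℕ.+ (d ℕ.+ 0)))
    (trans (cong (_*_ (P d)) (trans (P-+ d (d ℕ.+ 0)) (cong (λ k → P d * P k) (ℕP.+-identityʳ d))))
    (sym (*-assoc (P d) (P d) (P d))))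

  -- Summing the corrections at the multiples of p

  module _ (r s t : ℕ) where

    private
      F′ = F r s t
      G′ = G r s t
      Λ′ = Λ r s t

    correction≈0 : ∀ N j → correction r s t N j ≈[ 1 ] 0#
    correction≈0 N j = ≈-by₁ (# 2 * ⅓ * θ * (# p * # p * X))
      (nat 2 ⊗ Int-⅓ ⊗ Int-θ ⊗ (nat p ⊗ nat p ⊗ (nat N ⊗ (nat j ⊗ Int-Λ r s t (nat N) (nat j)))))
      (∣⇒≈0 {1} (p^1∣ p∣p)) (lem (# p) (# 2 * ⅓ * θ) X)
      where
      X = # N * (# j * Λ′ (# N) (# j))
      lem : ∀ p c x → c * (p * p * p * x) - 0# ≡ c * (p * p * x) * (p - 0#)
      lem = solve-∀ ring

    F-p* : ∀ N j → j ≤ N → F′ (p ℕ.* N) (p ℕ.* j) ≈[ 1 ] F′ N j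
    F-p* N j j≤N = ≈-trans (≈-weaken (s≤s z≤n)
      (≈-trans (≡⇒≈ (proj₁ (proj₂ R))) (*ˡ-≈ (Int-F r s t N j) (proj₂ (proj₂ R)))))
      (≈-by₁ (F′ N j) (Int-F r s t N j) (correction≈0 N j) (lem (F′ N j) (correction r s t N j)))
      where
      R = F-ratio r s t {0} {0} z≤n (1∣ N) (1∣ j) j≤N
      lem : ∀ f c → f * (1# + c) - f ≡ f * (c - 0#)
      lem = solve-∀ ring

    F-p^* : ∀ d n u → u ≤ n → F′ (p ℕ.^ d ℕ.* n) (p ℕ.^ d ℕ.* u) ≈[ 1 ] F′ n u
    F-p^* zero    n u u≤n = ≡⇒≈ (cong₂ F′ (ℕP.*-identityˡ n) (ℕP.*-identityˡ u))
    F-p^* (suc d) n u u≤n = ≈-trans (≡⇒≈ (cong₂ F′ (ℕP.*-assoc p (p ℕ.^ d) n) (ℕP.*-assoc p (p ℕ.^ d) u)))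
      (≈-trans (F-p* (p ℕ.^ d ℕ.* n) (p ℕ.^ d ℕ.* u) (ℕP.*-monoʳ-≤ (p ℕ.^ d) u≤n)) (F-p^* d n u u≤n))

    G-p^* : ∀ d n .{{_ : ℕ.NonZero n}} c → G′ (p ℕ.^ d ℕ.* n) (p ℕ.^ d ℕ.* c) ≈[ 1 ] G′ n c
    G-p^* zero    n c = ≡⇒≈ (cong₂ G′ (ℕP.*-identityˡ n) (ℕP.*-identityˡ c))
    G-p^* (suc d) n c = ≈-trans (≡⇒≈ (cong₂ G′ (ℕP.*-assoc p (p ℕ.^ d) n)
      (trans (ℕP.*-assoc p (p ℕ.^ d) c) (sym (ℕP.+-identityʳ _)))))
      (≈-trans (G-block₁ r s t {p ℕ.^ d ℕ.* n} {{N-nonZero d n}} (p ℕ.^ d ℕ.* c) 0 (ℕP.<-≤-trans (s≤s z≤n) 5≤p))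
        (G-p^* d n c))

    G-even : ∀ N j → G′ N (2 ℕ.* j) ≡ Π one (- # N) j ^ r * # ((N ℕ.+ j) C j) ^ s * # ((2 ℕ.* j) C N) ^ t
    G-even N j = cong₂ (λ a b → a ^ r * b ^ s * # ((2 ℕ.* j) C N) ^ t) (Π-even (- # N) j)
      (trans (Π-even (# N) j) (Π-binomial N j))

    -- The summand of the sum common to all 𝒜, without its factor -1/3 (`κ-firstSum`).
    weighted : ℕ → ℕ → K
    weighted N j = F′ N j * (# N * (# j * Λ′ (# N) (# j)))

    Int-weighted : ∀ N j → Int (weighted N j)
    Int-weighted N j = Int-F r s t N j ⊗ (nat N ⊗ (nat j ⊗ Int-Λ r s t (nat N) (nat j)))

    -- N j Λ is homogeneous of degree three in (N, j), whence p^(3d); the factor F needs to be known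
    -- only modulo p.
    weighted-p^* : ∀ d n u → u ≤ n → weighted (p ℕ.^ d ℕ.* n) (p ℕ.^ d ℕ.* u) ≈[ 3 ℕ.* d ℕ.+ 1 ] P (3 ℕ.* d)
      * weighted n u
    weighted-p^* d n u u≤n = ≈-trans (≡⇒≈ exact)
      (scale (≈0-P (3 ℕ.* d)) (*ʳ-≈ (nat n ⊗ (nat u ⊗ Int-Λ r s t (nat n) (nat u))) (F-p^* d n u u≤n)))
      where
      q = P d
      N = p ℕ.^ d ℕ.* n
      j = p ℕ.^ d ℕ.* u
      homogeneous : ∀ r s t q n u → r * (q * n - q * u) + s * (q * n + q * u) + # 2 * t
        * (# 2 * (q * u) - q * n) ≡ q * (r * (n - u) + s * (n + u) + # 2 * t * (# 2 * u - n))
      homogeneous = solve-∀ ring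
      lem : ∀ f q n u l → f * (q * n * (q * u * (q * l))) ≡ q * q * q * (f * (n * (u * l)))
      lem = solve-∀ ring
      exact : weighted N j ≡ P (3 ℕ.* d) * (F′ N j * (# n * (# u * Λ′ (# n) (# u))))
      exact = trans (cong₂ (λ a b → F′ N j * (a * (b * Λ′ a b))) (#-* (p ℕ.^ d) n) (#-* (p ℕ.^ d) u))
        (trans (cong (λ l → F′ N j * (q * # n * (q * # u * l))) (homogeneous (# r) (# s) (# t) q (# n) (# u)))
        (trans (lem (F′ N j) q (# n) (# u) (Λ′ (# n) (# u)))
          (cong (_* (F′ N j * (# n * (# u * Λ′ (# n) (# u))))) (sym (P-3* d)))))

    -- The behaviour of the corrections away from the multiples of p^d. It holds with γ = `γ₂` for r
    -- = 2 and with γ = 0 for r ≥ 3, and so lets all r share the summation.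
    Off : ℕ → ℕ → K → Set
    Off d n γ = ∀ j → j < p ℕ.^ d ℕ.* n → ¬ p ℕ.^ d ∣ j →
      weighted (p ℕ.^ d ℕ.* n) j ≈[ 3 ℕ.* d ℕ.+ 1 ] P (3 ℕ.* d) * (γ * G′ (p ℕ.^ d ℕ.* n) (2 ℕ.* j))

    W : ℕ → K
    W N = sum N (λ j → G′ N (2 ℕ.* j))

    -- Subtracting p^(3d) γ G from every term removes those with p^d ∤ j. The remaining indices p^d
    -- u are compared with u at the bottom, so the full sum `W` at N enters with a plus sign and the
    -- one at n with a minus sign.
    sum-weighted : ∀ d n .{{_ : ℕ.NonZero n}} {γ} → Int γ → Off d n γ →
      sum (suc (p ℕ.^ d ℕ.* n)) (weighted (p ℕ.^ d ℕ.* n)) ≈[ 3 ℕ.* d ℕ.+ 1 ]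
      P (3 ℕ.* d) * (sum (suc n) (weighted n) + γ * (W (p ℕ.^ d ℕ.* n) - W n))
    sum-weighted d n {γ} iγ off = begin
      sum N f + f N ≡⟨ cong (_+ f N) split ⟩
      sum N (λ j → f j - g j) + sum N g + f N
        ≈⟨ +-≈ (+-≈ (sum-multiples (p ℕ.^ d) {{ℕP.m^n≢0 p d}} n (λ j → f j - g j) vanish) ≈-refl)
          (weighted-p^* d n n ℕP.≤-refl) ⟩
      sum n (λ u → f (p ℕ.^ d ℕ.* u) - g (p ℕ.^ d ℕ.* u)) + sum N g + Q * weighted n n
        ≈⟨ +-≈ (+-≈ (sum-≈ n (λ u u<n → +-≈ (weighted-p^* d n u (ℕP.<⇒≤ u<n)) (neg-≈ (g-p^* u)))) ≈-refl) ≈-refl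
          ⟩
      sum n (λ u → Q * weighted n u - Q * (γ * G′ n (2 ℕ.* u))) + sum N g + Q * weighted n n
        ≡⟨ cong₂ (λ a b → a + b + Q * weighted n n) first second ⟩
      Q * sum n (weighted n) - Q * (γ * W n) + Q * (γ * W N) + Q * weighted n n
        ≡⟨ lem Q (sum n (weighted n)) γ (W n) (W N) (weighted n n) ⟩
      Q * (sum (suc n) (weighted n) + γ * (W N - W n)) ∎
      where
      open ≈-Reasoning (3 ℕ.* d ℕ.+ 1)
      N = p ℕ.^ d ℕ.* n
      Q = P (3 ℕ.* d)
      f g : ℕ → K
      f = weighted N
      g j = Q * (γ * G′ N (2 ℕ.* j))
      lem : ∀ q a c w w′ b → q * a - q * (c * w) + q * (c * w′) + q * b ≡ q * (a + b + c * (w′ - w))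
      lem = solve-∀ ring
      lem₁ : ∀ a b → a ≡ a - b + b
      lem₁ = solve-∀ ring
      split : sum N f ≡ sum N (λ j → f j - g j) + sum N g
      split = trans (sum-ext N (λ j → lem₁ (f j) (g j))) (sum-+ N (λ j → f j - g j) g)
      vanish : ∀ j → j < N → ¬ p ℕ.^ d ∣ j → f j - g j ≈[ 3 ℕ.* d ℕ.+ 1 ] 0#
      vanish j j<N ∤j = ≈-by₁ 1# Int-1 (off j j<N ∤j) (l (f j) (g j))
        where
        l : ∀ a b → a - b - 0# ≡ 1# * (a - b)
        l = solve-∀ ring
      swap : ∀ q u → 2 ℕ.* (q ℕ.* u) ≡ q ℕ.* (2 ℕ.* u)
      swap = solveℕ-∀
      g-p^* : ∀ u → g (p ℕ.^ d ℕ.* u) ≈[ 3 ℕ.* d ℕ.+ 1 ] Q * (γ * G′ n (2 ℕ.* u))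
      g-p^* u = scale (≈0-P (3 ℕ.* d)) (*ˡ-≈ iγ
        (≈-trans (≡⇒≈ (cong (G′ N) (swap (p ℕ.^ d) u))) (G-p^* d n (2 ℕ.* u))))
      second : sum N g ≡ Q * (γ * W N)
      second = trans (sum-*ˡ N Q (λ j → γ * G′ N (2 ℕ.* j))) (cong (_*_ Q) (sum-*ˡ N γ (λ j → G′ N (2 ℕ.* j))))
      first : sum n (λ u → Q * weighted n u - Q * (γ * G′ n (2 ℕ.* u))) ≡ Q * sum n (weighted n) - Q * (γ * W n)
      first = trans (sum-+ n (λ u → Q * weighted n u) (λ u → - (Q * (γ * G′ n (2 ℕ.* u)))))
        (cong₂ _+_ (sum-*ˡ n Q (weighted n))
          (trans (sum-neg n (λ u → Q * (γ * G′ n (2 ℕ.* u))))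
          (cong (λ a → - a) (trans (sum-*ˡ n Q (λ u → γ * G′ n (2 ℕ.* u)))
          (cong (_*_ Q) (sum-*ˡ n γ (λ u → G′ n (2 ℕ.* u))))))))

  F-valuation : ∀ r s t {N j k} → # (N C j) ≈[ k ] 0# → F (suc (suc r)) s t N j ≈[ k ℕ.+ k ] 0#
  F-valuation r s t {N} {j} {k} h = ≈-trans
    (≡⇒≈ (lem (# (N C j)) (# (N C j) ^ r) (# ((N ℕ.+ j) C j) ^ s) (# ((2 ℕ.* j) C N) ^ t)))
    (*ʳ-≈0 (Int-^ (nat (N C j)) r ⊗ Int-^ (nat ((N ℕ.+ j) C j)) s ⊗ Int-^ (nat ((2 ℕ.* j) C N)) t) (*-≈0 h h))
    where
    lem : ∀ c d a b → c * (c * d) * a * b ≡ c * c * (d * a * b)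
    lem = solve-∀ ring

  module _ (r′ s t : ℕ) where

    private
      r = suc (suc r′)

    F-correction : ∀ d n .{{_ : ℕ.NonZero n}} j → j ≤ p ℕ.^ d ℕ.* n →
      let N = p ℕ.^ d ℕ.* n in
      F r s t (p ℕ.* N) (p ℕ.* j) ≈[ 3 ℕ.* suc d ℕ.+ 1 ] F r s t N j * (1# + correction r s t N j)
    -- If p^d divides j, the ratio has full precision and nothing is demanded of C(N, j): the
    -- exponent is d ∸ d = 0.
    F-correction d n j j≤N = [ (λ d∣j → go d ℕP.≤-refl d∣j
      (subst (λ k → # (N C j) ≈[ k ] 0#) (sym (ℕP.n∸n≡0 d)) (≈0-0 (nat (N C j))))) , other ]′ (valuation d j)
      where
      N = p ℕ.^ d ℕ.* n
      go : ∀ i → i ≤ d → p ℕ.^ i ∣ j → # (N C j) ≈[ d ∸ i ] 0# → F r s t (p ℕ.* N) (p ℕ.* j) ≈[ 3 ℕ.* suc d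
        ℕ.+ 1 ] F r s t N j * (1# + correction r s t N j)
      go i i≤d i∣j h = subst (λ e → F r s t (p ℕ.* N) (p ℕ.* j) ≈[ e ] F r s t N j
        * (1# + correction r s t N j)) (precision-total i≤d)
        (≈-trans (≡⇒≈ (proj₁ (proj₂ R))) (scale (F-valuation r′ s t {N} {j} h) (proj₂ (proj₂ R))))
        where R = F-ratio r s t {d} {i} i≤d (m∣m*n n) i∣j j≤N
      other : (∃[ i ] ∃[ j′ ] i < d × j ≡ p ℕ.^ i ℕ.* j′ × ¬ p ∣ j′) → F r s t (p ℕ.* N) (p ℕ.* j) ≈[ 3 ℕ.* suc
        d ℕ.+ 1 ] F r s t N j * (1# + correction r s t N j)
      other (i , j′ , i<d , eq , p∤j′) = go i (ℕP.<⇒≤ i<d) (subst (p ℕ.^ i ∣_) (sym eq) (m∣m*n j′))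
        (subst (λ k → # (N C k) ≈[ d ∸ i ] 0#) (sym eq) (C≈0 d n i j′ i<d p∤j′ (subst (_≤ N) eq j≤N)))

    multiples : ∀ d n .{{_ : ℕ.NonZero n}} {γ} → Int γ → Off r s t d n γ →
      let N = p ℕ.^ d ℕ.* n in
      sum (suc N) (λ j → F r s t (p ℕ.* N) (p ℕ.* j)) ≈[ 3 ℕ.* suc d ℕ.+ 1 ]
      sum (suc N) (F r s t N) + # 2 * ⅓ * θ
        * (P (3 ℕ.* suc d) * (sum (suc n) (weighted r s t n) + γ * (W r s t N - W r s t n)))
    multiples d n {γ} iγ off = begin
      sum (suc N) (λ j → F r s t (p ℕ.* N) (p ℕ.* j))
        ≈⟨ sum-≈ (suc N) (λ { j (s≤s j≤N) → F-correction d n j j≤N }) ⟩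
      sum (suc N) (λ j → F r s t N j * (1# + correction r s t N j))
        ≡⟨ trans (sum-ext (suc N) (λ j → lem (F r s t N j) (# 2 * ⅓ * θ) p³
          (# N * (# j * Λ r s t (# N) (# j)))))
          (trans (sum-+ (suc N) (F r s t N) (λ j → # 2 * ⅓ * θ * p³ * weighted r s t N j))
          (cong (_+_ (sum (suc N) (F r s t N))) (sum-*ˡ (suc N) (# 2 * ⅓ * θ * p³) (weighted r s t N)))) ⟩
      sum (suc N) (F r s t N) + # 2 * ⅓ * θ * p³ * sum (suc N) (weighted r s t N)
        ≈⟨ +-≈ ≈-refl (subst (λ e → # 2 * ⅓ * θ * p³ * sum (suc N) (weighted r s t N) ≈[ e ] # 2 * ⅓ * θ * p³
          * (P (3 ℕ.* d) * S)) (cong (ℕ._+ 1) (sym (ℕP.*-suc 3 d)))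
          (scale (*ˡ-≈0 (nat 2 ⊗ Int-⅓ ⊗ Int-θ) p³≈0) (sum-weighted r s t d n iγ off))) ⟩
      sum (suc N) (F r s t N) + # 2 * ⅓ * θ * p³ * (P (3 ℕ.* d) * S)
        ≡⟨ cong (_+_ (sum (suc N) (F r s t N)))
          (trans (lem′ (# 2 * ⅓ * θ) p³ (P (3 ℕ.* d)) S) (cong (λ a → # 2 * ⅓ * θ * (a * S)) (sym P-suc))) ⟩
      sum (suc N) (F r s t N) + # 2 * ⅓ * θ * (P (3 ℕ.* suc d) * S) ∎
      where
      open ≈-Reasoning (3 ℕ.* suc d ℕ.+ 1)
      N = p ℕ.^ d ℕ.* n
      S = sum (suc n) (weighted r s t n) + γ * (W r s t N - W r s t n)
      lem : ∀ f c q x → f * (1# + c * (q * x)) ≡ f + c * q * (f * x)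
      lem = solve-∀ ring
      lem′ : ∀ c q x y → c * q * (x * y) ≡ c * (q * x * y)
      lem′ = solve-∀ ring
      p≈ : # p ≈[ 1 ] 0#
      p≈ = ∣⇒≈0 {1} (p^1∣ p∣p)
      p³≈0 : p³ ≈[ 3 ] 0#
      p³≈0 = *-≈0 (*-≈0 p≈ p≈) p≈
      P-suc : P (3 ℕ.* suc d) ≡ p³ * P (3 ℕ.* d)
      P-suc = trans (cong P (ℕP.*-suc 3 d))
        (trans (P-+ 3 (3 ℕ.* d)) (cong (_* P (3 ℕ.* d))
        (trans (trans (#-* p (p ℕ.* (p ℕ.* 1)))
        (cong (_*_ (# p)) (trans (#-* p (p ℕ.* 1)) (cong (_*_ (# p)) (cong #_ (ℕP.*-identityʳ p))))))
        (sym (*-assoc (# p) (# p) (# p))))))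

    -- Off the multiples of p^d the powers of p in C(N,j)², N and j² always
    -- combine to p^(3d), whatever the valuation of j.
    weighted-off : ∀ d n .{{_ : ℕ.NonZero n}} i j′ → i < d → ¬ p ∣ j′ → p ℕ.^ i ℕ.* j′ ≤ p ℕ.^ d ℕ.* n →
      let N = p ℕ.^ d ℕ.* n ; j = p ℕ.^ i ℕ.* j′ in
      weighted r s t N j ≈[ 3 ℕ.* d ℕ.+ 1 ]
      P (3 ℕ.* d) * ((# s - # r + # 4 * # t) * # n * # n * # n * # (N C j) ^ r′
        * (Π one (- # N) j * Π one (- # N) j) * # ((N ℕ.+ j) C j) ^ s * # ((2 ℕ.* j) C N) ^ t)
    weighted-off d n i j′ i<d p∤j′ j≤N = ≈-trans (≡⇒≈ exact) (scale (≈0-P (3 ℕ.* d)) (≈-trans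
      (*ˡ-≈ (nat n ⊗ nat n ⊗ nat n ⊗ iX) ratio)
        (≡⇒≈ (lem₄ (# n) X (# s - # r + # 4 * # t) (# (N C j) ^ r′) π (# ((N ℕ.+ j) C j) ^ s)
        (# ((2 ℕ.* j) C N) ^ t) refl))))
      where
      N = p ℕ.^ d ℕ.* n
      j = p ℕ.^ i ℕ.* j′
      R = C-valuation d n i j′ i<d p∤j′ j≤N
      k = proj₁ R
      #k = proj₁ (proj₂ R)
      p∤k = proj₁ (proj₂ (proj₂ R))
      a = P (d ∸ i)
      b = P i
      π = Π one (- # N) j
      c = # n * (σ j * π) * ι k
      X = # (N C j) ^ r′ * (π * π) * # ((N ℕ.+ j) C j) ^ s * # ((2 ℕ.* j) C N) ^ t
      iπ : Int π
      iπ = Int-Π⁻ N {{N-nonZero d n}} j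
      iX : Int X
      iX = Int-^ (nat (N C j)) r′ ⊗ (iπ ⊗ iπ) ⊗ Int-^ (nat ((N ℕ.+ j) C j)) s ⊗ Int-^ (nat ((2 ℕ.* j) C N)) t
      Pd : P d ≡ a * b
      Pd = trans (cong P (sym (ℕP.m∸n+n≡m (ℕP.<⇒≤ i<d)))) (P-+ (d ∸ i) i)
      homogeneous : ∀ r s t q n u → r * (q * n - q * u) + s * (q * n + q * u) + # 2 * t
        * (# 2 * (q * u) - q * n) ≡ q * (r * (n - u) + s * (n + u) + # 2 * t * (# 2 * u - n))
      homogeneous = solve-∀ ring
      #N : # N ≡ b * (a * # n)
      #N = trans (#-* (p ℕ.^ d) n) (trans (cong (_* # n) Pd) (l a b (# n)))
        where
        l : ∀ a b n → a * b * n ≡ b * (a * n)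
        l = solve-∀ ring
      l = Λ r s t (a * # n) (# j′)
      lem₁ : ∀ a c D E T b n j l → a * c * (a * c * D) * E * T * (b * (a * n) * (b * j * (b * l))) ≡ (a * b)
        * (a * b) * (a * b) * (c * c * (D * E * T * n * (j * l)))
      lem₁ = solve-∀ ring
      lem₂ : ∀ n s π i D E T j l → n * (s * π) * i * (n * (s * π) * i) * (D * E * T * n * (j * l)) ≡ s * s
        * (n * n * n * (D * (π * π) * E * T) * (i * i * (j * l)))
      lem₂ = solve-∀ ring
      lem₄ : ∀ n X A D π E T → X ≡ D * (π * π) * E * T → n * n * n * X * A ≡ A * n * n * n * D * (π * π) * E * T
      lem₄ n X A D π E T refl = l′ n A D π E T
        where
        l′ : ∀ n A D π E T → n * n * n * (D * (π * π) * E * T) * A ≡ A * n * n * n * D * (π * π) * E * T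
        l′ = solve-∀ ring
      exact : weighted r s t N j ≡ P (3 ℕ.* d) * (# n * # n * # n * X * (ι k * ι k * (# j′ * l)))
      exact = begin
        # (N C j) ^ r * # ((N ℕ.+ j) C j) ^ s * # ((2 ℕ.* j) C N) ^ t * (# N * (# j * Λ r s t (# N) (# j)))
          ≡⟨ cong₂ (λ u v → u * (u * # (N C j) ^ r′) * # ((N ℕ.+ j) C j) ^ s * # ((2 ℕ.* j) C N) ^ t * v)
            (proj₂ (proj₂ (proj₂ R)))
               (trans (cong₂ (λ u v → u * (v * Λ r s t u v)) #N (#-* (p ℕ.^ i) j′))
                 (cong (λ v → b * (a * # n) * (b * # j′ * v))
                 (homogeneous (# r) (# s) (# t) b (a * # n) (# j′)))) ⟩
        a * c * (a * c * # (N C j) ^ r′) * # ((N ℕ.+ j) C j) ^ s * # ((2 ℕ.* j) C N) ^ t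
          * (b * (a * # n) * (b * # j′ * (b * l)))
          ≡⟨ lem₁ a c (# (N C j) ^ r′) (# ((N ℕ.+ j) C j) ^ s) (# ((2 ℕ.* j) C N) ^ t) b (# n) (# j′) l ⟩
        (a * b) * (a * b) * (a * b) * (c * c
          * (# (N C j) ^ r′ * # ((N ℕ.+ j) C j) ^ s * # ((2 ℕ.* j) C N) ^ t * # n * (# j′ * l)))
          ≡⟨ cong₂ _*_ (trans (cong (λ u → u * u * u) (sym Pd)) (sym (P-3* d)))
               (trans (lem₂ (# n) (σ j) π (ι k) (# (N C j) ^ r′) (# ((N ℕ.+ j) C j) ^ s) (# ((2 ℕ.* j) C N) ^ t)
                 (# j′) l)
               (trans (cong (_* (# n * # n * # n * X * (ι k * ι k * (# j′ * l)))) (σ² j)) (*-identityˡ _))) ⟩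
        P (3 ℕ.* d) * (# n * # n * # n * X * (ι k * ι k * (# j′ * l))) ∎
        where open ≡-Reasoning
      a≈0 : a ≈[ 1 ] 0#
      a≈0 = ≈-weaken (ℕP.m<n⇒0<n∸m i<d) (≈0-P (d ∸ i))
      -- Modulo p the argument a n of Λ vanishes and j′ ≡ -k. Hence j′ Λ ≡ (s - r + 4t) k², and the
      -- two factors ι k remove k².
      ratio : ι k * ι k * (# j′ * l) ≈[ 1 ] # s - # r + # 4 * # t
      ratio = ≈-by₁ Y (Int-ι k ⊗ Int-ι k ⊗ nat n
        ⊗ (nat r ⊗ nat k ⊕ nat s ⊗ (nat 2 ⊗ x ⊕ ⊝ nat k) ⊕ nat 2 ⊗ nat t ⊗ (x ⊕ ⊝ (nat 2 ⊗ nat k))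
        ⊕ ⊝ (nat 2 ⊗ nat s ⊗ nat k) ⊕ ⊝ (nat 2 ⊗ nat t ⊗ nat k))) a≈0
        (trans drop (trans (cong₂ (λ u v → ι k * ι k * (u * Λ r s t (a * # n) u) - (# s - # r + # 4 * # t)
          * (v * v)) #j′ (sym (ι-∤ p∤k)))
           (lem₅ (# r) (# s) (# t) a (# n) (# k) (ι k))))
        where
        x = nat (p ℕ.^ (d ∸ i)) ⊗ nat n
        Y = ι k * ι k * # n * (# r * # k + # s * (# 2 * (a * # n) - # k) + # 2 * # t * (a * # n - # 2 * # k)
          - # 2 * # s * # k - # 2 * # t * # k)
        drop : ι k * ι k * (# j′ * l) - (# s - # r + # 4 * # t) ≡ ι k * ι k * (# j′ * l)
          - (# s - # r + # 4 * # t) * (1# * 1#)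
        drop = cong (λ v → ι k * ι k * (# j′ * l) - v) (l₁ (# s - # r + # 4 * # t))
          where
          l₁ : ∀ a → a ≡ a * (1# * 1#)
          l₁ = solve-∀ ring
        #j′ : # j′ ≡ a * # n - # k
        #j′ = trans (l₂ (# j′) (a * # n)) (cong (_-_ (a * # n)) (sym #k))
          where
          l₂ : ∀ j x → j ≡ x - (x - j)
          l₂ = solve-∀ ring
        lem₅ : ∀ r s t a n k i → i * i * ((a * n - k)
          * (r * (a * n - (a * n - k)) + s * (a * n + (a * n - k)) + # 2 * t * (# 2 * (a * n - k) - a * n)))
          - (s - r + # 4 * t) * (k * i * (k * i))
             ≡ i * i * n * (r * k + s * (# 2 * (a * n) - k) + # 2 * t * (a * n - # 2 * k) - # 2 * s * k - # 2
               * t * k) * (a - 0#)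
        lem₅ = solve-∀ ring

  not-divisible : ∀ {d j} {A : Set} → ¬ p ℕ.^ d ∣ j → (∀ i j′ → i < d → j ≡ p ℕ.^ i ℕ.* j′ → ¬ p ∣ j′ → A) → A
  not-divisible {d} {j} ∤j f = [ (λ d∣j → ⊥-elim (∤j d∣j)) ,
    (λ { (i , j′ , i<d , eq , p∤j′) → f i j′ i<d eq p∤j′ }) ]′ (valuation d j)

  γ₂ : ℕ → ℕ → ℕ → K
  γ₂ s t n = (# s - # 2 + # 4 * # t) * # n * # n * # n

  Int-γ₂ : ∀ s t n → Int (γ₂ s t n)
  Int-γ₂ s t n = (nat s ⊕ ⊝ nat 2 ⊕ nat 4 ⊗ nat t) ⊗ nat n ⊗ nat n ⊗ nat n

  off-2 : ∀ s t d n .{{_ : ℕ.NonZero n}} → Off 2 s t d n (γ₂ s t n)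
  off-2 s t d n j j<N ∤j = not-divisible {d} ∤j λ { i j′ i<d refl p∤j′ →
    ≈-trans (weighted-off 0 s t d n i j′ i<d p∤j′ (ℕP.<⇒≤ j<N)) (≡⇒≈ (cong (_*_ (P (3 ℕ.* d)))
      (trans (lem (γ₂ s t n) (Π one (- # (p ℕ.^ d ℕ.* n)) j) (# ((p ℕ.^ d ℕ.* n ℕ.+ j) C j) ^ s)
        (# ((2 ℕ.* j) C (p ℕ.^ d ℕ.* n)) ^ t))
        (cong (_*_ (γ₂ s t n)) (sym (G-even 2 s t (p ℕ.^ d ℕ.* n) j)))))) }
    where
    lem : ∀ g π E T → g * 1# * (π * π) * E * T ≡ g * (π * (π * 1#) * E * T)
    lem = solve-∀ ring

  -- In `weighted-off` a factor C(N, j) is left over when r ≥ 3, and it is divisible by p because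
  -- p^d ∤ j.
  off-3 : ∀ r s t d n .{{_ : ℕ.NonZero n}} → Off (suc (suc (suc r))) s t d n 0#
  off-3 r s t d n j j<N ∤j = not-divisible {d} ∤j λ { i j′ i<d refl p∤j′ →
    ≈-trans (weighted-off (suc r) s t d n i j′ i<d p∤j′ (ℕP.<⇒≤ j<N)) (scale (≈0-P (3 ℕ.* d)) (≈-trans
      (≈-by₁ (X i j′) (iX i j′) (≈-weaken (ℕP.m<n⇒0<n∸m i<d) (C≈0 d n i j′ i<d p∤j′ (ℕP.<⇒≤ j<N)))
        (lem (# s - # suc (suc (suc r)) + # 4 * # t) (# n) (# (N C (p ℕ.^ i ℕ.* j′)))
          (# (N C (p ℕ.^ i ℕ.* j′)) ^ r) (Π one (- # N) (p ℕ.^ i ℕ.* j′))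
          (# ((N ℕ.+ p ℕ.^ i ℕ.* j′) C (p ℕ.^ i ℕ.* j′)) ^ s) (# ((2 ℕ.* (p ℕ.^ i ℕ.* j′)) C N) ^ t)))
      (≡⇒≈ (sym (zeroˡ (G (suc (suc (suc r))) s t N (2 ℕ.* j))))))) }
    where
    N = p ℕ.^ d ℕ.* n
    A = # s - # suc (suc (suc r)) + # 4 * # t
    X : ℕ → ℕ → K
    X i j′ = A * # n * # n * # n * # (N C k) ^ r * (Π one (- # N) k * Π one (- # N) k) * # ((N ℕ.+ k) C k) ^ s
      * # ((2 ℕ.* k) C N) ^ t
      where k = p ℕ.^ i ℕ.* j′
    iX : ∀ i j′ → Int (X i j′)
    iX i j′ = (nat s ⊕ ⊝ nat (suc (suc (suc r))) ⊕ nat 4 ⊗ nat t) ⊗ nat n ⊗ nat n ⊗ nat n ⊗ Int-^ (nat (N C k))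
      r ⊗ (Int-Π⁻ N {{N-nonZero d n}} k ⊗ Int-Π⁻ N {{N-nonZero d n}} k) ⊗ Int-^ (nat ((N ℕ.+ k) C k)) s ⊗ Int-^
      (nat ((2 ℕ.* k) C N)) t
      where k = p ℕ.^ i ℕ.* j′
    lem : ∀ A n c D π E T → A * n * n * n * (c * D) * (π * π) * E * T - 0# ≡ A * n * n * n * D * (π * π) * E * T
      * (c - 0#)
    lem = solve-∀ ring

  -- Descent through the powers of p

  Int-h₀ : ∀ c → Int (h₀ c)
  Int-h₀ c = nat 2 ⊗ (Int-ρ̂ c ⊗ Int-ι² c)

  Int-ℓ : ∀ c → Int (ℓ c)
  Int-ℓ c = nat 4 ⊗ Int-⅓ ⊕ Int-σ c ⊗ (Int-1 ⊕ nat 2 ⊗ nat c)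

  level-0 : ∀ c → level 0 c ≡ h₀ c
  level-0 c = trans (+-identityˡ _) (cong h₀ (trans (ℕP.+-identityʳ (1 ℕ.* c)) (ℕP.*-identityˡ c)))

  level-suc : ∀ i c → sum p (λ w → level i (p ℕ.* c ℕ.+ w)) ≡ level (suc i) c
  level-suc i c = begin
    sum p (λ w → sum q (λ j → h₀ (q ℕ.* (p ℕ.* c ℕ.+ w) ℕ.+ j)))
      ≡⟨ sum-ext p (λ w → sum-ext q (λ j → cong h₀ (lem p q c w j))) ⟩
    sum p (λ w → sum q (λ j → h₀ (p ℕ.* q ℕ.* c ℕ.+ (q ℕ.* w ℕ.+ j))))
      ≡⟨ sum-block q p (λ j → h₀ (p ℕ.* q ℕ.* c ℕ.+ j)) ⟨
    sum (q ℕ.* p) (λ j → h₀ (p ℕ.* q ℕ.* c ℕ.+ j))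
      ≡⟨ cong (λ n → sum n (λ j → h₀ (p ℕ.* q ℕ.* c ℕ.+ j))) (ℕP.*-comm q p) ⟩
    level (suc i) c ∎
    where
    open ≡-Reasoning
    q = p ℕ.^ i
    lem : ∀ p q c w j → q ℕ.* (p ℕ.* c ℕ.+ w) ℕ.+ j ≡ p ℕ.* q ℕ.* c ℕ.+ (q ℕ.* w ℕ.+ j)
    lem = solveℕ-∀

  level≈0 : ∀ i c → level i c ≈[ i ] 0#
  level≈0 zero    c = ≈0-0 (subst Int (sym (level-0 c)) (Int-h₀ c))
  level≈0 (suc i) c = ≈-trans (≈-weaken (ℕP.n≤1+n (suc i)) (level-≈ i c))
    (≈0-P* (suc i) (⊝ nat 2 ⊗ Int-θ ⊗ Int-ℓ c))

  module _ (r s t n : ℕ) .{{n-nonZero : ℕ.NonZero n}} where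

    N : ℕ → ℕ
    N e = p ℕ.^ e ℕ.* n

    g : ℕ → ℕ → K
    g e = G r s t (N e)

    Int-g : ∀ e c → Int (g e c)
    Int-g e = Int-G r s t (N e) {{N-nonZero e n}}

    N-suc : ∀ e → N (suc e) ≡ p ℕ.* N e
    N-suc e = ℕP.*-assoc p (p ℕ.^ e) n

    2N-suc : ∀ e → 2 ℕ.* N (suc e) ≡ p ℕ.* (2 ℕ.* N e)
    2N-suc e = trans (cong (2 ℕ.*_) (N-suc e)) (lem p (N e))
      where
      lem : ∀ p N → 2 ℕ.* (p ℕ.* N) ≡ p ℕ.* (2 ℕ.* N)
      lem = solveℕ-∀

    p^∣pN : ∀ e → p ℕ.^ suc e ∣ p ℕ.* N e
    p^∣pN e = subst (p ℕ.^ suc e ∣_) (N-suc e) (m∣m*n n)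

    sum-2N : ∀ e f → sum (2 ℕ.* N (suc e)) f ≡ sum (2 ℕ.* N e) (λ c → sum p (λ w → f (p ℕ.* c ℕ.+ w)))
    sum-2N e f = trans (cong (λ k → sum k f) (2N-suc e)) (sum-block p (2 ℕ.* N e) f)

    -- Modulo p the value of g at pc + w is that of the previous level at c, so only the block sums
    -- of the weight f matter.
    sum-blocks : ∀ e {f f′ : ℕ → K} → (∀ c → Int (f c)) → (∀ c → sum p (λ w → f (p ℕ.* c ℕ.+ w)) ≈[ 1 ] f′ c) →
      sum (2 ℕ.* N (suc e)) (λ c → f c * g (suc e) c) ≈[ 1 ] sum (2 ℕ.* N e) (λ c → f′ c * g e c)
    sum-blocks e {f} {f′} if h = begin
      sum (2 ℕ.* N (suc e)) (λ c → f c * g (suc e) c) ≡⟨ sum-2N e (λ c → f c * g (suc e) c) ⟩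
      sum (2 ℕ.* N e) (λ c → sum p (λ w → f (p ℕ.* c ℕ.+ w) * g (suc e) (p ℕ.* c ℕ.+ w)))
        ≈⟨ sum-≈ (2 ℕ.* N e) (λ c _ → sum-≈ p (λ w w<p → *ˡ-≈ (if (p ℕ.* c ℕ.+ w)) (g-block c w w<p))) ⟩
      sum (2 ℕ.* N e) (λ c → sum p (λ w → f (p ℕ.* c ℕ.+ w) * g e c))
        ≡⟨ sum-ext (2 ℕ.* N e) (λ c → sum-*ʳ p (g e c) (λ w → f (p ℕ.* c ℕ.+ w))) ⟩
      sum (2 ℕ.* N e) (λ c → sum p (λ w → f (p ℕ.* c ℕ.+ w)) * g e c)
        ≈⟨ sum-≈ (2 ℕ.* N e) (λ c _ → *ʳ-≈ (Int-g e c) (h c)) ⟩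
      sum (2 ℕ.* N e) (λ c → f′ c * g e c) ∎
      where
      open ≈-Reasoning 1
      g-block : ∀ c w → w < p → g (suc e) (p ℕ.* c ℕ.+ w) ≈[ 1 ] g e c
      g-block c w w<p = subst (λ k → G r s t k (p ℕ.* c ℕ.+ w) ≈[ 1 ] g e c) (sym (N-suc e))
        (G-block₁ r s t {N e} {{N-nonZero e n}} c w w<p)

    U R : ℕ → K
    U e = sum (2 ℕ.* N e) (g e)
    R e = sum (2 ℕ.* N e) (λ c → σ c * g e c)

    -- Every c is reached by p equal terms. With the weight σ, in contrast, a block adds up to σ c,
    -- so R keeps its value.
    U-suc : ∀ e → U (suc e) ≈[ 1 ] 0#
    U-suc e = begin
      U (suc e) ≡⟨ sum-ext (2 ℕ.* N (suc e)) (λ c → sym (*-identityˡ (g (suc e) c))) ⟩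
      sum (2 ℕ.* N (suc e)) (λ c → 1# * g (suc e) c)
        ≈⟨ sum-blocks e {λ _ → 1#} {λ _ → 0#} (λ _ → Int-1)
          (λ c → ≈-trans (≡⇒≈ (trans (sum-const p 1#) (lem (# p)))) (∣⇒≈0 {1} (p^1∣ p∣p))) ⟩
      sum (2 ℕ.* N e) (λ c → 0# * g e c) ≡⟨ trans (sum-*ˡ (2 ℕ.* N e) 0# (g e)) (zeroˡ _) ⟩
      0# ∎
      where
      open ≈-Reasoning 1
      lem : ∀ a → a * 1# ≡ a
      lem = solve-∀ ring

    R-suc : ∀ e → R (suc e) ≈[ 1 ] R e
    R-suc e = sum-blocks e {σ} {σ} Int-σ (λ c → ≡⇒≈
      (trans (sum-ext p (σ-block c)) (trans (sum-*ˡ p (σ c) σ)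
      (trans (cong (_*_ (σ c)) sum-σ-p) (trans (*-comm (σ c) 1#) (*-identityˡ (σ c)))))))

    R≈R₀ : ∀ e → R e ≈[ 1 ] R 0
    R≈R₀ zero    = ≈-refl
    R≈R₀ (suc e) = ≈-trans (R-suc e) (R≈R₀ e)

    Int-U : ∀ e → Int (U e)
    Int-U e = Int-sumAll (2 ℕ.* N e) (Int-g e)

    Int-R : ∀ e → Int (R e)
    Int-R e = Int-sumAll (2 ℕ.* N e) (λ c → Int-σ c ⊗ Int-g e c)

    -- e counts the powers of p still present in N, i those already summed out of the weight; a step
    -- of the descent leads from (e + 1, i) to (e, i + 1).
    S : ℕ → ℕ → K
    S e i = sum (2 ℕ.* N e) (λ c → level i c * g e c)

    Θ′ : ℕ → K
    Θ′ = Θ r s t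

    -- The expansion of g is known modulo p^(e+2) and the weight is divisible by p^i. The leading
    -- term sums to the next level, and the linear one needs only the block sums of the weight
    -- against Θ.
    S-step : ∀ e i {τ : ℕ → K} → (∀ c → sum p (λ w → level i (p ℕ.* c ℕ.+ w) * Θ′ (p ℕ.* c ℕ.+ w)) ≈[ suc i ] P
      i * τ c) →
      S (suc e) i ≈[ suc (suc (e ℕ.+ i)) ] S e (suc i) + P (suc (e ℕ.+ i))
        * (# n * sum (2 ℕ.* N e) (λ c → τ c * g e c))
    S-step e i {τ} h = begin
      S (suc e) i ≡⟨ sum-2N e (λ c → level i c * g (suc e) c) ⟩
      sum (2 ℕ.* N e) (λ c → sum p (λ w → level i (p ℕ.* c ℕ.+ w) * g (suc e) (p ℕ.* c ℕ.+ w)))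
        ≈⟨ sum-≈ (2 ℕ.* N e) (λ c _ → inner c) ⟩
      sum (2 ℕ.* N e) (λ c → level (suc i) c * g e c + P (suc (e ℕ.+ i)) * (# n * (τ c * g e c)))
        ≡⟨ trans (sum-+ (2 ℕ.* N e) (λ c → level (suc i) c * g e c)
          (λ c → P (suc (e ℕ.+ i)) * (# n * (τ c * g e c))))
          (cong (_+_ (S e (suc i))) (trans (sum-*ˡ (2 ℕ.* N e) (P (suc (e ℕ.+ i))) (λ c → # n * (τ c * g e c)))
          (cong (_*_ (P (suc (e ℕ.+ i)))) (sum-*ˡ (2 ℕ.* N e) (# n) (λ c → τ c * g e c))))) ⟩
      S e (suc i) + P (suc (e ℕ.+ i)) * (# n * sum (2 ℕ.* N e) (λ c → τ c * g e c)) ∎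
      where
      open ≈-Reasoning (suc (suc (e ℕ.+ i)))
      pN = # (p ℕ.* N e)
      pN≈0 : pN ≈[ suc e ] 0#
      pN≈0 = ∣⇒≈0 {suc e} (p^∣pN e)
      #pN : pN ≡ P (suc e) * # n
      #pN = trans (cong #_ (sym (N-suc e))) (#-* (p ℕ.^ suc e) n)
      lem₁ : ∀ l g x h → l * (g * (1# + x * h)) ≡ l * g + x * g * (l * h)
      lem₁ = solve-∀ ring
      lem₂ : ∀ a n g b t → a * n * g * (b * t) ≡ a * b * (n * (t * g))
      lem₂ = solve-∀ ring
      exponent : suc (suc (i ℕ.+ e)) ≡ suc (suc (e ℕ.+ i))
      exponent = cong (λ k → suc (suc k)) (ℕP.+-comm i e)
      term : ∀ c w → w < p → level i (p ℕ.* c ℕ.+ w) * g (suc e) (p ℕ.* c ℕ.+ w) ≈[ suc (suc (e ℕ.+ i)) ]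
             level i (p ℕ.* c ℕ.+ w) * g e c + pN * g e c * (level i (p ℕ.* c ℕ.+ w) * Θ′ (p ℕ.* c ℕ.+ w))
      term c w w<p = ≈-trans (subst₂ (λ E k → level i x * G r s t k x ≈[ E ] level i x
        * (g e c * (1# + pN * Θ′ x)))
          (trans (trans (ℕP.+-suc i (suc e)) (cong suc (ℕP.+-suc i e))) exponent) (sym (N-suc e))
          (scale (level≈0 i x) (G-block r s t {e} {N e} {{N-nonZero e n}} (p^∣pN e) c w w<p)))
        (≡⇒≈ (lem₁ (level i x) (g e c) pN (Θ′ x)))
        where x = p ℕ.* c ℕ.+ w
      inner : ∀ c → sum p (λ w → level i (p ℕ.* c ℕ.+ w) * g (suc e) (p ℕ.* c ℕ.+ w)) ≈[ suc (suc (e ℕ.+ i)) ]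
              level (suc i) c * g e c + P (suc (e ℕ.+ i)) * (# n * (τ c * g e c))
      inner c = begin
        sum p (λ w → level i (p ℕ.* c ℕ.+ w) * g (suc e) (p ℕ.* c ℕ.+ w)) ≈⟨ sum-≈ p (λ w w<p → term c w w<p) ⟩
        sum p (λ w → level i (p ℕ.* c ℕ.+ w) * g e c + pN * g e c
          * (level i (p ℕ.* c ℕ.+ w) * Θ′ (p ℕ.* c ℕ.+ w)))
          ≡⟨ trans (sum-+ p (λ w → level i (p ℕ.* c ℕ.+ w) * g e c)
            (λ w → pN * g e c * (level i (p ℕ.* c ℕ.+ w) * Θ′ (p ℕ.* c ℕ.+ w))))
            (cong₂ _+_ (trans (sum-*ʳ p (g e c) (λ w → level i (p ℕ.* c ℕ.+ w)))
            (cong (_* g e c) (level-suc i c)))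
            (sum-*ˡ p (pN * g e c) (λ w → level i (p ℕ.* c ℕ.+ w) * Θ′ (p ℕ.* c ℕ.+ w)))) ⟩
        level (suc i) c * g e c + pN * g e c * sum p (λ w → level i (p ℕ.* c ℕ.+ w) * Θ′ (p ℕ.* c ℕ.+ w))
          ≈⟨ +-≈ ≈-refl (subst (λ E → pN * g e c * sum p (λ w → level i (p ℕ.* c ℕ.+ w) * Θ′ (p ℕ.* c ℕ.+ w)) ≈[
            E ] pN * g e c * (P i * τ c)) (cong suc (ℕP.+-suc e i)) (scale (*ʳ-≈0 (Int-g e c) pN≈0) (h c))) ⟩
        level (suc i) c * g e c + pN * g e c * (P i * τ c)
          ≡⟨ cong (_+_ (level (suc i) c * g e c))
            (trans (cong (λ a → a * g e c * (P i * τ c)) #pN)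
            (trans (lem₂ (P (suc e)) (# n) (g e c) (P i) (τ c))
            (cong (_* (# n * (τ c * g e c))) (sym (P-+ (suc e) i))))) ⟩
        level (suc i) c * g e c + P (suc (e ℕ.+ i)) * (# n * (τ c * g e c)) ∎

    -- s - r comes with Ĥ and t with H; the block sums against H are four times those against Ĥ
    -- apart from the terms with σ c (-4 to -1 for h₀, 4/3 to 1/3 for ℓ). For r = 2 the same
    -- combination occurs in `γ₂`.
    α : K
    α = # s - # r + # 4 * # t

    τ₀ : ℕ → K
    τ₀ c = - α * θ + (# 2 * (# s - # r) + # t) * θ * σ c

    sum-Θ : ∀ (f : ℕ → K) (x : ℕ → ℕ) → sum p (λ w → f (x w) * Θ′ (x w)) ≡ (# s - # r) * sum p
      (λ w → f (x w) * Ĥ (x w)) + # t * sum p (λ w → f (x w) * H (x w))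
    sum-Θ f x = trans (sum-ext p (λ w → lem (f (x w)) (# s - # r) (Ĥ (x w)) (# t) (H (x w))))
      (trans (sum-+ p (λ w → (# s - # r) * (f (x w) * Ĥ (x w))) (λ w → # t * (f (x w) * H (x w))))
      (cong₂ _+_ (sum-*ˡ p (# s - # r) (λ w → f (x w) * Ĥ (x w))) (sum-*ˡ p (# t) (λ w → f (x w) * H (x w)))))
      where
      lem : ∀ f a h b h′ → f * (a * h + b * h′) ≡ a * (f * h) + b * (f * h′)
      lem = solve-∀ ring

    block-level-0 : ∀ c → sum p (λ w → level 0 (p ℕ.* c ℕ.+ w) * Θ′ (p ℕ.* c ℕ.+ w)) ≈[ 1 ] P 0 * τ₀ c
    block-level-0 c = begin
      sum p (λ w → level 0 (p ℕ.* c ℕ.+ w) * Θ′ (p ℕ.* c ℕ.+ w))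
        ≡⟨ trans (sum-ext p (λ w → cong (_* Θ′ (p ℕ.* c ℕ.+ w)) (level-0 (p ℕ.* c ℕ.+ w))))
          (sum-Θ h₀ (λ w → p ℕ.* c ℕ.+ w)) ⟩
      (# s - # r) * sum p (λ w → h₀ (p ℕ.* c ℕ.+ w) * Ĥ (p ℕ.* c ℕ.+ w)) + # t * sum p
        (λ w → h₀ (p ℕ.* c ℕ.+ w) * H (p ℕ.* c ℕ.+ w))
        ≈⟨ +-≈ (*ˡ-≈ (nat s ⊕ ⊝ nat r) (block-h₀Ĥ c)) (*ˡ-≈ (nat t) (block-h₀H c)) ⟩
      (# s - # r) * ((- 1# + # 2 * σ c) * θ) + # t * ((- # 4 + σ c) * θ) ≡⟨ lem (# s - # r) (# t) (σ c) θ ⟩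
      P 0 * τ₀ c ∎
      where
      open ≈-Reasoning 1
      lem : ∀ a t s x → a * ((- 1# + # 2 * s) * x) + t * ((- # 4 + s) * x) ≡ # 1
        * (- (a + # 4 * t) * x + (# 2 * a + t) * x * s)
      lem = solve-∀ ring

    τ₁ : K
    τ₁ = - (# 2 * ⅓ * α * θ)

    block-level-suc : ∀ i c → sum p (λ w → level (suc i) (p ℕ.* c ℕ.+ w) * Θ′ (p ℕ.* c ℕ.+ w)) ≈[ suc (suc i) ]
      P (suc i) * τ₁
    block-level-suc i c = begin
      sum p (λ w → level (suc i) (x w) * Θ′ (x w))
        ≈⟨ sum-≈ p (λ w _ → *ʳ-≈ (Int-Θ r s t (x w)) (level-≈ i (x w))) ⟩
      sum p (λ w → P (suc i) * (- # 2 * θ * ℓ (x w)) * Θ′ (x w))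
        ≡⟨ trans (sum-ext p (λ w → lem (P (suc i)) (- # 2 * θ) (ℓ (x w)) (Θ′ (x w))))
          (trans (sum-*ˡ p (P (suc i)) (λ w → - # 2 * θ * (ℓ (x w) * Θ′ (x w))))
          (cong (_*_ (P (suc i))) (trans (sum-*ˡ p (- # 2 * θ) (λ w → ℓ (x w) * Θ′ (x w)))
          (cong (_*_ (- # 2 * θ)) (sum-Θ ℓ x))))) ⟩
      P (suc i) * (- # 2 * θ * ((# s - # r) * sum p (λ w → ℓ (x w) * Ĥ (x w)) + # t * sum p
        (λ w → ℓ (x w) * H (x w))))
        ≈⟨ P*≈ i (*ˡ-≈ (⊝ nat 2 ⊗ Int-θ) (+-≈ (*ˡ-≈ (nat s ⊕ ⊝ nat r) (block-ℓĤ c))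
          (*ˡ-≈ (nat t) (block-ℓH c)))) ⟩
      P (suc i) * (- # 2 * θ * ((# s - # r) * ⅓ + # t * (# 4 * ⅓)))
        ≡⟨ cong (_*_ (P (suc i))) (lem′ θ (# s - # r) (# t)) ⟩
      P (suc i) * τ₁ ∎
      where
      open ≈-Reasoning (suc (suc i))
      x : ℕ → ℕ
      x w = p ℕ.* c ℕ.+ w
      lem : ∀ a b l t → a * (b * l) * t ≡ a * (b * (l * t))
      lem = solve-∀ ring
      lem′ : ∀ x a t → - # 2 * x * (a * ⅓ + t * (# 4 * ⅓)) ≡ - (# 2 * ⅓ * (a + # 4 * t) * x)
      lem′ = solve-∀ ring

    -- Of the corrections picked up on the way down only the last one survives,
    -- since U vanishes modulo p above the bottom level.
    S-descend : ∀ e i → S (suc e) (suc i) ≈[ suc (suc (e ℕ.+ suc i)) ] S 0 (suc (e ℕ.+ suc i)) + P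
      (suc (e ℕ.+ suc i)) * (# n * (τ₁ * U 0))
    S-descend zero    i = ≈-trans (S-step 0 (suc i) {λ _ → τ₁} (block-level-suc i))
      (≡⇒≈ (cong (λ a → S 0 (suc (suc i)) + P (suc (suc i)) * (# n * a)) (sum-*ˡ (2 ℕ.* N 0) τ₁ (g 0))))
    S-descend (suc e) i = begin
      S (suc (suc e)) (suc i) ≈⟨ S-step (suc e) (suc i) {λ _ → τ₁} (block-level-suc i) ⟩
      S (suc e) (suc (suc i)) + P m * (# n * sum (2 ℕ.* N (suc e)) (λ c → τ₁ * g (suc e) c))
        ≡⟨ cong (λ a → S (suc e) (suc (suc i)) + P m * (# n * a)) (sum-*ˡ (2 ℕ.* N (suc e)) τ₁ (g (suc e))) ⟩
      S (suc e) (suc (suc i)) + P m * (# n * (τ₁ * U (suc e))) ≈⟨ +-≈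
        (subst (λ k → S (suc e) (suc (suc i)) ≈[ suc (suc k) ] S 0 (suc k) + P (suc k) * (# n * (τ₁ * U 0)))
        (ℕP.+-suc e (suc i)) (S-descend e (suc i)))
            (P*≈ (suc e ℕ.+ suc i) (*ˡ-≈ (nat n)
              (*ˡ-≈ (⊝ (nat 2 ⊗ Int-⅓ ⊗ (nat s ⊕ ⊝ nat r ⊕ nat 4 ⊗ nat t) ⊗ Int-θ)) (U-suc e)))) ⟩
      S 0 m + P m * (# n * (τ₁ * U 0)) + P m * (# n * (τ₁ * 0#))
        ≡⟨ lem (S 0 m + P m * (# n * (τ₁ * U 0))) (P m) (# n) τ₁ ⟩
      S 0 m + P m * (# n * (τ₁ * U 0)) ∎
      where
      m = suc (suc e ℕ.+ suc i)
      open ≈-Reasoning (suc m)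
      lem : ∀ a b c d → a + b * (c * (d * 0#)) ≡ a
      lem = solve-∀ ring

    -- The term with U d - U 0 unites two cases. For d = 0 the first step already ends at the bottom
    -- and gives -α U 0. For d > 0 its U d vanishes modulo p, and the last step of the descent gives
    -- -(2/3) α U 0 instead.
    S-total : ∀ d → S (suc d) 0 ≈[ suc (suc d) ] S 0 (suc d) + P (suc d)
      * (# n * (θ * (- α * U 0 + (# 2 * (# s - # r) + # t) * R 0 - ⅓ * α * (U d - U 0))))
    S-total d = ≈-trans (subst (λ k → S (suc d) 0 ≈[ suc (suc k) ] S d 1 + P (suc k)
      * (# n * sum (2 ℕ.* N d) (λ c → τ₀ c * g d c))) (ℕP.+-identityʳ d) (S-step d 0 {τ₀} block-level-0))
      (≈-trans (≡⇒≈ (cong (λ a → S d 1 + P (suc d) * (# n * a)) sum-τ₀)) (rest d))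
      where
      B′ = # 2 * (# s - # r) + # t
      iA : Int α
      iA = nat s ⊕ ⊝ nat r ⊕ nat 4 ⊗ nat t
      iB : Int B′
      iB = nat 2 ⊗ (nat s ⊕ ⊝ nat r) ⊕ nat t
      sum-τ₀ : sum (2 ℕ.* N d) (λ c → τ₀ c * g d c) ≡ - α * θ * U d + B′ * θ * R d
      sum-τ₀ = trans (sum-ext (2 ℕ.* N d) (λ c → lem (- α * θ) (B′ * θ) (σ c) (g d c)))
        (trans (sum-+ (2 ℕ.* N d) (λ c → - α * θ * g d c) (λ c → B′ * θ * (σ c * g d c)))
        (cong₂ _+_ (sum-*ˡ (2 ℕ.* N d) (- α * θ) (g d)) (sum-*ˡ (2 ℕ.* N d) (B′ * θ) (λ c → σ c * g d c))))
        where
        lem : ∀ a b s g → (a + b * s) * g ≡ a * g + b * (s * g)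
        lem = solve-∀ ring
      rest : ∀ d → S d 1 + P (suc d) * (# n * (- α * θ * U d + B′ * θ * R d)) ≈[ suc (suc d) ] S 0 (suc d) + P
        (suc d) * (# n * (θ * (- α * U 0 + B′ * R 0 - ⅓ * α * (U d - U 0))))
      rest zero = ≡⇒≈ (cong (λ a → S 0 1 + P 1 * (# n * a)) (lem α θ (U 0) B′ (R 0)))
        where
        lem : ∀ a x u b v → - a * x * u + b * x * v ≡ x * (- a * u + b * v - ⅓ * a * (u - u))
        lem = solve-∀ ring
      rest (suc d) = begin
        S (suc d) 1 + P (suc (suc d)) * (# n * (- α * θ * U (suc d) + B′ * θ * R (suc d)))
          ≈⟨ +-≈ (subst (λ k → S (suc d) 1 ≈[ suc (suc k) ] S 0 (suc k) + P (suc k) * (# n * (τ₁ * U 0)))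
            (ℕP.+-comm d 1) (S-descend d 0)) (P*≈ (suc d)
            (*ˡ-≈ (nat n) (+-≈ (*ˡ-≈ (⊝ iA ⊗ Int-θ) (U-suc d)) (*ˡ-≈ (iB ⊗ Int-θ) (R≈R₀ (suc d)))))) ⟩
        S 0 (suc (suc d)) + P (suc (suc d)) * (# n * (τ₁ * U 0)) + P (suc (suc d))
          * (# n * (- α * θ * 0# + B′ * θ * R 0))
          ≡⟨ lem (S 0 (suc (suc d))) (P (suc (suc d))) (# n) α θ (U 0) B′ (R 0) ⟩
        S 0 (suc (suc d)) + P (suc (suc d)) * (# n * (θ * (- α * U 0 + B′ * R 0 - ⅓ * α * (0# - U 0))))
          ≈⟨ +-≈ ≈-refl (P*≈ (suc d) (*ˡ-≈ (nat n)
            (*ˡ-≈ Int-θ (+-≈ ≈-refl (neg-≈ (*ˡ-≈ (Int-⅓ ⊗ iA) (+-≈ (≈-sym (U-suc d)) ≈-refl))))))) ⟩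
        S 0 (suc (suc d)) + P (suc (suc d)) * (# n * (θ * (- α * U 0 + B′ * R 0 - ⅓ * α * (U (suc d) - U 0)))) ∎
        where
        open ≈-Reasoning (suc (suc (suc d)))
        lem : ∀ S P n α x u B v → S + P * (n * (- (# 2 * ⅓ * α * x) * u)) + P * (n * (- α * x * 0# + B * x * v))
          ≡ S + P * (n * (x * (- α * u + B * v - ⅓ * α * (0# - u))))
        lem = solve-∀ ring

    S-bottom : ∀ m → S 0 (suc m) ≈[ suc (suc m) ] P (suc m) * (- # 2 * θ * sum (2 ℕ.* N 0) (λ c → ℓ c * g 0 c))
    S-bottom m = ≈-trans (sum-≈ (2 ℕ.* N 0) (λ c _ → *ʳ-≈ (Int-g 0 c) (level-≈ m c)))
      (≡⇒≈ (trans (sum-ext (2 ℕ.* N 0) (λ c → lem (P (suc m)) (- # 2 * θ) (ℓ c) (g 0 c)))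
        (trans (sum-*ˡ (2 ℕ.* N 0) (P (suc m)) (λ c → - # 2 * θ * (ℓ c * g 0 c)))
        (cong (_*_ (P (suc m))) (sum-*ˡ (2 ℕ.* N 0) (- # 2 * θ) (λ c → ℓ c * g 0 c))))))
      where
      lem : ∀ a b l t → a * (b * l) * t ≡ a * (b * (l * t))
      lem = solve-∀ ring

  -- The summands prime to p

  -- cos(πc/2), sin(πc/2) and their sum (−1)^⌊c/2⌋.
  ν μ ε : ℕ → K
  ν zero    = 1#
  ν (suc c) = - μ c
  μ zero    = 0#
  μ (suc c) = ν c
  ε c = ν c + μ c

  Int-ν : ∀ c → Int (ν c)
  Int-μ : ∀ c → Int (μ c)
  Int-ν zero    = Int-1
  Int-ν (suc c) = ⊝ Int-μ c
  Int-μ zero    = Int-0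
  Int-μ (suc c) = Int-ν c

  Int-ε : ∀ c → Int (ε c)
  Int-ε c = Int-ν c ⊕ Int-μ c

  ν-+ : ∀ a b → ν (a ℕ.+ b) ≡ ν a * ν b - μ a * μ b
  μ-+ : ∀ a b → μ (a ℕ.+ b) ≡ μ a * ν b + ν a * μ b
  ν-+ zero    b = lem (ν b) (μ b)
    where
    lem : ∀ x y → x ≡ 1# * x - 0# * y
    lem = solve-∀ ring
  ν-+ (suc a) b = trans (cong (λ x → - x) (μ-+ a b)) (lem (ν a) (μ a) (ν b) (μ b))
    where
    lem : ∀ a a′ b b′ → - (a′ * b + a * b′) ≡ - a′ * b - a * b′
    lem = solve-∀ ring
  μ-+ zero    b = lem (ν b) (μ b)
    where
    lem : ∀ x y → y ≡ 0# * x + 1# * y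
    lem = solve-∀ ring
  μ-+ (suc a) b = trans (ν-+ a b) (lem (ν a) (μ a) (ν b) (μ b))
    where
    lem : ∀ a a′ b b′ → a * b - a′ * b′ ≡ a * b + - a′ * b′
    lem = solve-∀ ring

  ν²+μ² : ∀ c → ν c * ν c + μ c * μ c ≡ 1#
  ν²+μ² zero    = refl
  ν²+μ² (suc c) = trans (lem (ν c) (μ c)) (ν²+μ² c)
    where
    lem : ∀ a b → - b * - b + a * a ≡ a * a + b * b
    lem = solve-∀ ring

  ν-2* : ∀ k → ν (2 ℕ.* k) ≡ σ k
  μ-2* : ∀ k → μ (2 ℕ.* k) ≡ 0#
  ν-2* zero    = refl
  ν-2* (suc k) = trans (cong ν (2*suc k)) (cong (λ a → - a) (ν-2* k))
  μ-2* zero    = refl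
  μ-2* (suc k) = trans (cong μ (2*suc k)) (cong (λ a → - a) (μ-2* k))

  ν-p : ν p ≡ 0#
  ν-p = trans (cong ν p-odd) (cong (λ a → - a) (μ-2* M))

  μ-p² : μ p * μ p ≡ 1#
  μ-p² = trans (lem (μ p)) (trans (cong (λ a → a * a + μ p * μ p) (sym ν-p)) (ν²+μ² p))
    where
    lem : ∀ a → a * a ≡ 0# * 0# + a * a
    lem = solve-∀ ring

  -- For odd p, multiplication of the index by p preserves the cosine and multiplies the sine by
  -- sin(πp/2) = ±1. Keeping `μ p` as a factor avoids distinguishing p modulo 4.
  νμ-p* : ∀ c → ν (p ℕ.* c) ≡ ν c × μ (p ℕ.* c) ≡ μ p * μ c
  νμ-p* zero    = cong ν (ℕP.*-zeroʳ p) , trans (cong μ (ℕP.*-zeroʳ p)) (sym (zeroʳ (μ p)))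
  νμ-p* (suc c) =
    trans (cong ν (ℕP.*-suc p c)) (trans (ν-+ p (p ℕ.* c))
      (trans (cong₂ (λ a b → a * ν (p ℕ.* c) - μ p * b) ν-p (proj₂ (νμ-p* c)))
      (trans (lem (ν (p ℕ.* c)) (μ p) (μ c))
      (trans (cong (λ a → - (a * μ c)) μ-p²) (cong (λ a → - a) (*-identityˡ (μ c))))))) ,
    trans (cong μ (ℕP.*-suc p c)) (trans (μ-+ p (p ℕ.* c))
      (trans (cong₂ (λ a b → μ p * a + b * μ (p ℕ.* c)) (proj₁ (νμ-p* c)) ν-p)
      (lem′ (μ p * ν c) (μ (p ℕ.* c)))))
    where
    lem : ∀ a b c → 0# * a - b * (b * c) ≡ - (b * b * c)
    lem = solve-∀ ring
    lem′ : ∀ a b → a + 0# * b ≡ a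
    lem′ = solve-∀ ring

  ν-mirror : ∀ j k → j ℕ.+ k ≡ p → ν k ≡ μ p * μ j
  ν-mirror j k eq = begin
    ν k ≡⟨ *-identityˡ (ν k) ⟨
    1# * ν k ≡⟨ cong (_* ν k) (ν²+μ² j) ⟨
    (ν j * ν j + μ j * μ j) * ν k ≡⟨ lem (ν j) (μ j) (ν k) (μ k) ⟩
    ν j * (ν j * ν k - μ j * μ k) + (μ j * ν k + ν j * μ k) * μ j
      ≡⟨ cong₂ (λ a b → ν j * a + b * μ j) (trans (sym (ν-+ j k)) (trans (cong ν eq) ν-p))
        (trans (sym (μ-+ j k)) (cong μ eq)) ⟩
    ν j * 0# + μ p * μ j ≡⟨ lem′ (ν j) (μ p * μ j) ⟩
    μ p * μ j ∎
    where
    open ≡-Reasoning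
    lem : ∀ a b c d → (a * a + b * b) * c ≡ a * (a * c - b * d) + (b * c + a * d) * b
    lem = solve-∀ ring
    lem′ : ∀ a b → a * 0# + b ≡ b
    lem′ = solve-∀ ring

  ρ̂ν : ∀ c → ρ̂ c * ν c ≡ # 2 * ν c
  ρ̂ν c with parity c
  ... | k , inj₁ refl = trans (cong (λ s → (1# + s) * ν (2 ℕ.* k)) (σ-2* k)) (lem (ν (2 ℕ.* k)))
    where
    lem : ∀ a → (1# + 1#) * a ≡ # 2 * a
    lem = solve-∀ ring
  ... | k , inj₂ refl = trans (cong (λ a → ρ̂ (suc (2 ℕ.* k)) * - a) (μ-2* k))
    (trans (lem (ρ̂ (suc (2 ℕ.* k)))) (cong (λ a → # 2 * - a) (sym (μ-2* k))))
    where
    lem : ∀ a → a * - 0# ≡ # 2 * - 0#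
    lem = solve-∀ ring

  -- Equal to (-1)^k ι³ k at c = 2k, the 8 undoing the doubling, and 0 at odd c because ν vanishes
  -- there. It is the weight of the case r = 3 in the variable c.
  νι³ : ℕ → K
  νι³ c = # 8 * (ν c * ι³ c)

  Int-νι³ : ∀ c → Int (νι³ c)
  Int-νι³ c = nat 8 ⊗ (Int-ν c ⊗ Int-ι³ c)

  ι³-2* : ∀ k → # 8 * ι³ (2 ℕ.* k) ≡ ι³ k
  ι³-2* k = trans (lem (ι (2 ℕ.* k))) (cong (λ a → a * a * a) (ι-2* k))
    where
    lem : ∀ a → # 8 * (a * a * a) ≡ # 2 * a * (# 2 * a) * (# 2 * a)
    lem = solve-∀ ring

  νι³-2* : ∀ k → νι³ (2 ℕ.* k) ≡ σι³ k
  νι³-2* k = trans (lem (ν (2 ℕ.* k)) (ι³ (2 ℕ.* k))) (cong₂ _*_ (ν-2* k) (ι³-2* k))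
    where
    lem : ∀ a b → # 8 * (a * b) ≡ a * (# 8 * b)
    lem = solve-∀ ring

  ρ̂-νι³ : ∀ c x → ρ̂ c * (νι³ c * x) ≡ # 2 * (νι³ c * x)
  ρ̂-νι³ c x = trans (lem (ρ̂ c) (ν c) (ι³ c) x)
    (trans (cong (λ a → a * (# 8 * ι³ c * x)) (ρ̂ν c)) (lem′ (ν c) (ι³ c) x))
    where
    lem : ∀ a b c x → a * (# 8 * (b * c) * x) ≡ a * b * (# 8 * c * x)
    lem = solve-∀ ring
    lem′ : ∀ b c x → # 2 * b * (# 8 * c * x) ≡ # 2 * (# 8 * (b * c) * x)
    lem′ = solve-∀ ring

  σι³0 : σι³ 0 ≡ 0#
  σι³0 = trans (*-identityˡ _) (ι*0 {ι 0 * ι 0})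

  -- The even indices below p correspond to the lower half of the k, and σι³ is symmetric under
  -- reflection, so the sum is half of θ.
  sum-νι³ : sum p νι³ ≈[ 1 ] ½ * θ
  sum-νι³ = ≈-trans (≡⇒≈ half) (cancel p∤2 (≈-by₁ (- 1#) (⊝ Int-1) folded (lem θ Z)))
    where
    Z = sum (suc M) σι³
    lem : ∀ t z → # 2 * z - # 2 * (½ * t) ≡ - 1# * (t - (z + z))
    lem = solve-∀ ring
    lem₁ : ∀ a → a * 1# ≡ a
    lem₁ = solve-∀ ring
    lem₂ : ∀ a → a ≡ ½ * (# 2 * a)
    lem₂ = solve-∀ ring
    half : sum p νι³ ≡ Z
    half = trans (trans (lem₂ (sum p νι³))
      (cong (_*_ ½) (trans (sym (sum-*ˡ p (# 2) νι³))
      (trans (sum-ext p (λ c → sym (trans (cong (_*_ (ρ̂ c)) (sym (lem₁ (νι³ c))))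
      (trans (ρ̂-νι³ c 1#) (cong (_*_ (# 2)) (lem₁ (νι³ c)))))))
      (trans (cong (λ n → sum n (λ c → ρ̂ c * νι³ c)) p-odd) (sum-even-odd M νι³))))))
      (trans (sym (lem₂ (sum (suc M) (λ k → νι³ (2 ℕ.* k))))) (sum-ext (suc M) νι³-2*))
    lem₃ : ∀ M → suc M ℕ.+ M ≡ suc (2 ℕ.* M)
    lem₃ = solveℕ-∀
    lem₄ : ∀ a b → - a * - b ≡ a * b
    lem₄ = solve-∀ ring
    folded : θ ≈[ 1 ] Z + Z
    folded = sum-split-mirror {j = M} {k = M} {f = σι³} {g = σι³} σι³0 (trans (lem₃ M) (sym p-odd))
      (λ i l eq → ≈-trans (*-≈ (Int-ι³ (suc l)) (⊝ Int-σ (suc i)) (≡⇒≈ (σ-mirror σ-p (suc i) (suc l) eq))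
        (ι³-mirror p∣p (suc i) (suc l) eq)) (≡⇒≈ (lem₄ (σ (suc i)) (ι³ (suc i)))))

  -- Reflection in p exchanges ν and μ up to the sign `μ p` and reverses ι³, which leads back to
  -- `sum-νι³`.
  sum-μι³ : μ p * (# 8 * sum p (λ w → μ w * ι³ w)) ≈[ 1 ] - (½ * θ)
  sum-μι³ = ≈-by₂ 1# (- 1#) Int-1 (⊝ Int-1) mirrored sum-νι³
    (lem (μ p) (sum p (λ w → μ w * ι³ w)) (sum p νι³) (½ * θ))
    where
    lem : ∀ m y x t → m * (# 8 * y) - - t ≡ 1# * (x - - # 8 * m * y) + - 1# * (x - t)
    lem = solve-∀ ring
    lem′ : ∀ m u i → # 8 * (m * u * - i) ≡ - # 8 * m * (u * i)
    lem′ = solve-∀ ring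
    mirrored : sum p νι³ ≈[ 1 ] - # 8 * μ p * sum p (λ w → μ w * ι³ w)
    mirrored = ≈-trans (sum-mirror p {νι³} {λ w → - # 8 * μ p * (μ w * ι³ w)}
        (trans (cong (λ a → # 8 * (1# * a)) (ι*0 {ι 0 * ι 0})) refl)
          (trans (cong (λ a → - # 8 * μ p * (0# * a)) (ι*0 {ι 0 * ι 0}))
          (trans (cong (_*_ (- # 8 * μ p)) (zeroˡ 0#)) (zeroʳ (- # 8 * μ p))))
        (λ j k eq → ≈-trans (*ˡ-≈ (nat 8) (*-≈ (Int-ι³ (suc k)) (Int-μ p ⊗ Int-μ (suc j))
          (≡⇒≈ (ν-mirror (suc j) (suc k) eq)) (ι³-mirror p∣p (suc j) (suc k) eq)))
          (≡⇒≈ (lem′ (μ p) (μ (suc j)) (ι³ (suc j))))))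
      (≡⇒≈ (sum-*ˡ p (- # 8 * μ p) (λ w → μ w * ι³ w)))

  block-νι³ : ∀ c → sum p (λ w → νι³ (p ℕ.* c ℕ.+ w)) ≈[ 1 ] ½ * θ * ε c
  block-νι³ c = begin
    sum p (λ w → νι³ (p ℕ.* c ℕ.+ w))
      ≈⟨ sum-≈ p (λ w _ → *ˡ-≈ (nat 8) (*-≈ (Int-ι³ _) (Int-ν c ⊗ Int-ν w ⊕ ⊝ (Int-μ p ⊗ Int-μ c ⊗ Int-μ w))
        (≡⇒≈ (trans (ν-+ (p ℕ.* c) w) (cong₂ (λ a b → a * ν w - b * μ w) (proj₁ (νμ-p* c)) (proj₂ (νμ-p* c)))))
        (ι³-cong (ι-period c w)))) ⟩
    sum p (λ w → # 8 * ((ν c * ν w - μ p * μ c * μ w) * ι³ w))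
      ≡⟨ trans (sum-ext p (λ w → lem (ν c) (ν w) (μ p) (μ c) (μ w) (ι³ w)))
        (trans (sum-+ p (λ w → ν c * νι³ w) (λ w → - (# 8 * μ p * μ c) * (μ w * ι³ w)))
        (cong₂ _+_ (sum-*ˡ p (ν c) νι³) (sum-*ˡ p (- (# 8 * μ p * μ c)) (λ w → μ w * ι³ w)))) ⟩
    ν c * sum p νι³ + - (# 8 * μ p * μ c) * Y ≡⟨ cong (_+_ (ν c * sum p νι³)) (lem′ (μ p) (μ c) Y) ⟩
    ν c * sum p νι³ + - μ c * (μ p * (# 8 * Y)) ≈⟨ +-≈ (*ˡ-≈ (Int-ν c) sum-νι³) (*ˡ-≈ (⊝ Int-μ c) sum-μι³) ⟩
    ν c * (½ * θ) + - μ c * - (½ * θ) ≡⟨ lem″ (ν c) (μ c) (½ * θ) ⟩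
    ½ * θ * ε c ∎
    where
    open ≈-Reasoning 1
    Y = sum p (λ w → μ w * ι³ w)
    lem : ∀ a b m c d i → # 8 * ((a * b - m * c * d) * i) ≡ a * (# 8 * (b * i)) + - (# 8 * m * c) * (d * i)
    lem = solve-∀ ring
    lem′ : ∀ m c y → - (# 8 * m * c) * y ≡ - c * (m * (# 8 * y))
    lem′ = solve-∀ ring
    lem″ : ∀ a b x → a * x + - b * - x ≡ x * (a + b)
    lem″ = solve-∀ ring

  -- ε c = ν c - ν (c + 1), so the block telescopes to the same expression with p c and p (c + 1),
  -- where ν is unchanged by the factor p.
  block-ε : ∀ c → sum p (λ w → ε (p ℕ.* c ℕ.+ w)) ≡ ε c
  block-ε c = begin
    sum p (λ w → ε (a ℕ.+ w))
      ≡⟨ sum-ext p (λ w → trans (lem (ν (a ℕ.+ w)) (μ (a ℕ.+ w)))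
        (cong (λ k → - ν k - - ν (a ℕ.+ w)) (sym (ℕP.+-suc a w)))) ⟩
    sum p (λ w → T (suc w) - T w) ≡⟨ sum-telescope p T ⟩
    - ν (a ℕ.+ p) - - ν (a ℕ.+ 0)
      ≡⟨ cong₂ (λ x y → - x - - y) (trans (cong ν (trans (ℕP.+-comm a p) (sym (ℕP.*-suc p c))))
        (proj₁ (νμ-p* (suc c)))) (trans (cong ν (ℕP.+-identityʳ a)) (proj₁ (νμ-p* c))) ⟩
    - ν (suc c) - - ν c ≡⟨ lem (ν c) (μ c) ⟨
    ε c ∎
    where
    open ≡-Reasoning
    a = p ℕ.* c
    T : ℕ → K
    T w = - ν (a ℕ.+ w)
    lem : ∀ x y → x + y ≡ - - y - - x
    lem = solve-∀ ring

  χ-mirror : ∀ {m} → p ∣ m → ∀ j k → j ℕ.+ k ≡ m → χ k ≡ χ j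
  χ-mirror {m} d j k eq with p ∣? j
  ... | yes p∣j = trans (χ-∣ (∣m+n∣m⇒∣n (subst (p ∣_) (sym eq) d) p∣j)) (sym (zeroʳ (# j)))
  ... | no p∤j  = trans (ι-∤ (λ p∣k → p∤j (∣m+n∣m⇒∣n (subst (p ∣_) (trans (sym eq) (ℕP.+-comm j k)) d) p∣k)))
    (sym (#*recip′ p∤j))

  χ² : ∀ j → χ j * χ j ≡ χ j
  χ² j with p ∣? j
  ... | yes _  = trans (cong (λ a → a * a) (zeroʳ (# j))) (trans (zeroˡ 0#) (sym (zeroʳ (# j))))
  ... | no p∤j = trans (cong (λ a → a * a) (#*recip′ p∤j)) (sym (#*recip′ p∤j))

  χ-^ : ∀ j n → χ j ^ suc n ≡ χ j
  χ-^ j zero    = trans (*-comm (χ j) 1#) (*-identityˡ (χ j))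
  χ-^ j (suc n) = trans (cong (_*_ (χ j)) (χ-^ j n)) (χ² j)

  -- χ(k) = χ(N − k) = (N − k) ι(N − k), and N − k is absorbed by the binomial coefficient.
  χ-C : ∀ N .{{_ : ℕ.NonZero N}} → p ∣ N → ∀ k → k ≤ N → χ k * # (N C k) ≡ # N
    * (σ k * Π one (- # N) k * ι (N ∸ k))
  χ-C N p∣N k k≤N = begin
    χ k * # (N C k) ≡⟨ cong (_* # (N C k)) (χ-mirror p∣N (N ∸ k) k (ℕP.m∸n+n≡m k≤N)) ⟩
    # (N ∸ k) * ι (N ∸ k) * # (N C k) ≡⟨ lem (# (N ∸ k)) (ι (N ∸ k)) (# (N C k)) ⟩
    # (N C k) * # (N ∸ k) * ι (N ∸ k)
      ≡⟨ cong (_* ι (N ∸ k)) (trans (cong (_*_ (# (N C k))) (#-∸ k≤N)) (C-complement N k)) ⟩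
    # N * (σ k * Π one (- # N) k) * ι (N ∸ k) ≡⟨ *-assoc _ _ _ ⟩
    # N * (σ k * Π one (- # N) k * ι (N ∸ k)) ∎
    where
    open ≡-Reasoning
    lem : ∀ a b c → a * b * c ≡ c * a * b
    lem = solve-∀ ring

  -- χ is idempotent, so one indicator can be distributed over all the factors C(N, k), each of
  -- which then yields a factor N by `χ-C`.
  χ-F : ∀ r s t N .{{_ : ℕ.NonZero N}} → p ∣ N → ∀ k → k ≤ N →
    χ k * F (suc r) s t N k ≡ # N ^ suc r
      * ((σ k * Π one (- # N) k * ι (N ∸ k)) ^ suc r * (# ((N ℕ.+ k) C k) ^ s * # ((2 ℕ.* k) C N) ^ t))
  χ-F r s t N p∣N k k≤N = begin
    χ k * (# (N C k) ^ suc r * E * T) ≡⟨ lem (χ k) (# (N C k) ^ suc r) E T ⟩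
    χ k * # (N C k) ^ suc r * (E * T) ≡⟨ cong (λ a → a * # (N C k) ^ suc r * (E * T)) (sym (χ-^ k r)) ⟩
    χ k ^ suc r * # (N C k) ^ suc r * (E * T)
      ≡⟨ cong (_* (E * T)) (trans (sym (*-^ (χ k) (# (N C k)) (suc r)))
        (trans (cong (_^ suc r) (χ-C N p∣N k k≤N)) (*-^ (# N) X (suc r)))) ⟩
    # N ^ suc r * X ^ suc r * (E * T) ≡⟨ *-assoc _ _ _ ⟩
    # N ^ suc r * (X ^ suc r * (E * T)) ∎
    where
    open ≡-Reasoning
    E = # ((N ℕ.+ k) C k) ^ s
    T = # ((2 ℕ.* k) C N) ^ t
    X = σ k * Π one (- # N) k * ι (N ∸ k)
    lem : ∀ a b c d → a * (b * c * d) ≡ a * b * (c * d)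
    lem = solve-∀ ring

  χ-split : ∀ N′ (f : ℕ → K) → sum (p ℕ.* N′) f ≈[ e ] sum N′ (λ u → f (p ℕ.* u)) + sum (p ℕ.* N′)
    (λ k → χ k * f k)
  χ-split {e} N′ f = begin
    sum (p ℕ.* N′) f
      ≡⟨ trans (sum-ext (p ℕ.* N′) (λ k → lem (χ k) (f k)))
        (sum-+ (p ℕ.* N′) (λ k → (1# - χ k) * f k) (λ k → χ k * f k)) ⟩
    sum (p ℕ.* N′) (λ k → (1# - χ k) * f k) + sum (p ℕ.* N′) (λ k → χ k * f k)
      ≈⟨ +-≈ (sum-multiples p N′ (λ k → (1# - χ k) * f k)
        (λ k _ p∤k → ≡⇒≈ (trans (cong (λ a → (1# - a) * f k) (ι-∤ p∤k)) (lem′ (f k))))) ≈-refl ⟩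
    sum N′ (λ u → (1# - χ (p ℕ.* u)) * f (p ℕ.* u)) + sum (p ℕ.* N′) (λ k → χ k * f k)
      ≡⟨ cong (_+ sum (p ℕ.* N′) (λ k → χ k * f k))
        (sum-ext N′ (λ u → trans (cong (λ a → (1# - a) * f (p ℕ.* u)) (χ-∣ (m∣m*n u))) (lem″ (f (p ℕ.* u))))) ⟩
    sum N′ (λ u → f (p ℕ.* u)) + sum (p ℕ.* N′) (λ k → χ k * f k) ∎
    where
    open ≈-Reasoning e
    lem : ∀ c f → f ≡ (1# - c) * f + c * f
    lem = solve-∀ ring
    lem′ : ∀ f → (1# - 1#) * f ≡ 0#
    lem′ = solve-∀ ring
    lem″ : ∀ f → (1# - 0#) * f ≡ f
    lem″ = solve-∀ ring

  3+1≤4 : ∀ d → 3 ℕ.* suc d ℕ.+ 1 ≤ suc d ℕ.+ suc d ℕ.+ (suc d ℕ.+ suc d)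
  3+1≤4 d = subst (3 ℕ.* suc d ℕ.+ 1 ≤_) (lem d) (ℕP.m≤m+n (3 ℕ.* suc d ℕ.+ 1) d)
    where
    lem : ∀ d → 3 ℕ.* suc d ℕ.+ 1 ℕ.+ d ≡ suc d ℕ.+ suc d ℕ.+ (suc d ℕ.+ suc d)
    lem = solveℕ-∀

  -- Adding both kinds of summands, for r ≥ 4, r = 3 and r = 2

  module _ (s t n d : ℕ) .{{n-nonZero : ℕ.NonZero n}} where

    private
      m = suc d
      Nₘ = p ℕ.^ m ℕ.* n
      N′ = p ℕ.^ d ℕ.* n
      instance
        N≢0 : ℕ.NonZero Nₘ
        N≢0 = N-nonZero m n
      N≈0 : # Nₘ ≈[ m ] 0#
      N≈0 = ∣⇒≈0 {m} (m∣m*n n)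
      p∣Nₘ : p ∣ Nₘ
      p∣Nₘ = p∣p^ {d} (m∣m*n n)
      #N : # Nₘ ≡ P m * # n
      #N = #-* (p ℕ.^ m) n

    row : ℕ → K
    row r = sum (suc Nₘ) (F r s t Nₘ)

    row′ : ℕ → K
    row′ r = sum (suc N′) (F r s t N′)

    coprimePart : ℕ → K
    coprimePart r = sum Nₘ (λ k → χ k * F r s t Nₘ k)

    row-split : ∀ r {γ} → Int γ → Off (suc (suc r)) s t d n γ → row (suc (suc r)) ≈[ 3 ℕ.* m ℕ.+ 1 ]
      row′ (suc (suc r)) + # 2 * ⅓ * θ * (P (3 ℕ.* m)
        * (sum (suc n) (weighted (suc (suc r)) s t n) + γ * (W (suc (suc r)) s t N′ - W (suc (suc r)) s t n)))
        + coprimePart (suc (suc r))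
    row-split r₀ {γ} iγ off = begin
      row r ≡⟨ cong (λ k → sum (suc k) (F r s t k)) N≡ ⟩
      sum (p ℕ.* N′) (F r s t (p ℕ.* N′)) + F r s t (p ℕ.* N′) (p ℕ.* N′)
        ≈⟨ +-≈ (χ-split N′ (F r s t (p ℕ.* N′))) ≈-refl ⟩
      sum N′ (λ u → F r s t (p ℕ.* N′) (p ℕ.* u)) + sum (p ℕ.* N′) (λ k → χ k * F r s t (p ℕ.* N′) k) + F r s t
        (p ℕ.* N′) (p ℕ.* N′)
        -- The top index is a multiple of p outside the half-open range; here it rejoins the other
        -- multiples.
        ≡⟨ lem (sum N′ (λ u → F r s t (p ℕ.* N′) (p ℕ.* u))) (sum (p ℕ.* N′) (λ k → χ k * F r s t (p ℕ.* N′) k))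
          (F r s t (p ℕ.* N′) (p ℕ.* N′)) ⟩
      sum (suc N′) (λ u → F r s t (p ℕ.* N′) (p ℕ.* u)) + sum (p ℕ.* N′) (λ k → χ k * F r s t (p ℕ.* N′) k)
        ≈⟨ +-≈ (multiples r₀ s t d n iγ off) (≡⇒≈ (cong (λ k → sum k (λ j → χ j * F r s t k j)) (sym N≡))) ⟩
      row′ r + # 2 * ⅓ * θ * (P (3 ℕ.* m) * (sum (suc n) (weighted r s t n) + γ * (W r s t N′ - W r s t n)))
        + coprimePart r ∎
      where
      r = suc (suc r₀)
      open ≈-Reasoning (3 ℕ.* m ℕ.+ 1)
      N≡ : Nₘ ≡ p ℕ.* N′
      N≡ = ℕP.*-assoc p (p ℕ.^ d) n
      lem : ∀ a b c → a + b + c ≡ a + c + b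
      lem = solve-∀ ring

    private
      exponent₂ : m ℕ.+ m ℕ.+ suc m ≡ 3 ℕ.* m ℕ.+ 1
      exponent₂ = lem m
        where
        lem : ∀ m → m ℕ.+ m ℕ.+ suc m ≡ 3 ℕ.* m ℕ.+ 1
        lem = solveℕ-∀
      exponent₃ : m ℕ.+ m ℕ.+ m ℕ.+ 1 ≡ 3 ℕ.* m ℕ.+ 1
      exponent₃ = lem m
        where
        lem : ∀ m → m ℕ.+ m ℕ.+ m ℕ.+ 1 ≡ 3 ℕ.* m ℕ.+ 1
        lem = solveℕ-∀

    coprime-4 : ∀ r → coprimePart (suc (suc (suc (suc r)))) ≈[ 3 ℕ.* m ℕ.+ 1 ] 0#
    coprime-4 r = ≈-trans (sum-≈ Nₘ term) (≡⇒≈ (trans (sum-const Nₘ 0#) (zeroʳ (# Nₘ))))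
      where
      lem : ∀ a b c → a * (a * (a * (a * b))) * c ≡ a * a * (a * a) * (b * c)
      lem = solve-∀ ring
      term : ∀ k → k < Nₘ → χ k * F (suc (suc (suc (suc r)))) s t Nₘ k ≈[ 3 ℕ.* m ℕ.+ 1 ] 0#
      term k k<Nₘ = ≈-trans (≡⇒≈ (trans (χ-F (suc (suc (suc r))) s t Nₘ p∣Nₘ k (ℕP.<⇒≤ k<Nₘ))
        (lem (# Nₘ) (# Nₘ ^ r) X)))
        (≈-weaken (3+1≤4 d) (*ʳ-≈0 (Int-^ (nat Nₘ) r ⊗ iX) (*-≈0 (*-≈0 N≈0 N≈0) (*-≈0 N≈0 N≈0))))
        where
        X = (σ k * Π one (- # Nₘ) k * ι (Nₘ ∸ k)) ^ suc (suc (suc (suc r)))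
          * (# ((Nₘ ℕ.+ k) C k) ^ s * # ((2 ℕ.* k) C Nₘ) ^ t)
        iX : Int X
        iX = Int-^ (Int-σ k ⊗ Int-Π⁻ Nₘ k ⊗ Int-ι (Nₘ ∸ k)) (suc (suc (suc (suc r))))
          ⊗ (Int-^ (nat ((Nₘ ℕ.+ k) C k)) s ⊗ Int-^ (nat ((2 ℕ.* k) C Nₘ)) t)

    total-4 : ∀ r → row (suc (suc (suc (suc r)))) ≈[ 3 ℕ.* m ℕ.+ 1 ]
      row′ (suc (suc (suc (suc r)))) + P (3 ℕ.* m)
        * (θ * (# 2 * ⅓ * sum (suc n) (weighted (suc (suc (suc (suc r)))) s t n)))
    total-4 r = ≈-trans (row-split (suc (suc r)) Int-0 (off-3 (suc r) s t d n))
      (≈-trans (+-≈ ≈-refl (coprime-4 r)) (≡⇒≈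
        (lem (row′ (suc (suc (suc (suc r))))) θ (P (3 ℕ.* m))
        (sum (suc n) (weighted (suc (suc (suc (suc r)))) s t n))
        (W (suc (suc (suc (suc r)))) s t N′ - W (suc (suc (suc (suc r)))) s t n))))
      where
      lem : ∀ a x q w v → a + # 2 * ⅓ * x * (q * (w + 0# * v)) + 0# ≡ a + q * (x * (# 2 * ⅓ * w))
      lem = solve-∀ ring

    εG : K
    εG = sum (2 ℕ.* (p ℕ.^ 0 ℕ.* n)) (λ c → ε c * g 3 s t n 0 c)

    ε-descend : ∀ e → sum (2 ℕ.* (p ℕ.^ e ℕ.* n)) (λ c → ε c * g 3 s t n e c) ≈[ 1 ] εG
    ε-descend zero    = ≈-refl
    ε-descend (suc e) = ≈-trans (sum-blocks 3 s t n e {ε} {ε} Int-ε (λ c → ≡⇒≈ (block-ε c))) (ε-descend e)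

    -- The minus sign comes from ι³ (N - k) ≡ -ι³ k. N³ already supplies p^(3m), so the sum is
    -- needed modulo p only; there ε replaces the weight after one block step and reproduces itself
    -- down to the bottom.
    coprime-3 : coprimePart 3 ≈[ 3 ℕ.* m ℕ.+ 1 ] P (3 ℕ.* m) * (θ * (- ½ * (# n * # n * # n * εG)))
    coprime-3 = begin
      coprimePart 3 ≈⟨ sum-≈ Nₘ term ⟩
      sum Nₘ (λ k → # Nₘ * # Nₘ * # Nₘ * (- 1# * (σι³ k * G 3 s t Nₘ (2 ℕ.* k))))
        ≡⟨ trans (sum-*ˡ Nₘ (# Nₘ * # Nₘ * # Nₘ) (λ k → - 1# * (σι³ k * G 3 s t Nₘ (2 ℕ.* k))))
          (cong (_*_ (# Nₘ * # Nₘ * # Nₘ)) (trans (sum-*ˡ Nₘ (- 1#) (λ k → σι³ k * G 3 s t Nₘ (2 ℕ.* k)))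
          (cong (_*_ (- 1#)) paired))) ⟩
      # Nₘ * # Nₘ * # Nₘ * (- 1# * sum (2 ℕ.* Nₘ) (λ c → νι³ c * G 3 s t Nₘ c))
        ≈⟨ N³* (*ˡ-≈ (⊝ Int-1) weights) ⟩
      # Nₘ * # Nₘ * # Nₘ * (- 1# * (½ * θ * εG))
        ≡⟨ trans (cong (λ a → a * a * a * (- 1# * (½ * θ * εG))) #N)
          (trans (lem′ (P m) (# n) θ εG) (cong (_* (θ * (- ½ * (# n * # n * # n * εG)))) (sym (P-3* m)))) ⟩
      P (3 ℕ.* m) * (θ * (- ½ * (# n * # n * # n * εG))) ∎
      where
      open ≈-Reasoning (3 ℕ.* m ℕ.+ 1)
      N³* : ∀ {x y} → x ≈[ 1 ] y → # Nₘ * # Nₘ * # Nₘ * x ≈[ 3 ℕ.* m ℕ.+ 1 ] # Nₘ * # Nₘ * # Nₘ * y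
      N³* {x} {y} h = subst (λ e → # Nₘ * # Nₘ * # Nₘ * x ≈[ e ] # Nₘ * # Nₘ * # Nₘ * y) exponent₃
        (scale (*-≈0 (*-≈0 N≈0 N≈0) N≈0) h)
      lem′ : ∀ q n x y → q * n * (q * n) * (q * n) * (- 1# * (½ * x * y)) ≡ q * q * q
        * (x * (- ½ * (n * n * n * y)))
      lem′ = solve-∀ ring
      lem : ∀ s π i E T → s * π * i * (s * π * i * (s * π * i * 1#)) * (E * T) ≡ s * s
        * (s * (i * i * i) * (π * (π * (π * 1#)) * E * T))
      lem = solve-∀ ring
      lem₁ : ∀ n x → n * (n * (n * 1#)) * x ≡ n * n * n * x
      lem₁ = solve-∀ ring
      lem₂ : ∀ s i g → s * - i * g ≡ - 1# * (s * i * g)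
      lem₂ = solve-∀ ring
      term : ∀ k → k < Nₘ → χ k * F 3 s t Nₘ k ≈[ 3 ℕ.* m ℕ.+ 1 ] # Nₘ * # Nₘ * # Nₘ
        * (- 1# * (σι³ k * G 3 s t Nₘ (2 ℕ.* k)))
      term k k<Nₘ = ≈-trans (≡⇒≈ (trans (χ-F 2 s t Nₘ p∣Nₘ k (ℕP.<⇒≤ k<Nₘ))
        (trans (lem₁ (# Nₘ) _) (cong (_*_ (# Nₘ * # Nₘ * # Nₘ))
          (trans (lem (σ k) (Π one (- # Nₘ) k) (ι (Nₘ ∸ k)) (# ((Nₘ ℕ.+ k) C k) ^ s) (# ((2 ℕ.* k) C Nₘ) ^ t))
          (trans (cong₂ (λ a b → a * (σ k * ι³ (Nₘ ∸ k) * b)) (σ² k) (sym (G-even 3 s t Nₘ k)))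
            (*-identityˡ _)))))))
        (N³* (≈-trans (*ʳ-≈ (Int-G 3 s t Nₘ (2 ℕ.* k))
          (*ˡ-≈ (Int-σ k) (ι³-mirror p∣Nₘ k (Nₘ ∸ k) (ℕP.m+[n∸m]≡n (ℕP.<⇒≤ k<Nₘ)))))
          (≡⇒≈ (lem₂ (σ k) (ι³ k) (G 3 s t Nₘ (2 ℕ.* k))))))
      paired : sum Nₘ (λ k → σι³ k * G 3 s t Nₘ (2 ℕ.* k)) ≡ sum (2 ℕ.* Nₘ) (λ c → νι³ c * G 3 s t Nₘ c)
      paired = trans (sum-ext Nₘ (λ k → cong (_* G 3 s t Nₘ (2 ℕ.* k)) (sym (νι³-2* k))))
          (trans (l (sum Nₘ (λ k → νι³ (2 ℕ.* k) * G 3 s t Nₘ (2 ℕ.* k))))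
            (trans (cong (_*_ ½) (trans (sym (sum-even Nₘ (λ c → νι³ c * G 3 s t Nₘ c)))
            (trans (sum-ext (2 ℕ.* Nₘ) (λ c → ρ̂-νι³ c (G 3 s t Nₘ c)))
            (sum-*ˡ (2 ℕ.* Nₘ) (# 2) (λ c → νι³ c * G 3 s t Nₘ c)))))
            (sym (l (sum (2 ℕ.* Nₘ) (λ c → νι³ c * G 3 s t Nₘ c))))))
        where
        l : ∀ a → a ≡ ½ * (# 2 * a)
        l = solve-∀ ring
      weights : sum (2 ℕ.* Nₘ) (λ c → νι³ c * G 3 s t Nₘ c) ≈[ 1 ] ½ * θ * εG
      weights = ≈-trans (sum-blocks 3 s t n d {νι³} {λ c → ½ * θ * ε c} Int-νι³ block-νι³)
        (≈-trans (≡⇒≈ (trans (sum-ext (2 ℕ.* N′) (λ c → *-assoc (½ * θ) (ε c) (g 3 s t n d c)))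
          (sum-*ˡ (2 ℕ.* N′) (½ * θ) (λ c → ε c * g 3 s t n d c)))) (*ˡ-≈ (Int-½ ⊗ Int-θ) (ε-descend d)))

    total-3 : row 3 ≈[ 3 ℕ.* m ℕ.+ 1 ] row′ 3 + P (3 ℕ.* m)
      * (θ * (# 2 * ⅓ * sum (suc n) (weighted 3 s t n) + - ½ * (# n * # n * # n * εG)))
    total-3 = ≈-trans (row-split 1 Int-0 (off-3 0 s t d n)) (≈-trans (+-≈ ≈-refl coprime-3)
      (≡⇒≈ (lem (row′ 3) θ (P (3 ℕ.* m)) (sum (suc n) (weighted 3 s t n)) (W 3 s t N′ - W 3 s t n)
        (- ½ * (# n * # n * # n * εG)))))
      where
      lem : ∀ a x q w v y → a + # 2 * ⅓ * x * (q * (w + 0# * v)) + q * (x * y) ≡ a + q * (x * (# 2 * ⅓ * w + y))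
      lem = solve-∀ ring

    private
      A₂ B₂ U₀ R₀ ℓG : K
      A₂ = α 2 s t n
      B₂ = # 2 * (# s - # 2) + # t
      U₀ = U 2 s t n 0
      R₀ = R 2 s t n 0
      ℓG = sum (2 ℕ.* (p ℕ.^ 0 ℕ.* n)) (λ c → ℓ c * g 2 s t n 0 c)
      Uₐ = U 2 s t n d

    -- The summand with ℓG is the bottom of the descent, the terms with A₂ and B₂ are its
    -- first-order corrections, and 8 R₀ comes from the linear term of ι² (N - k).
    V : K
    V = - # 2 * ℓG + # n * (- A₂ * U₀ + B₂ * R₀ - ⅓ * A₂ * (Uₐ - U₀) + # 8 * R₀)

    cubes : sum (2 ℕ.* Nₘ) (λ c → # 8 * (ρ̂ c * ι³ c) * G 2 s t Nₘ c) ≈[ 1 ] # 8 * θ * R₀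
    cubes = ≈-trans (sum-blocks 2 s t n d {λ c → # 8 * (ρ̂ c * ι³ c)} {λ c → # 8 * (σ c * θ)}
      (λ c → nat 8 ⊗ (Int-ρ̂ c ⊗ Int-ι³ c)) block-ι³)
      (≈-trans (≡⇒≈ (trans (sum-ext (2 ℕ.* N′) (λ c → lem (σ c) θ (g 2 s t n d c)))
        (sum-*ˡ (2 ℕ.* N′) (# 8 * θ) (λ c → σ c * g 2 s t n d c)))) (*ˡ-≈ (nat 8 ⊗ Int-θ) (R≈R₀ 2 s t n d)))
      where
      lem : ∀ s x g → # 8 * (s * x) * g ≡ # 8 * x * (s * g)
      lem = solve-∀ ring

    squares : S 2 s t n m 0 + # Nₘ * sum (2 ℕ.* Nₘ) (λ c → # 8 * (ρ̂ c * ι³ c) * G 2 s t Nₘ c) ≈[ suc m ] P m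
      * (θ * V)
    squares = begin
      S 2 s t n m 0 + # Nₘ * sum (2 ℕ.* Nₘ) (λ c → # 8 * (ρ̂ c * ι³ c) * G 2 s t Nₘ c)
        ≈⟨ +-≈ (≈-trans (S-total 2 s t n d) (+-≈ (S-bottom 2 s t n d) ≈-refl))
          (subst (λ e → # Nₘ * sum (2 ℕ.* Nₘ) (λ c → # 8 * (ρ̂ c * ι³ c) * G 2 s t Nₘ c) ≈[ e ] # Nₘ
          * (# 8 * θ * R₀)) (ℕP.+-comm m 1) (scale N≈0 cubes)) ⟩
      P m * (- # 2 * θ * ℓG) + P m * (# n * (θ * (- A₂ * U₀ + B₂ * R₀ - ⅓ * A₂ * (Uₐ - U₀)))) + # Nₘ
        * (# 8 * θ * R₀)
        ≡⟨ trans (cong (λ a → P m * (- # 2 * θ * ℓG) + P m * (# n * (θ * Y)) + a * (# 8 * θ * R₀)) #N)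
          (lem (P m) θ ℓG (# n) Y R₀) ⟩
      P m * (θ * V) ∎
      where
      open ≈-Reasoning (suc m)
      Y = - A₂ * U₀ + B₂ * R₀ - ⅓ * A₂ * (Uₐ - U₀)
      lem : ∀ q x l n y r → q * (- # 2 * x * l) + q * (n * (x * y)) + q * n * (# 8 * x * r) ≡ q
        * (x * (- # 2 * l + n * (y + # 8 * r)))
      lem = solve-∀ ring

    -- N² supplies p^(2m), and the remaining sum must be known modulo p^(m+1). Reflection turns ι²
    -- (N - k) into ι² k + 2N ι³ k; the first part is the descent `S`, the second needs `cubes`
    -- modulo p only.
    coprime-2 : coprimePart 2 ≈[ 3 ℕ.* m ℕ.+ 1 ] P (3 ℕ.* m) * (# n * # n * (θ * V))
    coprime-2 = begin
      coprimePart 2 ≈⟨ sum-≈ Nₘ term ⟩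
      sum Nₘ (λ k → # Nₘ * # Nₘ * ((ι² k + # 2 * # Nₘ * ι³ k) * G 2 s t Nₘ (2 ℕ.* k)))
        ≡⟨ trans (sum-*ˡ Nₘ (# Nₘ * # Nₘ) (λ k → (ι² k + # 2 * # Nₘ * ι³ k) * G 2 s t Nₘ (2 ℕ.* k)))
          (cong (_*_ (# Nₘ * # Nₘ)) paired) ⟩
      # Nₘ * # Nₘ * (S 2 s t n m 0 + # Nₘ * sum (2 ℕ.* Nₘ) (λ c → # 8 * (ρ̂ c * ι³ c) * G 2 s t Nₘ c))
        ≈⟨ N²* squares ⟩
      # Nₘ * # Nₘ * (P m * (θ * V))
        ≡⟨ trans (cong (λ a → a * a * (P m * (θ * V))) #N)
          (trans (lem (P m) (# n) (θ * V)) (cong (_* (# n * # n * (θ * V))) (sym (P-3* m)))) ⟩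
      P (3 ℕ.* m) * (# n * # n * (θ * V)) ∎
      where
      open ≈-Reasoning (3 ℕ.* m ℕ.+ 1)
      N²* : ∀ {x y} → x ≈[ suc m ] y → # Nₘ * # Nₘ * x ≈[ 3 ℕ.* m ℕ.+ 1 ] # Nₘ * # Nₘ * y
      N²* {x} {y} h = subst (λ e → # Nₘ * # Nₘ * x ≈[ e ] # Nₘ * # Nₘ * y) exponent₂ (scale (*-≈0 N≈0 N≈0) h)
      lem : ∀ q n x → q * n * (q * n) * (q * x) ≡ q * q * q * (n * n * x)
      lem = solve-∀ ring
      lem₀ : ∀ s π i E T → s * π * i * (s * π * i * 1#) * (E * T) ≡ s * s * (i * i * (π * (π * 1#) * E * T))
      lem₀ = solve-∀ ring
      lem₁ : ∀ n x → n * (n * 1#) * x ≡ n * n * x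
      lem₁ = solve-∀ ring
      term : ∀ k → k < Nₘ → χ k * F 2 s t Nₘ k ≈[ 3 ℕ.* m ℕ.+ 1 ] # Nₘ * # Nₘ
        * ((ι² k + # 2 * # Nₘ * ι³ k) * G 2 s t Nₘ (2 ℕ.* k))
      term k k<Nₘ = ≈-trans (≡⇒≈ (trans (χ-F 1 s t Nₘ p∣Nₘ k (ℕP.<⇒≤ k<Nₘ))
        (trans (lem₁ (# Nₘ) _) (cong (_*_ (# Nₘ * # Nₘ))
          (trans (lem₀ (σ k) (Π one (- # Nₘ) k) (ι (Nₘ ∸ k)) (# ((Nₘ ℕ.+ k) C k) ^ s) (# ((2 ℕ.* k) C Nₘ) ^ t))
          (trans (cong₂ (λ a b → a * (ι² (Nₘ ∸ k) * b)) (σ² k) (sym (G-even 2 s t Nₘ k))) (*-identityˡ _)))))))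
        (N²* (*ʳ-≈ (Int-G 2 s t Nₘ (2 ℕ.* k))
          (≈-weaken (suc≤ d) (ι²-mirror {d} (m∣m*n n) k (Nₘ ∸ k) (ℕP.m+[n∸m]≡n (ℕP.<⇒≤ k<Nₘ))))))
      f : ℕ → K
      f c = (# 4 * ι² c + # 2 * # Nₘ * (# 8 * ι³ c)) * G 2 s t Nₘ c
      l : ∀ a → a ≡ ½ * (# 2 * a)
      l = solve-∀ ring
      l₁ : ∀ a → # 2 * a * (# 2 * a) ≡ # 4 * (a * a)
      l₁ = solve-∀ ring
      l₂ : ∀ r a n b g → r * ((# 4 * a + # 2 * n * (# 8 * b)) * g) ≡ # 2
        * (# 2 * (r * a) * g + n * (# 8 * (r * b) * g))
      l₂ = solve-∀ ring
      expand : sum (2 ℕ.* Nₘ) (λ c → ρ̂ c * f c) ≡ # 2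
        * (S 2 s t n m 0 + # Nₘ * sum (2 ℕ.* Nₘ) (λ c → # 8 * (ρ̂ c * ι³ c) * G 2 s t Nₘ c))
      expand = trans (sum-ext (2 ℕ.* Nₘ) (λ c → trans (l₂ (ρ̂ c) (ι² c) (# Nₘ) (ι³ c) (G 2 s t Nₘ c))
        (cong (λ a → # 2 * (a * G 2 s t Nₘ c + # Nₘ * (# 8 * (ρ̂ c * ι³ c) * G 2 s t Nₘ c)))
        (sym (level-0 c)))))
        (trans (sum-*ˡ (2 ℕ.* Nₘ) (# 2) (λ c → level 0 c * G 2 s t Nₘ c + # Nₘ
          * (# 8 * (ρ̂ c * ι³ c) * G 2 s t Nₘ c)))
          (cong (_*_ (# 2)) (trans (sum-+ (2 ℕ.* Nₘ) (λ c → level 0 c * G 2 s t Nₘ c)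
          (λ c → # Nₘ * (# 8 * (ρ̂ c * ι³ c) * G 2 s t Nₘ c)))
          (cong (_+_ (S 2 s t n m 0)) (sum-*ˡ (2 ℕ.* Nₘ) (# Nₘ) (λ c → # 8 * (ρ̂ c * ι³ c) * G 2 s t Nₘ c))))))
      paired : sum Nₘ (λ k → (ι² k + # 2 * # Nₘ * ι³ k) * G 2 s t Nₘ (2 ℕ.* k)) ≡ S 2 s t n m 0 + # Nₘ * sum
        (2 ℕ.* Nₘ) (λ c → # 8 * (ρ̂ c * ι³ c) * G 2 s t Nₘ c)
      paired = trans (sum-ext Nₘ (λ k → cong (_* G 2 s t Nₘ (2 ℕ.* k))
        (cong₂ (λ a b → a + # 2 * # Nₘ * b) (trans (cong (λ a → a * a) (sym (ι-2* k))) (l₁ (ι (2 ℕ.* k))))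
        (sym (ι³-2* k)))))
        (trans (l (sum Nₘ (λ k → f (2 ℕ.* k))))
          (trans (cong (_*_ ½) (trans (sym (sum-even Nₘ f)) expand)) (sym (l _))))

    W-half : ∀ e → W 2 s t (p ℕ.^ e ℕ.* n) ≡ ½ * (U 2 s t n e + R 2 s t n e)
    W-half e = trans (l (W 2 s t (p ℕ.^ e ℕ.* n)))
      (cong (_*_ ½) (trans (sym (sum-even (p ℕ.^ e ℕ.* n) (g 2 s t n e)))
      (sum-ρ̂ (2 ℕ.* (p ℕ.^ e ℕ.* n)) (g 2 s t n e))))
      where
      l : ∀ a → a ≡ ½ * (# 2 * a)
      l = solve-∀ ring

    -- U d - U 0 occurs with coefficient A₂ n³/3 through `W` and -A₂ n³/3 through `V` and cancels
    -- identically. What is left of level d is R d, which is congruent to R 0.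
    total-2 : row 2 ≈[ 3 ℕ.* m ℕ.+ 1 ] row′ 2 + P (3 ℕ.* m) * (θ *
      (# 2 * ⅓ * sum (suc n) (weighted 2 s t n) + # n * # n
        * (- # 2 * ℓG + # n * (- A₂ * U₀ + (B₂ + # 8) * R₀))))
    total-2 = begin
      row 2 ≈⟨ row-split 0 (Int-γ₂ s t n) (off-2 s t d n) ⟩
      row′ 2 + # 2 * ⅓ * θ * (Q * (w + γ₂ s t n * (W 2 s t N′ - W 2 s t n))) + coprimePart 2
        ≈⟨ +-≈ ≈-refl coprime-2 ⟩
      row′ 2 + # 2 * ⅓ * θ * (Q * (w + γ₂ s t n * (W 2 s t N′ - W 2 s t n))) + Q * (# n * # n * (θ * V))
        ≡⟨ cong₂ (λ a b → row′ 2 + # 2 * ⅓ * θ * (Q * (w + γ₂ s t n * (a - b))) + Q * (# n * # n * (θ * V)))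
          (W-half d) (trans (cong (W 2 s t) (sym (ℕP.*-identityˡ n))) (W-half 0)) ⟩
      row′ 2 + # 2 * ⅓ * θ * (Q * (w + A₂ * # n * # n * # n * (½ * (Uₐ + Rₐ) - ½ * (U₀ + R₀)))) + Q
        * (# n * # n * (θ * V))
        ≡⟨ lem (row′ 2) θ Q w A₂ (# n) Uₐ Rₐ U₀ R₀ ℓG B₂ ⟩
      row′ 2 + (Q * (⅓ * θ * A₂ * # n * # n * # n * Rₐ) + Q
        * (θ * (# 2 * ⅓ * w + # n * # n * (- # 2 * ℓG + # n * (- A₂ * U₀ + (B₂ + # 8) * R₀))) - ⅓ * θ * A₂ * # n
        * # n * # n * R₀))
        ≈⟨ +-≈ ≈-refl (+-≈ (scale (≈0-P (3 ℕ.* m))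
          (*ˡ-≈ (Int-⅓ ⊗ Int-θ ⊗ (nat s ⊕ ⊝ nat 2 ⊕ nat 4 ⊗ nat t) ⊗ nat n ⊗ nat n ⊗ nat n) (R≈R₀ 2 s t n d)))
          ≈-refl) ⟩
      row′ 2 + (Q * (⅓ * θ * A₂ * # n * # n * # n * R₀) + Q
        * (θ * (# 2 * ⅓ * w + # n * # n * (- # 2 * ℓG + # n * (- A₂ * U₀ + (B₂ + # 8) * R₀))) - ⅓ * θ * A₂ * # n
        * # n * # n * R₀))
        ≡⟨ cong (_+_ (row′ 2)) (lem′ Q (⅓ * θ * A₂ * # n * # n * # n * R₀)
          (θ * (# 2 * ⅓ * w + # n * # n * (- # 2 * ℓG + # n * (- A₂ * U₀ + (B₂ + # 8) * R₀))))) ⟩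
      row′ 2 + Q * (θ * (# 2 * ⅓ * w + # n * # n * (- # 2 * ℓG + # n * (- A₂ * U₀ + (B₂ + # 8) * R₀)))) ∎
      where
      open ≈-Reasoning (3 ℕ.* m ℕ.+ 1)
      Q = P (3 ℕ.* m)
      w = sum (suc n) (weighted 2 s t n)
      Rₐ = R 2 s t n d
      lem′ : ∀ q a b → q * a + q * (b - a) ≡ q * b
      lem′ = solve-∀ ring
      lem : ∀ a x q w A n u r u₀ r₀ l b →
        a + # 2 * ⅓ * x * (q * (w + A * n * n * n * (½ * (u + r) - ½ * (u₀ + r₀)))) + q
          * (n * n * (x * (- # 2 * l + n * (- A * u₀ + b * r₀ - ⅓ * A * (u - u₀) + # 8 * r₀))))
        ≡ a + (q * (⅓ * x * A * n * n * n * r) + q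
          * (x * (# 2 * ⅓ * w + n * n * (- # 2 * l + n * (- A * u₀ + (b + # 8) * r₀))) - ⅓ * x * A * n * n * n
          * r₀))
      lem = solve-∀ ring

  -- Rational numbers

  ζ : ℤ → K
  ζ i = κ (ℤ→ℚ i)

  ℤ→ℚ≡mkℚ : ∀ i → ℤ→ℚ i ≡ mkℚ i 0 (coprime-sym (1-coprimeTo ℤ.∣ i ∣))
  ℤ→ℚ≡mkℚ i = ℚP.↥p/↧p≡p (mkℚ i 0 (coprime-sym (1-coprimeTo ℤ.∣ i ∣)))

  ζ-+ : ∀ i j → ζ (i ℤ.+ j) ≡ ζ i + ζ j
  ζ-+ i j = sym (trans (cong₂ (λ a b → κ (a ℚ.+ b)) (ℤ→ℚ≡mkℚ i) (ℤ→ℚ≡mkℚ j))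
    (cong₂ (λ a b → κ ((a ℤ.+ b) / 1)) (ℤP.*-identityʳ i) (ℤP.*-identityʳ j)))

  ζ-* : ∀ i j → ζ (i ℤ.* j) ≡ ζ i * ζ j
  ζ-* i j = sym (cong₂ (λ a b → κ (a ℚ.* b)) (ℤ→ℚ≡mkℚ i) (ℤ→ℚ≡mkℚ j))

  ζ-neg : ∀ i → ζ (ℤ.- i) ≡ - ζ i
  ζ-neg i = trans (lem (ζ i) (ζ (ℤ.- i)))
    (trans (cong (_- ζ i) (trans (sym (ζ-+ i (ℤ.- i))) (cong ζ (ℤP.+-inverseʳ i)))) (lem′ (ζ i)))
    where
    lem : ∀ a b → b ≡ a + b - a
    lem = solve-∀ ring
    lem′ : ∀ a → 0# - a ≡ - a
    lem′ = solve-∀ ring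

  ζ-sub : ∀ i j → ζ (i ℤ.- j) ≡ ζ i - ζ j
  ζ-sub i j = trans (ζ-+ i (ℤ.- j)) (cong (_+_ (ζ i)) (ζ-neg j))

  ζ-plus : ∀ i n {x} → ζ i ≡ x → ζ (i ℤ.+ + n) ≡ x + # n
  ζ-plus i n eq = trans (ζ-+ i (+ n)) (cong₂ _+_ eq (κ-q n))

  ζ-minus : ∀ i n {x} → ζ i ≡ x → ζ (i ℤ.- + n) ≡ x - # n
  ζ-minus i n eq = trans (ζ-sub i (+ n)) (cong₂ _-_ eq (κ-q n))

  p∤1 : ¬ p ∣ 1
  p∤1 = p∤ (s≤s (s≤s z≤n))

  p∤* : ∀ {a b} → ¬ p ∣ a → ¬ p ∣ b → ¬ p ∣ a ℕ.* b
  p∤* {a} {b} p∤a p∤b d = [ p∤a , p∤b ]′ (euclidsLemma a b p-prime d)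

  Int⇒fraction : ∀ {x} → Int x → ∃[ d ] ∃[ i ] ¬ p ∣ d × # d * x ≡ ζ i
  Int⇒fraction (nat n) = 1 , + n , p∤1 , trans (lem (# n)) (sym (κ-q n))
    where
    lem : ∀ a → # 1 * a ≡ a
    lem = solve-∀ ring
  Int⇒fraction (_⊕_ {x} {y} ix iy) with Int⇒fraction ix | Int⇒fraction iy
  ... | d , i , p∤d , eq | d′ , i′ , p∤d′ , eq′ = d ℕ.* d′ , i ℤ.* + d′ ℤ.+ i′ ℤ.* + d , p∤* p∤d p∤d′ , (begin
    # (d ℕ.* d′) * (x + y)                ≡⟨ cong (_* (x + y)) (#-* d d′) ⟩
    # d * # d′ * (x + y)                  ≡⟨ lem (# d) (# d′) x y ⟩
    # d * x * # d′ + # d′ * y * # d      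
      ≡⟨ cong₂ _+_ (cong₂ _*_ eq (sym (κ-q d′))) (cong₂ _*_ eq′ (sym (κ-q d))) ⟩
    ζ i * ζ (+ d′) + ζ i′ * ζ (+ d)       ≡⟨ cong₂ _+_ (ζ-* i (+ d′)) (ζ-* i′ (+ d)) ⟨
    ζ (i ℤ.* + d′) + ζ (i′ ℤ.* + d)       ≡⟨ ζ-+ (i ℤ.* + d′) (i′ ℤ.* + d) ⟨
    ζ (i ℤ.* + d′ ℤ.+ i′ ℤ.* + d)         ∎)
    where
    open ≡-Reasoning
    lem : ∀ d d′ x y → d * d′ * (x + y) ≡ d * x * d′ + d′ * y * d
    lem = solve-∀ ring
  Int⇒fraction (_⊗_ {x} {y} ix iy) with Int⇒fraction ix | Int⇒fraction iy
  ... | d , i , p∤d , eq | d′ , i′ , p∤d′ , eq′ = d ℕ.* d′ , i ℤ.* i′ , p∤* p∤d p∤d′ ,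
    trans (cong (_* (x * y)) (#-* d d′)) (trans (lem (# d) (# d′) x y)
      (trans (cong₂ _*_ eq eq′) (sym (ζ-* i i′))))
    where
    lem : ∀ d d′ x y → d * d′ * (x * y) ≡ d * x * (d′ * y)
    lem = solve-∀ ring
  Int⇒fraction (⊝_ {x} ix) with Int⇒fraction ix
  ... | d , i , p∤d , eq = d , ℤ.- i , p∤d , trans (lem (# d) x) (trans (cong (λ a → - a) eq) (sym (ζ-neg i)))
    where
    lem : ∀ d x → d * - x ≡ - (d * x)
    lem = solve-∀ ring
  Int⇒fraction (inv {d} p∤d) = d , + 1 , p∤d , trans (#*recip′ p∤d) (sym (κ-q 1))

  κ-injective : ∀ {a b} → κ a ≡ κ b → a ≡ b
  κ-injective refl = refl

  -- If d w is an integer with p ∤ d and w is reduced, the denominator divides numerator times d,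
  -- hence d, and so p cannot divide it.
  Int⇒p∤denominator : ∀ {w} → Int (κ w) → ¬ p ∣ ℚ.denominatorℕ w
  Int⇒p∤denominator {w@(mkℚ num den-1 c)} iw p∣den with Int⇒fraction iw
  ... | d , i , p∤d , eq = p∤d (∣-trans p∣den (coprime-divisor (coprime-sym (coprime-recompute c)) den∣))
    where
    equation : mkℚ (+ d) 0 (coprime-sym (1-coprimeTo d)) ℚ.* w ≡ mkℚ i 0 (coprime-sym (1-coprimeTo ℤ.∣ i ∣))
    equation = trans (cong (ℚ._* w) (sym (ℕ→ℚ≡mkℚ d)))
      (trans (κ-injective (trans (cong (_* κ w) (κ-q d)) eq)) (ℤ→ℚ≡mkℚ i))
    cross : (+ d ℤ.* num) ℤ.* + 1 ≡ i ℤ.* + (1 ℕ.* suc den-1)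
    cross with ℚᵘP.≃-trans (ℚᵘP.≃-sym (ℚP.toℚᵘ-homo-* (mkℚ (+ d) 0 (coprime-sym (1-coprimeTo d))) w))
      (ℚP.toℚᵘ-cong equation)
    ... | ℚᵘ.*≡* e = e
    absolute : ℤ.∣ num ∣ ℕ.* d ≡ ℤ.∣ i ∣ ℕ.* suc den-1
    absolute = trans (ℕP.*-comm ℤ.∣ num ∣ d)
      (trans (sym (ℤP.abs-* (+ d) num)) (trans
      (cong ℤ.∣_∣ (trans (sym (ℤP.*-identityʳ (+ d ℤ.* num)))
      (trans cross (cong (λ k → i ℤ.* + k) (ℕP.*-identityˡ (suc den-1)))))) (ℤP.abs-* i (+ suc den-1))))
    den∣ : suc den-1 ∣ ℤ.∣ num ∣ ℕ.* d
    den∣ = divides ℤ.∣ i ∣ absolute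

  ≈⇒modℚ : ∀ {x y} j → κ x ≈[ j ] κ y → x ≡ y [modℚ p ^ j ]
  ≈⇒modℚ {x} {y} j (quotient {w} iw eq) = Int⇒p∤denominator (subst Int (sym (begin
    (κ x - κ y) * recip (p ℕ.^ j)         ≡⟨ cong (_* recip (p ℕ.^ j)) eq ⟩
    P j * w * recip (p ℕ.^ j)             ≡⟨ lem (P j) w (recip (p ℕ.^ j)) ⟩
    P j * recip (p ℕ.^ j) * w             ≡⟨ cong (_* w) (P-inverse j) ⟩
    1# * w                                ≡⟨ *-identityˡ w ⟩
    w                                     ∎)) iw)
    where
    open ≡-Reasoning
    lem : ∀ a b c → a * b * c ≡ a * c * b
    lem = solve-∀ ring

  κ-sumTo : ∀ n f → κ (sumTo n f) ≡ sum (suc n) (κ ∘ f)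
  κ-sumTo zero    f = sym (+-identityˡ (κ (f 0)))
  κ-sumTo (suc n) f = cong (_+ κ (f (suc n))) (κ-sumTo n f)

  κ-sumBelow : ∀ n f → κ (sumBelow n f) ≡ sum n (κ ∘ f)
  κ-sumBelow zero    f = refl
  κ-sumBelow (suc n) f = κ-sumTo n f

  κ-monomial : ∀ a b c r s t → κ (ℕ→ℚ (a ℕ.^ r ℕ.* b ℕ.^ s ℕ.* c ℕ.^ t)) ≡ # a ^ r * # b ^ s * # c ^ t
  κ-monomial a b c r s t = trans (κ-q (a ℕ.^ r ℕ.* b ℕ.^ s ℕ.* c ℕ.^ t))
    (trans (#-* (a ℕ.^ r ℕ.* b ℕ.^ s) (c ℕ.^ t))
    (cong₂ _*_ (trans (#-* (a ℕ.^ r) (b ℕ.^ s)) (cong₂ _*_ (#-^ a r) (#-^ b s))) (#-^ c t)))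

  κ-Apéry : ∀ r s t N → κ (Apéry r s t N) ≡ sum (suc N) (F r s t N)
  κ-Apéry r s t N = trans (κ-sumTo N _)
    (sum-ext (suc N) (λ k → κ-monomial (N C k) ((N ℕ.+ k) C k) ((2 ℕ.* k) C N) r s t))

  #-*₃ : ∀ a b c → # (a ℕ.* b ℕ.* c) ≡ # a * # b * # c
  #-*₃ a b c = trans (#-* (a ℕ.* b) c) (cong (_* # c) (#-* a b))

  κ-firstSum : ∀ r s t n → κ (firstSum r s t n) ≡ - ⅓ * sum (suc n) (weighted r s t n)
  κ-firstSum r s t n = cong (_*_ (- ⅓)) (trans (κ-sumTo n _) (sum-ext (suc n) (λ k → trans
    (cong₂ _*_ (cong₂ _*_ (κ-monomial (n C k) ((n ℕ.+ k) C k) ((2 ℕ.* k) C n) r s t)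
      (trans (κ-q (n ℕ.* k)) (#-* n k))) (linear k))
    (lem (F r s t n k) (# n) (# k) (Λ r s t (# n) (# k))))))
    where
    lem : ∀ f n k l → f * (n * k) * l ≡ f * (n * (k * l))
    lem = solve-∀ ring
    lem′ : ∀ s r t n k → s * n + s * k + r * n - r * k + # 4 * t * k - # 2 * t * n ≡ r * (n - k) + s * (n + k)
      + # 2 * t * (# 2 * k - n)
    lem′ = solve-∀ ring
    linear : ∀ k → ζ (+ (s ℕ.* n) ℤ.+ + (s ℕ.* k) ℤ.+ + (r ℕ.* n) ℤ.- + (r ℕ.* k) ℤ.+ + (4 ℕ.* t ℕ.* k) ℤ.-
      + (2 ℕ.* t ℕ.* n)) ≡ Λ r s t (# n) (# k)
    linear k = trans (ζ-minus i₅ (2 ℕ.* t ℕ.* n)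
      (ζ-plus i₄ (4 ℕ.* t ℕ.* k) (ζ-minus i₃ (r ℕ.* k)
      (ζ-plus i₂ (r ℕ.* n) (ζ-plus i₁ (s ℕ.* k) (κ-q (s ℕ.* n)))))))
      (trans (cong₂ _-_ (cong₂ _+_ (cong₂ _-_ (cong₂ _+_ (cong₂ _+_ (#-* s n) (#-* s k)) (#-* r n)) (#-* r k))
        (#-*₃ 4 t k)) (#-*₃ 2 t n))
        (lem′ (# s) (# r) (# t) (# n) (# k)))
      where
      i₁ = + (s ℕ.* n)
      i₂ = i₁ ℤ.+ + (s ℕ.* k)
      i₃ = i₂ ℤ.+ + (r ℕ.* n)
      i₄ = i₃ ℤ.- + (r ℕ.* k)
      i₅ = i₄ ℤ.+ + (4 ℕ.* t ℕ.* k)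

  sum-pairs : ∀ n f → sum (2 ℕ.* n) f ≡ sum n (λ k → f (2 ℕ.* k) + f (suc (2 ℕ.* k)))
  sum-pairs zero    f = refl
  sum-pairs (suc n) f = trans (cong (λ k → sum k f) (2*suc n))
    (trans (cong (λ a → a + f (2 ℕ.* n) + f (suc (2 ℕ.* n))) (sum-pairs n f)) (+-assoc _ _ _))

  -- Comparison with the explicit formulas for 𝒜

  module _ (s t n : ℕ) .{{n-nonZero : ℕ.NonZero n}} where

    E : ℕ → K
    E k = # ((n ℕ.+ k) C k) ^ s

    -- D₀ k is also n C(n-1, k): it converts the powers of n C(n-1, k) left by the descent into the
    -- (n - k)C(n, k) of 𝒜.
    T₀ T₁ D₀ : ℕ → K
    T₀ k = # ((2 ℕ.* k) C n) ^ t
    T₁ k = # ((2 ℕ.* k ℕ.+ 1) C n) ^ t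
    D₀ k = # (n C k) * (# n - # k)

    G-2k : ∀ r k → G r s t n (2 ℕ.* k) ≡ Π one (- # n) k ^ r * E k * T₀ k
    G-2k r k = G-even r s t n k

    G-2k+1 : ∀ r k → G r s t n (suc (2 ℕ.* k)) ≡ Π one (- # n) k ^ r * E k * T₁ k
    G-2k+1 r k = cong₂ (λ a b → a * b) (cong₂ (λ a b → a ^ r * b ^ s)
      (trans (Π-odd (- # n) k) (Π-even (- # n) k))
      (trans (Π-odd (# n) k) (trans (Π-even (# n) k) (Π-binomial n k))))
      (cong (λ i → # (i C n) ^ t) (ℕP.+-comm 1 (2 ℕ.* k)))

    D₀≡ : ∀ k → D₀ k ≡ # n * (σ k * Π one (- # n) k)
    D₀≡ k = C-complement n k

    D₀² : ∀ k → # n * # n * (Π one (- # n) k * Π one (- # n) k) ≡ D₀ k * D₀ k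
    D₀² k = trans (trans (lem (# n) (Π one (- # n) k))
      (cong (λ a → a * (# n * # n * (Π one (- # n) k * Π one (- # n) k))) (sym (σ² k))))
      (trans (lem′ (# n) (Π one (- # n) k) (σ k)) (cong (λ a → a * a) (sym (D₀≡ k))))
      where
      lem : ∀ n x → n * n * (x * x) ≡ 1# * (n * n * (x * x))
      lem = solve-∀ ring
      lem′ : ∀ n x s → s * s * (n * n * (x * x)) ≡ n * (s * x) * (n * (s * x))
      lem′ = solve-∀ ring

    D₀³ : ∀ k → # n * # n * # n * (σ k * (Π one (- # n) k * Π one (- # n) k * Π one (- # n) k)) ≡ D₀ k * D₀ k
      * D₀ k
    D₀³ k = trans (trans (lem (# n) (Π one (- # n) k) (σ k))
      (cong (λ a → a * (# n * # n * # n * (σ k * (Π one (- # n) k * Π one (- # n) k * Π one (- # n) k))))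
      (sym (σ² k))))
      (trans (lem′ (# n) (Π one (- # n) k) (σ k)) (cong (λ a → a * a * a) (sym (D₀≡ k))))
      where
      lem : ∀ n x s → n * n * n * (s * (x * x * x)) ≡ 1# * (n * n * n * (s * (x * x * x)))
      lem = solve-∀ ring
      lem′ : ∀ n x s → s * s * (n * n * n * (s * (x * x * x))) ≡ n * (s * x) * (n * (s * x)) * (n * (s * x))
      lem′ = solve-∀ ring

    -- The coefficient of p^(3m) θ in the total. The factor -2 in `calA3≡` is that of B_{p-3} ≡ -2θ,
    -- and it turns the weight -1/2 of the cubic part into 1/4.
    X₃ : K
    X₃ = # 2 * ⅓ * sum (suc n) (weighted 3 s t n) + - ½
      * (# n * # n * # n * sum (2 ℕ.* (p ℕ.^ 0 ℕ.* n)) (λ c → ε c * g 3 s t n 0 c))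

    calA3≡ : X₃ ≡ - # 2 * κ (calA3 s t n)
    calA3≡ = trans (cong (λ a → # 2 * ⅓ * w + - ½ * (# n * # n * # n * a))
      (cong (λ k → sum (2 ℕ.* k) (λ c → ε c * G 3 s t k c)) (ℕP.*-identityˡ n)))
      (trans (cong (λ a → # 2 * ⅓ * w + - ½ * a) cubes≡)
        (trans (lem w Z) (cong (_*_ (- # 2))
        (sym (cong₂ (λ a b → a + ¼ * b) (κ-firstSum 3 s t n) (trans (κ-sumBelow n _) (sum-cong n term)))))))
      where
      w = sum (suc n) (weighted 3 s t n)
      Z = sum n (λ k → D₀ k * D₀ k * D₀ k * (E k * (T₀ k + T₁ k)))
      lem : ∀ w z → # 2 * ⅓ * w + - ½ * z ≡ - # 2 * (- ⅓ * w + ¼ * z)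
      lem = solve-∀ ring
      lem₁ : ∀ π E a b s → s * (π * (π * (π * 1#)) * E * a) + s * (π * (π * (π * 1#)) * E * b) ≡ s * (π * π * π)
        * (E * (a + b))
      lem₁ = solve-∀ ring
      lem₂ : ∀ c m E a b → m * (m * (m * 1#)) * (c * (c * (c * 1#))) * E * (a + b) ≡ c * m * (c * m) * (c * m)
        * (E * (a + b))
      lem₂ = solve-∀ ring
      lem₃ : ∀ a → a + 0# ≡ a
      lem₃ = solve-∀ ring
      lem₄ : ∀ a → - 0# + a ≡ a
      lem₄ = solve-∀ ring
      ε₀ : ∀ k → ε (2 ℕ.* k) ≡ σ k
      ε₀ k = trans (cong₂ _+_ (ν-2* k) (μ-2* k)) (lem₃ (σ k))
      ε₁ : ∀ k → ε (suc (2 ℕ.* k)) ≡ σ k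
      ε₁ k = trans (cong₂ (λ a b → - a + b) (μ-2* k) (ν-2* k)) (lem₄ (σ k))
      cubes≡ : # n * # n * # n * sum (2 ℕ.* n) (λ c → ε c * G 3 s t n c) ≡ Z
      cubes≡ = trans (cong (_*_ (# n * # n * # n)) (sum-pairs n (λ c → ε c * G 3 s t n c)))
        (trans (sym (sum-*ˡ n (# n * # n * # n)
        (λ k → ε (2 ℕ.* k) * G 3 s t n (2 ℕ.* k) + ε (suc (2 ℕ.* k)) * G 3 s t n (suc (2 ℕ.* k)))))
        (sum-ext n (λ k → trans (cong (_*_ (# n * # n * # n))
          (trans (cong₂ _+_ (cong₂ _*_ (ε₀ k) (G-2k 3 k)) (cong₂ _*_ (ε₁ k) (G-2k+1 3 k)))
          (lem₁ (Π one (- # n) k) (E k) (T₀ k) (T₁ k) (σ k))))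
          (trans (sym (*-assoc (# n * # n * # n) (σ k * (Π one (- # n) k * Π one (- # n) k * Π one (- # n) k))
            (E k * (T₀ k + T₁ k)))) (cong (_* (E k * (T₀ k + T₁ k))) (D₀³ k))))))
      term : ∀ k → k < n → κ (ℕ→ℚ ((n ∸ k) ℕ.^ 3 ℕ.* (n C k) ℕ.^ 3 ℕ.* ((n ℕ.+ k) C k) ℕ.^ s
        ℕ.* (((2 ℕ.* k) C n) ℕ.^ t ℕ.+ ((2 ℕ.* k ℕ.+ 1) C n) ℕ.^ t))) ≡ D₀ k * D₀ k * D₀ k
        * (E k * (T₀ k + T₁ k))
      term k k<n = trans (κ-q ((n ∸ k) ℕ.^ 3 ℕ.* (n C k) ℕ.^ 3 ℕ.* ((n ℕ.+ k) C k) ℕ.^ s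
        ℕ.* (((2 ℕ.* k) C n) ℕ.^ t ℕ.+ ((2 ℕ.* k ℕ.+ 1) C n) ℕ.^ t)))
        (trans (#-*₃ ((n ∸ k) ℕ.^ 3 ℕ.* (n C k) ℕ.^ 3) (((n ℕ.+ k) C k) ℕ.^ s)
          (((2 ℕ.* k) C n) ℕ.^ t ℕ.+ ((2 ℕ.* k ℕ.+ 1) C n) ℕ.^ t))
        (trans (cong₂ _*_ (cong₂ _*_ (trans (#-* ((n ∸ k) ℕ.^ 3) ((n C k) ℕ.^ 3))
          (cong₂ _*_ (trans (#-^ (n ∸ k) 3) (cong (_^ 3) (#-∸ (ℕP.<⇒≤ k<n)))) (#-^ (n C k) 3)))
          (#-^ ((n ℕ.+ k) C k) s))
            (trans (#-+ (((2 ℕ.* k) C n) ℕ.^ t) (((2 ℕ.* k ℕ.+ 1) C n) ℕ.^ t))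
              (cong₂ _+_ (#-^ ((2 ℕ.* k) C n) t) (#-^ ((2 ℕ.* k ℕ.+ 1) C n) t))))
          (lem₂ (# (n C k)) (# n - # k) (E k) (T₀ k) (T₁ k))))

    Int-X₃ : Int X₃
    Int-X₃ = nat 2 ⊗ Int-⅓ ⊗ Int-sumAll (suc n) (Int-weighted 3 s t n) ⊕ ⊝ Int-½
      ⊗ (nat n ⊗ nat n ⊗ nat n ⊗ Int-sumAll (2 ℕ.* (p ℕ.^ 0 ℕ.* n)) (λ c → Int-ε c ⊗ Int-g 3 s t n 0 c))

    ℓG₂ : K
    ℓG₂ = sum (2 ℕ.* (p ℕ.^ 0 ℕ.* n)) (λ c → ℓ c * g 2 s t n 0 c)

    a₂ b₂ : K
    a₂ = # s - # 2 + # 4 * # t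
    b₂ = # 2 * (# s - # 2) + # t

    X₂ : K
    X₂ = # 2 * ⅓ * sum (suc n) (weighted 2 s t n) + # n * # n
      * (- # 2 * ℓG₂ + # n * (- a₂ * U 2 s t n 0 + (b₂ + # 8) * R 2 s t n 0))

    Int-X₂ : Int X₂
    Int-X₂ = nat 2 ⊗ Int-⅓ ⊗ Int-sumAll (suc n) (Int-weighted 2 s t n) ⊕ nat n ⊗ nat n ⊗
      (⊝ nat 2 ⊗ Int-sumAll (2 ℕ.* (p ℕ.^ 0 ℕ.* n)) (λ c → Int-ℓ c ⊗ Int-g 2 s t n 0 c) ⊕ nat n ⊗
        (⊝ (nat s ⊕ ⊝ nat 2 ⊕ nat 4 ⊗ nat t) ⊗ Int-U 2 s t n 0 ⊕ (nat 2 ⊗ (nat s ⊕ ⊝ nat 2) ⊕ nat t ⊕ nat 8)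
          ⊗ Int-R 2 s t n 0))

    -- The coefficient of G at c in the bottom sum. At c = 2k and 2k + 1 it is -1/3 times the two
    -- linear forms of 𝒜; their constants 14 = 6(4/3 + 1) and -10 = 6(4/3 - 3), like the terms ±24k,
    -- come from -2ℓ.
    co : ℕ → K
    co c = - # 2 * ℓ c + # n * (- a₂ + (b₂ + # 8) * σ c)

    calA2≡ : X₂ ≡ - # 2 * κ (calA2 s t n)
    calA2≡ = trans (cong (λ a → # 2 * ⅓ * w + a) squares≡) (trans (lem w Z₀ Z₁) (cong (_*_ (- # 2)) (sym
      (cong₂ _+_ (cong₂ (λ a b → a + recip 6 * b) (κ-firstSum 2 s t n)
        (trans (κ-sumBelow n _) (sum-cong n term₀)))
        (cong (_*_ (recip 6)) (trans (κ-sumBelow n _) (sum-cong n term₁)))))))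
      where
      w = sum (suc n) (weighted 2 s t n)
      e₀ e₁ z₀ z₁ : ℕ → K
      e₀ k = # 9 * # n * # t - # 3 * # n * # s + # 24 * # k - # 18 * # n + # 14
      e₁ k = # 9 * # n * # s + # 15 * # n * # t - # 24 * # k + # 6 * # n - # 10
      z₀ k = D₀ k * D₀ k * (E k * T₀ k * e₀ k)
      z₁ k = D₀ k * D₀ k * (E k * T₁ k * e₁ k)
      Z₀ = sum n z₀
      Z₁ = sum n z₁
      lem : ∀ w x y → # 2 * ⅓ * w + (- ⅓ * x + - ⅓ * y) ≡ - # 2 * (- ⅓ * w + recip 6 * x + recip 6 * y)
      lem = solve-∀ ring
      collect : ∀ c → - # 2 * (ℓ c * G 2 s t (p ℕ.^ 0 ℕ.* n) c)
        + (# n * - a₂ * G 2 s t (p ℕ.^ 0 ℕ.* n) c + # n * (b₂ + # 8) * (σ c * G 2 s t (p ℕ.^ 0 ℕ.* n) c)) ≡ co c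
        * G 2 s t (p ℕ.^ 0 ℕ.* n) c
      collect c = l (ℓ c) (# n) a₂ (b₂ + # 8) (σ c) (G 2 s t (p ℕ.^ 0 ℕ.* n) c)
        where
        l : ∀ x n a b s g → - # 2 * (x * g) + (n * - a * g + n * b * (s * g)) ≡ (- # 2 * x + n * (- a + b * s))
          * g
        l = solve-∀ ring
      gather : - # 2 * ℓG₂ + # n * (- a₂ * U 2 s t n 0 + (b₂ + # 8) * R 2 s t n 0) ≡ sum (2 ℕ.* n)
        (λ c → co c * G 2 s t n c)
      gather = trans (l (- # 2 * ℓG₂) (# n) a₂ (U 2 s t n 0) (b₂ + # 8) (R 2 s t n 0))
        (trans (sym (trans (sum-+ N₀ _ _) (cong₂ _+_ (sum-*ˡ N₀ (- # 2) (λ c → ℓ c * g₀ c))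
        (trans (sum-+ N₀ _ _) (cong₂ _+_ (sum-*ˡ N₀ (# n * - a₂) g₀)
        (sum-*ˡ N₀ (# n * (b₂ + # 8)) (λ c → σ c * g₀ c)))))))
        (trans (sum-ext N₀ collect) (cong (λ k → sum (2 ℕ.* k) (λ c → co c * G 2 s t k c)) (ℕP.*-identityˡ n))))
        where
        N₀ = 2 ℕ.* (p ℕ.^ 0 ℕ.* n)
        g₀ : ℕ → K
        g₀ = G 2 s t (p ℕ.^ 0 ℕ.* n)
        l : ∀ x n a u b r → x + n * (- a * u + b * r) ≡ x + (n * - a * u + n * b * r)
        l = solve-∀ ring
      even : ∀ s t n k → - # 2 * (# 4 * ⅓ + 1# * (1# + # 2 * (# 2 * k))) + n
        * (- (s - # 2 + # 4 * t) + (# 2 * (s - # 2) + t + # 8) * 1#) ≡ - ⅓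
        * (# 9 * n * t - # 3 * n * s + # 24 * k - # 18 * n + # 14)
      even = solve-∀ ring
      odd : ∀ s t n k → - # 2 * (# 4 * ⅓ + - 1# * (1# + # 2 * (1# + # 2 * k))) + n
        * (- (s - # 2 + # 4 * t) + (# 2 * (s - # 2) + t + # 8) * - 1#) ≡ - ⅓
        * (# 9 * n * s + # 15 * n * t - # 24 * k + # 6 * n - # 10)
      odd = solve-∀ ring
      co₀ : ∀ k → co (2 ℕ.* k) ≡ - ⅓ * e₀ k
      co₀ k = trans (cong₂ (λ u v → - # 2 * (# 4 * ⅓ + u * (1# + # 2 * v)) + # n * (- a₂ + (b₂ + # 8) * u))
        (σ-2* k) (#-* 2 k)) (even (# s) (# t) (# n) (# k))
      co₁ : ∀ k → co (suc (2 ℕ.* k)) ≡ - ⅓ * e₁ k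
      co₁ k = trans (cong₂ (λ u v → - # 2 * (# 4 * ⅓ + - u * (1# + # 2 * (1# + v))) + # n
        * (- a₂ + (b₂ + # 8) * - u)) (σ-2* k) (#-* 2 k)) (odd (# s) (# t) (# n) (# k))
      pair : ∀ k → # n * # n * (co (2 ℕ.* k) * G 2 s t n (2 ℕ.* k) + co (suc (2 ℕ.* k)) * G 2 s t n
        (suc (2 ℕ.* k))) ≡ - ⅓ * z₀ k + - ⅓ * z₁ k
      pair k = trans (cong (_*_ (# n * # n))
        (cong₂ _+_ (cong₂ _*_ (co₀ k) (G-2k 2 k)) (cong₂ _*_ (co₁ k) (G-2k+1 2 k))))
        (trans (l (# n) (e₀ k) (e₁ k) (Π one (- # n) k) (E k) (T₀ k) (T₁ k))
          (cong (λ d → - ⅓ * (d * (E k * T₀ k * e₀ k)) + - ⅓ * (d * (E k * T₁ k * e₁ k))) (D₀² k)))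
        where
        l : ∀ n x y π E a b → n * n * (- ⅓ * x * (π * (π * 1#) * E * a) + - ⅓ * y * (π * (π * 1#) * E * b))
          ≡ - ⅓ * (n * n * (π * π) * (E * a * x)) + - ⅓ * (n * n * (π * π) * (E * b * y))
        l = solve-∀ ring
      squares≡ : # n * # n * (- # 2 * ℓG₂ + # n * (- a₂ * U 2 s t n 0 + (b₂ + # 8) * R 2 s t n 0)) ≡ - ⅓ * Z₀
        + - ⅓ * Z₁
      squares≡ = trans (cong (_*_ (# n * # n)) (trans gather (sum-pairs n (λ c → co c * G 2 s t n c))))
        (trans (sym (sum-*ˡ n (# n * # n) (λ k → co (2 ℕ.* k) * G 2 s t n (2 ℕ.* k) + co (suc (2 ℕ.* k)) * G 2 s
          t n (suc (2 ℕ.* k)))))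
        (trans (sum-ext n pair) (trans (sum-+ n (λ k → - ⅓ * z₀ k) (λ k → - ⅓ * z₁ k))
          (cong₂ _+_ (sum-*ˡ n (- ⅓) z₀) (sum-*ˡ n (- ⅓) z₁)))))
      shape : ∀ c m E T e → c * (c * 1#) * E * T * (m * (m * 1#)) * e ≡ c * m * (c * m) * (E * T * e)
      shape = solve-∀ ring
      square : ∀ k → k < n → κ (ℕ→ℚ ((n ∸ k) ℕ.^ 2)) ≡ (# n - # k) ^ 2
      square k k<n = trans (κ-q ((n ∸ k) ℕ.^ 2)) (trans (#-^ (n ∸ k) 2) (cong (_^ 2) (#-∸ (ℕP.<⇒≤ k<n))))
      linear₀ : ∀ k → ζ (+ (9 ℕ.* n ℕ.* t) ℤ.- + (3 ℕ.* n ℕ.* s) ℤ.+ + (24 ℕ.* k) ℤ.- + (18 ℕ.* n) ℤ.+ + 14)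
        ≡ e₀ k
      linear₀ k = trans (ζ-plus i₄ 14 (ζ-minus i₃ (18 ℕ.* n)
        (ζ-plus i₂ (24 ℕ.* k) (ζ-minus i₁ (3 ℕ.* n ℕ.* s) (κ-q (9 ℕ.* n ℕ.* t))))))
        (cong (_+ # 14) (cong₂ _-_ (cong₂ _+_ (cong₂ _-_ (#-*₃ 9 n t) (#-*₃ 3 n s)) (#-* 24 k)) (#-* 18 n)))
        where
        i₁ = + (9 ℕ.* n ℕ.* t)
        i₂ = i₁ ℤ.- + (3 ℕ.* n ℕ.* s)
        i₃ = i₂ ℤ.+ + (24 ℕ.* k)
        i₄ = i₃ ℤ.- + (18 ℕ.* n)
      linear₁ : ∀ k → ζ (+ (9 ℕ.* n ℕ.* s) ℤ.+ + (15 ℕ.* n ℕ.* t) ℤ.- + (24 ℕ.* k) ℤ.+ + (6 ℕ.* n) ℤ.- + 10)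
        ≡ e₁ k
      linear₁ k = trans (ζ-minus i₄ 10 (ζ-plus i₃ (6 ℕ.* n)
        (ζ-minus i₂ (24 ℕ.* k) (ζ-plus i₁ (15 ℕ.* n ℕ.* t) (κ-q (9 ℕ.* n ℕ.* s))))))
        (cong (_- # 10) (cong₂ _+_ (cong₂ _-_ (cong₂ _+_ (#-*₃ 9 n s) (#-*₃ 15 n t)) (#-* 24 k)) (#-* 6 n)))
        where
        i₁ = + (9 ℕ.* n ℕ.* s)
        i₂ = i₁ ℤ.+ + (15 ℕ.* n ℕ.* t)
        i₃ = i₂ ℤ.- + (24 ℕ.* k)
        i₄ = i₃ ℤ.+ + (6 ℕ.* n)
      term₀ : ∀ k → k < n → κ (ℕ→ℚ ((n C k) ℕ.^ 2 ℕ.* ((n ℕ.+ k) C k) ℕ.^ s ℕ.* ((2 ℕ.* k) C n) ℕ.^ t) ℚ.* ℕ→ℚ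
        ((n ∸ k) ℕ.^ 2) ℚ.* ℤ→ℚ (+ (9 ℕ.* n ℕ.* t) ℤ.- + (3 ℕ.* n ℕ.* s) ℤ.+ + (24 ℕ.* k) ℤ.- + (18 ℕ.* n) ℤ.+
        + 14)) ≡ z₀ k
      term₀ k k<n = trans (cong₂ _*_ (cong₂ _*_ (κ-monomial (n C k) ((n ℕ.+ k) C k) ((2 ℕ.* k) C n) 2 s t)
        (square k k<n)) (linear₀ k)) (shape (# (n C k)) (# n - # k) (E k) (T₀ k) (e₀ k))
      term₁ : ∀ k → k < n → κ (ℕ→ℚ ((n C k) ℕ.^ 2 ℕ.* ((n ℕ.+ k) C k) ℕ.^ s ℕ.* ((2 ℕ.* k ℕ.+ 1) C n) ℕ.^ t)
        ℚ.* ℕ→ℚ ((n ∸ k) ℕ.^ 2) ℚ.* ℤ→ℚ (+ (9 ℕ.* n ℕ.* s) ℤ.+ + (15 ℕ.* n ℕ.* t) ℤ.- + (24 ℕ.* k) ℤ.+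
        + (6 ℕ.* n) ℤ.- + 10)) ≡ z₁ k
      term₁ k k<n = trans (cong₂ _*_ (cong₂ _*_ (κ-monomial (n C k) ((n ℕ.+ k) C k) ((2 ℕ.* k ℕ.+ 1) C n) 2 s t)
        (square k k<n)) (linear₁ k)) (shape (# (n C k)) (# n - # k) (E k) (T₁ k) (e₁ k))

  -- From θ to the Bernoulli number

  conclude : ∀ r s t n d .{{_ : ℕ.NonZero n}} {X 𝒜} → Int X → X ≡ - # 2 * κ 𝒜 →
    row s t n d r ≈[ 3 ℕ.* suc d ℕ.+ 1 ] row′ s t n d r + P (3 ℕ.* suc d) * (θ * X) →
    Apéry r s t (n ℕ.* p ℕ.^ suc d) ≡ Apéry r s t (n ℕ.* p ℕ.^ d) ℚ.+ ℕ→ℚ (p ℕ.^ (3 ℕ.* suc d)) ℚ.* B (p ∸ 3)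
      ℚ.* 𝒜 [modℚ p ^ (3 ℕ.* suc d ℕ.+ 1) ]
  conclude r s t n d {X} {𝒜} iX X≡ h = ≈⇒modℚ (3 ℕ.* suc d ℕ.+ 1) (begin
    κ (Apéry r s t (n ℕ.* p ℕ.^ suc d))
      ≡⟨ trans (κ-Apéry r s t (n ℕ.* p ℕ.^ suc d))
        (cong (λ N → sum (suc N) (F r s t N)) (ℕP.*-comm n (p ℕ.^ suc d))) ⟩
    row s t n d r ≈⟨ h ⟩
    row′ s t n d r + Q * (θ * X)
      ≡⟨ cong (λ a → row′ s t n d r + Q * a) (trans (cong (_*_ θ) X≡) (lem θ (κ 𝒜))) ⟩
    row′ s t n d r + Q * (- # 2 * θ * κ 𝒜) ≈⟨ +-≈ ≈-refl (scale (≈0-P (3 ℕ.* suc d)) (*ʳ-≈ i𝒜 (≈-sym 𝔹≈θ))) ⟩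
    row′ s t n d r + Q * (𝔹 (p ∸ 3) * κ 𝒜) ≡⟨ cong (_+_ (row′ s t n d r)) (sym (*-assoc Q (𝔹 (p ∸ 3)) (κ 𝒜))) ⟩
    row′ s t n d r + Q * 𝔹 (p ∸ 3) * κ 𝒜
      ≡⟨ cong₂ (λ a b → a + b * 𝔹 (p ∸ 3) * κ 𝒜)
        (trans (cong (λ N → sum (suc N) (F r s t N)) (ℕP.*-comm (p ℕ.^ d) n))
        (sym (κ-Apéry r s t (n ℕ.* p ℕ.^ d)))) (sym (κ-q (p ℕ.^ (3 ℕ.* suc d)))) ⟩
    κ (Apéry r s t (n ℕ.* p ℕ.^ d) ℚ.+ ℕ→ℚ (p ℕ.^ (3 ℕ.* suc d)) ℚ.* B (p ∸ 3) ℚ.* 𝒜) ∎)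
    where
    open ≈-Reasoning (3 ℕ.* suc d ℕ.+ 1)
    Q = P (3 ℕ.* suc d)
    lem : ∀ t a → t * (- # 2 * a) ≡ - # 2 * t * a
    lem = solve-∀ ring
    lem′ : ∀ a → a ≡ - ½ * (- # 2 * a)
    lem′ = solve-∀ ring
    -- Replacing -2θ by B_{p-3}, known modulo p only, requires 𝒜 to be p-integral; this follows from
    -- X = -2 𝒜 as p is odd.
    i𝒜 : Int (κ 𝒜)
    i𝒜 = subst Int (sym (trans (lem′ (κ 𝒜)) (cong (_*_ (- ½)) (sym X≡)))) (⊝ Int-½ ⊗ iX)

  apéry-congruence : ∀ n d → 1 ≤ n → ∀ r s t →
    Apéry (2 ℕ.+ r) s t (n ℕ.* p ℕ.^ suc d) ≡ Apéry (2 ℕ.+ r) s t (n ℕ.* p ℕ.^ d) ℚ.+ ℕ→ℚ (p ℕ.^ (3 ℕ.* suc d))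
      ℚ.* B (p ∸ 3) ℚ.* calA (2 ℕ.+ r) s t n [modℚ p ^ (3 ℕ.* suc d ℕ.+ 1) ]
  apéry-congruence n@(suc _) d _ 0 s t = conclude 2 s t n d (Int-X₂ s t n) (calA2≡ s t n) (total-2 s t n d)
  apéry-congruence n@(suc _) d _ 1 s t = conclude 3 s t n d (Int-X₃ s t n) (calA3≡ s t n) (total-3 s t n d)
  apéry-congruence n@(suc _) d _ (suc (suc r)) s t = conclude (4 ℕ.+ r) s t n d {X}
    (nat 2 ⊗ Int-⅓ ⊗ Int-sumAll (suc n) (Int-weighted (4 ℕ.+ r) s t n))
      (trans (lem (sum (suc n) (weighted (4 ℕ.+ r) s t n)))
        (cong (_*_ (- # 2)) (sym (κ-firstSum (4 ℕ.+ r) s t n)))) (total-4 s t n d r)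
    where
    X = # 2 * ⅓ * sum (suc n) (weighted (4 ℕ.+ r) s t n)
    lem : ∀ w → # 2 * ⅓ * w ≡ - # 2 * (- ⅓ * w)
    lem = solve-∀ ring

open import Defs
open import Data.Nat using (ℕ; _≤_; _+_; _*_; _^_; _∸_)
open import Data.Nat.Primality using (Prime)
open import Data.Rational as ℚ using (ℚ)

theorem1p1 : (p : ℕ) → Prime p → 5 ≤ p →
    (n m : ℕ) → 1 ≤ n → 1 ≤ m →
    (r s t : ℕ) → 2 ≤ r →
    A r s t (n * p ^ m)
    ≡ A r s t (n * p ^ (m ∸ 1))
    ℚ.+ q (p ^ (3 * m)) ℚ.* B (p ∸ 3) ℚ.* calA r s t n
    [modℚ p ^ (3 * m + 1) ]
theorem1p1 p p-prime 5≤p n (suc d) 1≤n _ (suc (suc r)) s t _ =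
  Supercongruence.apéry-congruence p p-prime 5≤p n d 1≤n r s t
theorem1p1 _ _ _ _ _ _ _ (suc zero) _ _ (s≤s ())
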